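{- There is a constant $C>0$ such that for all non-negative integers $n,r,h$, $$\mathbb{E}\left(L_n(r)-L_n(r+h)\right)^4\le C\,h^2n.$$ Consequently, the sequence of processes $(l_n(t))_{t\ge0}$, $l_n(t)=\frac1{\sqrt n}L_n(t\sqrt n)$, is tight in $C[0,\infty)$.
   Context: For a uniformly random unlabelled rooted tree (rooted tree up to root-preserving isomorphism) with $n$ vertices, $L_n(k)$ ($k$ a non-negative integer) is the number of vertices at distance $k$ from the root, and for non-integer $t\ge0$, $L_n(t)=(\lfloor t\rfloor+1-t)L_n(\lfloor t\rfloor)+(t-\lfloor t\rfloor)L_n(\lfloor t\rfloor+1)$. -}

module Defs where

open import Data.Bool.Base using (Bool; true; if_then_else_)
open import Data.Empty using (⊥-elim)
open import Data.Integer.Base as ℤ using (ℤ; +_)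
import Data.Integer.Properties as ℤₚ
open import Data.List.Base
  using (List; []; _∷_; _++_; map; foldr; length; filter; deduplicate; cartesianProductWith)
open import Data.List.Membership.Propositional using (_∈_; lose)
open import Data.List.Membership.Propositional.Properties
  using (∈-filter⁺; ∈-map⁺; ∈-cartesianProductWith⁺)
import Data.List.Membership.Setoid.Properties as SetoidMembershipₚ
open import Data.List.Properties using (length-++; length-map)
open import Data.List.Relation.Binary.Permutation.Homogeneous as Perm using (Permutation)
open import Data.List.Relation.Binary.Permutation.Propositional as ↭ using (_↭_)
import Data.List.Relation.Binary.Permutation.Propositional.Properties as ↭ₚ
import Data.List.Relation.Binary.Permutation.Setoid.Properties as SetoidPermutationₚ
open import Data.List.Relation.Binary.Pointwise.Base using (Pointwise; []; _∷_)
open import Data.List.Relation.Unary.All using (All; []; _∷_)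
open import Data.List.Relation.Unary.All.Properties using (all-filter; deduplicate⁺)
open import Data.List.Relation.Unary.AllPairs using (AllPairs)
open import Data.List.Relation.Unary.Any using (Any; here; there; any?; _─_; lookup)
open import Data.List.Relation.Unary.Any.Properties using (lookup-result)
open import Data.List.Relation.Unary.Unique.DecSetoid.Properties using (deduplicate-!)
open import Data.Nat.Base as ℕ using (ℕ; zero; suc; z≤n; s≤s)
import Data.Nat.Properties as ℕₚ
open import Data.Nat.Tactic.RingSolver using (solve-∀)
open import Data.Product.Base using (∃; Σ; _×_; _,_; proj₁; proj₂)
open import Data.Rational.Base as ℚ using (ℚ; 0ℚ; 1ℚ; ½; mkℚ; *≤*)
import Data.Rational.Properties as ℚₚ
open import Data.Rational.Solver using (module +-*-Solver)
open import Data.Rational.Unnormalised.Base as ℚᵘ using (mkℚᵘ)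
import Data.Rational.Unnormalised.Properties as ℚᵘₚ
open import Data.Sum.Base using (inj₁; inj₂)
open import Relation.Binary.Bundles using (Setoid; DecSetoid)
open import Relation.Binary.PropositionalEquality
  using (_≡_; refl; sym; trans; cong; cong₂; subst; subst₂)
open import Relation.Nullary.Decidable using (Dec; yes; no; map′)
open import Relation.Nullary.Negation using (¬_)

------------------------------------------------------------------------
-- Unlabelled rooted trees

-- Rooted trees with the children of every vertex listed in some order;
-- the order is forgotten by _≅_.
data Tree : Set where
  node : List Tree → Tree

-- Root-preserving isomorphism: the root subtrees are matched up by a
-- permutation, matched subtrees being isomorphic.
data _≅_ : Tree → Tree → Set where
  node : ∀ {ts us} → Permutation _≅_ ts us → node ts ≅ node us

infix 4 _≅_

-- The distances from the root, listed over all vertices.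
mutual
  depths : Tree → List ℕ
  depths (node ts) = 0 ∷ map suc (depthsᶠ ts)

  depthsᶠ : List Tree → List ℕ
  depthsᶠ []       = []
  depthsᶠ (t ∷ ts) = depths t ++ depthsᶠ ts

size : Tree → ℕ
size t = length (depths t)

L : Tree → ℕ → ℕ
L t k = length (filter (ℕₚ._≟ k) (depths t))

record UnlabelledTrees (n : ℕ) : Set where
  field
    representatives : List Tree
    sizes           : All (λ t → size t ≡ n) representatives
    complete        : ∀ t → size t ≡ n → Any (t ≅_) representatives
    distinct        : AllPairs (λ t u → ¬ (t ≅ u)) representatives

mutual
  ≅-refl : ∀ t → t ≅ t
  ≅-refl (node ts) = node (Perm.refl (≅-reflᶠ ts))

  ≅-reflᶠ : ∀ ts → Pointwise _≅_ ts ts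
  ≅-reflᶠ []       = []
  ≅-reflᶠ (t ∷ ts) = ≅-refl t ∷ ≅-reflᶠ ts

mutual
  ≅-sym : ∀ {t u} → t ≅ u → u ≅ t
  ≅-sym (node p) = node (≅-symᵖ p)

  ≅-symᵖ : ∀ {ts us} → Permutation _≅_ ts us → Permutation _≅_ us ts
  ≅-symᵖ (Perm.refl es)     = Perm.refl (≅-symᶠ es)
  ≅-symᵖ (Perm.prep e p)    = Perm.prep (≅-sym e) (≅-symᵖ p)
  ≅-symᵖ (Perm.swap e e′ p) = Perm.swap (≅-sym e′) (≅-sym e) (≅-symᵖ p)
  ≅-symᵖ (Perm.trans p q)   = Perm.trans (≅-symᵖ q) (≅-symᵖ p)

  ≅-symᶠ : ∀ {ts us} → Pointwise _≅_ ts us → Pointwise _≅_ us ts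
  ≅-symᶠ []       = []
  ≅-symᶠ (e ∷ es) = ≅-sym e ∷ ≅-symᶠ es

≅-trans : ∀ {t u v} → t ≅ u → u ≅ v → t ≅ v
≅-trans (node p) (node q) = node (Perm.trans p q)

≅-setoid : Setoid _ _
≅-setoid = record
  { Carrier       = Tree
  ; _≈_           = _≅_
  ; isEquivalence = record { refl = ≅-refl _ ; sym = ≅-sym ; trans = ≅-trans }
  }

private
  module ≅-Perm = SetoidPermutationₚ ≅-setoid

  pull : ∀ {t us} (p : Any (t ≅_) us) → Permutation _≅_ us (t ∷ (us ─ p))
  pull (here t≅u) = Perm.prep (≅-sym t≅u) (Perm.refl (≅-reflᶠ _))
  pull (there p)  =
    Perm.trans (Perm.prep (≅-refl _) (pull p))
               (Perm.swap (≅-refl _) (≅-refl _) (Perm.refl (≅-reflᶠ _)))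

mutual
  _≅?_ : ∀ t u → Dec (t ≅ u)
  node ts ≅? node us = map′ node (λ { (node p) → p }) (permutation? ts us)

  permutation? : ∀ ts us → Dec (Permutation _≅_ ts us)
  permutation? []       []       = yes (Perm.refl [])
  permutation? []       (u ∷ us) = no λ p → ≅-Perm.¬x∷xs↭[] (≅-symᵖ p)
  permutation? (t ∷ ts) us with any? (t ≅?_) us
  ... | no  t∉us = no λ p → t∉us (≅-Perm.∈-resp-↭ p (here (≅-refl t)))
  ... | yes t∈us = map′
    (λ p → Perm.trans (Perm.prep (≅-refl t) p) (≅-symᵖ (pull t∈us)))
    (λ p → ≅-Perm.drop-∷ (Perm.trans p (pull t∈us)))
    (permutation? ts (us ─ t∈us))

≅-decSetoid : DecSetoid _ _
≅-decSetoid = record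
  { Carrier          = Tree
  ; _≈_              = _≅_
  ; isDecEquivalence = record
    { isEquivalence = Setoid.isEquivalence ≅-setoid
    ; _≟_           = _≅?_
    }
  }

-- The profile is a function of the isomorphism class.
mutual
  depths-cong : ∀ {t u} → t ≅ u → depths t ↭ depths u
  depths-cong (node p) = ↭.prep 0 (↭ₚ.map⁺ suc (depths-congᵖ p))

  depths-congᵖ : ∀ {ts us} → Permutation _≅_ ts us → depthsᶠ ts ↭ depthsᶠ us
  depths-congᵖ (Perm.refl es)     = depths-congᶠ es
  depths-congᵖ (Perm.prep e p)    = ↭ₚ.++⁺ (depths-cong e) (depths-congᵖ p)
  depths-congᵖ (Perm.swap {x = t} {y = u} e e′ p) =
    ↭.trans (↭ₚ.shifts (depths t) (depths u))
            (↭ₚ.++⁺ (depths-cong e′) (↭ₚ.++⁺ (depths-cong e) (depths-congᵖ p)))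
  depths-congᵖ (Perm.trans p q)   = ↭.trans (depths-congᵖ p) (depths-congᵖ q)

  depths-congᶠ : ∀ {ts us} → Pointwise _≅_ ts us → depthsᶠ ts ↭ depthsᶠ us
  depths-congᶠ []       = ↭.refl
  depths-congᶠ (e ∷ es) = ↭ₚ.++⁺ (depths-cong e) (depths-congᶠ es)

L-cong : ∀ {t u} → t ≅ u → ∀ k → L t k ≡ L u k
L-cong t≅u k = ↭ₚ.↭-length (↭ₚ.filter-↭ (ℕₚ._≟ k) (depths-cong t≅u))

-- Contains every ordered forest with at most n vertices.
forests : ℕ → List (List Tree)
forests zero    = [] ∷ []
forests (suc n) = [] ∷ cartesianProductWith (λ f g → node f ∷ g) (forests n) (forests n)

private
  sizeᶠ : List Tree → ℕ
  sizeᶠ f = length (depthsᶠ f)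

  sizeᶠ-∷ : ∀ f g → sizeᶠ (node f ∷ g) ≡ suc (sizeᶠ f ℕ.+ sizeᶠ g)
  sizeᶠ-∷ f g = cong suc (trans (length-++ (map suc (depthsᶠ f)))
                                (cong (ℕ._+ sizeᶠ g) (length-map suc (depthsᶠ f))))

  ∈-forests : ∀ n f → sizeᶠ f ℕ.≤ n → f ∈ forests n
  ∈-forests zero    []           _ = here refl
  ∈-forests (suc n) []           _ = here refl
  ∈-forests zero    (node f ∷ g) le with () ← le
  ∈-forests (suc n) (node f ∷ g) le with s≤s le′ ← subst (ℕ._≤ suc n) (sizeᶠ-∷ f g) le =
    there (∈-cartesianProductWith⁺ (λ f g → node f ∷ g)
      (∈-forests n f (ℕₚ.≤-trans (ℕₚ.m≤m+n _ _) le′))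
      (∈-forests n g (ℕₚ.≤-trans (ℕₚ.m≤n+m _ _) le′)))

  orderedTrees : ℕ → List Tree
  orderedTrees n = filter (λ t → size t ℕₚ.≟ n) (map node (forests n))

  ∈-orderedTrees : ∀ n t → size t ≡ n → t ∈ orderedTrees n
  ∈-orderedTrees n (node f) eq = ∈-filter⁺ (λ t → size t ℕₚ.≟ n)
    (∈-map⁺ node (∈-forests n f (ℕₚ.≤-trans (ℕₚ.n≤1+n _)
      (ℕₚ.≤-reflexive (trans (cong suc (sym (length-map suc (depthsᶠ f)))) eq))))) eq

unlabelledTrees : ∀ n → UnlabelledTrees n
unlabelledTrees n = record
  { representatives = deduplicate _≅?_ (orderedTrees n)
  ; sizes           = deduplicate⁺ _≅?_ (all-filter _ (map node (forests n)))
  ; complete        = λ t eq → SetoidMembershipₚ.∈-deduplicate⁺ ≅-setoid _≅?_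
                        (λ e e′ → ≅-trans e′ (≅-sym e))
                        (lose (∈-orderedTrees n t eq) (≅-refl t))
  ; distinct        = deduplicate-! ≅-decSetoid (orderedTrees n)
  }

trees : ℕ → List Tree
trees n = UnlabelledTrees.representatives (unlabelledTrees n)

------------------------------------------------------------------------
-- Expectation and probability for a uniformly random element of `trees n`

-- The mean over the empty sample space (the case n = 0) is set to 0.
mean : List ℤ → ℚ
mean []       = 0ℚ
mean (x ∷ xs) = foldr ℤ._+_ (+ 0) (x ∷ xs) ℚ./ suc (length xs)

𝔼 : ℕ → (Tree → ℤ) → ℚ
𝔼 n X = mean (map X (trees n))

ℙ : ℕ → (Tree → Bool) → ℚ
ℙ n A = 𝔼 n (λ t → if A t then + 1 else + 0)

------------------------------------------------------------------------
-- Real numbers as Cauchy sequences of rationals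

Cauchy : (ℕ → ℚ) → Set
Cauchy x = ∀ ε → 0ℚ ℚ.< ε →
  ∃ λ N → ∀ m n → N ℕ.≤ m → N ℕ.≤ n → ℚ.∣ x m ℚ.- x n ∣ ℚ.≤ ε

record ℝ : Set where
  constructor real
  field
    seq    : ℕ → ℚ
    cauchy : Cauchy seq

open ℝ public

infix  4 _≈ᵣ_ _≤ᵣ_ _<ᵣ_
infixl 6 _+ᵣ_ _-ᵣ_
infixl 7 _*ᵣ_

_≈ᵣ_ _≤ᵣ_ _<ᵣ_ : ℝ → ℝ → Set
x ≈ᵣ y = ∀ ε → 0ℚ ℚ.< ε → ∃ λ N → ∀ n → N ℕ.≤ n → ℚ.∣ seq x n ℚ.- seq y n ∣ ℚ.≤ ε
x ≤ᵣ y = ∀ ε → 0ℚ ℚ.< ε → ∃ λ N → ∀ n → N ℕ.≤ n → seq x n ℚ.≤ seq y n ℚ.+ ε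
x <ᵣ y = ∃ λ ε → 0ℚ ℚ.< ε × ∃ λ N → ∀ n → N ℕ.≤ n → seq x n ℚ.+ ε ℚ.≤ seq y n

private
  open +-*-Solver

  half-pos : ∀ {ε} → 0ℚ ℚ.< ε → 0ℚ ℚ.< ½ ℚ.* ε
  half-pos {ε} ε>0 = subst (ℚ._< ½ ℚ.* ε) (ℚₚ.*-zeroʳ ½) (ℚₚ.*-monoʳ-<-pos ½ ε>0)

  halves : ∀ ε → ½ ℚ.* ε ℚ.+ ½ ℚ.* ε ≡ ε
  halves ε = trans (sym (ℚₚ.*-distribʳ-+ ε ½ ½)) (ℚₚ.*-identityˡ ε)

  ∣∣-≤ : ∀ {p q} → p ℚ.≤ q → ℚ.- p ℚ.≤ q → ℚ.∣ p ∣ ℚ.≤ q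
  ∣∣-≤ {p} p≤q -p≤q with ℚₚ.∣p∣≡p∨∣p∣≡-p p
  ... | inj₁ eq = subst (ℚ._≤ _) (sym eq) p≤q
  ... | inj₂ eq = subst (ℚ._≤ _) (sym eq) -p≤q

  p-q+q≡p : ∀ p q → p ℚ.- q ℚ.+ q ≡ p
  p-q+q≡p = solve 2 (λ p q → p :- q :+ q := p) refl

  q+r-q≡r : ∀ q r → q ℚ.+ r ℚ.- q ≡ r
  q+r-q≡r = solve 2 (λ q r → q :+ r :- q := r) refl

  q-p≡-[p-q] : ∀ p q → q ℚ.- p ≡ ℚ.- (p ℚ.- q)
  q-p≡-[p-q] = solve 2 (λ p q → q :- p := :- (p :- q)) refl

  q-p≡-p--q : ∀ p q → q ℚ.- p ≡ ℚ.- p ℚ.- (ℚ.- q)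
  q-p≡-p--q = solve 2 (λ p q → q :- p := :- p :- (:- q)) refl

  +-interchange : ∀ p q r s → p ℚ.+ q ℚ.- (r ℚ.+ s) ≡ (p ℚ.- r) ℚ.+ (q ℚ.- s)
  +-interchange = solve 4 (λ p q r s → p :+ q :- (r :+ s) := (p :- r) :+ (q :- s)) refl

  *-difference : ∀ p q r s →
    p ℚ.* q ℚ.- r ℚ.* s ≡ p ℚ.* (q ℚ.- s) ℚ.+ s ℚ.* (p ℚ.- r)
  *-difference =
    solve 4 (λ p q r s → p :* q :- r :* s := p :* (q :- s) :+ s :* (p :- r)) refl

  p*[q*r]≡q*[p*r] : ∀ p q r → p ℚ.* (q ℚ.* r) ≡ q ℚ.* (p ℚ.* r)
  p*[q*r]≡q*[p*r] = solve 3 (λ p q r → p :* (q :* r) := q :* (p :* r)) refl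

  p≤q+r⇒p-q≤r : ∀ {p q r} → p ℚ.≤ q ℚ.+ r → p ℚ.- q ℚ.≤ r
  p≤q+r⇒p-q≤r {p} {q} {r} h = subst (p ℚ.- q ℚ.≤_)
    (q+r-q≡r q r) (ℚₚ.+-monoˡ-≤ (ℚ.- q) h)

  ∣p∣≤∣p-q∣+∣q∣ : ∀ p q → ℚ.∣ p ∣ ℚ.≤ ℚ.∣ p ℚ.- q ∣ ℚ.+ ℚ.∣ q ∣
  ∣p∣≤∣p-q∣+∣q∣ p q = subst (λ z → ℚ.∣ z ∣ ℚ.≤ ℚ.∣ p ℚ.- q ∣ ℚ.+ ℚ.∣ q ∣)
    (p-q+q≡p p q) (ℚₚ.∣p+q∣≤∣p∣+∣q∣ (p ℚ.- q) q)

  ∣p-q∣≡∣q-p∣ : ∀ p q → ℚ.∣ p ℚ.- q ∣ ≡ ℚ.∣ q ℚ.- p ∣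
  ∣p-q∣≡∣q-p∣ p q = trans
    (cong ℚ.∣_∣ (q-p≡-[p-q] q p)) (ℚₚ.∣-p∣≡∣p∣ (q ℚ.- p))

  ∣∣-lipschitz : ∀ p q → ℚ.∣ ℚ.∣ p ∣ ℚ.- ℚ.∣ q ∣ ∣ ℚ.≤ ℚ.∣ p ℚ.- q ∣
  ∣∣-lipschitz p q = ∣∣-≤ (half p q)
    (subst₂ ℚ._≤_ (q-p≡-[p-q] ℚ.∣ p ∣ ℚ.∣ q ∣)
                  (∣p-q∣≡∣q-p∣ q p) (half q p))
    where
    half : ∀ p q → ℚ.∣ p ∣ ℚ.- ℚ.∣ q ∣ ℚ.≤ ℚ.∣ p ℚ.- q ∣
    half p q = p≤q+r⇒p-q≤r (subst (ℚ.∣ p ∣ ℚ.≤_) (ℚₚ.+-comm ℚ.∣ p ℚ.- q ∣ ℚ.∣ q ∣)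
                                  (∣p∣≤∣p-q∣+∣q∣ p q))

fromℚ : ℚ → ℝ
fromℚ q = real (λ _ → q) λ ε ε>0 → 0 , λ _ _ _ _ →
  subst (λ z → ℚ.∣ z ∣ ℚ.≤ ε) (sym (ℚₚ.+-inverseʳ q)) (ℚₚ.<⇒≤ ε>0)

fromℕ : ℕ → ℝ
fromℕ n = fromℚ (+ n ℚ./ 1)

0ᵣ : ℝ
0ᵣ = fromℚ 0ℚ

_+ᵣ_ : ℝ → ℝ → ℝ
seq    (x +ᵣ y) n = seq x n ℚ.+ seq y n
cauchy (x +ᵣ y) ε ε>0
  with M , hx ← cauchy x (½ ℚ.* ε) (half-pos ε>0)
     | N , hy ← cauchy y (½ ℚ.* ε) (half-pos ε>0)
  = M ℕ.⊔ N , λ m n ≤m ≤n → begin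
    ℚ.∣ seq x m ℚ.+ seq y m ℚ.- (seq x n ℚ.+ seq y n) ∣
      ≡⟨ cong ℚ.∣_∣ (+-interchange (seq x m) (seq y m) (seq x n) (seq y n)) ⟩
    ℚ.∣ (seq x m ℚ.- seq x n) ℚ.+ (seq y m ℚ.- seq y n) ∣
      ≤⟨ ℚₚ.∣p+q∣≤∣p∣+∣q∣ (seq x m ℚ.- seq x n) (seq y m ℚ.- seq y n) ⟩
    ℚ.∣ seq x m ℚ.- seq x n ∣ ℚ.+ ℚ.∣ seq y m ℚ.- seq y n ∣
      ≤⟨ ℚₚ.+-mono-≤ (hx m n (ℕₚ.m⊔n≤o⇒m≤o M N ≤m) (ℕₚ.m⊔n≤o⇒m≤o M N ≤n))
                     (hy m n (ℕₚ.m⊔n≤o⇒n≤o M N ≤m) (ℕₚ.m⊔n≤o⇒n≤o M N ≤n)) ⟩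
    ½ ℚ.* ε ℚ.+ ½ ℚ.* ε
      ≡⟨ halves ε ⟩
    ε ∎
  where open ℚₚ.≤-Reasoning

-ᵣ_ : ℝ → ℝ
seq    (-ᵣ x) n = ℚ.- seq x n
cauchy (-ᵣ x) ε ε>0 with N , h ← cauchy x ε ε>0 = N , λ m n ≤m ≤n →
  subst (ℚ._≤ ε)
    (trans (∣p-q∣≡∣q-p∣ (seq x m) (seq x n))
           (cong ℚ.∣_∣ (q-p≡-p--q (seq x m) (seq x n))))
    (h m n ≤m ≤n)

_-ᵣ_ : ℝ → ℝ → ℝ
x -ᵣ y = x +ᵣ (-ᵣ y)

∣_∣ᵣ : ℝ → ℝ
seq    ∣ x ∣ᵣ n = ℚ.∣ seq x n ∣
cauchy ∣ x ∣ᵣ ε ε>0 with N , h ← cauchy x ε ε>0 = N , λ m n ≤m ≤n →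
  ℚₚ.≤-trans (∣∣-lipschitz (seq x m) (seq x n)) (h m n ≤m ≤n)

private
  eventually-bounded : ∀ x → ∃ λ B → ∃ λ N → 0ℚ ℚ.< B × (∀ n → N ℕ.≤ n → ℚ.∣ seq x n ∣ ℚ.≤ B)
  eventually-bounded x with N , h ← cauchy x 1ℚ (ℚₚ.positive⁻¹ 1ℚ) =
    1ℚ ℚ.+ ℚ.∣ seq x N ∣ , N , ℚₚ.+-mono-<-≤ (ℚₚ.positive⁻¹ 1ℚ) (ℚₚ.0≤∣p∣ (seq x N)) , λ n N≤n →
      ℚₚ.≤-trans (∣p∣≤∣p-q∣+∣q∣ (seq x n) (seq x N))
                 (ℚₚ.+-monoˡ-≤ ℚ.∣ seq x N ∣ (h n N N≤n ℕₚ.≤-refl))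

  -- ε divided by B
  quotient : ∀ {B ε} → 0ℚ ℚ.< B → 0ℚ ℚ.< ε → ∃ λ δ → 0ℚ ℚ.< δ × B ℚ.* δ ≡ ε
  quotient {B} {ε} B>0 ε>0 =
    ε ℚ.* 1/B ,
    ℚₚ.positive⁻¹ (ε ℚ.* 1/B) {{ℚₚ.pos*pos⇒pos ε {{ℚ.positive ε>0}} 1/B {{ℚₚ.1/pos⇒pos B}}}} ,
    trans (p*[q*r]≡q*[p*r] B ε 1/B)
          (trans (cong (ε ℚ.*_) (ℚₚ.*-inverseʳ B)) (ℚₚ.*-identityʳ ε))
    where
    instance
      B-pos : ℚ.Positive B
      B-pos = ℚ.positive B>0
      B-nonZero : ℚ.NonZero B
      B-nonZero = ℚₚ.pos⇒nonZero B
    1/B = ℚ.1/ B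

  *-mono-≤-∣∣ : ∀ {p q B δ} → 0ℚ ℚ.< B → ℚ.∣ p ∣ ℚ.≤ B → ℚ.∣ q ∣ ℚ.≤ δ → ℚ.∣ p ℚ.* q ∣ ℚ.≤ B ℚ.* δ
  *-mono-≤-∣∣ {p} {q} {B} {δ} B>0 hp hq = begin
    ℚ.∣ p ℚ.* q ∣      ≡⟨ ℚₚ.∣p*q∣≡∣p∣*∣q∣ p q ⟩
    ℚ.∣ p ∣ ℚ.* ℚ.∣ q ∣ ≤⟨ ℚₚ.*-monoʳ-≤-nonNeg ℚ.∣ q ∣ {{ℚₚ.∣-∣-nonNeg q}} hp ⟩
    B ℚ.* ℚ.∣ q ∣      ≤⟨ ℚₚ.*-monoˡ-≤-nonNeg B {{ℚ.nonNegative (ℚₚ.<⇒≤ B>0)}} hq ⟩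
    B ℚ.* δ            ∎
    where open ℚₚ.≤-Reasoning

  *-difference-≤ : ∀ {a b c d A B δ η} → 0ℚ ℚ.< A → 0ℚ ℚ.< B →
    ℚ.∣ a ∣ ℚ.≤ A → ℚ.∣ d ∣ ℚ.≤ B → ℚ.∣ b ℚ.- d ∣ ℚ.≤ δ → ℚ.∣ a ℚ.- c ∣ ℚ.≤ η →
    ℚ.∣ a ℚ.* b ℚ.- c ℚ.* d ∣ ℚ.≤ A ℚ.* δ ℚ.+ B ℚ.* η
  *-difference-≤ {a} {b} {c} {d} {A} {B} {δ} {η} A>0 B>0 hA hB hδ hη = begin
    ℚ.∣ a ℚ.* b ℚ.- c ℚ.* d ∣
      ≡⟨ cong ℚ.∣_∣ (*-difference a b c d) ⟩
    ℚ.∣ a ℚ.* (b ℚ.- d) ℚ.+ d ℚ.* (a ℚ.- c) ∣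
      ≤⟨ ℚₚ.∣p+q∣≤∣p∣+∣q∣ (a ℚ.* (b ℚ.- d)) (d ℚ.* (a ℚ.- c)) ⟩
    ℚ.∣ a ℚ.* (b ℚ.- d) ∣ ℚ.+ ℚ.∣ d ℚ.* (a ℚ.- c) ∣
      ≤⟨ ℚₚ.+-mono-≤ (*-mono-≤-∣∣ A>0 hA hδ) (*-mono-≤-∣∣ B>0 hB hη) ⟩
    A ℚ.* δ ℚ.+ B ℚ.* η ∎
    where open ℚₚ.≤-Reasoning

  *-cauchy : ∀ x y → Cauchy (λ n → seq x n ℚ.* seq y n)
  *-cauchy x y ε ε>0 =
    let A , M₀ , A>0 , hA = eventually-bounded x
        B , N₀ , B>0 , hB = eventually-bounded y
        δ , δ>0 , Aδ      = quotient A>0 (half-pos ε>0)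
        η , η>0 , Bη      = quotient B>0 (half-pos ε>0)
        M , hx            = cauchy x η η>0
        N , hy            = cauchy y δ δ>0
    in (M₀ ℕ.⊔ N₀) ℕ.⊔ (M ℕ.⊔ N) , λ m n ≤m ≤n →
       let ≤m₁ = ℕₚ.m⊔n≤o⇒m≤o (M₀ ℕ.⊔ N₀) (M ℕ.⊔ N) ≤m
           ≤n₁ = ℕₚ.m⊔n≤o⇒m≤o (M₀ ℕ.⊔ N₀) (M ℕ.⊔ N) ≤n
           ≤m₂ = ℕₚ.m⊔n≤o⇒n≤o (M₀ ℕ.⊔ N₀) (M ℕ.⊔ N) ≤m
           ≤n₂ = ℕₚ.m⊔n≤o⇒n≤o (M₀ ℕ.⊔ N₀) (M ℕ.⊔ N) ≤n
       in subst (ℚ.∣ seq x m ℚ.* seq y m ℚ.- seq x n ℚ.* seq y n ∣ ℚ.≤_)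
            (trans (cong₂ ℚ._+_ Aδ Bη) (halves ε))
            (*-difference-≤ A>0 B>0
              (hA m (ℕₚ.m⊔n≤o⇒m≤o M₀ N₀ ≤m₁))
              (hB n (ℕₚ.m⊔n≤o⇒n≤o M₀ N₀ ≤n₁))
              (hy m n (ℕₚ.m⊔n≤o⇒n≤o M N ≤m₂) (ℕₚ.m⊔n≤o⇒n≤o M N ≤n₂))
              (hx m n (ℕₚ.m⊔n≤o⇒m≤o M N ≤m₂) (ℕₚ.m⊔n≤o⇒m≤o M N ≤n₂)))

_*ᵣ_ : ℝ → ℝ → ℝ
seq    (x *ᵣ y) n = seq x n ℚ.* seq y n
cauchy (x *ᵣ y)   = *-cauchy x y

√-step : ℕ → ℕ → ℕ
√-step n a with suc a ℕ.* suc a ℕₚ.≤? n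
... | yes _ = suc a
... | no  _ = a

-- The largest a with a * a ≤ n.
isqrt : ℕ → ℕ
isqrt zero    = 0
isqrt (suc n) = √-step (suc n) (isqrt n)

private
  isqrt-lower : ∀ n → isqrt n ℕ.* isqrt n ℕ.≤ n
  isqrt-lower zero    = z≤n
  isqrt-lower (suc n) with suc (isqrt n) ℕ.* suc (isqrt n) ℕₚ.≤? suc n
  ... | yes h = h
  ... | no  _ = ℕₚ.m≤n⇒m≤1+n (isqrt-lower n)

  isqrt-upper : ∀ n → n ℕ.< suc (isqrt n) ℕ.* suc (isqrt n)
  isqrt-upper zero    = s≤s z≤n
  isqrt-upper (suc n) with suc (isqrt n) ℕ.* suc (isqrt n) ℕₚ.≤? suc n
  ... | yes _ = ℕₚ.≤-<-trans (isqrt-upper n)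
                  (ℕₚ.*-mono-< (ℕₚ.n<1+n (suc (isqrt n))) (ℕₚ.n<1+n (suc (isqrt n))))
  ... | no  h = ℕₚ.≰⇒> h

  *-cancel-square-< : ∀ {a b} → a ℕ.* a ℕ.< b ℕ.* b → a ℕ.< b
  *-cancel-square-< h = ℕₚ.≰⇒> λ b≤a → ℕₚ.<⇒≱ h (ℕₚ.*-mono-≤ b≤a b≤a)

  √-seq : ℕ → ℕ → ℚ
  √-seq n m = + isqrt (n ℕ.* (suc m ℕ.* suc m)) ℚ./ suc m

  isqrt-cross : ∀ n k l →
    isqrt (n ℕ.* (k ℕ.* k)) ℕ.* suc l ℕ.≤ suc (isqrt (n ℕ.* (suc l ℕ.* suc l))) ℕ.* k
  isqrt-cross n zero    l rewrite ℕₚ.*-zeroʳ n = z≤n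
  isqrt-cross n (suc k) l = ℕₚ.<⇒≤ (*-cancel-square-< (begin-strict
    a ℕ.* l′ ℕ.* (a ℕ.* l′)                       ≡⟨ rearrange₁ a l′ ⟩
    a ℕ.* a ℕ.* (l′ ℕ.* l′)                       ≤⟨ ℕₚ.*-monoˡ-≤ (l′ ℕ.* l′) (isqrt-lower (n ℕ.* (k′ ℕ.* k′))) ⟩
    n ℕ.* (k′ ℕ.* k′) ℕ.* (l′ ℕ.* l′)             ≡⟨ rearrange₂ n k′ l′ ⟩
    n ℕ.* (l′ ℕ.* l′) ℕ.* (k′ ℕ.* k′)             <⟨ ℕₚ.*-monoˡ-< (k′ ℕ.* k′) (isqrt-upper (n ℕ.* (l′ ℕ.* l′))) ⟩
    b ℕ.* b ℕ.* (k′ ℕ.* k′)                       ≡⟨ sym (rearrange₁ b k′) ⟩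
    b ℕ.* k′ ℕ.* (b ℕ.* k′)                       ∎))
    where
    open ℕₚ.≤-Reasoning
    k′ = suc k
    l′ = suc l
    a = isqrt (n ℕ.* (k′ ℕ.* k′))
    b = suc (isqrt (n ℕ.* (l′ ℕ.* l′)))
    rearrange₁ : ∀ a l → a ℕ.* l ℕ.* (a ℕ.* l) ≡ a ℕ.* a ℕ.* (l ℕ.* l)
    rearrange₁ = solve-∀
    rearrange₂ : ∀ n k l → n ℕ.* (k ℕ.* k) ℕ.* (l ℕ.* l) ≡ n ℕ.* (l ℕ.* l) ℕ.* (k ℕ.* k)
    rearrange₂ = solve-∀

  √-seq-cross : ∀ n k l → √-seq n k ℚ.≤ √-seq n l ℚ.+ + 1 ℚ./ suc l
  √-seq-cross n k l = ℚₚ.toℚᵘ-cancel-≤ (begin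
    ℚ.toℚᵘ (√-seq n k)                                ≃⟨ ℚₚ.toℚᵘ-fromℚᵘ (mkℚᵘ (+ a) k) ⟩
    mkℚᵘ (+ a) k                                      ≤⟨ ℚᵘ.*≤* cross ⟩
    mkℚᵘ (+ b) l ℚᵘ.+ mkℚᵘ (+ 1) l                    ≃⟨ ℚᵘₚ.≃-sym (ℚᵘₚ.+-cong (ℚₚ.toℚᵘ-fromℚᵘ (mkℚᵘ (+ b) l))
                                                           (ℚₚ.toℚᵘ-fromℚᵘ (mkℚᵘ (+ 1) l))) ⟩
    ℚ.toℚᵘ (√-seq n l) ℚᵘ.+ ℚ.toℚᵘ (+ 1 ℚ./ suc l)   ≃⟨ ℚᵘₚ.≃-sym (ℚₚ.toℚᵘ-homo-+ (√-seq n l) (+ 1 ℚ./ suc l)) ⟩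
    ℚ.toℚᵘ (√-seq n l ℚ.+ + 1 ℚ./ suc l)             ∎)
    where
    open ℚᵘₚ.≤-Reasoning
    a = isqrt (n ℕ.* (suc k ℕ.* suc k))
    b = isqrt (n ℕ.* (suc l ℕ.* suc l))
    rearrange₁ : ∀ a l → a ℕ.* l ℕ.* l ≡ a ℕ.* (l ℕ.* l)
    rearrange₁ = solve-∀
    rearrange₂ : ∀ b k l → suc b ℕ.* k ℕ.* l ≡ (b ℕ.* l ℕ.+ 1 ℕ.* l) ℕ.* k
    rearrange₂ = solve-∀
    crossℕ : a ℕ.* (suc l ℕ.* suc l) ℕ.≤ (b ℕ.* suc l ℕ.+ 1 ℕ.* suc l) ℕ.* suc k
    crossℕ = subst₂ ℕ._≤_ (rearrange₁ a (suc l)) (rearrange₂ b (suc k) (suc l))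
               (ℕₚ.*-monoˡ-≤ (suc l) (isqrt-cross n (suc k) l))
    cross : + a ℤ.* (+ (suc l ℕ.* suc l)) ℤ.≤ (+ b ℤ.* + suc l ℤ.+ + 1 ℤ.* + suc l) ℤ.* + suc k
    cross = subst₂ ℤ._≤_ (ℤₚ.pos-* a (suc l ℕ.* suc l))
      (trans (ℤₚ.pos-* (b ℕ.* suc l ℕ.+ 1 ℕ.* suc l) (suc k))
        (cong (ℤ._* + suc k) (trans (ℤₚ.pos-+ (b ℕ.* suc l) (1 ℕ.* suc l))
          (cong₂ ℤ._+_ (ℤₚ.pos-* b (suc l)) (ℤₚ.pos-* 1 (suc l))))))
      (ℤ.+≤+ crossℕ)

  archimedean : ∀ ε → 0ℚ ℚ.< ε → ∃ λ N → ∀ l → N ℕ.≤ l → + 1 ℚ./ suc l ℚ.≤ ε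
  archimedean (mkℚ ℤ.+[1+ p ] d c) _ = d , λ l d≤l → ℚₚ.toℚᵘ-cancel-≤ (begin
    ℚ.toℚᵘ (+ 1 ℚ./ suc l)  ≃⟨ ℚₚ.toℚᵘ-fromℚᵘ (mkℚᵘ (+ 1) l) ⟩
    mkℚᵘ (+ 1) l            ≤⟨ ℚᵘ.*≤* (subst₂ ℤ._≤_ (ℤₚ.pos-* 1 (suc d)) (ℤₚ.pos-* (suc p) (suc l))
                                 (ℤ.+≤+ (ℕₚ.*-mono-≤ {1} {suc p} (s≤s z≤n) (s≤s d≤l)))) ⟩
    mkℚᵘ ℤ.+[1+ p ] d       ∎)
    where open ℚᵘₚ.≤-Reasoning
  archimedean (mkℚ (+ 0) d c)      ε>0 with () ← ℚ.positive ε>0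
  archimedean (mkℚ ℤ.-[1+ _ ] d c) ε>0 with () ← ℚ.positive ε>0

-- The m-th term is ⌊(m+1)√n⌋ / (m+1).
√ : ℕ → ℝ
seq    (√ n) m = + isqrt (n ℕ.* (suc m ℕ.* suc m)) ℚ./ suc m
cauchy (√ n) ε ε>0 with N , h ← archimedean ε ε>0 = N , λ k l N≤k N≤l →
  ∣∣-≤ (p≤q+r⇒p-q≤r (ℚₚ.≤-trans (√-seq-cross n k l) (ℚₚ.+-monoʳ-≤ (√-seq n l) (h l N≤l))))
       (subst (ℚ._≤ ε) (q-p≡-[p-q] (√-seq n k) (√-seq n l))
         (p≤q+r⇒p-q≤r (ℚₚ.≤-trans (√-seq-cross n l k) (ℚₚ.+-monoʳ-≤ (√-seq n k) (h k N≤k)))))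

------------------------------------------------------------------------
-- The space C[0,∞) with locally uniform convergence

-- Continuity makes `fun` respect _≈ᵣ_ and ignore the proof of 0ᵣ ≤ᵣ x.
record C[0,∞[ : Set where
  field
    fun        : ∀ x → 0ᵣ ≤ᵣ x → ℝ
    continuous : ∀ x 0≤x ε → 0ℚ ℚ.< ε →
      ∃ λ δ → 0ℚ ℚ.< δ ×
        (∀ y 0≤y → ∣ y -ᵣ x ∣ᵣ ≤ᵣ fromℚ δ → ∣ fun y 0≤y -ᵣ fun x 0≤x ∣ᵣ ≤ᵣ fromℚ ε)

open C[0,∞[ public

_≐_ : C[0,∞[ → C[0,∞[ → Set
f ≐ g = ∀ x 0≤x → fun f x 0≤x ≈ᵣ fun g x 0≤x

infix 4 _≐_

-- sup |f - g| ≤ ε on [0,m].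
Within : ℕ → ℚ → C[0,∞[ → C[0,∞[ → Set
Within m ε f g = ∀ x 0≤x → x ≤ᵣ fromℕ m → ∣ fun f x 0≤x -ᵣ fun g x 0≤x ∣ᵣ ≤ᵣ fromℚ ε

CauchySequence : (ℕ → C[0,∞[) → Set
CauchySequence F = ∀ m ε → 0ℚ ℚ.< ε →
  ∃ λ N → ∀ i j → N ℕ.≤ i → N ℕ.≤ j → Within m ε (F i) (F j)

_⟶_ : (ℕ → C[0,∞[) → C[0,∞[ → Set
F ⟶ g = ∀ m ε → 0ℚ ℚ.< ε → ∃ λ N → ∀ i → N ℕ.≤ i → Within m ε (F i) g

infix 4 _⟶_

-- Compactness in its constructive form: totally bounded and complete.
record Compact (K : C[0,∞[ → Set) : Set where
  field
    respects       : ∀ {f g} → f ≐ g → K f → K g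
    totallyBounded : ∀ m ε → 0ℚ ℚ.< ε →
      ∃ λ fs → All K fs × (∀ f → K f → Any (Within m ε f) fs)
    complete       : ∀ F → (∀ i → K (F i)) → CauchySequence F → ∃ λ g → K g × F ⟶ g

-- A sequence of random elements of C[0,∞), the n-th (n ≥ 1) defined on the
-- sample space `trees n`: `X n t f` says that f is its path at outcome t.
Process : Set₁
Process = ℕ → Tree → C[0,∞[ → Set

-- The event A serves to bound the (inner) probability of "X n lies in K"
-- from below, membership in K not being decidable.
Tight : Process → Set₁
Tight X = ∀ ε → 0ℚ ℚ.< ε →
  Σ (C[0,∞[ → Set) λ K → Compact K ×
    (∀ n → 1 ℕ.≤ n → Σ (Tree → Bool) λ A →
      (∀ t → t ∈ trees n → A t ≡ true → ∃ λ f → X n t f × K f) × 1ℚ ℚ.- ε ℚ.≤ ℙ n A)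

-- y = L t (x), interpolated linearly, for those x ≥ 0 whose integer part k
-- is known.
Interpolates : Tree → ℝ → ℝ → Set
Interpolates t x y = ∀ k → fromℕ k ≤ᵣ x → x <ᵣ fromℕ (suc k) →
  y ≈ᵣ (fromℕ (suc k) -ᵣ x) *ᵣ fromℕ (L t k) +ᵣ (x -ᵣ fromℕ k) *ᵣ fromℕ (L t (suc k))

-- The defining equation √n · l_n(x) = L_n(x√n).  The integer part of x√n can
-- be found for a dense set of x, so by continuity f is unique up to _≐_.
l : Process
l n t f = ∀ x 0≤x → Interpolates t (x *ᵣ √ n) (√ n *ᵣ fun f x 0≤x)

-- Fourth moment: let y be the generating series of unlabelled rooted trees and a = 1 / (1 - y).  As
-- [xⁿ] a ≤ n [xⁿ] y, it suffices to dominate moment series by multiples of a, coefficient by coefficient.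
-- A tree is a root with a multiset of subtrees, so the series A_q(k) of (L(k) - L(k + h))^q satisfies
-- A_q(k + 1) = y (A_q(k) + lower moments + error), where the errors come from the terms F(xⁱ), i ≥ 2, of
-- Pólya's formula and are exponentially smaller.  The series A₁ carries the factor 1 - y; its products
-- with A₁ and A₃, too large to be summed over k, are absorbed by adding a multiple of U² to A₂ and of
-- U A₃ to A₄, U being the series of first moments of L(k).  This gives A₂ = O(h) a and A₄ = O(h²) a.
--
-- Tightness: by the fourth moment bound and Markov's inequality, all increments of L over dyadic
-- intervals are small outside an event of probability ε, and chaining turns this into a modulus of
-- continuity of the rescaled path.  The compact set is the closure of the limits of chains of piecewise
-- linear functions with quantised values, each clamped to a neighbourhood of its predecessor.
{-# OPTIONS --safe #-}
module Submission where

open import Defs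
open import Algebra.Bundles using (CommutativeRing)
import Algebra.Solver.Ring as RingSolver
open import Algebra.Solver.Ring.AlmostCommutativeRing using (fromCommutativeRing; _-Raw-AlmostCommutative⟶_)
open import Data.Bool.Base using (Bool; true; if_then_else_)
open import Data.Empty using (⊥-elim)
open import Data.Integer.Base as ℤ using (ℤ; +_; -[1+_]; ∣_∣)
import Data.Integer.Properties as ℤP
open import Data.Integer.Tactic.RingSolver using () renaming (solve-∀ to solveℤ)
open import Data.List.Base using (List; []; _∷_; _++_; map; foldr; length; filter; concatMap; downFrom)
open import Data.Maybe.Base using (Maybe; just; nothing)
open import Data.Nat.Base as ℕ using (ℕ; zero; suc; z≤n; s≤s)
import Data.Nat.DivMod as ℕD
import Data.Nat.Properties as ℕP
open import Data.Nat.Tactic.RingSolver using () renaming (solve-∀ to solveℕ)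
open import Data.Product.Base using (∃; Σ; _×_; _,_; proj₁; proj₂)
open import Data.Sum.Base using (_⊎_; inj₁; inj₂)
open import Relation.Binary.PropositionalEquality using (_≡_; _≢_; refl; sym; trans; cong; cong₂; subst; subst₂)
open import Relation.Nullary.Decidable using (Dec; yes; no; does; _→-dec_)
open import Relation.Nullary.Negation using (¬_; contradiction)
import Data.List.Properties as ListP
open import Data.List.Membership.Propositional using (_∈_)
open import Data.List.Relation.Unary.All as All using (All; []; _∷_)
import Data.List.Relation.Unary.All.Properties as AllP
open import Data.List.Relation.Unary.Any as Any using (Any; here; there; any?)
import Data.List.Relation.Unary.Any.Properties as AnyP
open import Data.List.Relation.Unary.AllPairs as AllPairs using (AllPairs; []; _∷_)
import Data.List.Relation.Unary.AllPairs.Properties as AllPairsP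
open import Data.List.Relation.Binary.Pointwise.Base using (Pointwise; []; _∷_)
open import Data.List.Relation.Binary.Permutation.Homogeneous as Perm using (Permutation)
import Data.List.Relation.Binary.Permutation.Setoid.Properties as SetoidPerm
import Data.List.Relation.Binary.Permutation.Propositional.Properties as PermP
open import Data.Rational.Base as ℚ using (ℚ; 0ℚ; 1ℚ; ½)
import Data.Rational.Properties as ℚP
open import Data.Rational.Unnormalised.Base as ℚᵘ using (mkℚᵘ)
import Data.Rational.Unnormalised.Properties as ℚᵘP
open import Data.Rational.Solver using () renaming (module +-*-Solver to ℚS)

-- Formal power series over ℤ

-- No analytic information on y is used, only integer inequalities between coefficients. The scale
-- is a = 1 / (1 - y): passing to the next level multiplies by y, and y a ≼ a, so what enters at one
-- level is never amplified later, while a sum over all levels costs one factor a. Hence two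
-- classes: series with F a ≼ c a, closed under products, and series with only F ≼ c a, of which a
-- product can bear one, since a² is not O(a). Sums of first moments over the levels lie in the
-- second class, so the products of the recursion are sorted until each has at most one such factor.
-- Powers of h arise from (1 - y^h) / (1 - y), a sum of h powers of y, and from h-fold accumulation.
-- Errors are harmless because y has coefficients at most 4^n, so that F(x²) grows like 2^n up to
-- powers of n, while a grows by at least 5/2 per step. In the chaining, increments at dyadic depth
-- d may be of order (7/8)^d: that some increment is larger has probability of order (2048/2401)^d,
-- which is summable because 2 (7/8)⁴ > 1.

Ser : Set
Ser = ℕ → ℤ

infix 4 _≈_ _≼_
record _≈_ (F G : Ser) : Set where
  constructor mk
  field at : ∀ n → F n ≡ G n
open _≈_ public

infixl 6 _⊕_
infixl 7 _⊗_
infix  8 ⊝_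

opaque
  _⊕_ : Ser → Ser → Ser
  (F ⊕ G) n = F n ℤ.+ G n

  ⊝_ : Ser → Ser
  (⊝ F) n = ℤ.- F n

  ⊕-at : ∀ F G n → (F ⊕ G) n ≡ F n ℤ.+ G n
  ⊕-at F G n = refl

  ⊝-at : ∀ F n → (⊝ F) n ≡ ℤ.- F n
  ⊝-at F n = refl

-- The Cauchy product through F = F 0 + x · `tl F`: the recursion peels the left factor and leaves
-- the right one whole.
_⊗_ : Ser → Ser → Ser
(F ⊗ G) zero    = F 0 ℤ.* G 0
(F ⊗ G) (suc n) = F 0 ℤ.* G (suc n) ℤ.+ ((λ i → F (suc i)) ⊗ G) n

cst : ℤ → Ser
cst c zero    = c
cst c (suc n) = + 0

𝟘 𝟙 : Ser
𝟘 = cst (+ 0)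
𝟙 = cst (+ 1)

tl : Ser → Ser
tl F n = F (suc n)

cst0 : ∀ n → 𝟘 n ≡ + 0
cst0 zero    = refl
cst0 (suc n) = refl

⊗-cong : ∀ {F F′ G G′} → F ≈ F′ → G ≈ G′ → ∀ n → (F ⊗ G) n ≡ (F′ ⊗ G′) n
⊗-cong p q zero    = cong₂ ℤ._*_ (at p 0) (at q 0)
⊗-cong p q (suc n) = cong₂ ℤ._+_ (cong₂ ℤ._*_ (at p 0) (at q (suc n)))
                                 (⊗-cong (mk λ i → at p (suc i)) q n)

-- Mirror image of the defining equation, peeling the right factor; commutativity is the comparison
-- of the two.
⊗-step : ∀ F G n → (F ⊗ G) (suc n) ≡ F (suc n) ℤ.* G 0 ℤ.+ (F ⊗ tl G) n
⊗-step F G zero    = ℤP.+-comm (F 0 ℤ.* G 1) (F 1 ℤ.* G 0)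
⊗-step F G (suc n) rewrite ⊗-step (tl F) G n =
  lem (F 0 ℤ.* G (suc (suc n))) (F (suc (suc n)) ℤ.* G 0) ((tl F ⊗ tl G) n)
  where
  lem : ∀ a b c → a ℤ.+ (b ℤ.+ c) ≡ b ℤ.+ (a ℤ.+ c)
  lem = solveℤ

⊗-comm : ∀ F G n → (F ⊗ G) n ≡ (G ⊗ F) n
⊗-comm F G zero    = ℤP.*-comm (F 0) (G 0)
⊗-comm F G (suc n) = trans
  (cong₂ ℤ._+_ (ℤP.*-comm (F 0) (G (suc n))) (⊗-comm (tl F) G n)) (sym (⊗-step G F n))

opaque
  unfolding _⊕_ ⊝_

  ⊗-distribˡ : ∀ F G H n → (F ⊗ (G ⊕ H)) n ≡ (F ⊗ G) n ℤ.+ (F ⊗ H) n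
  ⊗-distribˡ F G H zero    = ℤP.*-distribˡ-+ (F 0) (G 0) (H 0)
  ⊗-distribˡ F G H (suc n) rewrite ⊗-distribˡ (tl F) G H n =
    lem (F 0) (G (suc n)) (H (suc n)) ((tl F ⊗ G) n) ((tl F ⊗ H) n)
    where
    lem : ∀ a b c d e → a ℤ.* (b ℤ.+ c) ℤ.+ (d ℤ.+ e) ≡ (a ℤ.* b ℤ.+ d) ℤ.+ (a ℤ.* c ℤ.+ e)
    lem = solveℤ

  ⊗-scale : ∀ c F G n → ((λ i → c ℤ.* F i) ⊗ G) n ≡ c ℤ.* (F ⊗ G) n
  ⊗-scale c F G zero    = ℤP.*-assoc c (F 0) (G 0)
  ⊗-scale c F G (suc n) rewrite ⊗-scale c (tl F) G n =
    lem c (F 0) (G (suc n)) ((tl F ⊗ G) n)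
    where
    lem : ∀ c a b d → c ℤ.* a ℤ.* b ℤ.+ c ℤ.* d ≡ c ℤ.* (a ℤ.* b ℤ.+ d)
    lem = solveℤ

  ⊗-distribʳ : ∀ F G H n → ((G ⊕ H) ⊗ F) n ≡ (G ⊗ F) n ℤ.+ (H ⊗ F) n
  ⊗-distribʳ F G H n = trans (⊗-comm (G ⊕ H) F n) (trans (⊗-distribˡ F G H n)
    (cong₂ ℤ._+_ (⊗-comm F G n) (⊗-comm F H n)))

  ⊗-assoc : ∀ F G H n → ((F ⊗ G) ⊗ H) n ≡ (F ⊗ (G ⊗ H)) n
  ⊗-assoc F G H zero    = ℤP.*-assoc (F 0) (G 0) (H 0)
  ⊗-assoc F G H (suc n)
    rewrite ⊗-distribʳ H (λ i → F 0 ℤ.* G (suc i)) (tl F ⊗ G) n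
          | ⊗-scale (F 0) (tl G) H n
          | ⊗-assoc (tl F) G H n =
    lem (F 0) (G 0) (H (suc n)) ((tl G ⊗ H) n) ((tl F ⊗ (G ⊗ H)) n)
    where
    lem : ∀ a b c d e → a ℤ.* b ℤ.* c ℤ.+ (a ℤ.* d ℤ.+ e) ≡ a ℤ.* (b ℤ.* c ℤ.+ d) ℤ.+ e
    lem = solveℤ


  ⊕-cong : ∀ {F F′ G G′} → F ≈ F′ → G ≈ G′ → F ⊕ G ≈ F′ ⊕ G′
  ⊕-cong p q = mk λ n → cong₂ ℤ._+_ (at p n) (at q n)

  ⊕-assoc : ∀ F G H → (F ⊕ G) ⊕ H ≈ F ⊕ (G ⊕ H)
  ⊕-assoc F G H = mk λ n → ℤP.+-assoc (F n) (G n) (H n)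

  ⊕-comm : ∀ F G → F ⊕ G ≈ G ⊕ F
  ⊕-comm F G = mk λ n → ℤP.+-comm (F n) (G n)

  ⊕-identityˡ : ∀ F → 𝟘 ⊕ F ≈ F
  ⊕-identityˡ F = mk λ n → trans (cong (ℤ._+ F n) (cst0 n)) (ℤP.+-identityˡ (F n))

  ⊕-inverseˡ : ∀ F → ⊝ F ⊕ F ≈ 𝟘
  ⊕-inverseˡ F = mk λ n → trans (ℤP.+-inverseˡ (F n)) (sym (cst0 n))

  ⊗-distrib : (∀ F G H → F ⊗ (G ⊕ H) ≈ F ⊗ G ⊕ F ⊗ H) × (∀ F G H → (G ⊕ H) ⊗ F ≈ G ⊗ F ⊕ H ⊗ F)
  ⊗-distrib = (λ F G H → mk (⊗-distribˡ F G H)) , (λ F G H → mk (⊗-distribʳ F G H))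

  ⊝-cong : ∀ {F G} → F ≈ G → ⊝ F ≈ ⊝ G
  ⊝-cong p = mk λ n → cong ℤ.-_ (at p n)

⊗-zeroˡ : ∀ F G → (∀ n → F n ≡ + 0) → ∀ n → (F ⊗ G) n ≡ + 0
⊗-zeroˡ F G z zero    rewrite z 0 = refl
⊗-zeroˡ F G z (suc n) rewrite z 0 | ⊗-zeroˡ (tl F) G (λ i → z (suc i)) n = refl

⊗-cst : ∀ c G n → (cst c ⊗ G) n ≡ c ℤ.* G n
⊗-cst c G zero    = refl
⊗-cst c G (suc n) rewrite ⊗-zeroˡ (tl (cst c)) G (λ _ → refl) n = ℤP.+-identityʳ _

⊗-identityˡ : ∀ G n → (𝟙 ⊗ G) n ≡ G n
⊗-identityˡ G n = trans (⊗-cst (+ 1) G n) (ℤP.*-identityˡ (G n))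

≈-trans′ : ∀ {F G H} → F ≈ G → G ≈ H → F ≈ H
≈-trans′ p q = mk λ n → trans (at p n) (at q n)

serRing : CommutativeRing _ _
serRing = record
  { Carrier = Ser ; _≈_ = _≈_ ; _+_ = _⊕_ ; _*_ = _⊗_ ; -_ = ⊝_ ; 0# = 𝟘 ; 1# = 𝟙
  ; isCommutativeRing = record
    { isRing = record
      { +-isAbelianGroup = record
        { isGroup = record
          { isMonoid = record
            { isSemigroup = record
              { isMagma = record
                { isEquivalence = record
                  { refl  = mk λ _ → refl
                  ; sym   = λ p → mk λ n → sym (at p n)
                  ; trans = λ p q → mk λ n → trans (at p n) (at q n) }
                ; ∙-cong = ⊕-cong }
              ; assoc = ⊕-assoc }
            ; identity = ⊕-identityˡ , (λ F → ≈-trans′ (⊕-comm F 𝟘) (⊕-identityˡ F)) }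
          ; inverse = ⊕-inverseˡ , (λ F → ≈-trans′ (⊕-comm F (⊝ F)) (⊕-inverseˡ F))
          ; ⁻¹-cong = ⊝-cong }
        ; comm = ⊕-comm }
      ; *-cong = λ p q → mk (⊗-cong p q)
      ; *-assoc = λ F G H → mk (⊗-assoc F G H)
      ; *-identity = (λ F → mk (⊗-identityˡ F))
                   , (λ F → mk λ n → trans (⊗-comm F 𝟙 n) (⊗-identityˡ F n))
      ; distrib = ⊗-distrib }
    ; *-comm = λ F G → mk (⊗-comm F G) } }

open CommutativeRing serRing public
  using () renaming (refl to ≈-refl; sym to ≈-sym; trans to ≈-trans; setoid to serSetoid;
                     +-cong to ⊕-≈; *-cong to ⊗-≈; -‿cong to ⊝-≈)

cst-⊗ : ∀ a b → cst (a ℤ.* b) ≈ cst a ⊗ cst b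
cst-⊗ a b = mk λ n → sym (trans (⊗-cst a (cst b) n) (lem n))
  where
  lem : ∀ n → a ℤ.* cst b n ≡ cst (a ℤ.* b) n
  lem zero    = refl
  lem (suc n) = ℤP.*-zeroʳ a

opaque
  unfolding _⊕_ ⊝_

  cst-⊕ : ∀ a b → cst (a ℤ.+ b) ≈ cst a ⊕ cst b
  cst-⊕ a b = mk λ { zero → refl ; (suc n) → refl }

  cst-⊝ : ∀ a → cst (ℤ.- a) ≈ ⊝ cst a
  cst-⊝ a = mk λ { zero → refl ; (suc n) → refl }

cst-≟ : (a b : ℤ) → Maybe (cst a ≈ cst b)
cst-≟ a b with a ℤP.≟ b
... | yes refl = just ≈-refl
... | no _     = nothing

cst-morphism : CommutativeRing.rawRing ℤP.+-*-commutativeRing -Raw-AlmostCommutative⟶ fromCommutativeRing serRing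
cst-morphism = record
  { ⟦_⟧ = cst ; +-homo = cst-⊕ ; *-homo = cst-⊗ ; -‿homo = cst-⊝ ; 0-homo = ≈-refl ; 1-homo = ≈-refl }

module Solve = RingSolver (CommutativeRing.rawRing ℤP.+-*-commutativeRing) (fromCommutativeRing serRing) cst-morphism cst-≟
open Solve public using (solve; _:=_; _:+_; _:*_; _:-_; :-_; con)

-- F ≼ G : the coefficients of G dominate those of F in absolute value.
record _≼_ (F G : Ser) : Set where
  constructor dom
  field le : ∀ n → + ∣ F n ∣ ℤ.≤ G n
open _≼_ public

ℕ≤⇒ℤ≤ : ∀ {m n} → m ℕ.≤ n → + m ℤ.≤ + n
ℕ≤⇒ℤ≤ = ℤ.+≤+

abs-nonneg : ∀ {x} → + 0 ℤ.≤ x → + ∣ x ∣ ≡ x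
abs-nonneg = ℤP.0≤i⇒+∣i∣≡i

≤-abs : ∀ x → x ℤ.≤ + ∣ x ∣
≤-abs (+ n)      = ℤP.≤-refl
≤-abs (-[1+ n ]) = ℤ.-≤+

abs-+ : ∀ {a b c d} → + ∣ a ∣ ℤ.≤ c → + ∣ b ∣ ℤ.≤ d → + ∣ a ℤ.+ b ∣ ℤ.≤ c ℤ.+ d
abs-+ {a} {b} p q = ℤP.≤-trans (ℕ≤⇒ℤ≤ (ℤP.∣i+j∣≤∣i∣+∣j∣ a b)) (ℤP.+-mono-≤ p q)

*-mono-≤-0 : ∀ {a b c d} → + 0 ℤ.≤ a → + 0 ℤ.≤ b → a ℤ.≤ c → b ℤ.≤ d → a ℤ.* b ℤ.≤ c ℤ.* d
*-mono-≤-0 {+ a} {+ b} {+ c} {+ d} _ _ (ℤ.+≤+ p) (ℤ.+≤+ q) =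
  subst₂ ℤ._≤_ (ℤP.pos-* a b) (ℤP.pos-* c d) (ℕ≤⇒ℤ≤ (ℕP.*-mono-≤ p q))

abs-* : ∀ {a b c d} → + ∣ a ∣ ℤ.≤ c → + ∣ b ∣ ℤ.≤ d → + ∣ a ℤ.* b ∣ ℤ.≤ c ℤ.* d
abs-* {a} {b} p q = subst (ℤ._≤ _) (sym (trans (cong +_ (ℤP.abs-* a b)) (ℤP.pos-* ∣ a ∣ ∣ b ∣)))
  (*-mono-≤-0 (ℕ≤⇒ℤ≤ z≤n) (ℕ≤⇒ℤ≤ z≤n) p q)

-- Self-domination means nonnegative coefficients, so the congruence rules `≼-⊕` and `≼-⊗` double as
-- proofs of positivity.
Pos : Ser → Set
Pos F = F ≼ F

pos : ∀ {F} → (∀ n → + 0 ℤ.≤ F n) → Pos F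
pos p = dom λ n → ℤP.≤-reflexive (abs-nonneg (p n))

≼-nonneg : ∀ {F G} → F ≼ G → ∀ n → + 0 ℤ.≤ G n
≼-nonneg p n = ℤP.≤-trans (ℕ≤⇒ℤ≤ z≤n) (le p n)

≼-trans : ∀ {F G H} → F ≼ G → G ≼ H → F ≼ H
≼-trans {F} {G} p q = dom λ n → ℤP.≤-trans (le p n) (ℤP.≤-trans (≤-abs (G n)) (le q n))

≼-resp : ∀ {F F′ G G′} → F ≈ F′ → G ≈ G′ → F ≼ G → F′ ≼ G′
≼-resp e f p = dom λ n → subst₂ (λ a b → + ∣ a ∣ ℤ.≤ b) (at e n) (at f n) (le p n)

≼-respˡ : ∀ {F F′ G} → F ≈ F′ → F ≼ G → F′ ≼ G
≼-respˡ e = ≼-resp e ≈-refl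

≼-respʳ : ∀ {F G G′} → G ≈ G′ → F ≼ G → F ≼ G′
≼-respʳ e = ≼-resp ≈-refl e

opaque
  unfolding _⊕_ ⊝_

  ≼-⊕ : ∀ {F F′ G G′} → F ≼ G → F′ ≼ G′ → F ⊕ F′ ≼ G ⊕ G′
  ≼-⊕ {F} {F′} p q = dom λ n → abs-+ {F n} {F′ n} (le p n) (le q n)

  ≼-⊝ : ∀ {F G} → F ≼ G → ⊝ F ≼ G
  ≼-⊝ {F} p = dom λ n → subst (λ z → + z ℤ.≤ _) (sym (ℤP.∣-i∣≡∣i∣ (F n))) (le p n)

⊗-dom : ∀ {F F′ G G′} → F ≼ G → F′ ≼ G′ → ∀ n → + ∣ (F ⊗ F′) n ∣ ℤ.≤ (G ⊗ G′) n
⊗-dom {F} {F′} p q zero    = abs-* {F 0} {F′ 0} (le p 0) (le q 0)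
⊗-dom {F} {F′} p q (suc n) = abs-+ {F 0 ℤ.* F′ (suc n)} {(tl F ⊗ F′) n}
  (abs-* {F 0} {F′ (suc n)} (le p 0) (le q (suc n)))
  (⊗-dom (dom λ i → le p (suc i)) q n)

≼-⊗ : ∀ {F F′ G G′} → F ≼ G → F′ ≼ G′ → F ⊗ F′ ≼ G ⊗ G′
≼-⊗ p q = dom (⊗-dom p q)

Pos-cst : ∀ c → Pos (cst (+ c))
Pos-cst c = pos λ { zero → ℕ≤⇒ℤ≤ z≤n ; (suc n) → ℕ≤⇒ℤ≤ z≤n }

≼-cst : ∀ {c d} → c ℕ.≤ d → cst (+ c) ≼ cst (+ d)
≼-cst p = dom λ { zero → ℕ≤⇒ℤ≤ p ; (suc n) → ℕ≤⇒ℤ≤ z≤n }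

𝟘≼ : ∀ {G} → Pos G → 𝟘 ≼ G
𝟘≼ {G} p = dom λ n → subst (λ z → + ∣ z ∣ ℤ.≤ G n) (sym (cst0 n)) (≼-nonneg p n)

opaque
  unfolding _⊕_ ⊝_

  ≼-⊕ʳ : ∀ {F G H} → F ≼ G → Pos H → F ≼ G ⊕ H
  ≼-⊕ʳ {F} {G} {H} p q = dom λ n → ℤP.≤-trans (le p n)
    (subst (ℤ._≤ G n ℤ.+ H n) (ℤP.+-identityʳ (G n)) (ℤP.+-monoʳ-≤ (G n) (≼-nonneg q n)))

  ≼-⊕ˡ : ∀ {F G H} → F ≼ H → Pos G → F ≼ G ⊕ H
  ≼-⊕ˡ {F} {G} {H} p q = ≼-respʳ (mk λ n → ℤP.+-comm (H n) (G n)) (≼-⊕ʳ p q)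


-- Sums over lists

∑ : ∀ {A : Set} → List A → (A → ℤ) → ℤ
∑ []       f = + 0
∑ (x ∷ xs) f = f x ℤ.+ ∑ xs f

∑-cong : ∀ {A : Set} {f g : A → ℤ} (xs : List A) → (∀ x → f x ≡ g x) → ∑ xs f ≡ ∑ xs g
∑-cong []       e = refl
∑-cong (x ∷ xs) e = cong₂ ℤ._+_ (e x) (∑-cong xs e)

∑-congᴬ : ∀ {A : Set} {f g : A → ℤ} {xs : List A} → All (λ x → f x ≡ g x) xs → ∑ xs f ≡ ∑ xs g
∑-congᴬ []       = refl
∑-congᴬ (e ∷ es) = cong₂ ℤ._+_ e (∑-congᴬ es)

∑-zero : ∀ {A : Set} {f : A → ℤ} {xs : List A} → All (λ x → f x ≡ + 0) xs → ∑ xs f ≡ + 0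
∑-zero []       = refl
∑-zero (e ∷ es) = cong₂ ℤ._+_ e (∑-zero es)

∑-+ : ∀ {A : Set} (f g : A → ℤ) xs → ∑ xs (λ x → f x ℤ.+ g x) ≡ ∑ xs f ℤ.+ ∑ xs g
∑-+ f g []       = refl
∑-+ f g (x ∷ xs) rewrite ∑-+ f g xs = lem (f x) (g x) (∑ xs f) (∑ xs g)
  where
  lem : ∀ a b c d → (a ℤ.+ b) ℤ.+ (c ℤ.+ d) ≡ (a ℤ.+ c) ℤ.+ (b ℤ.+ d)
  lem = solveℤ

∑-* : ∀ {A : Set} c (f : A → ℤ) xs → ∑ xs (λ x → c ℤ.* f x) ≡ c ℤ.* ∑ xs f
∑-* c f []       = sym (ℤP.*-zeroʳ c)
∑-* c f (x ∷ xs) rewrite ∑-* c f xs = sym (ℤP.*-distribˡ-+ c (f x) (∑ xs f))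

∑-*ʳ : ∀ {A : Set} c (f : A → ℤ) xs → ∑ xs (λ x → f x ℤ.* c) ≡ ∑ xs f ℤ.* c
∑-*ʳ c f xs = trans (∑-cong xs λ x → ℤP.*-comm (f x) c) (trans (∑-* c f xs) (ℤP.*-comm c _))

∑-++ : ∀ {A : Set} (f : A → ℤ) xs ys → ∑ (xs ++ ys) f ≡ ∑ xs f ℤ.+ ∑ ys f
∑-++ f []       ys = sym (ℤP.+-identityˡ _)
∑-++ f (x ∷ xs) ys rewrite ∑-++ f xs ys = sym (ℤP.+-assoc (f x) _ _)

∑-map : ∀ {A B : Set} (f : B → ℤ) (g : A → B) xs → ∑ (map g xs) f ≡ ∑ xs (λ x → f (g x))
∑-map f g []       = refl
∑-map f g (x ∷ xs) = cong (λ z → f (g x) ℤ.+ z) (∑-map f g xs)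

∑-concatMap : ∀ {A B : Set} (f : B → ℤ) (g : A → List B) xs →
  ∑ (concatMap g xs) f ≡ ∑ xs (λ x → ∑ (g x) f)
∑-concatMap f g []       = refl
∑-concatMap f g (x ∷ xs) = trans (∑-++ f (g x) (concatMap g xs))
  (cong (λ z → ∑ (g x) f ℤ.+ z) (∑-concatMap f g xs))

∑-swap : ∀ {A B : Set} (f : A → B → ℤ) xs ys →
  ∑ xs (λ x → ∑ ys (λ y → f x y)) ≡ ∑ ys (λ y → ∑ xs (λ x → f x y))
∑-swap f []       ys = sym (∑-zero (All.universal (λ _ → refl) ys))
∑-swap f (x ∷ xs) ys rewrite ∑-swap f xs ys = sym (∑-+ (f x) (λ y → ∑ xs (λ x → f x y)) ys)

∑-mono : ∀ {A : Set} {f g : A → ℤ} {xs} → All (λ x → f x ℤ.≤ g x) xs → ∑ xs f ℤ.≤ ∑ xs g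
∑-mono []       = ℤP.≤-refl
∑-mono (p ∷ ps) = ℤP.+-mono-≤ p (∑-mono ps)

∑-abs : ∀ {A : Set} {f g : A → ℤ} {xs} → All (λ x → + ∣ f x ∣ ℤ.≤ g x) xs → + ∣ ∑ xs f ∣ ℤ.≤ ∑ xs g
∑-abs []       = ℤP.≤-refl
∑-abs {f = f} {xs = x ∷ xs} (p ∷ ps) = abs-+ {f x} {∑ xs f} p (∑-abs ps)

ind : ∀ {P : Set} → Dec P → ℤ
ind (yes _) = + 1
ind (no _)  = + 0

ind-yes : ∀ {P : Set} (d : Dec P) → P → ind d ≡ + 1
ind-yes (yes _) p = refl
ind-yes (no ¬p) p = contradiction p ¬p

ind-no : ∀ {P : Set} (d : Dec P) → ¬ P → ind d ≡ + 0
ind-no (yes p) ¬p = contradiction p ¬p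
ind-no (no _)  ¬p = refl

∑-rng-trim : ∀ {M} (f : ℕ → ℤ) N → M ℕ.≤ N → (∀ i → M ℕ.≤ i → f i ≡ + 0) →
  ∑ (downFrom N) f ≡ ∑ (downFrom M) f
∑-rng-trim {M} f N M≤N z with ℕP.m≤n⇒m<n∨m≡n M≤N
... | inj₂ refl = refl
∑-rng-trim {M} f (suc N) M≤N z | inj₁ (s≤s M≤N′) =
  trans (cong₂ ℤ._+_ (z N M≤N′) (∑-rng-trim f N M≤N′ z)) (ℤP.+-identityˡ _)

∑-rng-shift : ∀ (f : ℕ → ℤ) N → ∑ (downFrom (suc N)) f ≡ f 0 ℤ.+ ∑ (downFrom N) (λ i → f (suc i))
∑-rng-shift f zero    = refl
∑-rng-shift f (suc N) rewrite ∑-rng-shift f N = lem (f (suc N)) (f 0) (∑ (downFrom N) (λ i → f (suc i)))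
  where
  lem : ∀ a b c → a ℤ.+ (b ℤ.+ c) ≡ b ℤ.+ (a ℤ.+ c)
  lem = solveℤ

∑-rng-zero : ∀ (f : ℕ → ℤ) N → (∀ i → i ℕ.< N → f i ≡ + 0) → ∑ (downFrom N) f ≡ + 0
∑-rng-zero f zero    z = refl
∑-rng-zero f (suc N) z = cong₂ ℤ._+_ (z N ℕP.≤-refl) (∑-rng-zero f N λ i p → z i (ℕP.m≤n⇒m≤1+n p))

∑-rng-single : ∀ (f : ℕ → ℤ) N k → k ℕ.< N → (∀ i → i ≢ k → f i ≡ + 0) → ∑ (downFrom N) f ≡ f k
∑-rng-single f (suc N) k k<N z with ℕP.m<1+n⇒m<n∨m≡n k<N
... | inj₂ refl = trans (cong (λ w → f N ℤ.+ w) (∑-rng-zero f N λ i p → z i (ℕP.<⇒≢ p)))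
                        (ℤP.+-identityʳ (f N))
... | inj₁ k<N′ = trans (cong₂ ℤ._+_ (z N (ℕP.>⇒≢ k<N′)) (∑-rng-single f N k k<N′ z)) (ℤP.+-identityˡ (f k))

-- Unlabelled trees as a setoid: sums of class functions

ClassFun : (Tree → ℤ) → Set
ClassFun f = ∀ {t u} → t ≅ u → f t ≡ f u

Distinct : List Tree → Set
Distinct = AllPairs (λ t u → ¬ (t ≅ u))

data Remove (y : Tree) : List Tree → List Tree → Set where
  here  : ∀ {x xs} → y ≅ x → Remove y (x ∷ xs) xs
  there : ∀ {x xs xs′} → Remove y xs xs′ → Remove y (x ∷ xs) (x ∷ xs′)

remove : ∀ {y xs} → Any (y ≅_) xs → ∃ (Remove y xs)
remove (here e)  = _ , here e
remove (there p) = _ , there (proj₂ (remove p))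

∑-remove : ∀ {g y xs xs′} → ClassFun g → Remove y xs xs′ → ∑ xs g ≡ g y ℤ.+ ∑ xs′ g
∑-remove {g} {xs = x ∷ xs} c (here e) = cong (λ z → z ℤ.+ ∑ xs g) (sym (c e))
∑-remove {g} {y} {x ∷ xs} {_ ∷ xs′} c (there r) rewrite ∑-remove c r = lem (g x) (g y) (∑ xs′ g)
  where
  lem : ∀ a b c → a ℤ.+ (b ℤ.+ c) ≡ b ℤ.+ (a ℤ.+ c)
  lem = solveℤ

remove-length : ∀ {y xs xs′} → Remove y xs xs′ → length xs ≡ suc (length xs′)
remove-length (here _)  = refl
remove-length (there r) = cong suc (remove-length r)

remove-all : ∀ {P : Tree → Set} {y xs xs′} → Remove y xs xs′ → All P xs → All P xs′
remove-all (here _)  (_ ∷ ps) = ps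
remove-all (there r) (p ∷ ps) = p ∷ remove-all r ps

remove-distinct : ∀ {y xs xs′} → Remove y xs xs′ → Distinct xs → Distinct xs′
remove-distinct (here _)  (_ ∷ ds) = ds
remove-distinct (there r) (d ∷ ds) = remove-all r d ∷ remove-distinct r ds

remove-any : ∀ {y z xs xs′} → Remove y xs xs′ → ¬ (z ≅ y) → Any (z ≅_) xs → Any (z ≅_) xs′
remove-any (here e)  z≇y (here z≅x) = contradiction (≅-trans z≅x (≅-sym e)) z≇y
remove-any (here e)  z≇y (there p)  = p
remove-any (there r) z≇y (here e)   = here e
remove-any (there r) z≇y (there p)  = there (remove-any r z≇y p)

remove-fresh : ∀ {y xs xs′} → Remove y xs xs′ → Distinct xs → All (λ x → ¬ (x ≅ y)) xs′
remove-fresh (here e)  (d ∷ _)  = All.map (λ x≇ x≅y → x≇ (≅-sym (≅-trans x≅y e))) d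
remove-fresh (there r) (d ∷ ds) = fresh r d ∷ remove-fresh r ds
  where
  fresh : ∀ {x y xs xs′} → Remove y xs xs′ → All (λ u → ¬ (x ≅ u)) xs → ¬ (x ≅ y)
  fresh (here e)  (p ∷ _)  x≅y = p (≅-trans x≅y e)
  fresh (there r) (_ ∷ ps) x≅y = fresh r ps x≅y

remove-perm : ∀ {y xs xs′} → Remove y xs xs′ → Permutation _≅_ xs (y ∷ xs′)
remove-perm (here e)  = Perm.prep (≅-sym e) (Perm.refl (≅-reflᶠ _))
remove-perm (there r) = Perm.trans (Perm.prep (≅-refl _) (remove-perm r))
  (Perm.swap (≅-refl _) (≅-refl _) (Perm.refl (≅-reflᶠ _)))

-- Representatives of isomorphism classes are arbitrary, so bijections between classes are used
-- through sums over duplicate-free lists. Each entry of `ys` is deleted from `xs`; distinctness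
-- keeps the rest of `ys` inside what remains, and on the leftovers `g` vanishes.
∑-transfer : ∀ {g} → ClassFun g → ∀ xs ys → Distinct xs → Distinct ys →
  All (λ y → Any (y ≅_) xs) ys → All (λ x → g x ≡ + 0 ⊎ Any (x ≅_) ys) xs → ∑ xs g ≡ ∑ ys g
∑-transfer c xs []       dx dy sub cov = ∑-zero (All.map (λ { (inj₁ e) → e ; (inj₂ ()) }) cov)
∑-transfer {g} c xs (y ∷ ys) dx (dy ∷ dys) (p ∷ ps) cov with remove p
... | xs′ , r = trans (∑-remove c r) (cong (λ z → g y ℤ.+ z)
  (∑-transfer c xs′ ys (remove-distinct r dx) dys (sub dy ps)
    (All.zipWith shrink (remove-all r cov , remove-fresh r dx))))
  where
  sub : ∀ {zs} → All (λ u → ¬ (y ≅ u)) zs → All (λ z → Any (z ≅_) xs) zs → All (λ z → Any (z ≅_) xs′) zs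
  sub []       []       = []
  sub (n ∷ ns) (q ∷ qs) = remove-any r (λ e → n (≅-sym e)) q ∷ sub ns qs
  shrink : ∀ {x} → (g x ≡ + 0 ⊎ Any (x ≅_) (y ∷ ys)) × ¬ (x ≅ y) → g x ≡ + 0 ⊎ Any (x ≅_) ys
  shrink (inj₁ e , _)           = inj₁ e
  shrink (inj₂ (here e) , n)    = contradiction e n
  shrink (inj₂ (there q) , _)   = inj₂ q

length-embed : ∀ xs ys → Distinct xs → All (λ x → Any (x ≅_) ys) xs → length xs ℕ.≤ length ys
length-embed []       ys dx sub = z≤n
length-embed (x ∷ xs) ys (d ∷ dx) (p ∷ ps) with remove p
... | ys′ , r = subst (suc (length xs) ℕ.≤_) (sym (remove-length r))
  (s≤s (length-embed xs ys′ dx (sub d ps)))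
  where
  sub : ∀ {zs} → All (λ u → ¬ (x ≅ u)) zs → All (λ z → Any (z ≅_) ys) zs → All (λ z → Any (z ≅_) ys′) zs
  sub []       []       = []
  sub (n ∷ ns) (q ∷ qs) = remove-any r (λ e → n (≅-sym e)) q ∷ sub ns qs

∑-perm : ∀ {d} → ClassFun d → ∀ {ts us} → Permutation _≅_ ts us → ∑ ts d ≡ ∑ us d
∑-perm {d} c (Perm.refl es) = pw es
  where
  pw : ∀ {ts us} → Pointwise _≅_ ts us → ∑ ts d ≡ ∑ us d
  pw []       = refl
  pw (e ∷ es) = cong₂ ℤ._+_ (c e) (pw es)
∑-perm c (Perm.prep e p) = cong₂ ℤ._+_ (c e) (∑-perm c p)
∑-perm {d} c (Perm.swap {xs} {ys} {x} {y} {x′} {y′} e e′ p)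
  rewrite c e | c e′ | ∑-perm c p = lem (d x′) (d y′) (∑ ys d)
  where
  lem : ∀ a b c → a ℤ.+ (b ℤ.+ c) ≡ b ℤ.+ (a ℤ.+ c)
  lem = solveℤ
∑-perm c (Perm.trans p q) = trans (∑-perm c p) (∑-perm c q)

-- The generating series of class functions

-- `ψ` does not count the root: its degree is the size of the forest of root subtrees, so that
-- `⟦ Φ ⟧` is x · `ψ Φ`.
⟦_⟧ ψ : (Tree → ℤ) → Ser
⟦ Φ ⟧ n = ∑ (trees n) Φ
ψ Φ n   = ∑ (trees (suc n)) Φ

-- The monomial x^e.
δ : ℕ → Ser
δ zero            = 𝟙
δ (suc e) zero    = + 0
δ (suc e) (suc n) = δ e n

δ-self : ∀ e → δ e e ≡ + 1
δ-self zero    = refl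
δ-self (suc e) = δ-self e

δ-other : ∀ e n → e ≢ n → δ e n ≡ + 0
δ-other zero    zero    e≢n = contradiction refl e≢n
δ-other zero    (suc n) e≢n = refl
δ-other (suc e) zero    e≢n = refl
δ-other (suc e) (suc n) e≢n = δ-other e n (λ p → e≢n (cong suc p))

δ-hit : ∀ e F m → (δ e ⊗ F) (e ℕ.+ m) ≡ F m
δ-hit zero    F m = ⊗-identityˡ F m
δ-hit (suc e) F m = trans (ℤP.+-identityˡ _) (δ-hit e F m)

δ-miss : ∀ e F n → n ℕ.< e → (δ e ⊗ F) n ≡ + 0
δ-miss (suc e) F zero    _         = refl
δ-miss (suc e) F (suc n) (s≤s n<e) = trans (ℤP.+-identityˡ _) (δ-miss e F n n<e)

δ-δ : ∀ e f → δ e ⊗ δ f ≈ δ (e ℕ.+ f)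
δ-δ e f = mk (go e)
  where
  go : ∀ e n → (δ e ⊗ δ f) n ≡ δ (e ℕ.+ f) n
  go zero    n       = ⊗-identityˡ (δ f) n
  go (suc e) zero    = refl
  go (suc e) (suc n) = trans (ℤP.+-identityˡ _) (go e n)

opaque
  unfolding _⊕_

  ∑ˢ : ∀ {A : Set} → List A → (A → Ser) → Ser
  ∑ˢ xs F m = ∑ xs (λ x → F x m)

  ∑ˢ-cong : ∀ {A : Set} (xs : List A) {F G : A → Ser} → (∀ x → F x ≈ G x) → ∑ˢ xs F ≈ ∑ˢ xs G
  ∑ˢ-cong xs e = mk λ n → ∑-cong xs (λ x → at (e x) n)

  ∑ˢ-⊕ : ∀ {A : Set} (xs : List A) (F G : A → Ser) → ∑ˢ xs (λ x → F x ⊕ G x) ≈ ∑ˢ xs F ⊕ ∑ˢ xs G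
  ∑ˢ-⊕ xs F G = mk λ n → ∑-+ (λ x → F x n) (λ x → G x n) xs

  ∑ˢ-⊗ : ∀ {A : Set} (xs : List A) (F : A → Ser) G → ∑ˢ xs (λ x → F x ⊗ G) ≈ ∑ˢ xs F ⊗ G
  ∑ˢ-⊗ []       F G = mk λ n → sym (⊗-zeroˡ (∑ˢ [] F) G (λ _ → refl) n)
  ∑ˢ-⊗ (x ∷ xs) F G = mk λ n → trans (cong (λ z → (F x ⊗ G) n ℤ.+ z) (at (∑ˢ-⊗ xs F G) n))
    (sym (⊗-distribʳ G (F x) (∑ˢ xs F) n))


  ∑ˢ-at : ∀ {A : Set} (xs : List A) (F : A → Ser) n → ∑ˢ xs F n ≡ ∑ xs (λ x → F x n)
  ∑ˢ-at xs F n = refl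

  ∑ˢ-[] : ∀ {A : Set} (F : A → Ser) → ∑ˢ [] F ≈ 𝟘
  ∑ˢ-[] F = mk λ n → sym (cst0 n)

  ∑ˢ-∷ : ∀ {A : Set} x (xs : List A) (F : A → Ser) → ∑ˢ (x ∷ xs) F ≈ F x ⊕ ∑ˢ xs F
  ∑ˢ-∷ x xs F = mk λ n → refl

⊗∑ˢ : ∀ {A : Set} (xs : List A) (F : A → Ser) G → ∑ˢ xs (λ x → G ⊗ F x) ≈ G ⊗ ∑ˢ xs F
⊗∑ˢ xs F G = ≈-trans (∑ˢ-cong xs (λ x → mk (⊗-comm G (F x))))
  (≈-trans (∑ˢ-⊗ xs F G) (mk (⊗-comm (∑ˢ xs F) G)))

module _ (n : ℕ) where
  open UnlabelledTrees (unlabelledTrees n) public using ()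
    renaming (sizes to trees-sizes; complete to trees-complete; distinct to trees-distinct)

-- Attaching copies of a fixed subtree to the root

ch : Tree → List Tree
ch (node ts) = ts

add : Tree → Tree → Tree
add t (node ts) = node (t ∷ ts)

ch-perm : ∀ {T U} → T ≅ U → Permutation _≅_ (ch T) (ch U)
ch-perm (node p) = p

add-cong : ∀ t {T U} → T ≅ U → add t T ≅ add t U
add-cong t (node p) = node (Perm.prep (≅-refl t) p)

add-cancel : ∀ t {T U} → add t T ≅ add t U → T ≅ U
add-cancel t {node _} {node _} (node p) = node (SetoidPerm.drop-∷ ≅-setoid p)

size-cong : ∀ {t u} → t ≅ u → size t ≡ size u
size-cong e = PermP.↭-length (depths-cong e)

size-add : ∀ t T → size (add t T) ≡ size t ℕ.+ size T
size-add t (node ts) = trans (cong suc (trans (ListP.length-map suc (depths t ++ depthsᶠ ts))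
    (trans (ListP.length-++ (depths t)) (cong (size t ℕ.+_) (sym (ListP.length-map suc (depthsᶠ ts)))))))
  (sym (ℕP.+-suc (size t) _))

size-pos : ∀ t → 1 ℕ.≤ size t
size-pos (node ts) = s≤s z≤n

mult : Tree → List Tree → ℤ
mult t M = ∑ M (λ u → ind (t ≅? u))

ind-≅-cong : ∀ t {u v} → u ≅ v → ind (t ≅? u) ≡ ind (t ≅? v)
ind-≅-cong t {u} {v} e with t ≅? u
... | yes p = sym (ind-yes (t ≅? v) (≅-trans p e))
... | no ¬p = sym (ind-no (t ≅? v) (λ q → ¬p (≅-trans q (≅-sym e))))

ind-≅-congˡ : ∀ {t t′} u → t ≅ t′ → ind (t ≅? u) ≡ ind (t′ ≅? u)
ind-≅-congˡ {t} {t′} u e with t ≅? u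
... | yes p = sym (ind-yes (t′ ≅? u) (≅-trans (≅-sym e) p))
... | no ¬p = sym (ind-no (t′ ≅? u) (λ q → ¬p (≅-trans e q)))

mult-zero : ∀ t {M} → ¬ Any (t ≅_) M → mult t M ≡ + 0
mult-zero t {[]}    ¬p = refl
mult-zero t {u ∷ M} ¬p = cong₂ ℤ._+_ (ind-no (t ≅? u) (λ e → ¬p (here e))) (mult-zero t (λ p → ¬p (there p)))

kids : (Tree → ℤ) → Tree → ℤ
kids d T = ∑ (ch T) d

kids-class : ∀ {d} → ClassFun d → ClassFun (kids d)
kids-class c e = ∑-perm c (ch-perm e)

marked : Tree → (Tree → ℤ) → Ser
marked t Φ = ψ (λ T → Φ T ℤ.* mult t (ch T))

-- Attaching `t` is injective on isomorphism classes, because multisets cancel, and its image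
-- consists of the trees with a copy of `t` below the root; `van` makes `g` vanish on all others.
-- The degree shifts by `size t`.
⟦⟧-add : ∀ t {g} → ClassFun g → (∀ T → mult t (ch T) ≡ + 0 → g T ≡ + 0) →
  ψ g ≈ δ (size t) ⊗ ψ (λ T → g (add t T))
⟦⟧-add t {g} c van = mk go
  where
  s = size t
  split : ∀ T {ts′} → Remove t (ch T) ts′ → T ≅ add t (node ts′)
  split (node ts) r = node (remove-perm r)
  go : ∀ n → ψ g n ≡ (δ s ⊗ ψ (λ T → g (add t T))) n
  go n with s ℕP.≤? n
  ... | no s≰n = trans (∑-zero (All.map zeroes (trees-sizes (suc n))))
                       (sym (δ-miss s _ n (ℕP.≰⇒> s≰n)))
    where
    zeroes : ∀ {T} → size T ≡ suc n → g T ≡ + 0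
    zeroes {T} e with any? (t ≅?_) (ch T)
    ... | no ¬p = van T (mult-zero t ¬p)
    ... | yes p with remove p
    ... | ts′ , r = contradiction (ℕP.≤-pred (subst (suc s ℕ.≤_) (trans (sym (trans (size-cong (split T r)) (size-add t (node ts′)))) e)
            (subst (ℕ._≤ s ℕ.+ size (node ts′)) (ℕP.+-comm s 1) (ℕP.+-monoʳ-≤ s (size-pos (node ts′)))))) s≰n
  ... | yes s≤n with ℕP.m≤n⇒∃[o]m+o≡n s≤n
  ... | m , refl = trans (∑-transfer c (trees (suc (s ℕ.+ m))) ys (trees-distinct (suc (s ℕ.+ m))) dys
                           (AllP.map⁺ (All.map member (trees-sizes (suc m)))) (All.map cover (trees-sizes (suc (s ℕ.+ m)))))
                     (trans (∑-map g (add t) (trees (suc m))) (sym (δ-hit s _ m)))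
    where
    ys = map (add t) (trees (suc m))
    dys : Distinct ys
    dys = AllPairsP.map⁺ (AllPairs.map (λ ¬e e → ¬e (add-cancel t e)) (trees-distinct (suc m)))
    member : ∀ {T} → size T ≡ suc m → Any (add t T ≅_) (trees (suc (s ℕ.+ m)))
    member {T} e = trees-complete _ (add t T) (trans (size-add t T) (trans (cong (s ℕ.+_) e) (ℕP.+-suc s m)))
    cover : ∀ {T} → size T ≡ suc (s ℕ.+ m) → g T ≡ + 0 ⊎ Any (T ≅_) ys
    cover {T} e with any? (t ≅?_) (ch T)
    ... | no ¬p = inj₁ (van T (mult-zero t ¬p))
    ... | yes p with remove p
    ... | ts′ , r = inj₂ (AnyP.map⁺ (Any.map (λ q → ≅-trans (split T r) (add-cong t q))
            (trees-complete (suc m) (node ts′) (ℕP.+-cancelˡ-≡ s _ _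
              (trans (sym (trans (size-cong (split T r)) (size-add t (node ts′)))) (trans e (sym (ℕP.+-suc s m))))))))

opaque
  unfolding _⊕_

  ψ-+ : ∀ Φ Ψ → ψ (λ T → Φ T ℤ.+ Ψ T) ≈ ψ Φ ⊕ ψ Ψ
  ψ-+ Φ Ψ = mk λ n → ∑-+ Φ Ψ (trees (suc n))

ψ-* : ∀ c Φ → ψ (λ T → c ℤ.* Φ T) ≈ cst c ⊗ ψ Φ
ψ-* c Φ = mk λ n → trans (∑-* c Φ (trees (suc n))) (sym (⊗-cst c (ψ Φ) n))

ψ-cong : ∀ {Φ Ψ} → (∀ T → Φ T ≡ Ψ T) → ψ Φ ≈ ψ Ψ
ψ-cong e = mk λ n → ∑-cong (trees (suc n)) e

addN : ℕ → Tree → Tree → Tree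
addN zero    t T = T
addN (suc i) t T = addN i t (add t T)

addN-cong : ∀ i t {T U} → T ≅ U → addN i t T ≅ addN i t U
addN-cong zero    t e = e
addN-cong (suc i) t e = addN-cong i t (add-cong t e)

marked-step : ∀ t {Φ} → ClassFun Φ →
  marked t Φ ≈ δ (size t) ⊗ (ψ (λ T → Φ (add t T)) ⊕ marked t (λ T → Φ (add t T)))
marked-step t {Φ} c = ≈-trans
  (⟦⟧-add t (λ {T} {U} e → cong₂ ℤ._*_ (c e) (kids-class (ind-≅-cong t) e))
    (λ T z → trans (cong (Φ T ℤ.*_) z) (ℤP.*-zeroʳ (Φ T))))
  (⊗-≈ ≈-refl (≈-trans (ψ-cong step) (ψ-+ _ _)))
  where
  step : ∀ T → Φ (add t T) ℤ.* mult t (ch (add t T)) ≡ Φ (add t T) ℤ.+ Φ (add t T) ℤ.* mult t (ch T)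
  step (node ts) rewrite ind-yes (t ≅? t) (≅-refl t) = lem (Φ (node (t ∷ ts))) (mult t ts)
    where
    lem : ∀ a b → a ℤ.* (+ 1 ℤ.+ b) ≡ a ℤ.+ a ℤ.* b
    lem = solveℤ

-- The multiplicity of `t` is the number of i ≥ 1 such that i copies can be detached. This produces
-- the terms F(xⁱ) of Pólya's formula without any infinite product; the remainder has order N ·
-- `size t` and does not reach degrees below `N`.
marked-unroll : ∀ t {Φ} → ClassFun Φ → ∀ N →
  marked t Φ ≈ ∑ˢ (downFrom N) (λ i → δ (suc i ℕ.* size t) ⊗ ψ (λ T → Φ (addN (suc i) t T)))
               ⊕ δ (N ℕ.* size t) ⊗ marked t (λ T → Φ (addN N t T))
marked-unroll t {Φ} c zero = ≈-sym (≈-trans (⊕-≈ (∑ˢ-[] _) ≈-refl)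
  (solve 1 (λ M → con (+ 0) :+ con (+ 1) :* M := M) ≈-refl (marked t Φ)))
marked-unroll t {Φ} c (suc N) = ≈-trans (marked-unroll t c N) (≈-trans
  (⊕-≈ ≈-refl (⊗-≈ ≈-refl (marked-step t (λ e → c (addN-cong N t e)))))
  (≈-trans (solve 5 (λ S D1 D2 P Q → S :+ D1 :* (D2 :* (P :+ Q)) := ((D2 :* D1) :* P :+ S) :+ (D2 :* D1) :* Q) ≈-refl
             S (δ (N ℕ.* s)) (δ s) (ψ (λ T → Φ (addN (suc N) t T))) (marked t (λ T → Φ (addN (suc N) t T))))
           (⊕-≈ (≈-trans (⊕-≈ (⊗-≈ (δ-δ s (N ℕ.* s)) ≈-refl) ≈-refl) (≈-sym (∑ˢ-∷ N (downFrom N) _)))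
                (⊗-≈ (δ-δ s (N ℕ.* s)) ≈-refl))))
  where
  s = size t
  S = ∑ˢ (downFrom N) (λ i → δ (suc i ℕ.* s) ⊗ ψ (λ T → Φ (addN (suc i) t T)))

allTrees : ℕ → List Tree
allTrees N = concatMap trees (downFrom N)

∑-isolate : ∀ {d} → ClassFun d → ∀ N u → size u ℕ.< N → ∑ (allTrees N) (λ t → d t ℤ.* ind (t ≅? u)) ≡ d u
∑-isolate {d} c N u u<N = trans (∑-concatMap g trees (downFrom N))
  (trans (∑-rng-single (λ s → ∑ (trees s) g) N (size u) u<N other) same)
  where
  g = λ t → d t ℤ.* ind (t ≅? u)
  no-iso : ∀ {t} → ¬ (t ≅ u) → g t ≡ + 0
  no-iso {t} n = trans (cong (d t ℤ.*_) (ind-no (t ≅? u) n)) (ℤP.*-zeroʳ (d t))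
  other : ∀ s → s ≢ size u → ∑ (trees s) g ≡ + 0
  other s s≢ = ∑-zero (All.map (λ {t} e → no-iso (λ q → s≢ (trans (sym e) (size-cong q)))) (trees-sizes s))
  same : ∑ (trees (size u)) g ≡ d u
  same = trans (∑-transfer (λ {t} {t′} e → cong₂ ℤ._*_ (c e) (ind-≅-congˡ u e)) (trees (size u)) (u ∷ [])
      (trees-distinct (size u)) ([] ∷ []) (trees-complete (size u) u refl ∷ [])
      (All.universal (λ t → alt t (t ≅? u)) (trees (size u))))
    (trans (ℤP.+-identityʳ (g u)) (trans (cong (d u ℤ.*_) (ind-yes (u ≅? u) (≅-refl u))) (ℤP.*-identityʳ (d u))))
    where
    alt : ∀ t → Dec (t ≅ u) → g t ≡ + 0 ⊎ Any (t ≅_) (u ∷ [])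
    alt t (yes e) = inj₂ (here e)
    alt t (no n)  = inj₁ (no-iso n)

∑-by-class : ∀ {d} → ClassFun d → ∀ N M → All (λ u → size u ℕ.< N) M →
  ∑ M d ≡ ∑ (allTrees N) (λ t → d t ℤ.* mult t M)
∑-by-class {d} c N []      []       = sym (∑-zero (All.universal (λ t → ℤP.*-zeroʳ (d t)) (allTrees N)))
∑-by-class {d} c N (u ∷ M) (p ∷ ps) = sym (trans
  (∑-cong (allTrees N) (λ t → ℤP.*-distribˡ-+ (d t) (ind (t ≅? u)) (mult t M)))
  (trans (∑-+ _ _ (allTrees N)) (cong₂ ℤ._+_ (∑-isolate c N u p) (sym (∑-by-class c N M ps)))))

ch-sizes : ∀ T → All (λ u → size u ℕ.< size T) (ch T)
ch-sizes (node [])       = []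
ch-sizes (node (u ∷ us)) =
  subst (size u ℕ.<_) (sym (size-add u (node us)))
    (subst (ℕ._≤ size u ℕ.+ size (node us)) (ℕP.+-comm (size u) 1) (ℕP.+-monoʳ-≤ (size u) (size-pos (node us))))
  ∷ All.map (λ p → ℕP.≤-trans p (subst (size (node us) ℕ.≤_) (sym (size-add u (node us))) (ℕP.m≤n+m _ _)))
            (ch-sizes (node us))

-- The sum over root subtrees is rearranged by isomorphism class. In degree `n` all subtrees have
-- fewer than `N` vertices, so finitely many classes suffice.
ψ-kids : ∀ {d Φ} → ClassFun d → ∀ N n → n ℕ.< N →
  ψ (λ T → Φ T ℤ.* kids d T) n ≡ ∑ (allTrees N) (λ t → d t ℤ.* marked t Φ n)
ψ-kids {d} {Φ} c N n n<N = trans (∑-congᴬ (All.map expand (trees-sizes (suc n))))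
  (trans (∑-swap _ (trees (suc n)) (allTrees N))
         (∑-cong (allTrees N) λ t → trans (∑-cong (trees (suc n)) (λ T → lem (Φ T) (d t) (mult t (ch T))))
                                          (∑-* (d t) _ (trees (suc n)))))
  where
  lem : ∀ a b c → a ℤ.* (b ℤ.* c) ≡ b ℤ.* (a ℤ.* c)
  lem = solveℤ
  expand : ∀ {T} → size T ≡ suc n →
    Φ T ℤ.* kids d T ≡ ∑ (allTrees N) (λ t → Φ T ℤ.* (d t ℤ.* mult t (ch T)))
  expand {T} e = trans (cong (Φ T ℤ.*_) (∑-by-class c N (ch T)
      (All.map (λ p → ℕP.<-≤-trans p (ℕP.≤-trans (ℕP.≤-reflexive e) n<N)) (ch-sizes T))))
    (sym (∑-* (Φ T) _ (allTrees N)))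

kids-addN : ∀ d i t T → kids d (addN i t T) ≡ kids d T ℤ.+ + i ℤ.* d t
kids-addN d zero    t T = sym (ℤP.+-identityʳ _)
kids-addN d (suc i) t T@(node ts) = trans (kids-addN d i t (add t T))
  (lem (d t) (∑ ts d) (+ i))
  where
  lem : ∀ a b i → a ℤ.+ b ℤ.+ i ℤ.* a ≡ b ℤ.+ (+ 1 ℤ.+ i) ℤ.* a
  lem = solveℤ

∑ˢ-swap : ∀ {A B : Set} (F : A → B → Ser) xs ys →
  ∑ˢ xs (λ x → ∑ˢ ys (F x)) ≈ ∑ˢ ys (λ y → ∑ˢ xs (λ x → F x y))
∑ˢ-swap F xs ys = mk λ n → trans (∑ˢ-at xs _ n) (trans (∑-cong xs λ x → ∑ˢ-at ys (F x) n)
  (trans (∑-swap (λ x y → F x y n) xs ys) (sym (trans (∑ˢ-at ys _ n) (∑-cong ys λ y → ∑ˢ-at xs (λ x → F x y) n)))))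

ψ-∑ : ∀ {A : Set} (xs : List A) (Φ : A → Tree → ℤ) → ψ (λ T → ∑ xs (λ x → Φ x T)) ≈ ∑ˢ xs (λ x → ψ (Φ x))
ψ-∑ xs Φ = mk λ n → trans (∑-swap (λ T x → Φ x T) (trees (suc n)) xs) (sym (∑ˢ-at xs _ n))

⊗-local : ∀ {F F′} G n → (∀ m → m ℕ.≤ n → F m ≡ F′ m) → (F ⊗ G) n ≡ (F′ ⊗ G) n
⊗-local G zero    e = cong (ℤ._* G 0) (e 0 z≤n)
⊗-local G (suc n) e = cong₂ ℤ._+_ (cong (ℤ._* G (suc n)) (e 0 z≤n)) (⊗-local G n λ m p → e (suc m) (s≤s p))

-- Er k F = Σ_{i≥2} i^k F(x^i)
Er : ℕ → Ser → Ser
Er k F m = ∑ (downFrom m) λ i → ∑ (downFrom (suc m)) λ s →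
  (+ (2 ℕ.+ i)) ℤ.^ k ℤ.* δ ((2 ℕ.+ i) ℕ.* s) m ℤ.* F s

-- Moments and cumulants of additive functionals

M : ℕ → (Tree → ℤ) → Ser
M p d = ⟦ (λ t → d t ℤ.^ p) ⟧

-- This is Σ_{i ≥ 1} i^p M_{p+1}(xⁱ), with i = 1 as main term. It plays the role of the cumulant of
-- order p + 1 of the sum of `d` over the root subtrees.
K : ℕ → (Tree → ℤ) → Ser
K p d = M (suc p) d ⊕ Er p (M (suc p) d)

module _ (d : Tree → ℤ) (cd : ClassFun d) (N : ℕ) where

  -- The truncation of `K k d` to trees with fewer than `N` vertices and to at most `N` copies;
  -- `κ-local` shows that degrees below `N` are exact.
  κ : ℕ → Ser
  κ k = ∑ˢ (allTrees N) λ t → ∑ˢ (downFrom N) λ i →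
    cst (d t ℤ.* (+ suc i ℤ.* d t) ℤ.^ k) ⊗ δ (suc i ℕ.* size t)

  -- To be used with Φ = X^p: i copies of `t` change X by i · `d t`, and `ks`, `b`, `Ψ` record the
  -- binomial expansion. Summing the powers of i · `d t` over t and i leaves the series `κ k`.
  ψ-kids-expand : ∀ {Φ} → ClassFun Φ → (ks : List ℕ) (b : ℕ → ℤ) (Ψ : ℕ → Tree → ℤ) →
    (∀ t i T → Φ (addN (suc i) t T) ≡ ∑ ks (λ k → b k ℤ.* ((+ suc i ℤ.* d t) ℤ.^ k ℤ.* Ψ k T))) →
    ∀ n → n ℕ.< N →
    ψ (λ T → Φ T ℤ.* kids d T) n ≡ ∑ˢ ks (λ k → cst (b k) ⊗ (κ k ⊗ ψ (Ψ k))) n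
  ψ-kids-expand {Φ} cΦ ks b Ψ ex n n<N = trans (ψ-kids {Φ = Φ} cd N n n<N)
    (trans (∑-congᴬ (All.universal unroll (allTrees N)))
      (trans (sym (∑ˢ-at (allTrees N) _ n)) (at collect n)))
    where
    term : Tree → ℕ → ℕ → Ser
    term t i k = cst (b k) ⊗ ((cst (d t ℤ.* (+ suc i ℤ.* d t) ℤ.^ k) ⊗ δ (suc i ℕ.* size t)) ⊗ ψ (Ψ k))
    expand : ∀ t i → cst (d t) ⊗ (δ (suc i ℕ.* size t) ⊗ ψ (λ T → Φ (addN (suc i) t T))) ≈ ∑ˢ ks (term t i)
    expand t i = ≈-trans (⊗-≈ ≈-refl (⊗-≈ ≈-refl (≈-trans (ψ-cong (ex t i)) (ψ-∑ ks _))))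
      (≈-trans (≈-sym (≈-trans (⊗∑ˢ ks _ (cst (d t))) (⊗-≈ ≈-refl (⊗∑ˢ ks _ (δ (suc i ℕ.* size t))))))
        (∑ˢ-cong ks λ k → ≈-trans (⊗-≈ ≈-refl (⊗-≈ ≈-refl (≈-trans (ψ-* (b k) _) (⊗-≈ ≈-refl (ψ-* (c ℤ.^ k) (Ψ k))))))
          (≈-trans (solve 5 (λ D E B C P → D :* (E :* (B :* (C :* P))) := B :* (((D :* C) :* E) :* P)) ≈-refl
                     (cst (d t)) (δ (suc i ℕ.* size t)) (cst (b k)) (cst (c ℤ.^ k)) (ψ (Ψ k)))
            (⊗-≈ ≈-refl (⊗-≈ (⊗-≈ (≈-sym (cst-⊗ (d t) (c ℤ.^ k))) ≈-refl) ≈-refl)))))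
      where c = + suc i ℤ.* d t
    unroll : ∀ t → d t ℤ.* marked t Φ n ≡ ∑ˢ (downFrom N) (λ i → ∑ˢ ks (term t i)) n
    unroll t = trans (cong (d t ℤ.*_) (trans (at (marked-unroll t cΦ N) n)
        (trans (⊕-at _ _ n) (trans (cong (λ z → ∑ˢ (downFrom N) (λ i → δ (suc i ℕ.* size t) ⊗ ψ (λ T → Φ (addN (suc i) t T))) n ℤ.+ z) (δ-miss (N ℕ.* size t) _ n
          (ℕP.<-≤-trans n<N (subst (ℕ._≤ N ℕ.* size t) (ℕP.*-identityʳ N) (ℕP.*-monoʳ-≤ N (size-pos t))))))
          (ℤP.+-identityʳ _)))))
      (trans (sym (⊗-cst (d t) _ n)) (at (≈-trans (≈-sym (⊗∑ˢ (downFrom N) _ (cst (d t)))) (∑ˢ-cong (downFrom N) (expand t))) n))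
    collect : ∑ˢ (allTrees N) (λ t → ∑ˢ (downFrom N) (λ i → ∑ˢ ks (term t i))) ≈ ∑ˢ ks (λ k → cst (b k) ⊗ (κ k ⊗ ψ (Ψ k)))
    collect = ≈-trans (∑ˢ-cong (allTrees N) λ t → ∑ˢ-swap (term t) (downFrom N) ks)
      (≈-trans (∑ˢ-swap _ (allTrees N) ks) (∑ˢ-cong ks λ k →
        ≈-trans (∑ˢ-cong (allTrees N) λ t → ⊗∑ˢ (downFrom N) _ (cst (b k)))
          (≈-trans (⊗∑ˢ (allTrees N) _ (cst (b k))) (⊗-≈ ≈-refl
            (≈-trans (∑ˢ-cong (allTrees N) λ t → ∑ˢ-⊗ (downFrom N) _ (ψ (Ψ k))) (∑ˢ-⊗ (allTrees N) _ (ψ (Ψ k))))))))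

  κ-local : ∀ k m → m ℕ.< N → κ k m ≡ K k d m
  κ-local k m m<N = trans (∑ˢ-at (allTrees N) _ m) (trans (∑-cong (allTrees N) (λ t → ∑ˢ-at (downFrom N) _ m))
    (trans (∑-concatMap _ trees (downFrom N)) (trans (∑-cong (downFrom N) by-size)
      (trans (∑-swap (λ s i → G i s) (downFrom N) (downFrom N)) (trans (main N m<N) (sym (⊕-at _ _ m)))))))
    where
    F = M (suc k) d
    G : ℕ → ℕ → ℤ
    G i s = (+ suc i) ℤ.^ k ℤ.* δ (suc i ℕ.* s) m ℤ.* F s
    pow : ∀ c x k → x ℤ.* (c ℤ.* x) ℤ.^ k ≡ c ℤ.^ k ℤ.* x ℤ.^ suc k
    pow c x zero    = sym (ℤP.*-identityˡ (x ℤ.* + 1))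
    pow c x (suc k) = trans (l₁ x c ((c ℤ.* x) ℤ.^ k)) (trans (cong (c ℤ.* x ℤ.*_) (pow c x k)) (l₂ c x (c ℤ.^ k) (x ℤ.^ k)))
      where
      l₁ : ∀ x c z → x ℤ.* (c ℤ.* x ℤ.* z) ≡ c ℤ.* x ℤ.* (x ℤ.* z)
      l₁ = solveℤ
      l₂ : ∀ c x u v → c ℤ.* x ℤ.* (u ℤ.* (x ℤ.* v)) ≡ c ℤ.* u ℤ.* (x ℤ.* (x ℤ.* v))
      l₂ = solveℤ
    by-size : ∀ s → ∑ (trees s) (λ t → ∑ (downFrom N) (λ i →
        (cst (d t ℤ.* (+ suc i ℤ.* d t) ℤ.^ k) ⊗ δ (suc i ℕ.* size t)) m)) ≡ ∑ (downFrom N) (λ i → G i s)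
    by-size s = trans (∑-swap _ (trees s) (downFrom N)) (∑-cong (downFrom N) λ i →
      trans (∑-congᴬ (All.map (λ {t} e → trans (⊗-cst _ (δ (suc i ℕ.* size t)) m)
          (trans (cong₂ (λ u v → u ℤ.* δ (suc i ℕ.* v) m) (pow (+ suc i) (d t) k) e)
                 (l₃ ((+ suc i) ℤ.^ k) (d t ℤ.^ suc k) (δ (suc i ℕ.* s) m)))) (trees-sizes s)))
        (∑-* ((+ suc i) ℤ.^ k ℤ.* δ (suc i ℕ.* s) m) (λ t → d t ℤ.^ suc k) (trees s)))
      where
      l₃ : ∀ a b c → a ℤ.* b ℤ.* c ≡ a ℤ.* c ℤ.* b
      l₃ = solveℤ
    δ-big : ∀ i s → m ℕ.< suc i ℕ.* s → G i s ≡ + 0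
    δ-big i s p = trans (cong (λ z → (+ suc i) ℤ.^ k ℤ.* z ℤ.* F s) (δ-other (suc i ℕ.* s) m (ℕP.>⇒≢ p)))
      (cong (ℤ._* F s) (ℤP.*-zeroʳ ((+ suc i) ℤ.^ k)))
    main : ∀ N → m ℕ.< N → ∑ (downFrom N) (λ i → ∑ (downFrom N) (G i)) ≡ F m ℤ.+ Er k F m
    main (suc N′) (s≤s m≤N′) = trans (∑-rng-shift (λ i → ∑ (downFrom (suc N′)) (G i)) N′) (cong₂ ℤ._+_ first rest)
      where
      one^ : ∀ k → (+ 1) ℤ.^ k ≡ + 1
      one^ zero    = refl
      one^ (suc k) = trans (ℤP.*-identityˡ _) (one^ k)
      first : ∑ (downFrom (suc N′)) (G 0) ≡ F m
      first = trans (∑-rng-single (G 0) (suc N′) m (s≤s m≤N′) (λ s s≢m →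
          trans (cong (λ z → (+ 1) ℤ.^ k ℤ.* z ℤ.* F s) (δ-other (1 ℕ.* s) m (λ e → s≢m (trans (sym (ℕP.*-identityˡ s)) e))))
                (cong (ℤ._* F s) (ℤP.*-zeroʳ ((+ 1) ℤ.^ k)))))
        (trans (cong₂ (λ u v → u ℤ.* v ℤ.* F m) (one^ k) (trans (cong (λ z → δ z m) (ℕP.*-identityˡ m)) (δ-self m)))
               (ℤP.*-identityˡ (F m)))
      rest : ∑ (downFrom N′) (λ i → ∑ (downFrom (suc N′)) (G (suc i))) ≡ Er k F m
      rest = trans (∑-cong (downFrom N′) λ i → ∑-rng-trim (G (suc i)) (suc N′) (s≤s m≤N′) (λ s m<s →
               δ-big (suc i) s (ℕP.<-≤-trans m<s (ℕP.m≤m+n s (suc i ℕ.* s)))))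
        (∑-rng-trim _ N′ m≤N′ (λ i m≤i → ∑-rng-zero (G (suc i)) (suc m) (λ s _ → big i s m≤i)))
        where
        big : ∀ i s → m ℕ.≤ i → G (suc i) s ≡ + 0
        big i zero    m≤i = ℤP.*-zeroʳ ((+ suc (suc i)) ℤ.^ k ℤ.* δ (suc (suc i) ℕ.* 0) m)
        big i (suc s) m≤i = δ-big (suc i) (suc s) (ℕP.<-≤-trans (ℕP.m<n⇒m<1+n (s≤s m≤i)) (ℕP.m≤m*n (suc (suc i)) (suc s)))

y : Ser
y = ⟦ (λ _ → + 1) ⟧

⟦⟧-δ : ∀ Φ → ⟦ Φ ⟧ ≈ δ 1 ⊗ ψ Φ
⟦⟧-δ Φ = mk λ { zero → refl ; (suc n) → sym (δ-hit 1 (ψ Φ) n) }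

∑ˢ-fold : ∀ {A : Set} (xs : List A) F → ∑ˢ xs F ≈ foldr (λ x S → F x ⊕ S) 𝟘 xs
∑ˢ-fold []       F = ∑ˢ-[] F
∑ˢ-fold (x ∷ xs) F = ≈-trans (∑ˢ-∷ x xs F) (⊕-≈ ≈-refl (∑ˢ-fold xs F))

-- d′ is the additive functional induced by d on the subtrees at the root.
module Moments (d d′ : Tree → ℤ) (cd : ClassFun d) (eq : ∀ T → d′ T ≡ kids d T) where

  private
    X : Tree → ℤ
    X = kids d

    Φ : ℕ → Tree → ℤ
    Φ p T = X T ℤ.^ p

    cΦ : ∀ p → ClassFun (Φ p)
    cΦ p e = cong (ℤ._^ p) (kids-class cd e)

    Ψ : ℕ → ℕ → Tree → ℤ
    Ψ p k T = X T ℤ.^ (p ℕ.∸ k)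

    A : ℕ → Ser
    A p = ψ (Φ p)

    -- In X^(p+1) = X · X^p the factor X is summed over the root subtrees. The result is the
    -- recursion of moments in terms of cumulants, with binomial coefficients `b k`; solving it up
    -- to p = 4 gives the familiar coefficients 1, 3, 1 and 1, 4, 3, 6, 1.
    expand : ∀ p ks (b : ℕ → ℤ) →
      (∀ x c → (x ℤ.+ c) ℤ.^ p ≡ ∑ ks (λ k → b k ℤ.* (c ℤ.^ k ℤ.* x ℤ.^ (p ℕ.∸ k)))) →
      A (suc p) ≈ foldr (λ k S → (cst (b k) ⊗ (K k d ⊗ A (p ℕ.∸ k))) ⊕ S) 𝟘 ks
    expand p ks b ex = ≈-trans (mk λ n → trans (at (ψ-cong (λ T → ℤP.*-comm (X T) (Φ p T))) n)
        (trans (ψ-kids-expand d cd (suc n) (cΦ p) ks b (Ψ p)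
                  (λ t i T → trans (cong (ℤ._^ p) (kids-addN d (suc i) t T)) (ex (X T) (+ suc i ℤ.* d t)))
                  n (ℕP.n<1+n n))
          (trans (∑ˢ-at ks _ n) (trans (∑-cong ks λ k → trans (⊗-cst (b k) _ n)
              (trans (cong (b k ℤ.*_) (⊗-local (A (p ℕ.∸ k)) n λ m m≤n → κ-local d cd (suc n) k m (s≤s m≤n)))
                     (sym (⊗-cst (b k) _ n))))
            (sym (∑ˢ-at ks _ n))))))
      (∑ˢ-fold ks _)

    lift : ∀ p → M p d′ ≈ δ 1 ⊗ A p
    lift p = ≈-trans (mk λ n → ∑-cong (trees n) λ T → cong (ℤ._^ p) (eq T)) (⟦⟧-δ (Φ p))

    K₁ = K 0 d
    K₂ = K 1 d
    K₃ = K 2 d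
    K₄ = K 3 d

    e₁ : ∀ x c → (x ℤ.+ c) ℤ.^ 0 ≡ ∑ (0 ∷ []) (λ k → + 1 ℤ.* (c ℤ.^ k ℤ.* x ℤ.^ (0 ℕ.∸ k)))
    e₁ x c = refl
    e₂ : ∀ x c → (x ℤ.+ c) ℤ.* + 1 ≡ + 1 ℤ.* (+ 1 ℤ.* (x ℤ.* + 1)) ℤ.+ (+ 1 ℤ.* ((c ℤ.* + 1) ℤ.* + 1) ℤ.+ + 0)
    e₂ = solveℤ
    e₃ : ∀ x c → (x ℤ.+ c) ℤ.* ((x ℤ.+ c) ℤ.* + 1) ≡ + 1 ℤ.* (+ 1 ℤ.* (x ℤ.* (x ℤ.* + 1)))
      ℤ.+ (+ 2 ℤ.* ((c ℤ.* + 1) ℤ.* (x ℤ.* + 1)) ℤ.+ (+ 1 ℤ.* ((c ℤ.* (c ℤ.* + 1)) ℤ.* + 1) ℤ.+ + 0))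
    e₃ = solveℤ
    e₄ : ∀ x c → (x ℤ.+ c) ℤ.* ((x ℤ.+ c) ℤ.* ((x ℤ.+ c) ℤ.* + 1)) ≡ + 1 ℤ.* (+ 1 ℤ.* (x ℤ.* (x ℤ.* (x ℤ.* + 1))))
      ℤ.+ (+ 3 ℤ.* ((c ℤ.* + 1) ℤ.* (x ℤ.* (x ℤ.* + 1))) ℤ.+ (+ 3 ℤ.* ((c ℤ.* (c ℤ.* + 1)) ℤ.* (x ℤ.* + 1))
        ℤ.+ (+ 1 ℤ.* ((c ℤ.* (c ℤ.* (c ℤ.* + 1))) ℤ.* + 1) ℤ.+ + 0)))
    e₄ = solveℤ

    b₃ b₄ : ℕ → ℤ
    b₃ 1 = + 2
    b₃ _ = + 1
    b₄ 1 = + 3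
    b₄ 2 = + 3
    b₄ _ = + 1

    p₁ : A 1 ≈ cst (+ 1) ⊗ (K₁ ⊗ A 0) ⊕ 𝟘
    p₁ = expand 0 (0 ∷ []) (λ _ → + 1) e₁
    p₂ : A 2 ≈ cst (+ 1) ⊗ (K₁ ⊗ A 1) ⊕ (cst (+ 1) ⊗ (K₂ ⊗ A 0) ⊕ 𝟘)
    p₂ = expand 1 (0 ∷ 1 ∷ []) (λ _ → + 1) e₂
    p₃ : A 3 ≈ cst (+ 1) ⊗ (K₁ ⊗ A 2) ⊕ (cst (+ 2) ⊗ (K₂ ⊗ A 1) ⊕ (cst (+ 1) ⊗ (K₃ ⊗ A 0) ⊕ 𝟘))
    p₃ = expand 2 (0 ∷ 1 ∷ 2 ∷ []) b₃ e₃
    p₄ : A 4 ≈ cst (+ 1) ⊗ (K₁ ⊗ A 3) ⊕ (cst (+ 3) ⊗ (K₂ ⊗ A 2) ⊕ (cst (+ 3) ⊗ (K₃ ⊗ A 1) ⊕ (cst (+ 1) ⊗ (K₄ ⊗ A 0) ⊕ 𝟘)))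
    p₄ = expand 3 (0 ∷ 1 ∷ 2 ∷ 3 ∷ []) b₄ e₄

    q₁ : A 1 ≈ K₁ ⊗ A 0
    q₁ = ≈-trans p₁ (solve 2 (λ k a → con (+ 1) :* (k :* a) :+ con (+ 0) := k :* a) ≈-refl K₁ (A 0))
    q₂ : A 2 ≈ (K₂ ⊕ K₁ ⊗ K₁) ⊗ A 0
    q₂ = ≈-trans p₂ (≈-trans (⊕-≈ (⊗-≈ ≈-refl (⊗-≈ ≈-refl q₁)) ≈-refl)
      (solve 3 (λ k₁ k₂ a → con (+ 1) :* (k₁ :* (k₁ :* a)) :+ (con (+ 1) :* (k₂ :* a) :+ con (+ 0))
                 := (k₂ :+ k₁ :* k₁) :* a) ≈-refl K₁ K₂ (A 0)))
    q₃ : A 3 ≈ (K₃ ⊕ (cst (+ 3) ⊗ (K₁ ⊗ K₂) ⊕ K₁ ⊗ (K₁ ⊗ K₁))) ⊗ A 0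
    q₃ = ≈-trans p₃ (≈-trans (⊕-≈ (⊗-≈ ≈-refl (⊗-≈ ≈-refl q₂)) (⊕-≈ (⊗-≈ ≈-refl (⊗-≈ ≈-refl q₁)) ≈-refl))
      (solve 4 (λ k₁ k₂ k₃ a → con (+ 1) :* (k₁ :* ((k₂ :+ k₁ :* k₁) :* a))
                   :+ (con (+ 2) :* (k₂ :* (k₁ :* a)) :+ (con (+ 1) :* (k₃ :* a) :+ con (+ 0)))
                 := (k₃ :+ (con (+ 3) :* (k₁ :* k₂) :+ k₁ :* (k₁ :* k₁))) :* a) ≈-refl K₁ K₂ K₃ (A 0)))
    q₄ : A 4 ≈ (K₄ ⊕ (cst (+ 4) ⊗ (K₁ ⊗ K₃) ⊕ (cst (+ 3) ⊗ (K₂ ⊗ K₂)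
                  ⊕ (cst (+ 6) ⊗ ((K₁ ⊗ K₁) ⊗ K₂) ⊕ (K₁ ⊗ K₁) ⊗ (K₁ ⊗ K₁))))) ⊗ A 0
    q₄ = ≈-trans p₄ (≈-trans (⊕-≈ (⊗-≈ ≈-refl (⊗-≈ ≈-refl q₃)) (⊕-≈ (⊗-≈ ≈-refl (⊗-≈ ≈-refl q₂)) (⊕-≈ (⊗-≈ ≈-refl (⊗-≈ ≈-refl q₁)) ≈-refl)))
      (solve 5 (λ k₁ k₂ k₃ k₄ a →
          con (+ 1) :* (k₁ :* ((k₃ :+ (con (+ 3) :* (k₁ :* k₂) :+ k₁ :* (k₁ :* k₁))) :* a))
          :+ (con (+ 3) :* (k₂ :* ((k₂ :+ k₁ :* k₁) :* a)) :+ (con (+ 3) :* (k₃ :* (k₁ :* a)) :+ (con (+ 1) :* (k₄ :* a) :+ con (+ 0))))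
          := (k₄ :+ (con (+ 4) :* (k₁ :* k₃) :+ (con (+ 3) :* (k₂ :* k₂)
               :+ (con (+ 6) :* ((k₁ :* k₁) :* k₂) :+ (k₁ :* k₁) :* (k₁ :* k₁))))) :* a) ≈-refl K₁ K₂ K₃ K₄ (A 0)))

    finish : ∀ p Q → A p ≈ Q ⊗ A 0 → M p d′ ≈ y ⊗ Q
    finish p Q e = ≈-trans (lift p) (≈-trans (⊗-≈ ≈-refl e)
      (≈-trans (solve 3 (λ D Q a → D :* (Q :* a) := (D :* a) :* Q) ≈-refl (δ 1) Q (A 0))
               (⊗-≈ (≈-sym (⟦⟧-δ (λ _ → + 1))) ≈-refl)))

  moment₁ : M 1 d′ ≈ y ⊗ K 0 d
  moment₁ = finish 1 _ q₁

  moment₂ : M 2 d′ ≈ y ⊗ (K 1 d ⊕ K 0 d ⊗ K 0 d)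
  moment₂ = finish 2 _ q₂

  moment₃ : M 3 d′ ≈ y ⊗ (K 2 d ⊕ (cst (+ 3) ⊗ (K 0 d ⊗ K 1 d) ⊕ K 0 d ⊗ (K 0 d ⊗ K 0 d)))
  moment₃ = finish 3 _ q₃

  moment₄ : M 4 d′ ≈ y ⊗ (K 3 d ⊕ (cst (+ 4) ⊗ (K 0 d ⊗ K 2 d) ⊕ (cst (+ 3) ⊗ (K 1 d ⊗ K 1 d)
              ⊕ (cst (+ 6) ⊗ ((K 0 d ⊗ K 0 d) ⊗ K 1 d) ⊕ (K 0 d ⊗ K 0 d) ⊗ (K 0 d ⊗ K 0 d)))))
  moment₄ = finish 4 _ q₄

-- Growth of the number of unlabelled trees

infixr 9 _^ˢ_
_^ˢ_ : Ser → ℕ → Ser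
F ^ˢ zero  = 𝟙
F ^ˢ suc j = F ⊗ F ^ˢ j

y-length : ∀ n → y n ≡ + length (trees n)
y-length n = go (trees n)
  where
  go : ∀ (ts : List Tree) → ∑ ts (λ _ → + 1) ≡ + length ts
  go []       = refl
  go (t ∷ ts) = cong (λ z → + 1 ℤ.+ z) (go ts)

Pos-y : Pos y
Pos-y = pos λ n → subst (+ 0 ℤ.≤_) (sym (y-length n)) (ℕ≤⇒ℤ≤ z≤n)

leaf : Tree
leaf = node []

-- Two injections raise the size by one: planting the tree on a new root, and adding a leaf at the
-- root. For n ≥ 2 their images are disjoint, since the only root subtree of a planted tree is not a
-- leaf.
trees-double : ∀ n → 2 ℕ.≤ n → length (trees n) ℕ.+ length (trees n) ℕ.≤ length (trees (suc n))
trees-double n 2≤n = subst (ℕ._≤ length (trees (suc n)))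
  (trans (ListP.length-++ (map stem (trees n))) (cong₂ ℕ._+_ (ListP.length-map stem (trees n)) (ListP.length-map (add leaf) (trees n))))
  (length-embed (map stem (trees n) ++ map (add leaf) (trees n)) (trees (suc n))
    (AllPairsP.++⁺ (AllPairsP.map⁺ (AllPairs.map (λ ¬e e → ¬e (stem-cancel e)) (trees-distinct n)))
                   (AllPairsP.map⁺ (AllPairs.map (λ ¬e e → ¬e (add-cancel leaf e)) (trees-distinct n)))
                   (AllP.map⁺ (All.map (λ {T} sT → AllP.map⁺ (All.universal (λ U → apart T U sT) (trees n))) (trees-sizes n))))
    (AllP.++⁺ (AllP.map⁺ (All.map (λ {T} e → trees-complete (suc n) (stem T) (trans (size-stem T) (cong suc e))) (trees-sizes n)))
              (AllP.map⁺ (All.map (λ {T} e → trees-complete (suc n) (add leaf T) (trans (size-add leaf T) (cong suc e))) (trees-sizes n)))))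
  where
  stem : Tree → Tree
  stem T = node (T ∷ [])
  size-stem : ∀ T → size (stem T) ≡ suc (size T)
  size-stem T = trans (size-add T leaf) (ℕP.+-comm (size T) 1)
  single : ∀ {T U} → Permutation _≅_ (T ∷ []) (U ∷ []) → T ≅ U
  single {T} {U} p with SetoidPerm.∈-resp-↭ ≅-setoid p (here (≅-refl T))
  ... | here e = e
  stem-cancel : ∀ {T U} → stem T ≅ stem U → T ≅ U
  stem-cancel (node p) = single p
  apart : ∀ T U → size T ≡ n → ¬ (stem T ≅ add leaf U)
  apart T (node us) sT (node p) with SetoidPerm.∈-resp-↭ ≅-setoid (≅-symᵖ p) (here (≅-refl leaf))
  ... | here e = ℕP.<⇒≱ 2≤n (ℕP.≤-reflexive (trans (sym sT) (sym (size-cong e))))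

y1 : y 1 ≡ + 1
y1 = refl

y-double : ∀ n → 2 ℕ.≤ n → y n ℤ.+ y n ℤ.≤ y (suc n)
y-double n p = subst₂ ℤ._≤_ (sym (cong₂ ℤ._+_ (y-length n) (y-length n))) (sym (y-length (suc n))) (ℕ≤⇒ℤ≤ (trees-double n p))

y-mono : ∀ n → 1 ℕ.≤ n → y n ℤ.≤ y (suc n)
y-mono (suc zero)    p = ℤP.≤-refl
y-mono (suc (suc n)) p = ℤP.≤-trans (subst (ℤ._≤ y (2 ℕ.+ n) ℤ.+ y (2 ℕ.+ n)) (ℤP.+-identityʳ _)
  (ℤP.+-monoʳ-≤ (y (2 ℕ.+ n)) (≼-nonneg Pos-y (2 ℕ.+ n)))) (y-double (2 ℕ.+ n) (s≤s (s≤s z≤n)))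

∑-rng-cong : ∀ {f g : ℕ → ℤ} N → (∀ j → j ℕ.< N → f j ≡ g j) → ∑ (downFrom N) f ≡ ∑ (downFrom N) g
∑-rng-cong zero    e = refl
∑-rng-cong (suc N) e = cong₂ ℤ._+_ (e N ℕP.≤-refl) (∑-rng-cong N λ j p → e j (ℕP.m≤n⇒m≤1+n p))

⊗-∑ : ∀ F G n → (F ⊗ G) n ≡ ∑ (downFrom (suc n)) (λ j → F j ℤ.* G (n ℕ.∸ j))
⊗-∑ F G zero    = sym (ℤP.+-identityʳ _)
⊗-∑ F G (suc n) = trans (⊗-step F G n) (cong₂ ℤ._+_ (cong (λ z → F (suc n) ℤ.* G z) (sym (ℕP.n∸n≡0 n)))
  (trans (⊗-∑ F (tl G) n) (∑-rng-cong (suc n) λ { j (s≤s j≤n) → cong (λ z → F j ℤ.* G z) (sym (ℕP.+-∸-assoc 1 j≤n)) })))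

-- Detach one subtree of the root: a tree with more than one vertex is a pair of smaller trees.
y-split : ∀ n → y (2 ℕ.+ n) ℤ.≤ (y ⊗ y) (2 ℕ.+ n)
y-split n = subst₂ ℤ._≤_ (sym (y-length (2 ℕ.+ n))) total (ℕ≤⇒ℤ≤
  (length-embed (trees (2 ℕ.+ n)) zs (trees-distinct (2 ℕ.+ n)) (All.map (λ {T} → cover T) (trees-sizes (2 ℕ.+ n)))))
  where
  joins : ℕ → List Tree
  joins s = concatMap (λ t → map (add t) (trees (suc (suc n) ℕ.∸ s))) (trees s)
  zs = concatMap joins (downFrom (suc (suc (suc n))))
  len : ∀ (xs : List Tree) → + length xs ≡ ∑ xs (λ _ → + 1)
  len []       = refl
  len (x ∷ xs) = cong (λ z → + 1 ℤ.+ z) (len xs)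
  total : + length zs ≡ (y ⊗ y) (2 ℕ.+ n)
  total = trans (len zs) (trans (∑-concatMap _ joins (downFrom (3 ℕ.+ n)))
    (trans (∑-cong (downFrom (3 ℕ.+ n)) λ s → trans (∑-concatMap _ _ (trees s))
        (trans (∑-cong (trees s) λ t → trans (∑-map _ (add t) (trees (2 ℕ.+ n ℕ.∸ s))) (sym (ℤP.*-identityˡ _)))
               (∑-*ʳ (y (2 ℕ.+ n ℕ.∸ s)) (λ _ → + 1) (trees s))))
      (sym (⊗-∑ y y (2 ℕ.+ n)))))
  find : ∀ (s : ℕ) N {P : Tree → Set} → s ℕ.< N → Any P (joins s) → Any P (concatMap joins (downFrom N))
  find s (suc N) p q with ℕP.m<1+n⇒m<n∨m≡n p
  ... | inj₂ refl = AnyP.++⁺ˡ q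
  ... | inj₁ s<N  = AnyP.++⁺ʳ (joins N) (find s N s<N q)
  cover : ∀ T → size T ≡ 2 ℕ.+ n → Any (T ≅_) zs
  cover (node []) ()
  cover (node (u ∷ us)) e = find (size u) (3 ℕ.+ n) (s≤s su≤)
      (AnyP.concatMap⁺ _ (Any.map (λ u≅t → AnyP.map⁺ (Any.map (λ r → join u≅t r) rest)) (trees-complete (size u) u refl)))
    where
    e′ : size u ℕ.+ size (node us) ≡ 2 ℕ.+ n
    e′ = trans (sym (size-add u (node us))) e
    su≤ : size u ℕ.≤ 2 ℕ.+ n
    su≤ = ℕP.m+n≤o⇒m≤o (size u) (ℕP.≤-reflexive e′)
    rest : Any (node us ≅_) (trees (2 ℕ.+ n ℕ.∸ size u))
    rest = trees-complete _ (node us) (sym (trans (cong (ℕ._∸ size u) (sym e′)) (ℕP.m+n∸m≡n (size u) _)))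
    join : ∀ {t U} → u ≅ t → node us ≅ U → node (u ∷ us) ≅ add t U
    join u≅t (node p) = node (Perm.prep u≅t p)

-- The series a = 1 / (1 - y)

≤-by : ∀ {x z d} → z ≡ x ℤ.+ d → + 0 ℤ.≤ d → x ℤ.≤ z
≤-by {x} {z} {d} e p = subst₂ ℤ._≤_ (ℤP.+-identityʳ x) (sym e) (ℤP.+-monoʳ-≤ x p)

0≤- : ∀ {x z} → x ℤ.≤ z → + 0 ℤ.≤ z ℤ.- x
0≤- = ℤP.i≤j⇒0≤j-i

0≤+ : ∀ {x z} → + 0 ℤ.≤ x → + 0 ℤ.≤ z → + 0 ℤ.≤ x ℤ.+ z
0≤+ p q = ℤP.+-mono-≤ p q

0≤* : ∀ {x z} → + 0 ℤ.≤ x → + 0 ℤ.≤ z → + 0 ℤ.≤ x ℤ.* z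
0≤* p q = *-mono-≤-0 ℤP.≤-refl ℤP.≤-refl p q

0≤^ : ∀ c j → + 0 ℤ.≤ (+ c) ℤ.^ j
0≤^ c zero    = ℕ≤⇒ℤ≤ z≤n
0≤^ c (suc j) = 0≤* {+ c} {(+ c) ℤ.^ j} (ℕ≤⇒ℤ≤ z≤n) (0≤^ c j)

pos-^ : ∀ c j → (+ c) ℤ.^ j ≡ + (c ℕ.^ j)
pos-^ c zero    = refl
pos-^ c (suc j) = trans (cong (+ c ℤ.*_) (pos-^ c j)) (sym (ℤP.pos-* c (c ℕ.^ j)))

0≤n : ∀ {n} → + 0 ℤ.≤ + n
0≤n = ℕ≤⇒ℤ≤ z≤n

⊗-vanish : ∀ F {G} n → (∀ m → m ℕ.≤ n → G m ≡ + 0) → (F ⊗ G) n ≡ + 0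
⊗-vanish F {G} n z = trans (⊗-∑ F G n) (∑-rng-zero _ (suc n) λ j _ →
  trans (cong (F j ℤ.*_) (z (n ℕ.∸ j) (ℕP.m∸n≤m n j))) (ℤP.*-zeroʳ (F j)))

y⊗-suc : ∀ G n → (y ⊗ G) (suc n) ≡ (tl y ⊗ G) n
y⊗-suc G n = ℤP.+-identityˡ _

y^-vanish : ∀ j n → n ℕ.< j → (y ^ˢ j) n ≡ + 0
y^-vanish (suc j) zero    p       = refl
y^-vanish (suc j) (suc n) (s≤s p) = trans (y⊗-suc (y ^ˢ j) n)
  (⊗-vanish (tl y) n λ m m≤n → y^-vanish j m (ℕP.≤-<-trans m≤n p))

Pos-^ : ∀ {F} → Pos F → ∀ j → Pos (F ^ˢ j)
Pos-^ p zero    = Pos-cst 1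
Pos-^ p (suc j) = ≼-⊗ p (Pos-^ p j)

y≼x+y² : y ≼ δ 1 ⊕ y ⊗ y
y≼x+y² = dom λ n → subst₂ ℤ._≤_ (sym (abs-nonneg (≼-nonneg Pos-y n))) (sym (⊕-at (δ 1) (y ⊗ y) n)) (go n)
  where
  go : ∀ n → y n ℤ.≤ δ 1 n ℤ.+ (y ⊗ y) n
  go 0             = ℤP.≤-refl
  go 1             = ℤP.≤-refl
  go (suc (suc n)) = ℤP.≤-trans (y-split n) (ℤP.≤-reflexive (sym (ℤP.+-identityˡ _)))

y^-suc≤ : ∀ j n → (y ^ˢ suc j) (suc n) ℤ.≤ (y ^ˢ j) n ℤ.+ (y ^ˢ suc (suc j)) (suc n)
y^-suc≤ j n = subst (λ z → z ℤ.≤ (y ^ˢ j) n ℤ.+ (y ^ˢ suc (suc j)) (suc n)) (abs-nonneg (≼-nonneg (Pos-^ Pos-y (suc j)) (suc n)))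
  (subst (+ ∣ (y ^ˢ suc j) (suc n) ∣ ℤ.≤_)
    (trans (at (solve 3 (λ d y p → (d :+ y :* y) :* p := d :* p :+ y :* (y :* p)) ≈-refl (δ 1) y (y ^ˢ j)) (suc n))
      (trans (⊕-at _ _ (suc n)) (cong (ℤ._+ (y ^ˢ suc (suc j)) (suc n)) (δ-hit 1 (y ^ˢ j) n))))
    (le (≼-⊗ y≼x+y² (Pos-^ Pos-y j)) (suc n)))

-- The two terms of y ≼ x + y² each halve the bound.
y^-bound : ∀ m n j → n ℕ.< j ℕ.+ m → (+ 2) ℤ.^ j ℤ.* (y ^ˢ j) n ℤ.≤ (+ 4) ℤ.^ n
-- `m` is the room left for raising `j`: once `j` exceeds `n`, the power `y ^ˢ j` has no term of
-- degree `n`.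
y^-bound zero n j p = subst (ℤ._≤ (+ 4) ℤ.^ n)
  (sym (trans (cong ((+ 2) ℤ.^ j ℤ.*_) (y^-vanish j n (subst (n ℕ.<_) (ℕP.+-identityʳ j) p))) (ℤP.*-zeroʳ ((+ 2) ℤ.^ j)))) (0≤^ 4 n)
y^-bound (suc m) zero    zero    p = ℤP.≤-refl
y^-bound (suc m) (suc n) zero    p = 0≤^ 4 (suc n)
y^-bound (suc m) zero    (suc j) p = subst (ℤ._≤ + 1) (sym (ℤP.*-zeroʳ ((+ 2) ℤ.^ suc j))) 0≤n
y^-bound (suc m) (suc n) (suc j) p = ℤP.*-cancelˡ-≤-pos _ _ (+ 2) (≤-by (lem ((+ 2) ℤ.^ j) ((+ 4) ℤ.^ n) _ _ _)
  (0≤+ (0≤+ (0≤* {+ 4} 0≤n (0≤- (y^-bound (suc n) n j (ℕP.m≤n+m (suc n) j)))) (0≤- (y^-bound m (suc n) (suc (suc j)) (subst (suc n ℕ.<_) (ℕP.+-suc (suc j) m) p))))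
       (0≤* {+ 4 ℤ.* (+ 2) ℤ.^ j} (0≤* {+ 4} 0≤n (0≤^ 2 j)) (0≤- (y^-suc≤ j n)))))
  where
  lem : ∀ p q a b c → + 2 ℤ.* (+ 4 ℤ.* q) ≡ + 2 ℤ.* (+ 2 ℤ.* p ℤ.* c) ℤ.+
    (+ 4 ℤ.* (q ℤ.- p ℤ.* a) ℤ.+ (+ 4 ℤ.* q ℤ.- + 2 ℤ.* (+ 2 ℤ.* p) ℤ.* b) ℤ.+ + 4 ℤ.* p ℤ.* (a ℤ.+ b ℤ.- c))
  lem = solveℤ

y≤4^ : ∀ n → y n ℤ.≤ (+ 4) ℤ.^ n
y≤4^ n = ℤP.≤-trans (≤-by (lem (y n)) (≼-nonneg Pos-y n))
  (subst (λ z → (+ 2) ℤ.* + 1 ℤ.* z ℤ.≤ (+ 4) ℤ.^ n) (trans (⊗-comm y 𝟙 n) (⊗-identityˡ y n)) (y^-bound (suc n) n 1 (ℕP.m≤n+m (suc n) 1)))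
  where
  lem : ∀ a → + 2 ℤ.* + 1 ℤ.* a ≡ a ℤ.+ a
  lem = solveℤ

-- The geometric series Σ y^j; it is finite in every degree because y has no constant term.
a : Ser
a n = ∑ (downFrom (suc n)) (λ j → (y ^ˢ j) n)

a-trunc : ∀ N n → n ℕ.< N → ∑ˢ (downFrom N) (y ^ˢ_) n ≡ a n
a-trunc N n p = trans (∑ˢ-at (downFrom N) (y ^ˢ_) n) (∑-rng-trim (λ j → (y ^ˢ j) n) N p (λ i → y^-vanish i n))

a-eq : a ≈ 𝟙 ⊕ y ⊗ a
a-eq = mk λ n → sym (trans (⊕-at 𝟙 (y ⊗ a) n) (trans (cong (λ z → 𝟙 n ℤ.+ z) (trans (⊗-comm y a n)
    (trans (⊗-local y n λ m m≤n → sym (a-trunc (suc n) m (s≤s m≤n)))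
      (trans (⊗-comm _ y n) (trans (sym (at (⊗∑ˢ (downFrom (suc n)) (y ^ˢ_) y) n)) (∑ˢ-at (downFrom (suc n)) _ n))))))
  (trans (sym (∑-rng-shift (λ j → (y ^ˢ j) n) (suc n)))
         (∑-rng-trim (λ j → (y ^ˢ j) n) (suc (suc n)) (ℕP.n≤1+n (suc n)) (λ i → y^-vanish i n)))))

∑-nonneg : ∀ {A : Set} {f : A → ℤ} {xs} → All (λ x → + 0 ℤ.≤ f x) xs → + 0 ℤ.≤ ∑ xs f
∑-nonneg []       = ℤP.≤-refl
∑-nonneg (p ∷ ps) = 0≤+ p (∑-nonneg ps)

Pos-a : Pos a
Pos-a = pos λ n → ∑-nonneg (All.universal (λ j → ≼-nonneg (Pos-^ Pos-y j) n) (downFrom (suc n)))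

a-suc : ∀ n → a (suc n) ≡ (tl y ⊗ a) n
a-suc n = trans (at a-eq (suc n)) (trans (⊕-at 𝟙 (y ⊗ a) (suc n)) (trans (ℤP.+-identityˡ _) (y⊗-suc a n)))

⊗-mono : ∀ {F F′ G} n → (∀ m → F m ℤ.≤ F′ m) → Pos G → (F ⊗ G) n ℤ.≤ (F′ ⊗ G) n
⊗-mono {G = G} zero    p q = ℤP.*-monoʳ-≤-nonNeg (G 0) {{ℤ.nonNegative (≼-nonneg q 0)}} (p 0)
⊗-mono {G = G} (suc n) p q = ℤP.+-mono-≤ (ℤP.*-monoʳ-≤-nonNeg (G (suc n)) {{ℤ.nonNegative (≼-nonneg q (suc n))}} (p 0))
  (⊗-mono n (λ m → p (suc m)) q)

a-double : ∀ n → a (suc n) ℤ.+ a (suc n) ℤ.≤ a (suc (suc n))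
a-double n = subst₂ ℤ._≤_ (cong₂ ℤ._+_ (ℤP.*-identityˡ (a (suc n))) (sym (a-suc n))) (sym (a-suc (suc n)))
  (ℤP.+-monoʳ-≤ (+ 1 ℤ.* a (suc n)) (⊗-mono n (λ m → y-mono (suc m) (s≤s z≤n)) Pos-a))

-- In a = 1 + y a the first two terms of y contribute a(n+2) + a(n+1) to a(n+3), and the rest is at
-- least twice the corresponding rest of a(n+2), because y doubles from degree 2 on.
a-triple : ∀ n → + 3 ℤ.* a (suc (suc n)) ℤ.≤ a (suc (suc (suc n))) ℤ.+ a (suc n)
a-triple n = ≤-by (trans (cong (ℤ._+ a (suc n)) (a-suc (suc (suc n))))
    (subst (λ x → + 1 ℤ.* x ℤ.+ (+ 1 ℤ.* a (suc n) ℤ.+ S₃) ℤ.+ a (suc n) ≡ + 3 ℤ.* x ℤ.+ (S₃ ℤ.- (S₂ ℤ.+ S₂)))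
      (sym (a-suc (suc n))) (lem (a (suc n)) S₂ S₃)))
  (0≤- S₂≤S₃)
  where
  F = tl (tl y)
  S₂ = (F ⊗ a) n
  S₃ = (tl F ⊗ a) n
  S₂≤S₃ : S₂ ℤ.+ S₂ ℤ.≤ S₃
  S₂≤S₃ = subst (ℤ._≤ S₃) (trans (⊗-cong (mk λ m → sym (⊕-at F F m)) (≈-refl {a}) n) (⊗-distribʳ a F F n))
    (⊗-mono n (λ m → y-double (suc (suc m)) (s≤s (s≤s z≤n))) Pos-a)
  lem : ∀ z s t → + 1 ℤ.* (+ 1 ℤ.* z ℤ.+ s) ℤ.+ (+ 1 ℤ.* z ℤ.+ t) ℤ.+ z ≡ + 3 ℤ.* (+ 1 ℤ.* z ℤ.+ s) ℤ.+ (t ℤ.- (s ℤ.+ s))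
  lem = solveℤ

-- The growth rate must exceed 2: coefficients of F(x²) are of order 2^n times a power of n, and
-- doubling of `a` alone would not make their convolution with `a` converge relative to `a`.
a-ratio : ∀ n → + 5 ℤ.* a (suc (suc n)) ℤ.≤ + 2 ℤ.* a (suc (suc (suc n)))
a-ratio n = ≤-by (lem (a (suc n)) (a (suc (suc n))) (a (suc (suc (suc n)))))
  (0≤+ (0≤* {+ 2} 0≤n (0≤- (a-triple n))) (0≤- (a-double n)))
  where
  lem : ∀ p q r → + 2 ℤ.* r ≡ + 5 ℤ.* q ℤ.+ (+ 2 ℤ.* (r ℤ.+ p ℤ.- + 3 ℤ.* q) ℤ.+ (q ℤ.- (p ℤ.+ p)))
  lem = solveℤ

a-growth₂ : ∀ n j → (+ 5) ℤ.^ j ℤ.* a (2 ℕ.+ n) ℤ.≤ (+ 2) ℤ.^ j ℤ.* a (2 ℕ.+ n ℕ.+ j)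
a-growth₂ n zero    = ℤP.≤-reflexive (cong (λ z → + 1 ℤ.* a (2 ℕ.+ z)) (sym (ℕP.+-identityʳ n)))
a-growth₂ n (suc j) = subst (λ z → (+ 5) ℤ.^ suc j ℤ.* a (2 ℕ.+ n) ℤ.≤ (+ 2) ℤ.^ suc j ℤ.* a (2 ℕ.+ z)) (sym (ℕP.+-suc n j))
  (≤-by (lem ((+ 5) ℤ.^ j) ((+ 2) ℤ.^ j) (a (2 ℕ.+ n)) (a (2 ℕ.+ n ℕ.+ j)) (a (3 ℕ.+ n ℕ.+ j)))
    (0≤+ (0≤* {+ 5} 0≤n (0≤- (a-growth₂ n j))) (0≤* (0≤^ 2 j) (0≤- (a-ratio (n ℕ.+ j))))))
  where
  lem : ∀ p q u v w → + 2 ℤ.* q ℤ.* w ≡ + 5 ℤ.* p ℤ.* u ℤ.+ (+ 5 ℤ.* (q ℤ.* v ℤ.- p ℤ.* u) ℤ.+ q ℤ.* (+ 2 ℤ.* w ℤ.- + 5 ℤ.* v))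
  lem = solveℤ

-- The factor 4 pays for the start 1, 1, 2 of the sequence, where the ratio 5/2 fails.
a-growth : ∀ n j → (+ 5) ℤ.^ j ℤ.* a n ℤ.≤ + 4 ℤ.* (+ 2) ℤ.^ j ℤ.* a (n ℕ.+ j)
a-growth (suc (suc n)) j = ℤP.≤-trans (a-growth₂ n j) (≤-by (lem ((+ 2) ℤ.^ j) (a (2 ℕ.+ n ℕ.+ j)))
  (0≤* {+ 3} 0≤n (0≤* (0≤^ 2 j) (≼-nonneg Pos-a (2 ℕ.+ n ℕ.+ j)))))
  where
  lem : ∀ q v → + 4 ℤ.* q ℤ.* v ≡ q ℤ.* v ℤ.+ + 3 ℤ.* (q ℤ.* v)
  lem = solveℤ
a-growth 0 0 = ℕ≤⇒ℤ≤ (s≤s z≤n)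
a-growth 0 1 = ℕ≤⇒ℤ≤ (ℕP.≤ᵇ⇒≤ 5 8 _)
a-growth 0 (suc (suc j)) = ≤-by (lem ((+ 5) ℤ.^ j) ((+ 2) ℤ.^ j) (a (2 ℕ.+ j)))
    (0≤+ (0≤* {+ 16} 0≤n (0≤- (a-growth₂ 0 j))) (0≤* {+ 7} 0≤n (0≤^ 5 j)))
  where
  lem : ∀ p q v → + 4 ℤ.* (+ 2 ℤ.* (+ 2 ℤ.* q)) ℤ.* v
    ≡ + 5 ℤ.* (+ 5 ℤ.* p) ℤ.* + 1 ℤ.+ (+ 16 ℤ.* (q ℤ.* v ℤ.- p ℤ.* + 2) ℤ.+ + 7 ℤ.* p)
  lem = solveℤ
a-growth 1 0 = ℕ≤⇒ℤ≤ (s≤s z≤n)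
a-growth 1 (suc j) = ≤-by (lem ((+ 5) ℤ.^ j) ((+ 2) ℤ.^ j) (a (2 ℕ.+ j)))
    (0≤+ (0≤* {+ 8} 0≤n (0≤- (a-growth₂ 0 j))) (0≤* {+ 11} 0≤n (0≤^ 5 j)))
  where
  lem : ∀ p q v → + 4 ℤ.* (+ 2 ℤ.* q) ℤ.* v ≡ + 5 ℤ.* p ℤ.* + 1 ℤ.+ (+ 8 ℤ.* (q ℤ.* v ℤ.- p ℤ.* + 2) ℤ.+ + 11 ℤ.* p)
  lem = solveℤ

-- 9 = 1 / (1 - 8/9). The induction carries the exact remainder 8^(n+1) B, which keeps everything in
-- the integers.
geometric-sum : ∀ (c : ℕ → ℤ) B n → + 0 ℤ.≤ B → (∀ j → j ℕ.≤ n → (+ 9) ℤ.^ j ℤ.* c j ℤ.≤ (+ 8) ℤ.^ j ℤ.* B) →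
  ∑ (downFrom (suc n)) c ℤ.≤ + 9 ℤ.* B
geometric-sum c B n B≥0 h = ℤP.*-cancelˡ-≤-pos _ _ ((+ 9) ℤ.^ n) {{pos9 n}}
  (≤-by (lem ((+ 9) ℤ.^ n) ((+ 8) ℤ.^ suc n) B (∑ (downFrom (suc n)) c)) (0≤+ (0≤- (go n h)) (0≤* (0≤^ 8 (suc n)) B≥0)))
  where
  pos9 : ∀ n → ℤ.Positive ((+ 9) ℤ.^ n)
  pos9 n = subst ℤ.Positive (sym (pos-^ 9 n)) (ℤ.positive (ℤ.+<+ (ℕP.m^n>0 9 n)))
  lem : ∀ p q B s → p ℤ.* (+ 9 ℤ.* B) ≡ p ℤ.* s ℤ.+ (+ 9 ℤ.* p ℤ.* B ℤ.- (p ℤ.* s ℤ.+ q ℤ.* B) ℤ.+ q ℤ.* B)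
  lem = solveℤ
  go : ∀ n → (∀ j → j ℕ.≤ n → (+ 9) ℤ.^ j ℤ.* c j ℤ.≤ (+ 8) ℤ.^ j ℤ.* B) →
    (+ 9) ℤ.^ n ℤ.* ∑ (downFrom (suc n)) c ℤ.+ (+ 8) ℤ.^ suc n ℤ.* B ℤ.≤ (+ 9) ℤ.^ suc n ℤ.* B
  go zero    h = ≤-by (l₀ (c 0) B) (0≤- (h 0 z≤n))
    where
    l₀ : ∀ x B → + 9 ℤ.* + 1 ℤ.* B ≡ + 1 ℤ.* (x ℤ.+ + 0) ℤ.+ + 8 ℤ.* + 1 ℤ.* B ℤ.+ (+ 1 ℤ.* B ℤ.- + 1 ℤ.* x)
    l₀ = solveℤ
  go (suc n) h = ≤-by (l₁ ((+ 9) ℤ.^ n) ((+ 8) ℤ.^ n) B (c (suc n)) (∑ (downFrom (suc n)) c))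
      (0≤+ (0≤* {+ 9} 0≤n (0≤- (go n λ j p → h j (ℕP.m≤n⇒m≤1+n p)))) (0≤- (h (suc n) ℕP.≤-refl)))
    where
    l₁ : ∀ p q B x s → + 9 ℤ.* (+ 9 ℤ.* p) ℤ.* B ≡ + 9 ℤ.* p ℤ.* (x ℤ.+ s) ℤ.+ + 8 ℤ.* (+ 8 ℤ.* q) ℤ.* B
      ℤ.+ (+ 9 ℤ.* (+ 9 ℤ.* p ℤ.* B ℤ.- (p ℤ.* s ℤ.+ + 8 ℤ.* q ℤ.* B)) ℤ.+ (+ 8 ℤ.* q ℤ.* B ℤ.- + 9 ℤ.* p ℤ.* x))
    l₁ = solveℤ

-- Polynomials against exponentials

bernoulli : ∀ b n → (suc b ℕ.+ n) ℕ.* suc b ℕ.^ n ℕ.≤ suc b ℕ.* (2 ℕ.+ b) ℕ.^ n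
bernoulli b zero    = ℕP.≤-reflexive (solveℕ₀ b)
  where
  solveℕ₀ : ∀ b → (suc b ℕ.+ 0) ℕ.* 1 ≡ suc b ℕ.* 1
  solveℕ₀ = solveℕ
bernoulli b (suc n) = ℕP.≤-trans (ℕP.m≤m+n _ (n ℕ.* suc b ℕ.^ n))
  (ℕP.≤-trans (ℕP.≤-reflexive (lem b n (suc b ℕ.^ n))) (ℕP.≤-trans (ℕP.*-monoʳ-≤ (2 ℕ.+ b) (bernoulli b n)) (ℕP.≤-reflexive (lem₂ b ((2 ℕ.+ b) ℕ.^ n)))))
  where
  lem : ∀ b n p → (suc b ℕ.+ suc n) ℕ.* (suc b ℕ.* p) ℕ.+ n ℕ.* p ≡ (2 ℕ.+ b) ℕ.* ((suc b ℕ.+ n) ℕ.* p)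
  lem = solveℕ
  lem₂ : ∀ b q → (2 ℕ.+ b) ℕ.* (suc b ℕ.* q) ≡ suc b ℕ.* ((2 ℕ.+ b) ℕ.* q)
  lem₂ = solveℕ

ℕ-^-*-^ : ∀ m n k → (m ℕ.* n) ℕ.^ k ≡ m ℕ.^ k ℕ.* n ℕ.^ k
ℕ-^-*-^ m n zero    = refl
ℕ-^-*-^ m n (suc k) = trans (cong (m ℕ.* n ℕ.*_) (ℕ-^-*-^ m n k)) (lem m n (m ℕ.^ k) (n ℕ.^ k))
  where
  lem : ∀ m n p q → m ℕ.* n ℕ.* (p ℕ.* q) ≡ m ℕ.* p ℕ.* (n ℕ.* q)
  lem = solveℕ

ℕ-^-swap : ∀ b m k → (b ℕ.^ m) ℕ.^ k ≡ (b ℕ.^ k) ℕ.^ m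
ℕ-^-swap b m k = trans (ℕP.^-*-assoc b m k) (trans (cong (b ℕ.^_) (ℕP.*-comm m k)) (sym (ℕP.^-*-assoc b k m)))

-- Bernoulli's inequality gives m ≤ (b + 1) ((b + 2) / (b + 1))^m; its k-th power is combined with
-- the hypothesis ((b + 2) / (b + 1))^k ≤ v / u.
poly-below : ∀ b k u v → (2 ℕ.+ b) ℕ.^ k ℕ.* u ℕ.≤ v ℕ.* suc b ℕ.^ k → ∀ m → m ℕ.^ k ℕ.* u ℕ.^ m ℕ.≤ suc b ℕ.^ k ℕ.* v ℕ.^ m
poly-below b k u v h m = ℕP.*-cancelʳ-≤ _ _ ((suc b ℕ.^ k) ℕ.^ m) {{ℕP.m^n≢0 (suc b ℕ.^ k) m {{ℕP.m^n≢0 (suc b) k}}}} (begin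
  m ℕ.^ k ℕ.* u ℕ.^ m ℕ.* (suc b ℕ.^ k) ℕ.^ m   ≡⟨ cong (m ℕ.^ k ℕ.* u ℕ.^ m ℕ.*_) (ℕ-^-swap (suc b) k m) ⟩
  m ℕ.^ k ℕ.* u ℕ.^ m ℕ.* (suc b ℕ.^ m) ℕ.^ k   ≡⟨ l₁ (m ℕ.^ k) (u ℕ.^ m) _ ⟩
  m ℕ.^ k ℕ.* (suc b ℕ.^ m) ℕ.^ k ℕ.* u ℕ.^ m   ≡⟨ cong (ℕ._* u ℕ.^ m) (sym (ℕ-^-*-^ m (suc b ℕ.^ m) k)) ⟩
  (m ℕ.* suc b ℕ.^ m) ℕ.^ k ℕ.* u ℕ.^ m         ≤⟨ ℕP.*-monoˡ-≤ (u ℕ.^ m) (ℕP.^-monoˡ-≤ k (ℕP.≤-trans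
                                                     (ℕP.*-monoˡ-≤ (suc b ℕ.^ m) (ℕP.m≤n+m m (suc b))) (bernoulli b m))) ⟩
  (suc b ℕ.* (2 ℕ.+ b) ℕ.^ m) ℕ.^ k ℕ.* u ℕ.^ m ≡⟨ cong (ℕ._* u ℕ.^ m) (trans (ℕ-^-*-^ (suc b) _ k) (cong (suc b ℕ.^ k ℕ.*_) (ℕ-^-swap (2 ℕ.+ b) m k))) ⟩
  suc b ℕ.^ k ℕ.* ((2 ℕ.+ b) ℕ.^ k) ℕ.^ m ℕ.* u ℕ.^ m ≡⟨ trans (ℕP.*-assoc (suc b ℕ.^ k) _ _) (cong (suc b ℕ.^ k ℕ.*_) (sym (ℕ-^-*-^ ((2 ℕ.+ b) ℕ.^ k) u m))) ⟩
  suc b ℕ.^ k ℕ.* ((2 ℕ.+ b) ℕ.^ k ℕ.* u) ℕ.^ m ≤⟨ ℕP.*-monoʳ-≤ (suc b ℕ.^ k) (ℕP.^-monoˡ-≤ m h) ⟩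
  suc b ℕ.^ k ℕ.* (v ℕ.* suc b ℕ.^ k) ℕ.^ m     ≡⟨ trans (cong (suc b ℕ.^ k ℕ.*_) (ℕ-^-*-^ v (suc b ℕ.^ k) m)) (sym (ℕP.*-assoc (suc b ℕ.^ k) _ _)) ⟩
  suc b ℕ.^ k ℕ.* v ℕ.^ m ℕ.* (suc b ℕ.^ k) ℕ.^ m ∎)
  where
  open ℕP.≤-Reasoning
  l₁ : ∀ x y z → x ℕ.* y ℕ.* z ≡ x ℕ.* z ℕ.* y
  l₁ = solveℕ

-- Rests on (101/100)^9 ≤ 10/9. The exponent 9 is 3 + 4 + 2: the weight i³, the fourth power of the
-- size, and the number of pairs (i, s) in a coefficient of `H`.
pow9 : ∀ m → m ℕ.^ 9 ℕ.* 9 ℕ.^ m ℕ.≤ 100 ℕ.^ 9 ℕ.* 10 ℕ.^ m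
pow9 = poly-below 99 9 9 10 (ℕP.≤ᵇ⇒≤ _ _ _)

-- Norms relative to a: N for factors, S for the coefficients themselves

record N (F : Ser) (c : ℕ) : Set where
  constructor mkN
  field
    posN  : Pos F
    bound : F ⊗ a ≼ cst (+ c) ⊗ a
open N public

S : Ser → ℕ → Set
S F c = F ≼ cst (+ c) ⊗ a

-- The size functional and rules for error series

sizeℤ : Tree → ℤ
sizeℤ t = + size t

size-class : ClassFun sizeℤ
size-class e = cong +_ (size-cong e)

kids-size : ∀ T → sizeℤ T ℤ.- + 1 ≡ kids sizeℤ T
kids-size (node ts) = trans (lem (+ length (map suc (depthsᶠ ts)))) (trans (cong +_ (ListP.length-map suc (depthsᶠ ts))) (go ts))
  where
  lem : ∀ x → + 1 ℤ.+ x ℤ.- + 1 ≡ x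
  lem = solveℤ
  go : ∀ ts → + length (depthsᶠ ts) ≡ ∑ ts sizeℤ
  go []       = refl
  go (t ∷ ts) = trans (cong +_ (ListP.length-++ (depths t))) (cong (λ z → sizeℤ t ℤ.+ z) (go ts))

∑-trees-size : ∀ n (f : ℤ → ℤ) → ∑ (trees n) (λ t → f (sizeℤ t)) ≡ f (+ n) ℤ.* y n
∑-trees-size n f = trans (∑-congᴬ (All.map (λ e → trans (cong (λ s → f (+ s)) e) (sym (ℤP.*-identityʳ (f (+ n))))) (trees-sizes n)))
  (∑-* (f (+ n)) (λ _ → + 1) (trees n))

Pos-δ : ∀ e → Pos (δ e)
Pos-δ e = pos (go e)
  where
  go : ∀ e n → + 0 ℤ.≤ δ e n
  go zero    zero    = 0≤n
  go zero    (suc n) = 0≤n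
  go (suc e) zero    = 0≤n
  go (suc e) (suc n) = go e n

^-mono-exp : ∀ c {k k′} → k ℕ.≤ k′ → (+ suc c) ℤ.^ k ℤ.≤ (+ suc c) ℤ.^ k′
^-mono-exp c {k} {k′} p = subst₂ ℤ._≤_ (sym (pos-^ (suc c) k)) (sym (pos-^ (suc c) k′)) (ℕ≤⇒ℤ≤ (ℕP.^-monoʳ-≤ (suc c) p))

Er-mono : ∀ {k k′ F G} → k ℕ.≤ k′ → F ≼ G → Er k F ≼ Er k′ G
Er-mono {k} {k′} {F} {G} k≤ p = dom λ m → ∑-abs (All.universal (λ i → ∑-abs
    {f = λ s → (+ (2 ℕ.+ i)) ℤ.^ k ℤ.* δ ((2 ℕ.+ i) ℕ.* s) m ℤ.* F s}
    {g = λ s → (+ (2 ℕ.+ i)) ℤ.^ k′ ℤ.* δ ((2 ℕ.+ i) ℕ.* s) m ℤ.* G s} {xs = downFrom (suc m)} (All.universal (λ s →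
    abs-* {(+ (2 ℕ.+ i)) ℤ.^ k ℤ.* δ ((2 ℕ.+ i) ℕ.* s) m} {F s}
      (subst (ℤ._≤ (+ (2 ℕ.+ i)) ℤ.^ k′ ℤ.* δ ((2 ℕ.+ i) ℕ.* s) m)
         (sym (abs-nonneg (0≤* (0≤^ (2 ℕ.+ i) k) (≼-nonneg (Pos-δ ((2 ℕ.+ i) ℕ.* s)) m))))
         (ℤP.*-monoʳ-≤-nonNeg (δ ((2 ℕ.+ i) ℕ.* s) m) {{ℤ.nonNegative (≼-nonneg (Pos-δ ((2 ℕ.+ i) ℕ.* s)) m)}} (^-mono-exp (suc i) k≤)))
      (le p s)) (downFrom (suc m)))) (downFrom m))

∑-weight-∑ˢ : ∀ {A : Set} (w : ℕ → ℤ) (xs : List A) (F : A → Ser) ss →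
  ∑ ss (λ s → w s ℤ.* ∑ˢ xs F s) ≡ ∑ xs (λ x → ∑ ss (λ s → w s ℤ.* F x s))
∑-weight-∑ˢ w xs F ss = trans (∑-cong ss λ s → trans (cong (w s ℤ.*_) (∑ˢ-at xs F s)) (sym (∑-* (w s) (λ x → F x s) xs)))
  (∑-swap (λ s x → w s ℤ.* F x s) ss xs)

∑-weight-sub : ∀ (w : ℕ → ℤ) F G ss →
  ∑ ss (λ s → w s ℤ.* (F ⊕ ⊝ G) s) ≡ ∑ ss (λ s → w s ℤ.* F s) ℤ.+ ℤ.- + 1 ℤ.* ∑ ss (λ s → w s ℤ.* G s)
∑-weight-sub w F G ss = trans (∑-cong ss λ s → trans (cong (w s ℤ.*_) (trans (⊕-at F (⊝ G) s) (cong (λ z → F s ℤ.+ z) (⊝-at G s)))) (lem (w s) (F s) (G s)))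
  (trans (∑-+ (λ s → w s ℤ.* F s) (λ s → ℤ.- + 1 ℤ.* (w s ℤ.* G s)) ss) (cong (λ z → ∑ ss (λ s → w s ℤ.* F s) ℤ.+ z) (∑-* (ℤ.- + 1) (λ s → w s ℤ.* G s) ss)))
  where
  lem : ∀ w x z → w ℤ.* (x ℤ.+ ℤ.- z) ≡ w ℤ.* x ℤ.+ ℤ.- + 1 ℤ.* (w ℤ.* z)
  lem = solveℤ

Er-weight : ℕ → ℕ → ℕ → ℕ → ℤ
Er-weight k m i s = (+ (2 ℕ.+ i)) ℤ.^ k ℤ.* δ ((2 ℕ.+ i) ℕ.* s) m

Er-∑ : ∀ {A : Set} k (xs : List A) (F : A → Ser) → Er k (∑ˢ xs F) ≈ ∑ˢ xs (λ x → Er k (F x))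
Er-∑ k xs F = mk λ m → trans (∑-cong (downFrom m) λ i → ∑-weight-∑ˢ (Er-weight k m i) xs F (downFrom (suc m)))
  (trans (∑-swap (λ i x → ∑ (downFrom (suc m)) (λ s → Er-weight k m i s ℤ.* F x s)) (downFrom m) xs) (sym (∑ˢ-at xs _ m)))

Er-sub : ∀ k F G → Er k (F ⊕ ⊝ G) ≈ Er k F ⊕ ⊝ Er k G
Er-sub k F G = mk λ m → trans
  (trans (∑-cong (downFrom m) λ i → ∑-weight-sub (Er-weight k m i) F G (downFrom (suc m)))
   (trans (∑-+ (λ i → ∑ (downFrom (suc m)) (λ s → Er-weight k m i s ℤ.* F s))
               (λ i → ℤ.- + 1 ℤ.* ∑ (downFrom (suc m)) (λ s → Er-weight k m i s ℤ.* G s)) (downFrom m))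
     (cong (λ z → Er k F m ℤ.+ z) (∑-* (ℤ.- + 1) (λ i → ∑ (downFrom (suc m)) (λ s → Er-weight k m i s ℤ.* G s)) (downFrom m)))))
  (trans (lem₂ (Er k F m) (Er k G m)) (sym (trans (⊕-at (Er k F) (⊝ Er k G) m) (cong (λ z → Er k F m ℤ.+ z) (⊝-at (Er k G) m)))))
  where
  lem₂ : ∀ x z → x ℤ.+ ℤ.- + 1 ℤ.* z ≡ x ℤ.+ ℤ.- z
  lem₂ = solveℤ

-- The first moment identity for the size reads x y′ = y (1 + x y′ + E) with E nonnegative, while a
-- = 1 + y a. Strong induction on the degree therefore keeps a below 1 + x y′ + E, and one
-- multiplication by y gives the claim.
a≤size : ∀ n → a (suc n) ℤ.≤ + suc n ℤ.* y (suc n)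
a≤size n = ℤP.≤-trans (ℤP.≤-reflexive (a-suc n)) (go n)
  where
  open Moments sizeℤ (λ T → sizeℤ T ℤ.- + 1) size-class kids-size
  E = Er 0 (M 1 sizeℤ)
  Pos-M : Pos (M 1 sizeℤ)
  Pos-M = pos λ n → ∑-nonneg (All.universal (λ t → 0≤* {sizeℤ t} 0≤n 0≤n) (trees n))
  M-at : ∀ n → M 1 sizeℤ n ≡ + n ℤ.* + 1 ℤ.* y n
  M-at n = ∑-trees-size n (ℤ._^ 1)
  go : ∀ n → (tl y ⊗ a) n ℤ.≤ + suc n ℤ.* y (suc n)
  below : ∀ m → a m ℤ.≤ δ 0 m ℤ.+ (M 1 sizeℤ m ℤ.+ E m)
  below-lt : ∀ n m → m ℕ.< n → a m ℤ.≤ δ 0 m ℤ.+ (M 1 sizeℤ m ℤ.+ E m)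
  step : ∀ n → (∀ m → m ℕ.≤ n → a m ℤ.≤ δ 0 m ℤ.+ (M 1 sizeℤ m ℤ.+ E m)) → (tl y ⊗ a) n ℤ.≤ + suc n ℤ.* y (suc n)
  step n h = ℤP.≤-trans (conv-mono n h) (ℤP.≤-reflexive (trans
      (⊗-cong (≈-refl {tl y}) (mk λ m → sym (trans (⊕-at (δ 0) (K 0 sizeℤ) m) (cong (λ z → δ 0 m ℤ.+ z) (⊕-at (M 1 sizeℤ) E m)))) n)
      (trans (⊗-distribˡ (tl y) (δ 0) (K 0 sizeℤ) n)
        (trans (cong₂ ℤ._+_ (trans (⊗-comm (tl y) 𝟙 n) (⊗-identityˡ (tl y) n))
            (trans (sym (y⊗-suc (K 0 sizeℤ) n)) (trans (sym (at moment₁ (suc n))) (∑-trees-size (suc n) (λ z → (z ℤ.- + 1) ℤ.* + 1)))))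
          (lem (+ suc n) (y (suc n)))))))
    where
    lem : ∀ s v → v ℤ.+ (s ℤ.- + 1) ℤ.* + 1 ℤ.* v ≡ s ℤ.* v
    lem = solveℤ
    conv-mono : ∀ {F : Ser} n → (∀ m → m ℕ.≤ n → a m ℤ.≤ F m) → (tl y ⊗ a) n ℤ.≤ (tl y ⊗ F) n
    conv-mono {F} n h = subst₂ ℤ._≤_ (sym (⊗-∑ (tl y) a n)) (sym (⊗-∑ (tl y) F n))
      (∑-mono (All.universal (λ j → ℤP.*-monoˡ-≤-nonNeg (tl y j) {{ℤ.nonNegative (≼-nonneg Pos-y (suc j))}} (h (n ℕ.∸ j) (ℕP.m∸n≤m n j))) (downFrom (suc n))))
  below-lt (suc n) zero    p = ≤-by refl (0≤+ (≼-nonneg Pos-M 0) (≼-nonneg (Er-mono {0} {0} z≤n Pos-M) 0))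
  below-lt (suc n) (suc m) (s≤s p) = ℤP.≤-trans (ℤP.≤-reflexive (a-suc m)) (ℤP.≤-trans (step m (λ j j≤m → below-lt n j (ℕP.≤-<-trans j≤m p)))
    (≤-by (trans (cong (λ z → + 0 ℤ.+ (z ℤ.+ E (suc m))) (M-at (suc m))) (lem (+ suc m) (y (suc m)) (E (suc m)))) (≼-nonneg (Er-mono {0} {0} z≤n Pos-M) (suc m))))
    where
    lem : ∀ s v e → + 0 ℤ.+ (s ℤ.* + 1 ℤ.* v ℤ.+ e) ≡ s ℤ.* v ℤ.+ e
    lem = solveℤ
  below m = below-lt (suc m) m ℕP.≤-refl
  go n = step n (λ m _ → below m)

-- A common majorant for all errors

size⁴ : Ser
size⁴ = ⟦ (λ t → + 16 ℤ.* sizeℤ t ℤ.^ 4) ⟧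

-- Weights i^p occur with p ≤ 3, as moments up to the fourth are needed, and a sum over levels of (p
-- + 1)-st powers is at most (2 `size t`)^(p+1), hence at most 16 `size t`⁴.
H : Ser
H = Er 3 size⁴

-- With j = i + 2 only j s = m contributes. There j³ s⁴ ≤ m⁷, and y(s) ≤ 4^s ≤ 2^m because j ≥ 2:
-- the substitution takes at least a square root of the growth rate.
H-term : ∀ m i s → (+ (2 ℕ.+ i)) ℤ.^ 3 ℤ.* δ ((2 ℕ.+ i) ℕ.* s) m ℤ.* size⁴ s ℤ.≤ + 16 ℤ.* (+ m) ℤ.^ 7 ℤ.* (+ 2) ℤ.^ m
H-term m i s with (2 ℕ.+ i) ℕ.* s ℕP.≟ m
... | no ne = ℤP.≤-trans (ℤP.≤-reflexive (trans (cong (λ z → (+ (2 ℕ.+ i)) ℤ.^ 3 ℤ.* z ℤ.* size⁴ s) (δ-other ((2 ℕ.+ i) ℕ.* s) m ne))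
    (trans (cong (ℤ._* size⁴ s) (ℤP.*-zeroʳ ((+ (2 ℕ.+ i)) ℤ.^ 3))) refl))) (0≤* (0≤* {+ 16} 0≤n (0≤^ m 7)) (0≤^ 2 m))
H-term m i zero    | yes refl = ℤP.≤-trans (ℤP.≤-reflexive (ℤP.*-zeroʳ ((+ (2 ℕ.+ i)) ℤ.^ 3 ℤ.* δ ((2 ℕ.+ i) ℕ.* 0) ((2 ℕ.+ i) ℕ.* 0)))) (0≤* (0≤* {+ 16} 0≤n (0≤^ ((2 ℕ.+ i) ℕ.* 0) 7)) (0≤^ 2 ((2 ℕ.+ i) ℕ.* 0)))
H-term m i s@(suc s′) | yes refl = ℤP.≤-trans
    (ℤP.≤-reflexive (trans (cong₂ (λ u v → (+ j) ℤ.^ 3 ℤ.* u ℤ.* v) (δ-self (j ℕ.* s)) (∑-trees-size s (λ z → + 16 ℤ.* z ℤ.^ 4)))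
                           (lem ((+ j) ℤ.^ 3) ((+ s) ℤ.^ 4) (y s))))
    (ℤP.≤-trans (*-mono-≤-0 (0≤* {+ 16} 0≤n (0≤* (0≤^ j 3) (0≤^ s 4))) (≼-nonneg Pos-y s)
        (ℤP.*-monoˡ-≤-nonNeg (+ 16) (*-mono-≤-0 (0≤^ j 3) (0≤^ s 4) (base j m 3 (ℕP.m≤m*n j s)) (base s m 4 (ℕP.m≤n*m s j))))
        (ℤP.≤-trans (y≤4^ s) 4^s≤2^m))
      (ℤP.≤-reflexive (lem₂ (+ m) ((+ 2) ℤ.^ m))))
  where
  j = 2 ℕ.+ i
  lem : ∀ p q v → p ℤ.* + 1 ℤ.* (+ 16 ℤ.* q ℤ.* v) ≡ + 16 ℤ.* (p ℤ.* q) ℤ.* v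
  lem = solveℤ
  lem₂ : ∀ x z → + 16 ℤ.* (x ℤ.* (x ℤ.* (x ℤ.* + 1)) ℤ.* (x ℤ.* (x ℤ.* (x ℤ.* (x ℤ.* + 1))))) ℤ.* z
    ≡ + 16 ℤ.* (x ℤ.* (x ℤ.* (x ℤ.* (x ℤ.* (x ℤ.* (x ℤ.* (x ℤ.* + 1))))))) ℤ.* z
  lem₂ = solveℤ
  base : ∀ u v k → u ℕ.≤ v → (+ u) ℤ.^ k ℤ.≤ (+ v) ℤ.^ k
  base u v k p = subst₂ ℤ._≤_ (sym (pos-^ u k)) (sym (pos-^ v k)) (ℕ≤⇒ℤ≤ (ℕP.^-monoˡ-≤ k p))
  4^s≤2^m : (+ 4) ℤ.^ s ℤ.≤ (+ 2) ℤ.^ m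
  4^s≤2^m = subst₂ ℤ._≤_ (trans (cong +_ (sym (ℕP.^-*-assoc 2 2 s))) (sym (pos-^ 4 s))) (sym (pos-^ 2 m))
    (ℕ≤⇒ℤ≤ (ℕP.^-monoʳ-≤ 2 (ℕP.*-monoˡ-≤ s (ℕP.m≤m+n 2 i))))

∑-rng-bound : ∀ {f : ℕ → ℤ} {B} n → (∀ j → j ℕ.< n → f j ℤ.≤ B) → ∑ (downFrom n) f ℤ.≤ + n ℤ.* B
∑-rng-bound {f} {B} zero    h = ℤP.≤-refl
∑-rng-bound {f} {B} (suc n) h = ℤP.≤-trans (ℤP.+-mono-≤ (h n ℕP.≤-refl) (∑-rng-bound n λ j p → h j (ℕP.m≤n⇒m≤1+n p)))
  (ℤP.≤-reflexive (lem (+ n) B))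
  where
  lem : ∀ n B → B ℤ.+ n ℤ.* B ≡ (+ 1 ℤ.+ n) ℤ.* B
  lem = solveℤ

H-coeff : ∀ m → H m ℤ.≤ + 32 ℤ.* (+ m) ℤ.^ 9 ℤ.* (+ 2) ℤ.^ m
H-coeff zero = ℤP.≤-refl
H-coeff m@(suc m′) = ℤP.≤-trans (∑-rng-bound m λ i _ → ∑-rng-bound (suc m) λ s _ → H-term m i s)
  (≤-by (lem (+ m′) ((+ m) ℤ.^ 7) ((+ 2) ℤ.^ m)) (0≤* {+ 16 ℤ.* (+ m)} 0≤n′ (0≤* {(+ m′)} 0≤n (0≤* (0≤^ m 7) (0≤^ 2 m)))))
  where
  0≤n′ : + 0 ℤ.≤ + 16 ℤ.* + m
  0≤n′ = 0≤* {+ 16} {+ m} 0≤n 0≤n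
  lem : ∀ x p z → + 32 ℤ.* ((+ 1 ℤ.+ x) ℤ.* ((+ 1 ℤ.+ x) ℤ.* p)) ℤ.* z
    ≡ (+ 1 ℤ.+ x) ℤ.* ((+ 1 ℤ.+ (+ 1 ℤ.+ x)) ℤ.* (+ 16 ℤ.* p ℤ.* z)) ℤ.+ + 16 ℤ.* (+ 1 ℤ.+ x) ℤ.* (x ℤ.* (p ℤ.* z))
  lem = solveℤ

Pos-size⁴ : Pos size⁴
Pos-size⁴ = pos λ n → ∑-nonneg (All.universal (λ t → 0≤* {+ 16} 0≤n (0≤^ (size t) 4)) (trees n))

Pos-Er : ∀ {k F} → Pos F → Pos (Er k F)
Pos-Er {k} = Er-mono {k} {k} ℕP.≤-refl

-- The ratio 8/9 is 2 · (2/5) · (10/9): growth of `H`, decay of a(n-j) relative to a(n), and the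
-- price of the polynomial factor. The constant 128 is 32 · 4, from `H-coeff` and `a-growth`, and 9
-- sums the geometric series.
H-bound : ∀ c → (∀ m → m ℕ.^ 9 ℕ.* 9 ℕ.^ m ℕ.≤ c ℕ.* 10 ℕ.^ m) → N H (9 ℕ.* (128 ℕ.* c))
H-bound c pow = mkN (Pos-Er {3} Pos-size⁴) (dom λ n → subst₂ ℤ._≤_
    (trans (sym (⊗-∑ H a n)) (sym (abs-nonneg (≼-nonneg (≼-⊗ (Pos-Er {3} Pos-size⁴) Pos-a) n))))
    (trans (sym (ℤP.*-assoc (+ 9) (+ (128 ℕ.* c)) (a n))) (trans (cong (ℤ._* a n) (sym (ℤP.pos-* 9 (128 ℕ.* c)))) (sym (⊗-cst _ a n))))
    (geometric-sum (λ j → H j ℤ.* a (n ℕ.∸ j)) (B n) n (0≤* {+ (128 ℕ.* c)} 0≤n (≼-nonneg Pos-a n)) (term n)))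
  where
  B : ℕ → ℤ
  B n = + (128 ℕ.* c) ℤ.* a n
  pow9ℤ : ∀ j → (+ j) ℤ.^ 9 ℤ.* (+ 9) ℤ.^ j ℤ.≤ + (c) ℤ.* (+ 10) ℤ.^ j
  pow9ℤ j = subst₂ ℤ._≤_ (trans (ℤP.pos-* (j ℕ.^ 9) (9 ℕ.^ j)) (sym (cong₂ ℤ._*_ (pos-^ j 9) (pos-^ 9 j))))
    (trans (ℤP.pos-* (c) (10 ℕ.^ j)) (cong (+ (c) ℤ.*_) (sym (pos-^ 10 j)))) (ℕ≤⇒ℤ≤ (pow j))
  ^-*ℤ : ∀ u v j → (u ℤ.* v) ℤ.^ j ≡ u ℤ.^ j ℤ.* v ℤ.^ j
  ^-*ℤ u v zero    = refl
  ^-*ℤ u v (suc j) = trans (cong (u ℤ.* v ℤ.*_) (^-*ℤ u v j)) (l₀ u v (u ℤ.^ j) (v ℤ.^ j))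
    where
    l₀ : ∀ u v p q → u ℤ.* v ℤ.* (p ℤ.* q) ≡ u ℤ.* p ℤ.* (v ℤ.* q)
    l₀ = solveℤ
  cancel : ∀ b j x z → (+ suc b) ℤ.^ j ℤ.* x ℤ.≤ (+ suc b) ℤ.^ j ℤ.* z → x ℤ.≤ z
  cancel b j x z = ℤP.*-cancelˡ-≤-pos x z ((+ suc b) ℤ.^ j)
    {{subst ℤ.Positive (sym (pos-^ (suc b) j)) (ℤ.positive (ℤ.+<+ (ℕP.m^n>0 (suc b) j)))}}
  term : ∀ n j → j ℕ.≤ n → (+ 9) ℤ.^ j ℤ.* (H j ℤ.* a (n ℕ.∸ j)) ℤ.≤ (+ 8) ℤ.^ j ℤ.* B n
  term n j j≤n = cancel 4 j _ _ (begin
    (+ 5) ℤ.^ j ℤ.* ((+ 9) ℤ.^ j ℤ.* (H j ℤ.* a (n ℕ.∸ j)))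
      ≡⟨ l₁ ((+ 5) ℤ.^ j) ((+ 9) ℤ.^ j) (H j) (a (n ℕ.∸ j)) ⟩
    (+ 9) ℤ.^ j ℤ.* (H j ℤ.* ((+ 5) ℤ.^ j ℤ.* a (n ℕ.∸ j)))
      ≤⟨ *-mono-≤-0 (0≤^ 9 j) (0≤* (≼-nonneg (Pos-Er {3} Pos-size⁴) j) (0≤* (0≤^ 5 j) (≼-nonneg Pos-a (n ℕ.∸ j)))) ℤP.≤-refl
           (*-mono-≤-0 (≼-nonneg (Pos-Er {3} Pos-size⁴) j) (0≤* (0≤^ 5 j) (≼-nonneg Pos-a (n ℕ.∸ j))) (H-coeff j)
             (subst (λ z → (+ 5) ℤ.^ j ℤ.* a (n ℕ.∸ j) ℤ.≤ + 4 ℤ.* (+ 2) ℤ.^ j ℤ.* a z) (ℕP.m∸n+n≡m j≤n) (a-growth (n ℕ.∸ j) j))) ⟩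
    (+ 9) ℤ.^ j ℤ.* (+ 32 ℤ.* (+ j) ℤ.^ 9 ℤ.* (+ 2) ℤ.^ j ℤ.* (+ 4 ℤ.* (+ 2) ℤ.^ j ℤ.* a n))
      ≡⟨ l₂ ((+ 9) ℤ.^ j) ((+ j) ℤ.^ 9) ((+ 2) ℤ.^ j) (a n) ⟩
    (+ j) ℤ.^ 9 ℤ.* (+ 9) ℤ.^ j ℤ.* (+ 128 ℤ.* ((+ 2) ℤ.^ j ℤ.* (+ 2) ℤ.^ j) ℤ.* a n)
      ≤⟨ ℤP.*-monoʳ-≤-nonNeg _ {{ℤ.nonNegative (0≤* (0≤* {+ 128} 0≤n (0≤* (0≤^ 2 j) (0≤^ 2 j))) (≼-nonneg Pos-a n))}} (pow9ℤ j) ⟩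
    + (c) ℤ.* (+ 10) ℤ.^ j ℤ.* (+ 128 ℤ.* ((+ 2) ℤ.^ j ℤ.* (+ 2) ℤ.^ j) ℤ.* a n)
      ≡⟨ cong (λ z → + (c) ℤ.* z ℤ.* (+ 128 ℤ.* ((+ 2) ℤ.^ j ℤ.* (+ 2) ℤ.^ j) ℤ.* a n)) (^-*ℤ (+ 5) (+ 2) j) ⟩
    + (c) ℤ.* ((+ 5) ℤ.^ j ℤ.* (+ 2) ℤ.^ j) ℤ.* (+ 128 ℤ.* ((+ 2) ℤ.^ j ℤ.* (+ 2) ℤ.^ j) ℤ.* a n)
      ≡⟨ l₃ (+ (c)) ((+ 5) ℤ.^ j) ((+ 2) ℤ.^ j) (a n) ⟩
    (+ 5) ℤ.^ j ℤ.* ((+ 2) ℤ.^ j ℤ.* ((+ 2) ℤ.^ j ℤ.* (+ 2) ℤ.^ j) ℤ.* (+ 128 ℤ.* + (c) ℤ.* a n))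
      ≡⟨ cong₂ (λ u v → (+ 5) ℤ.^ j ℤ.* (u ℤ.* (v ℤ.* a n))) (sym (trans (^-*ℤ (+ 2) (+ 4) j) (cong ((+ 2) ℤ.^ j ℤ.*_) (^-*ℤ (+ 2) (+ 2) j)))) (sym (ℤP.pos-* 128 (c))) ⟩
    (+ 5) ℤ.^ j ℤ.* ((+ 8) ℤ.^ j ℤ.* B n) ∎)
    where
    open ℤP.≤-Reasoning
    l₁ : ∀ p q h b → p ℤ.* (q ℤ.* (h ℤ.* b)) ≡ q ℤ.* (h ℤ.* (p ℤ.* b))
    l₁ = solveℤ
    l₂ : ∀ q x p b → q ℤ.* (+ 32 ℤ.* x ℤ.* p ℤ.* (+ 4 ℤ.* p ℤ.* b)) ≡ x ℤ.* q ℤ.* (+ 128 ℤ.* (p ℤ.* p) ℤ.* b)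
    l₂ = solveℤ
    l₃ : ∀ c p q b → c ℤ.* (p ℤ.* q) ℤ.* (+ 128 ℤ.* (q ℤ.* q) ℤ.* b) ≡ p ℤ.* (q ℤ.* (q ℤ.* q) ℤ.* (+ 128 ℤ.* c ℤ.* b))
    l₃ = solveℤ

opaque
  H-bounded : ∃ (N H)
  H-bounded = 9 ℕ.* (128 ℕ.* 100 ℕ.^ 9) , H-bound (100 ℕ.^ 9) pow9

-- Levels

lev : ℕ → Tree → ℤ
lev k t = + L t k

ind-cong : ∀ {P Q : Set} (d : Dec P) (e : Dec Q) → (P → Q) → (Q → P) → ind d ≡ ind e
ind-cong (yes p) e f g = sym (ind-yes e (f p))
ind-cong (no ¬p) e f g = sym (ind-no e (λ q → ¬p (g q)))

lev-∑ : ∀ k t → lev k t ≡ ∑ (depths t) (λ x → ind (x ℕP.≟ k))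
lev-∑ k t = go (depths t)
  where
  go : ∀ xs → + length (filter (ℕP._≟ k) xs) ≡ ∑ xs (λ x → ind (x ℕP.≟ k))
  go []       = refl
  go (x ∷ xs) = alt (x ℕP.≟ k)
    where
    alt : Dec (x ≡ k) → + length (filter (ℕP._≟ k) (x ∷ xs)) ≡ ind (x ℕP.≟ k) ℤ.+ ∑ xs (λ x → ind (x ℕP.≟ k))
    alt (yes e) = trans (cong (λ zs → + length zs) (ListP.filter-accept (ℕP._≟ k) e)) (cong₂ ℤ._+_ (sym (ind-yes (x ℕP.≟ k) e)) (go xs))
    alt (no n)  = trans (cong (λ zs → + length zs) (ListP.filter-reject (ℕP._≟ k) n))
      (trans (go xs) (sym (trans (cong (ℤ._+ ∑ xs (λ x → ind (x ℕP.≟ k))) (ind-no (x ℕP.≟ k) n)) (ℤP.+-identityˡ _))))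

lev-class : ∀ k → ClassFun (lev k)
lev-class k e = cong +_ (L-cong e k)

lev-zero : ∀ T → lev 0 T ≡ + 1
lev-zero T@(node ts) = trans (lev-∑ 0 T) (cong (λ z → + 1 ℤ.+ z)
  (trans (∑-map _ suc (depthsᶠ ts)) (∑-zero (All.universal (λ x → refl) (depthsᶠ ts)))))

lev-suc : ∀ k T → lev (suc k) T ≡ kids (lev k) T
lev-suc k T@(node ts) = trans (lev-∑ (suc k) T) (trans (ℤP.+-identityˡ _)
  (trans (∑-map _ suc (depthsᶠ ts)) (trans (∑-cong (depthsᶠ ts) λ x → ind-cong (suc x ℕP.≟ suc k) (x ℕP.≟ k) ℕP.suc-injective (cong suc)) (go ts))))
  where
  go : ∀ ts → ∑ (depthsᶠ ts) (λ x → ind (x ℕP.≟ k)) ≡ ∑ ts (lev k)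
  go []       = refl
  go (t ∷ ts) = trans (∑-++ _ (depths t) (depthsᶠ ts)) (cong₂ ℤ._+_ (sym (lev-∑ k t)) (go ts))

depths< : ∀ t → All (ℕ._< size t) (depths t)
depthsᶠ< : ∀ ts → All (ℕ._< length (depthsᶠ ts)) (depthsᶠ ts)
depths< (node ts) = s≤s z≤n ∷ AllP.map⁺ (All.map (λ p → s≤s (subst (_ ℕ.<_) (sym (ListP.length-map suc (depthsᶠ ts))) p)) (depthsᶠ< ts))
depthsᶠ< []       = []
depthsᶠ< (t ∷ ts) = AllP.++⁺ (All.map (λ p → ℕP.<-≤-trans p (subst (size t ℕ.≤_) (sym e) (ℕP.m≤m+n _ _))) (depths< t))
                             (All.map (λ p → ℕP.<-≤-trans p (subst (length (depthsᶠ ts) ℕ.≤_) (sym e) (ℕP.m≤n+m _ (size t)))) (depthsᶠ< ts))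
  where e = ListP.length-++ (depths t) {depthsᶠ ts}

∑-const : ∀ {A : Set} (xs : List A) c → ∑ xs (λ _ → c) ≡ + length xs ℤ.* c
∑-const []       c = refl
∑-const (x ∷ xs) c = trans (cong (λ z → c ℤ.+ z) (∑-const xs c)) (lem (+ length xs) c)
  where
  lem : ∀ n c → c ℤ.+ n ℤ.* c ≡ (+ 1 ℤ.+ n) ℤ.* c
  lem = solveℤ

hits : ∀ x c r → ∑ (downFrom r) (λ k → ind (x ℕP.≟ k ℕ.+ c)) ℤ.≤ + 1
hits x c zero    = 0≤n
hits x c (suc r) with x ℕP.≟ r ℕ.+ c
... | yes e = ℤP.≤-reflexive (cong (λ z → + 1 ℤ.+ z) (∑-rng-zero _ r λ k k<r →
  ind-no (x ℕP.≟ k ℕ.+ c) (λ e′ → ℕP.<⇒≢ k<r (ℕP.+-cancelʳ-≡ c k r (trans (sym e′) e)))))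
... | no _  = ℤP.≤-trans (ℤP.≤-reflexive (ℤP.+-identityˡ _)) (hits x c r)

∑-lev : ∀ t c r → ∑ (downFrom r) (λ k → lev (k ℕ.+ c) t) ℤ.≤ sizeℤ t
∑-lev t c r = subst₂ ℤ._≤_ (trans (∑-swap (λ x k → ind (x ℕP.≟ k ℕ.+ c)) (depths t) (downFrom r)) (∑-cong (downFrom r) λ k → sym (lev-∑ (k ℕ.+ c) t)))
  (trans (∑-const (depths t) (+ 1)) (ℤP.*-identityʳ _)) (∑-mono (All.universal (λ x → hits x c r) (depths t)))

-- A vertex of depth x is counted at most once for each k < x, hence at most `size t` times. The
-- bound does not depend on `h`, and this makes the accumulated errors `ε` summable uniformly in the
-- lag.
∑∑-lev : ∀ t r h → ∑ (downFrom r) (λ k → ∑ (downFrom h) (λ m → lev (m ℕ.+ suc k) t)) ℤ.≤ sizeℤ t ℤ.* sizeℤ t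
∑∑-lev t r h = subst₂ ℤ._≤_
  (trans (∑-swap (λ x k → ∑ (downFrom h) (λ m → ind (x ℕP.≟ m ℕ.+ suc k))) (depths t) (downFrom r))
    (∑-cong (downFrom r) λ k → trans (∑-swap (λ x m → ind (x ℕP.≟ m ℕ.+ suc k)) (depths t) (downFrom h)) (∑-cong (downFrom h) λ m → sym (lev-∑ (m ℕ.+ suc k) t))))
  (∑-const (depths t) (sizeℤ t)) (∑-mono (All.map (λ {x} x<s → pairs x r (ℕP.<⇒≤ x<s)) (depths< t)))
  where
  f : ℕ → ℕ → ℤ
  f x k = ∑ (downFrom h) (λ m → ind (x ℕP.≟ m ℕ.+ suc k))
  late : ∀ x k → x ℕ.≤ k → f x k ≡ + 0
  late x k p = ∑-zero (All.universal (λ m → ind-no (x ℕP.≟ m ℕ.+ suc k) (λ e → ℕP.<⇒≢ (ℕP.<-≤-trans (s≤s p) (ℕP.m≤n+m (suc k) m)) e)) (downFrom h))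
  pairs : ∀ x r {s} → x ℕ.≤ s → ∑ (downFrom r) (f x) ℤ.≤ + s
  pairs x r {s} x≤s with ℕP.≤-total r x
  ... | inj₁ r≤x = ℤP.≤-trans (∑-rng-bound r (λ k _ → hits x (suc k) h)) (ℤP.≤-trans (ℤP.≤-reflexive (ℤP.*-identityʳ (+ r))) (ℕ≤⇒ℤ≤ (ℕP.≤-trans r≤x x≤s)))
  ... | inj₂ x≤r = ℤP.≤-trans (ℤP.≤-reflexive (∑-rng-trim (f x) r x≤r (late x)))
    (ℤP.≤-trans (∑-rng-bound x (λ k _ → hits x (suc k) h)) (ℤP.≤-trans (ℤP.≤-reflexive (ℤP.*-identityʳ (+ x))) (ℕ≤⇒ℤ≤ x≤s)))

^-mono : ∀ {x z} k → + 0 ℤ.≤ x → x ℤ.≤ z → x ℤ.^ k ℤ.≤ z ℤ.^ k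
0≤^ℤ : ∀ {x} k → + 0 ℤ.≤ x → + 0 ℤ.≤ x ℤ.^ k
0≤^ℤ zero    p = 0≤n
0≤^ℤ (suc k) p = 0≤* p (0≤^ℤ k p)
^-mono zero    p q = ℤP.≤-refl
^-mono (suc k) p q = *-mono-≤-0 p (0≤^ℤ k p) q (^-mono k p q)

∑-power : ∀ (v : ℕ → ℤ) V r q → (∀ k → + 0 ℤ.≤ v k) → ∑ (downFrom r) v ℤ.≤ V → ∑ (downFrom r) (λ k → v k ℤ.^ suc q) ℤ.≤ V ℤ.^ suc q
∑-power v V r q p h = ℤP.≤-trans (go r ℕP.≤-refl)
    (ℤP.*-monoʳ-≤-nonNeg (V ℤ.^ q) {{ℤ.nonNegative (0≤^ℤ q (ℤP.≤-trans (∑-nonneg (All.universal p (downFrom r))) h))}} h)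
  where
  partial : ∀ s → s ℕ.≤ r → ∑ (downFrom s) v ℤ.≤ ∑ (downFrom r) v
  partial s s≤r with ℕP.m≤n⇒∃[o]m+o≡n s≤r
  ... | o , refl = up o
    where
    up : ∀ o → ∑ (downFrom s) v ℤ.≤ ∑ (downFrom (s ℕ.+ o)) v
    up zero    = ℤP.≤-reflexive (cong (λ z → ∑ (downFrom z) v) (sym (ℕP.+-identityʳ s)))
    up (suc o) = ℤP.≤-trans (up o) (subst (λ z → ∑ (downFrom (s ℕ.+ o)) v ℤ.≤ ∑ (downFrom z) v) (sym (ℕP.+-suc s o)) (≤-by (ℤP.+-comm (v (s ℕ.+ o)) _) (p (s ℕ.+ o))))
  one : ∀ s → s ℕ.< r → v s ℤ.≤ V
  one s s<r = ℤP.≤-trans (≤-by refl (∑-nonneg (All.universal p (downFrom s)))) (ℤP.≤-trans (partial (suc s) s<r) h)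
  go : ∀ s → s ℕ.≤ r → ∑ (downFrom s) (λ k → v k ℤ.^ suc q) ℤ.≤ ∑ (downFrom s) v ℤ.* V ℤ.^ q
  go zero    _   = ℤP.≤-refl
  go (suc s) s<r = ℤP.≤-trans (ℤP.+-mono-≤ (*-mono-≤-0 (p s) (0≤^ℤ q (p s)) ℤP.≤-refl (^-mono q (p s) (one s s<r))) (go s (ℕP.<⇒≤ s<r)))
    (ℤP.≤-reflexive (sym (ℤP.*-distribʳ-+ (V ℤ.^ q) (v s) (∑ (downFrom s) v))))

size-powers : ∀ t q → q ℕ.≤ 3 → (+ 2 ℤ.* sizeℤ t) ℤ.^ suc q ℤ.≤ + 16 ℤ.* sizeℤ t ℤ.^ 4
size-powers t q q≤3 with size t | size-pos t
... | suc s | _ = ℤP.≤-trans (^-mono-exp (s ℕ.+ suc (s ℕ.+ 0)) (s≤s q≤3)) (ℤP.≤-reflexive (lem (+ suc s)))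
  where
  lem : ∀ x → (+ 2 ℤ.* x) ℤ.* ((+ 2 ℤ.* x) ℤ.* ((+ 2 ℤ.* x) ℤ.* ((+ 2 ℤ.* x) ℤ.* + 1))) ≡ + 16 ℤ.* (x ℤ.* (x ℤ.* (x ℤ.* (x ℤ.* + 1))))
  lem = solveℤ

-- `Er` is linear, so errors of many levels add up to the error of one summed functional, which is
-- bounded tree by tree; the number of levels does not enter.
Er-∑-≼H : ∀ {A : Set} {p} → p ℕ.≤ 3 → (xs : List A) (w : A → Tree → ℤ) → (∀ x t → + 0 ℤ.≤ w x t) →
  (∀ t → ∑ xs (λ x → w x t) ℤ.≤ + 16 ℤ.* sizeℤ t ℤ.^ 4) → ∑ˢ xs (λ x → Er p ⟦ w x ⟧) ≼ H
Er-∑-≼H {p = p} p≤3 xs w nn h = ≼-respˡ (Er-∑ p xs (λ x → ⟦ w x ⟧)) (Er-mono p≤3 (dom λ n →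
  subst (λ z → + ∣ z ∣ ℤ.≤ size⁴ n) (sym (trans (∑ˢ-at xs (λ x → ⟦ w x ⟧) n) (∑-swap w xs (trees n))))
    (∑-abs (All.universal (λ t → subst (ℤ._≤ _) (sym (abs-nonneg (∑-nonneg (All.universal (λ x → nn x t) xs)))) (h t)) (trees n)))))

-- Orders of magnitude, for families indexed by the lag h + 1 and the level r

N-mono : ∀ {F G c} → Pos F → F ≼ G → N G c → N F c
N-mono p q n = mkN p (≼-trans (≼-⊗ q Pos-a) (bound n))

cst-a-mono : ∀ {c d} → c ℕ.≤ d → cst (+ c) ⊗ a ≼ cst (+ d) ⊗ a
cst-a-mono p = ≼-⊗ (≼-cst p) Pos-a

N-weaken : ∀ {F c d} → c ℕ.≤ d → N F c → N F d
N-weaken p n = mkN (posN n) (≼-trans (bound n) (cst-a-mono p))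

S-weaken : ∀ {F c d} → c ℕ.≤ d → S F c → S F d
S-weaken p s = ≼-trans s (cst-a-mono p)

cst-+ : ∀ c d → cst (+ c) ⊗ a ⊕ cst (+ d) ⊗ a ≈ cst (+ (c ℕ.+ d)) ⊗ a
cst-+ c d = ≈-trans (solve 3 (λ c d z → c :* z :+ d :* z := (c :+ d) :* z) ≈-refl (cst (+ c)) (cst (+ d)) a)
  (⊗-≈ (≈-sym (cst-⊕ (+ c) (+ d))) ≈-refl)

cst-* : ∀ c d → cst (+ c) ⊗ (cst (+ d) ⊗ a) ≈ cst (+ (c ℕ.* d)) ⊗ a
cst-* c d = ≈-trans (solve 3 (λ c d z → c :* (d :* z) := (c :* d) :* z) ≈-refl (cst (+ c)) (cst (+ d)) a)
  (⊗-≈ (≈-trans (≈-sym (cst-⊗ (+ c) (+ d))) (mk λ n → cong (λ z → cst z n) (sym (ℤP.pos-* c d)))) ≈-refl)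

S-⊕ : ∀ {F G c d} → S F c → S G d → S (F ⊕ G) (c ℕ.+ d)
S-⊕ {c = c} {d} p q = ≼-respʳ (cst-+ c d) (≼-⊕ p q)

N-⊕ : ∀ {F G c d} → N F c → N G d → N (F ⊕ G) (c ℕ.+ d)
N-⊕ {F} {G} {c} {d} p q = mkN (≼-⊕ (posN p) (posN q)) (≼-resp
  (solve 3 (λ f g z → f :* z :+ g :* z := (f :+ g) :* z) ≈-refl F G a) (cst-+ c d) (≼-⊕ (bound p) (bound q)))

-- An `S`-bound survives multiplication by an `N`-bounded series. Two `S`-bounds would only give a
-- multiple of a².
NS-⊗ : ∀ {F G c d} → N F c → S G d → S (F ⊗ G) (c ℕ.* d)
NS-⊗ {F} {G} {c} {d} p q = ≼-trans (≼-⊗ (posN p) q) (≼-resp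
  (solve 3 (λ f d z → d :* (f :* z) := f :* (d :* z)) ≈-refl F (cst (+ d)) a)
  (≈-trans (solve 3 (λ c d z → d :* (c :* z) := c :* (d :* z)) ≈-refl (cst (+ c)) (cst (+ d)) a) (cst-* c d))
  (≼-⊗ (Pos-cst d) (bound p)))

N-⊗ : ∀ {F G c d} → N F c → N G d → N (F ⊗ G) (c ℕ.* d)
N-⊗ {F} {G} {c} {d} p q = mkN (≼-⊗ (posN p) (posN q))
  (≼-respˡ (solve 3 (λ f g z → f :* (g :* z) := (f :* g) :* z) ≈-refl F G a) (NS-⊗ p (bound q)))

𝟙≼a : 𝟙 ≼ a
𝟙≼a = ≼-respʳ (≈-sym a-eq) (≼-⊕ʳ (Pos-cst 1) (≼-⊗ Pos-y Pos-a))

N⇒S : ∀ {F c} → N F c → S F c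
N⇒S {F} p = ≼-trans (≼-respˡ (solve 1 (λ f → f :* con (+ 1) := f) ≈-refl F) (≼-⊗ (posN p) 𝟙≼a)) (bound p)

cst1-a : cst (+ 1) ⊗ a ≈ a
cst1-a = solve 1 (λ z → con (+ 1) :* z := z) ≈-refl a

y⊗a≼a : y ⊗ a ≼ a
y⊗a≼a = ≼-respʳ (≈-sym a-eq) (≼-⊕ˡ (≼-⊗ Pos-y Pos-a) (Pos-cst 1))

N-y : N y 1
N-y = mkN Pos-y (≼-respʳ (≈-sym cst1-a) y⊗a≼a)

N-cst : ∀ c → N (cst (+ c)) c
N-cst c = mkN (Pos-cst c) (≼-⊗ (Pos-cst c) Pos-a)

N-resp : ∀ {F G c} → F ≈ G → N F c → N G c
N-resp e p = mkN (≼-resp e e (posN p)) (≼-respˡ (⊗-≈ e ≈-refl) (bound p))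

Fam : Set
Fam = ℕ → ℕ → Ser

infix 4 _▹_
-- F = O((h + 1)^j) in the norm `N`, the constant being uniform in the level `r`.
record NO (j : ℕ) (F : Fam) : Set where
  constructor _▹_
  field
    scale : ℕ
    holds : ∀ h r → N (F h r) (scale ℕ.* suc h ℕ.^ j)

record SO (j : ℕ) (F : Fam) : Set where
  constructor _▹_
  field
    scale : ℕ
    holds : ∀ h r → S (F h r) (scale ℕ.* suc h ℕ.^ j)

infixl 6 _⊞_
infixl 7 _⊠_
_⊞_ _⊠_ : Fam → Fam → Fam
(F ⊞ G) h r = F h r ⊕ G h r
(F ⊠ G) h r = F h r ⊗ G h r

cst# : ℕ → Fam
cst# c h r = cst (+ c)

y# : Fam
y# h r = y

∑# : Fam → Fam
∑# F h r = ∑ˢ (downFrom r) (F h)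

NO-pos : ∀ {j F} → NO j F → ∀ h r → Pos (F h r)
NO-pos (C ▹ p) h r = posN (p h r)

NO-mono : ∀ {j F G} → (∀ h r → Pos (F h r)) → (∀ h r → F h r ≼ G h r) → NO j G → NO j F
NO-mono p q (C ▹ n) = C ▹ λ h r → N-mono (p h r) (q h r) (n h r)

SO-mono : ∀ {j F G} → (∀ h r → F h r ≼ G h r) → SO j G → SO j F
SO-mono q (C ▹ n) = C ▹ λ h r → ≼-trans (q h r) (n h r)

NO-resp : ∀ {j F G} → (∀ h r → F h r ≈ G h r) → NO j F → NO j G
NO-resp e (C ▹ n) = C ▹ λ h r → N-resp (e h r) (n h r)

SO-resp : ∀ {j F G} → (∀ h r → F h r ≈ G h r) → SO j F → SO j G
SO-resp e (C ▹ n) = C ▹ λ h r → ≼-respˡ (e h r) (n h r)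

NO-⊞ : ∀ {j F G} → NO j F → NO j G → NO j (F ⊞ G)
NO-⊞ {j} (C ▹ p) (D ▹ q) = C ℕ.+ D ▹ λ h r → subst (N _) (sym (ℕP.*-distribʳ-+ (suc h ℕ.^ j) C D)) (N-⊕ (p h r) (q h r))

SO-⊞ : ∀ {j F G} → SO j F → SO j G → SO j (F ⊞ G)
SO-⊞ {j} (C ▹ p) (D ▹ q) = C ℕ.+ D ▹ λ h r → subst (S _) (sym (ℕP.*-distribʳ-+ (suc h ℕ.^ j) C D)) (S-⊕ (p h r) (q h r))

*-^-+ : ∀ C D s i j → (C ℕ.* s ℕ.^ i) ℕ.* (D ℕ.* s ℕ.^ j) ≡ C ℕ.* D ℕ.* s ℕ.^ (i ℕ.+ j)
*-^-+ C D s i j = trans (lem C D (s ℕ.^ i) (s ℕ.^ j)) (cong (C ℕ.* D ℕ.*_) (sym (ℕP.^-distribˡ-+-* s i j)))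
  where
  lem : ∀ c d p q → (c ℕ.* p) ℕ.* (d ℕ.* q) ≡ c ℕ.* d ℕ.* (p ℕ.* q)
  lem = solveℕ

NO-⊠ : ∀ {i j F G} → NO i F → NO j G → NO (i ℕ.+ j) (F ⊠ G)
NO-⊠ {i} {j} (C ▹ p) (D ▹ q) = C ℕ.* D ▹ λ h r → subst (N _) (*-^-+ C D (suc h) i j) (N-⊗ (p h r) (q h r))

SO-⊠ : ∀ {i j F G} → NO i F → SO j G → SO (i ℕ.+ j) (F ⊠ G)
SO-⊠ {i} {j} (C ▹ p) (D ▹ q) = C ℕ.* D ▹ λ h r → subst (S _) (*-^-+ C D (suc h) i j) (NS-⊗ (p h r) (q h r))

^-weaken : ∀ C h {i j} → i ℕ.≤ j → C ℕ.* suc h ℕ.^ i ℕ.≤ C ℕ.* suc h ℕ.^ j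
^-weaken C h p = ℕP.*-monoʳ-≤ C (ℕP.^-monoʳ-≤ (suc h) p)

NO-weaken : ∀ {i j F} → i ℕ.≤ j → NO i F → NO j F
NO-weaken p (C ▹ n) = C ▹ λ h r → N-weaken (^-weaken C h p) (n h r)

SO-weaken : ∀ {i j F} → i ℕ.≤ j → SO i F → SO j F
SO-weaken p (C ▹ n) = C ▹ λ h r → S-weaken (^-weaken C h p) (n h r)

NO⇒SO : ∀ {j F} → NO j F → SO j F
NO⇒SO (C ▹ p) = C ▹ λ h r → N⇒S (p h r)

const-NO : ∀ {c} (F : Fam) → (∀ h r → N (F h r) c) → NO 0 F
const-NO {c} F p = c ▹ λ h r → subst (N _) (sym (ℕP.*-identityʳ c)) (p h r)

NO-cst : ∀ c → NO 0 (cst# c)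
NO-cst c = const-NO (cst# c) (λ _ _ → N-cst c)

NO-y : NO 0 y#
NO-y = const-NO y# (λ _ _ → N-y)

Pos-∑ˢ : ∀ {A : Set} (xs : List A) {F : A → Ser} → (∀ x → Pos (F x)) → Pos (∑ˢ xs F)
Pos-∑ˢ xs {F} p = pos λ n → subst (+ 0 ℤ.≤_) (sym (∑ˢ-at xs F n)) (∑-nonneg (All.universal (λ x → ≼-nonneg (p x) n) xs))

≼-∑ˢ : ∀ {A : Set} (xs : List A) {F G : A → Ser} → (∀ x → F x ≼ G x) → ∑ˢ xs F ≼ ∑ˢ xs G
≼-∑ˢ xs {F} {G} p = dom λ n → subst₂ (λ u v → + ∣ u ∣ ℤ.≤ v) (sym (∑ˢ-at xs F n)) (sym (∑ˢ-at xs G n))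
  (∑-abs (All.universal (λ x → le (p x) n) xs))

∑ˢ-suc : ∀ (F : ℕ → Ser) r → ∑ˢ (downFrom (suc r)) F ≈ F r ⊕ ∑ˢ (downFrom r) F
∑ˢ-suc F r = ∑ˢ-∷ r (downFrom r) F

∑ˢ-0 : ∀ (F : ℕ → Ser) → ∑ˢ (downFrom 0) F ≈ 𝟘
∑ˢ-0 F = ∑ˢ-[] F

term≼∑ : ∀ (F : ℕ → Ser) r → (∀ k → Pos (F k)) → F r ≼ ∑ˢ (downFrom (suc r)) F
term≼∑ F r p = ≼-respʳ (≈-sym (∑ˢ-suc F r)) (≼-⊕ʳ (p r) (Pos-∑ˢ (downFrom r) p))

NO-term : ∀ {j F} → (∀ h k → Pos (F h k)) → NO j (∑# F) → NO j F
NO-term {F = F} p (C ▹ n) = C ▹ λ h r → N-mono (p h r) (term≼∑ (F h) r (p h)) (n h (suc r))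

∑ˢ-≼ : ∀ {F G : ℕ → Ser} r → (∀ k → F k ≼ G k) → ∑ˢ (downFrom r) F ≼ ∑ˢ (downFrom r) G
∑ˢ-≼ r = ≼-∑ˢ (downFrom r)

NO-∑-⊞ : ∀ {j F G} → NO j (∑# F) → NO j (∑# G) → NO j (∑# (F ⊞ G))
NO-∑-⊞ {j} {F} {G} p q = NO-resp {F = ∑# F ⊞ ∑# G} (λ h r → ≈-sym (∑ˢ-⊕ (downFrom r) (F h) (G h))) (NO-⊞ p q)

SO-∑-⊞ : ∀ {j F G} → SO j (∑# F) → SO j (∑# G) → SO j (∑# (F ⊞ G))
SO-∑-⊞ {j} {F} {G} p q = SO-resp {F = ∑# F ⊞ ∑# G} (λ h r → ≈-sym (∑ˢ-⊕ (downFrom r) (F h) (G h))) (SO-⊞ p q)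

SO-∑-const : ∀ {i j} {c : ℕ → Ser} {F} → NO i (λ h _ → c h) → SO j (∑# F) → SO (i ℕ.+ j) (∑# (λ h k → c h ⊗ F h k))
SO-∑-const {c = c} {F} p q = SO-resp {F = (λ h _ → c h) ⊠ ∑# F} (λ h r → ≈-sym (⊗∑ˢ (downFrom r) (F h) (c h))) (SO-⊠ p q)

-- A summable family times a bounded one: the bound of Y, a constant times `a`, is the same for all
-- levels and leaves the sum.
NO-∑-⊠ : ∀ {i j E Y} → (∀ h k → Pos (E h k)) → NO i (∑# E) → NO j Y → NO (i ℕ.+ j) (∑# (E ⊠ Y))
NO-∑-⊠ {i} {j} {E} {Y} pE (C ▹ p) (D ▹ q) = C ℕ.* D ▹ λ h r → subst (N _) (*-^-+ C D (suc h) i j)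
  (mkN (Pos-∑ˢ (downFrom r) (λ k → ≼-⊗ (pE h k) (posN (q h k)))) (≼-trans (≼-resp
    (≈-trans (∑ˢ-cong (downFrom r) λ k → solve 3 (λ e f z → e :* (f :* z) := (e :* f) :* z) ≈-refl (E h k) (Y h k) a) (∑ˢ-⊗ (downFrom r) _ a))
    (≈-trans (∑ˢ-cong (downFrom r) λ k → solve 3 (λ e d z → e :* (d :* z) := d :* (e :* z)) ≈-refl (E h k) (cst (+ (D ℕ.* suc h ℕ.^ j))) a)
      (≈-trans (⊗∑ˢ (downFrom r) _ _) (⊗-≈ ≈-refl (∑ˢ-⊗ (downFrom r) (E h) a))))
    (∑ˢ-≼ r λ k → ≼-⊗ (pE h k) (bound (q h k))))
    (≼-respʳ (≈-trans (cst-* (D ℕ.* suc h ℕ.^ j) (C ℕ.* suc h ℕ.^ i)) (mk λ n → cong (λ z → (cst (+ z) ⊗ a) n) (ℕP.*-comm (D ℕ.* suc h ℕ.^ j) _)))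
      (≼-⊗ (Pos-cst (D ℕ.* suc h ℕ.^ j)) (bound (p h r))))))

-- Affine recursions x_{k+1} = y x_k + p_k over the levels

run : Ser → (ℕ → Ser) → ℕ → Ser
run x₀ p zero    = x₀
run x₀ p (suc k) = y ⊗ run x₀ p k ⊕ p k

run# : (ℕ → Ser) → Fam → Fam
run# x₀ p h r = run (x₀ h) (p h) r

run-dom : ∀ {Z P : ℕ → Ser} {x₀ p} → Z 0 ≼ x₀ → (∀ k → Z (suc k) ≈ y ⊗ Z k ⊕ P k) → (∀ k → P k ≼ p k) → ∀ r → Z r ≼ run x₀ p r
run-dom z e q zero    = z
run-dom z e q (suc r) = ≼-respˡ (≈-sym (e r)) (≼-⊕ (≼-⊗ Pos-y (run-dom z e q r)) (q r))

run-pos : ∀ {x₀ p} → Pos x₀ → (∀ k → Pos (p k)) → ∀ r → Pos (run x₀ p r)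
run-pos z q zero    = z
run-pos z q (suc r) = ≼-⊕ (≼-⊗ Pos-y (run-pos z q r)) (q r)

-- As y a ≼ a, each forcing term counts once, however many levels ago it entered.
run-⊑ : ∀ {x₀ p} → Pos x₀ → (∀ k → Pos (p k)) → ∀ r → run x₀ p r ⊗ a ≼ (x₀ ⊕ ∑ˢ (downFrom r) p) ⊗ a
run-⊑ {x₀} {p} z q zero = ≼-⊗ (≼-⊕ʳ z (Pos-∑ˢ (downFrom 0) q)) Pos-a
run-⊑ {x₀} {p} z q (suc r) = ≼-trans (≼-resp
    (solve 4 (λ X Y P A → X :* (Y :* A) :+ P :* A := (Y :* X :+ P) :* A) ≈-refl (run x₀ p r) y (p r) a) ≈-refl
    (≼-⊕ (≼-⊗ (run-pos z q r) y⊗a≼a) (≼-⊗ (q r) Pos-a)))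
  (≼-respʳ (≈-trans (solve 4 (λ x s P A → (x :+ s) :* A :+ P :* A := (x :+ (P :+ s)) :* A) ≈-refl x₀ (∑ˢ (downFrom r) p) (p r) a)
             (⊗-≈ (⊕-≈ ≈-refl (≈-sym (∑ˢ-suc p r))) ≈-refl))
    (≼-⊕ (run-⊑ z q r) (≼-⊗ (q r) Pos-a)))

NO-run : ∀ {j x₀ p} → (∀ h k → Pos (p h k)) → NO j (λ h _ → x₀ h) → NO j (∑# p) → NO j (run# x₀ p)
NO-run {j} {x₀} {p} pp nx np = go (NO-⊞ nx np)
  where
  go : NO j ((λ h _ → x₀ h) ⊞ ∑# p) → NO j (run# x₀ p)
  go (C ▹ n) = C ▹ λ h r → mkN (run-pos (NO-pos nx h 0) (pp h) r) (≼-trans (run-⊑ (NO-pos nx h 0) (pp h) r) (bound (n h r)))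

-- The induction closes because Q ⊗ a ≼ a and a = 𝟙 ⊕ y ⊗ a.
sum-dom : ∀ {X p : ℕ → Ser} {Q} → N Q 1 → (∀ k → Pos (X k)) → (∀ k → Pos (p k)) → (∀ k → X (suc k) ≼ (y ⊗ Q) ⊗ X k ⊕ p k) →
  ∀ r → ∑ˢ (downFrom r) X ≼ (X 0 ⊕ ∑ˢ (downFrom r) p) ⊗ a
sum-dom {X} {p} {Q} nQ pX pp st r = go r
  where
  shift : ∀ r → ∑ˢ (downFrom (suc r)) X ≈ X 0 ⊕ ∑ˢ (downFrom r) (λ k → X (suc k))
  shift r = mk λ n → trans (∑ˢ-at (downFrom (suc r)) X n) (trans (∑-rng-shift (λ k → X k n) r)
    (sym (trans (⊕-at (X 0) _ n) (cong (λ z → X 0 n ℤ.+ z) (∑ˢ-at (downFrom r) _ n)))))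
  go : ∀ r → ∑ˢ (downFrom r) X ≼ (X 0 ⊕ ∑ˢ (downFrom r) p) ⊗ a
  go zero    = ≼-respˡ (≈-sym (∑ˢ-0 X)) (𝟘≼ (≼-⊗ (≼-⊕ (pX 0) (Pos-∑ˢ (downFrom 0) pp)) Pos-a))
  go (suc r) = ≼-respˡ (≈-sym (shift r)) (≼-trans
    (≼-⊕ (pX 0) (≼-trans (∑ˢ-≼ r st) (≼-respˡ (≈-sym (≈-trans (∑ˢ-⊕ (downFrom r) _ p) (⊕-≈ (⊗∑ˢ (downFrom r) X (y ⊗ Q)) ≈-refl)))
        (≼-⊕ (≼-⊗ (≼-⊗ Pos-y (posN nQ)) (go r)) (Pos-∑ˢ (downFrom r) pp)))))
    (≼-trans (≼-resp (solve 5 (λ x Y Q s A → (x :+ s) :+ (x :+ s) :* (Y :* (Q :* A)) := x :+ ((Y :* Q) :* ((x :+ s) :* A) :+ s)) ≈-refl (X 0) y Q (∑ˢ (downFrom r) p) a)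
               (≈-trans (solve 3 (λ x Y A → x :+ x :* (Y :* A) := x :* (con (+ 1) :+ Y :* A)) ≈-refl T y a) (⊗-≈ ≈-refl (≈-sym a-eq)))
               (≼-⊕ pT (≼-⊗ pT (≼-⊗ Pos-y (≼-respʳ cst1-a (bound nQ))))))
      (≼-⊗ (≼-⊕ (pX 0) (≼-respʳ (≈-sym (∑ˢ-suc p r)) (≼-⊕ˡ (Pos-∑ˢ (downFrom r) pp) (pp r)))) Pos-a)))
    where
    T = X 0 ⊕ ∑ˢ (downFrom r) p
    pT : Pos T
    pT = ≼-⊕ (pX 0) (Pos-∑ˢ (downFrom r) pp)

-- Summation over the levels costs 1 / (1 - y) = a and turns `N`-bounds into `S`-bounds. The series
-- `Q` leaves room for powers: the square and the cube of a first moment pick up y² and y³ per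
-- level, that is y Q with Q = y and Q = y².
SO-∑-sum : ∀ {j} {X p : Fam} {Q} → N Q 1 → (∀ h k → Pos (X h k)) → (∀ h k → Pos (p h k)) →
  (∀ h k → X h (suc k) ≼ (y ⊗ Q) ⊗ X h k ⊕ p h k) → NO j (λ h _ → X h 0) → NO j (∑# p) → SO j (∑# X)
SO-∑-sum {j} {X} {p} nQ pX pp st nx np = go (NO-⊞ nx np)
  where
  go : NO j ((λ h _ → X h 0) ⊞ ∑# p) → SO j (∑# X)
  go (C ▹ n) = C ▹ λ h r → ≼-trans (sum-dom nQ (pX h) (pp h) (st h) r) (bound (n h r))

SO-∑-run : ∀ {j x₀ p} → (∀ h k → Pos (p h k)) → NO j (λ h _ → x₀ h) → NO j (∑# p) → SO j (∑# (run# x₀ p))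
SO-∑-run {j} {x₀} {p} pp nx np = SO-∑-sum {X = run# x₀ p} {p = p} {Q = 𝟙} (N-cst 1) (λ h → run-pos (NO-pos nx h 0) (pp h)) pp
  (λ h k → ≼-respʳ (⊕-≈ (⊗-≈ (solve 1 (λ Y → Y := Y :* con (+ 1)) ≈-refl y) ≈-refl) ≈-refl) (run-pos (NO-pos nx h 0) (pp h) (suc k))) nx np

run-⊞ : ∀ x x′ p p′ r → run (x ⊕ x′) (λ k → p k ⊕ p′ k) r ≈ run x p r ⊕ run x′ p′ r
run-⊞ x x′ p p′ zero    = ≈-refl
run-⊞ x x′ p p′ (suc r) = ≈-trans (⊕-≈ (⊗-≈ ≈-refl (run-⊞ x x′ p p′ r)) ≈-refl)
  (solve 5 (λ Y A B P Q → Y :* (A :+ B) :+ (P :+ Q) := (Y :* A :+ P) :+ (Y :* B :+ Q)) ≈-refl y (run x p r) (run x′ p′ r) (p r) (p′ r))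

SO-run-⊞ : ∀ {j x₀ p q} → SO j (run# x₀ p) → SO j (run# (λ _ → 𝟘) q) → SO j (run# x₀ (p ⊞ q))
SO-run-⊞ {j} {x₀} {p} {q} s t = SO-resp {F = run# x₀ p ⊞ run# (λ _ → 𝟘) q}
  (λ h r → ≈-trans (≈-sym (run-⊞ (x₀ h) 𝟘 (p h) (q h) r)) (run-cong (p h) (q h) (solve 1 (λ x → x :+ con (+ 0) := x) ≈-refl (x₀ h)) r)) (SO-⊞ s t)
  where
  run-cong : ∀ {x x′} p q → x ≈ x′ → ∀ r → run x (λ k → p k ⊕ q k) r ≈ run x′ (λ k → p k ⊕ q k) r
  run-cong p q e zero    = e
  run-cong p q e (suc r) = ⊕-≈ (⊗-≈ ≈-refl (run-cong p q e r)) ≈-refl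

-- In y^(r-k) X_k Y_k the powers of y are given to X_k, which they carry up to at most X_r. So a
-- single factor X_r leaves the sum and only Y is summed; bounds on the single X_k would provide no
-- common factor.
run-common : ∀ {X Y : ℕ → Ser} → (∀ k → Pos (X k)) → (∀ k → Pos (Y k)) → (∀ k → y ⊗ X k ≼ X (suc k)) →
  ∀ r → run 𝟘 (λ k → y ⊗ (X k ⊗ Y k)) r ≼ X r ⊗ ∑ˢ (downFrom r) Y
run-common {X} {Y} pX pY c zero = ≼-respʳ (⊗-≈ ≈-refl (≈-sym (∑ˢ-0 Y))) (𝟘≼ (≼-⊗ (pX 0) (Pos-cst 0)))
run-common {X} {Y} pX pY c (suc r) = ≼-trans
  (≼-⊕ (≼-⊗ Pos-y (run-common pX pY c r)) (≼-⊗ Pos-y (≼-⊗ (pX r) (pY r))))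
  (≼-resp (solve 4 (λ z x s t → (z :* x) :* (t :+ s) := z :* (x :* s) :+ z :* (x :* t)) ≈-refl y (X r) (∑ˢ (downFrom r) Y) (Y r))
    (⊗-≈ ≈-refl (≈-sym (∑ˢ-suc Y r))) (≼-⊗ (c r) (≼-⊕ (pY r) (Pos-∑ˢ (downFrom r) pY))))

SO-common : ∀ {i j X Y} → (∀ h k → Pos (Y h k)) → (∀ h k → y ⊗ X h k ≼ X h (suc k)) → NO i X → SO j (∑# Y) →
  SO (i ℕ.+ j) (run# (λ _ → 𝟘) (λ h k → y ⊗ (X h k ⊗ Y h k)))
SO-common {X = X} {Y} pY c nx sy = SO-mono (λ h → run-common (NO-pos nx h) (pY h) (c h)) (SO-⊠ nx sy)

run-mono : ∀ {x p q} → Pos x → (∀ k → p k ≼ q k) → ∀ r → run x p r ≼ run x q r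
run-mono px h zero    = px
run-mono px h (suc r) = ≼-⊕ (≼-⊗ Pos-y (run-mono px h r)) (h r)

run-⊗ : ∀ p G r → run 𝟘 (λ k → p k ⊗ G) r ≈ run 𝟘 p r ⊗ G
run-⊗ p G zero    = solve 1 (λ g → con (+ 0) := con (+ 0) :* g) ≈-refl G
run-⊗ p G (suc r) = ≈-trans (⊕-≈ (⊗-≈ ≈-refl (run-⊗ p G r)) ≈-refl)
  (solve 4 (λ z x q g → z :* (x :* g) :+ q :* g := (z :* x :+ q) :* g) ≈-refl y (run 𝟘 p r) (p r) G)

-- The uniform majorant of Y is one multiple of `a` for all levels, so it factors out of the
-- recursion and only the summable E is accumulated.
SO-run-err : ∀ {i j E Y} → (∀ h k → Pos (E h k)) → NO i (∑# E) → SO j Y → SO (i ℕ.+ j) (run# (λ _ → 𝟘) (E ⊠ Y))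
SO-run-err {i} {j} {E} {Y} pE nE (D ▹ s) = go (NO-run {j = i} {x₀ = λ _ → 𝟘} {p = E} pE (NO-weaken z≤n (NO-cst 0)) nE)
  where
  go : NO i (run# (λ _ → 𝟘) E) → SO (i ℕ.+ j) (run# (λ _ → 𝟘) (E ⊠ Y))
  go (C ▹ n) = C ℕ.* D ▹ λ h r → subst (S _) (*-^-+ C D (suc h) i j) (≼-trans (run-mono (Pos-cst 0) (λ k → ≼-⊗ (pE h k) (s h k)) r)
    (≼-respˡ (≈-sym (run-⊗ (E h) _ r)) (NS-⊗ (n h r) (≼-⊗ (Pos-cst _) Pos-a))))

-- Generating series of the level sizes

-- Re-reads the level as a lag: at level 0 the difference is 1 - L(h + 1), so the initial values are
-- controlled by moments of the single level h + 1.
diag-N : ∀ {F : ℕ → Ser} → NO 0 (λ _ r → F r) → NO 0 (λ h _ → F h)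
diag-N (C ▹ n) = C ▹ λ h _ → n 0 h

diag-S : ∀ {F : ℕ → Ser} → SO 0 (λ _ r → F r) → SO 0 (λ h _ → F h)
diag-S (C ▹ n) = C ▹ λ h _ → n 0 h

N-y⊗ : ∀ {F c} → N F c → N (y ⊗ F) c
N-y⊗ {c = c} p = subst (N _) (ℕP.+-identityʳ c) (N-⊗ N-y p)

S-y⊗ : ∀ {F c} → S F c → S (y ⊗ F) c
S-y⊗ {c = c} p = subst (S _) (ℕP.+-identityʳ c) (NS-⊗ N-y p)

run-N : ∀ {x₀} {F : ℕ → Ser} {c D} h → N x₀ c → (∀ k → k ℕ.< h → N (F k) D) → N (run x₀ (λ k → y ⊗ F k) h) (c ℕ.+ h ℕ.* D)
run-N {c = c} zero n f = subst (N _) (sym (ℕP.+-identityʳ c)) n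
run-N {x₀} {F} {c} {D} (suc h) n f = subst (N _) (lem c h D)
  (N-⊕ {y ⊗ run x₀ (λ k → y ⊗ F k) h} {y ⊗ F h} (N-y⊗ (run-N {F = F} h n λ k p → f k (ℕP.m≤n⇒m≤1+n p))) (N-y⊗ {F h} (f h ℕP.≤-refl)))
  where
  lem : ∀ c h D → c ℕ.+ h ℕ.* D ℕ.+ D ≡ c ℕ.+ (D ℕ.+ h ℕ.* D)
  lem = solveℕ

run-S : ∀ {x₀} {F : ℕ → Ser} {c D} h → S x₀ c → (∀ k → k ℕ.< h → S (F k) D) → S (run x₀ (λ k → y ⊗ F k) h) (c ℕ.+ h ℕ.* D)
run-S {c = c} zero n f = subst (S _) (sym (ℕP.+-identityʳ c)) n
run-S {x₀} {F} {c} {D} (suc h) n f = subst (S _) (lem c h D)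
  (S-⊕ {y ⊗ run x₀ (λ k → y ⊗ F k) h} {y ⊗ F h} (S-y⊗ (run-S {F = F} h n λ k p → f k (ℕP.m≤n⇒m≤1+n p))) (S-y⊗ {F h} (f h ℕP.≤-refl)))
  where
  lem : ∀ c h D → c ℕ.+ h ℕ.* D ℕ.+ D ≡ c ℕ.+ (D ℕ.+ h ℕ.* D)
  lem = solveℕ

run-scale : ∀ c C h i → c ℕ.+ h ℕ.* (C ℕ.* suc h ℕ.^ i) ℕ.≤ (c ℕ.+ C) ℕ.* suc h ℕ.^ suc i
run-scale c C h i = ℕP.≤-trans (ℕP.+-mono-≤ (ℕP.m≤m*n c (suc h ℕ.^ suc i) {{ℕP.m^n≢0 (suc h) (suc i)}}) (ℕP.*-monoˡ-≤ (C ℕ.* suc h ℕ.^ i) (ℕP.n≤1+n h)))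
  (ℕP.≤-reflexive (lem c C (suc h) (suc h ℕ.^ i)))
  where
  lem : ∀ c C s p → c ℕ.* (s ℕ.* p) ℕ.+ s ℕ.* (C ℕ.* p) ≡ (c ℕ.+ C) ℕ.* (s ℕ.* p)
  lem = solveℕ

scale-below : ∀ C i {k h} → k ℕ.< h → C ℕ.* suc k ℕ.^ i ℕ.≤ C ℕ.* suc h ℕ.^ i
scale-below C i p = ℕP.*-monoʳ-≤ C (ℕP.^-monoˡ-≤ i (s≤s (ℕP.<⇒≤ p)))

NO-accumulate : ∀ {i c x₀} {F : ℕ → Ser} → N x₀ c → NO i (λ h _ → F h) → NO (suc i) (λ h _ → run x₀ (λ k → y ⊗ F k) h)
NO-accumulate {i} {c} {x₀} {F} n (C ▹ f) = c ℕ.+ C ▹ λ h r → N-weaken (run-scale c C h i) (run-N {F = F} h n λ k p → N-weaken {F = F k} (scale-below C i p) (f k 0))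

SO-accumulate : ∀ {i c x₀} {F : ℕ → Ser} → S x₀ c → SO i (λ h _ → F h) → SO (suc i) (λ h _ → run x₀ (λ k → y ⊗ F k) h)
SO-accumulate {i} {c} {x₀} {F} n (C ▹ f) = c ℕ.+ C ▹ λ h r → S-weaken (run-scale c C h i) (run-S {F = F} h n λ k p → S-weaken {F = F k} (scale-below C i p) (f k 0))

M-dom : ∀ {f v : Tree → ℤ} q → (∀ t → + ∣ f t ∣ ℤ.≤ v t) → M q f ≼ M q v
M-dom {f} {v} q h = dom λ n → ∑-abs (All.universal (λ t → power (f t) (v t) q (h t)) (trees n))
  where
  power : ∀ x z q → + ∣ x ∣ ℤ.≤ z → + ∣ x ℤ.^ q ∣ ℤ.≤ z ℤ.^ q
  power x z zero    p = ℤP.≤-refl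
  power x z (suc q) p = abs-* {x} {x ℤ.^ q} p (power x z q p)

Pos-M : ∀ {v : Tree → ℤ} q → (∀ t → + 0 ℤ.≤ v t) → Pos (M q v)
Pos-M {v} q p = M-dom {v} {v} q (λ t → ℤP.≤-reflexive (abs-nonneg (p t)))

Er-cong : ∀ {k F G} → F ≈ G → Er k F ≈ Er k G
Er-cong {k} {F} {G} e = mk λ m → ∑-cong (downFrom m) λ i → ∑-cong (downFrom (suc m)) λ s → cong (Er-weight k m i s ℤ.*_) (at e s)

gap : ℕ → Ser
gap k = Er 0 (M 1 (lev k))

-- The first moment with its own Pólya error included. It is this series that the recursion
-- multiplies by y, so `U-suc` is left with the summable forcing `gap`.
U : ℕ → Ser
U k = K 0 (lev k)

Pos-lev : ∀ q k → Pos (M q (lev k))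
Pos-lev q k = Pos-M {lev k} q (λ _ → 0≤n)

Pos-gap : ∀ k → Pos (gap k)
Pos-gap k = Pos-Er {0} {M 1 (lev k)} (Pos-lev 1 k)

Pos-U : ∀ k → Pos (U k)
Pos-U k = ≼-⊕ (Pos-lev 1 k) (Pos-gap k)

module Level (k : ℕ) = Moments (lev k) (lev (suc k)) (lev-class k) (lev-suc k)

U-suc : ∀ k → U (suc k) ≈ y ⊗ U k ⊕ gap (suc k)
U-suc k = ⊕-≈ (Level.moment₁ k) ≈-refl

size≤size⁴ : ∀ t → sizeℤ t ℤ.≤ + 16 ℤ.* sizeℤ t ℤ.^ 4
size≤size⁴ t = ℤP.≤-trans (≤-by (lem (sizeℤ t)) 0≤n) (size-powers t 0 z≤n)
  where
  lem : ∀ x → (+ 2 ℤ.* x) ℤ.* + 1 ≡ x ℤ.+ x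
  lem = solveℤ

size²≤size⁴ : ∀ t → sizeℤ t ℤ.* sizeℤ t ℤ.≤ + 16 ℤ.* sizeℤ t ℤ.^ 4
size²≤size⁴ t = ℤP.≤-trans (≤-by (lem (sizeℤ t)) (0≤* {+ 3} 0≤n (0≤* {sizeℤ t} {sizeℤ t} 0≤n 0≤n))) (size-powers t 1 (s≤s z≤n))
  where
  lem : ∀ x → (+ 2 ℤ.* x) ℤ.* ((+ 2 ℤ.* x) ℤ.* + 1) ≡ x ℤ.* x ℤ.+ + 3 ℤ.* (x ℤ.* x)
  lem = solveℤ

∑-gap : ∀ c r → ∑ˢ (downFrom r) (λ k → gap (k ℕ.+ c)) ≼ H
∑-gap c r = Er-∑-≼H {p = 0} z≤n (downFrom r) (λ k t → lev (k ℕ.+ c) t ℤ.^ 1) (λ k t → 0≤^ (L t (k ℕ.+ c)) 1)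
  (λ t → ℤP.≤-trans (ℤP.≤-reflexive (∑-cong (downFrom r) λ k → ℤP.*-identityʳ (lev (k ℕ.+ c) t))) (ℤP.≤-trans (∑-lev t c r) (size≤size⁴ t)))

∑-gap-suc : ∀ c r → ∑ˢ (downFrom r) (λ k → gap (suc k ℕ.+ c)) ≼ H
∑-gap-suc c r = ≼-respˡ (∑ˢ-cong (downFrom r) λ k → mk λ n → cong (λ z → gap z n) (ℕP.+-suc k c)) (∑-gap (suc c) r)

∑∑-gap : ∀ h r → ∑ˢ (downFrom r) (λ k → ∑ˢ (downFrom h) (λ m → gap (suc (m ℕ.+ k)))) ≼ H
∑∑-gap h r = ≼-respˡ (∑ˢ-cong (downFrom r) λ k → ≈-trans (Er-cong {0} (mk λ n → sym (trans (∑ˢ-at (downFrom h) _ n)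
      (trans (∑-swap (λ m t → lev (suc (m ℕ.+ k)) t ℤ.^ 1) (downFrom h) (trees n)) (∑-cong (trees n) λ t → ∑-cong (downFrom h) λ m → ℤP.*-identityʳ _)))))
      (Er-∑ 0 (downFrom h) (λ m → M 1 (lev (suc (m ℕ.+ k))))))
  (Er-∑-≼H {p = 0} z≤n (downFrom r) (λ k t → ∑ (downFrom h) (λ m → lev (suc (m ℕ.+ k)) t)) (λ k t → ∑-nonneg (All.universal (λ m → 0≤n) (downFrom h)))
    (λ t → ℤP.≤-trans (ℤP.≤-reflexive (∑-cong (downFrom r) λ k → ∑-cong (downFrom h) λ m → cong (λ z → lev z t) (sym (ℕP.+-suc m k))))
       (ℤP.≤-trans (∑∑-lev t r h) (size²≤size⁴ t))))

pair : ℕ → ℕ → Tree → ℤ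
pair h k t = lev k t ℤ.+ lev (k ℕ.+ h) t

-- The sum of the two levels dominates both their difference and the lower level alone, so the
-- errors of both are covered.
Ê : ℕ → ℕ → ℕ → Ser
Ê p h k = Er p (M (suc p) (pair (suc h) k))

0≤pair : ∀ h k t → + 0 ℤ.≤ pair h k t
0≤pair h k t = 0≤n

∑-pair : ∀ h t r → ∑ (downFrom r) (λ k → pair h k t) ℤ.≤ + 2 ℤ.* sizeℤ t
∑-pair h t r = ℤP.≤-trans (ℤP.≤-reflexive (∑-+ (λ k → lev k t) (λ k → lev (k ℕ.+ h) t) (downFrom r)))
  (ℤP.≤-trans (ℤP.+-mono-≤ (subst (ℤ._≤ sizeℤ t) (∑-cong (downFrom r) λ k → cong (λ z → lev z t) (ℕP.+-identityʳ k)) (∑-lev t 0 r)) (∑-lev t h r)) (ℤP.≤-reflexive (lem (sizeℤ t))))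
  where
  lem : ∀ x → x ℤ.+ x ≡ + 2 ℤ.* x
  lem = solveℤ

Pos-Ê : ∀ p h k → Pos (Ê p h k)
Pos-Ê p h k = Pos-Er {p} {M (suc p) (pair (suc h) k)} (Pos-M {pair (suc h) k} (suc p) (0≤pair (suc h) k))

NO-H : ∀ {F : Fam} → (∀ h r → Pos (F h r)) → (∀ h r → F h r ≼ H) → NO 0 F
NO-H pF q = const-NO _ (λ h r → N-mono (pF h r) (q h r) (proj₂ H-bounded))

NO-∑Ê : ∀ p → p ℕ.≤ 3 → NO 0 (∑# (Ê p))
NO-∑Ê p p≤3 = NO-H (λ h r → Pos-∑ˢ (downFrom r) (Pos-Ê p h)) (λ h r → Er-∑-≼H {p = p} p≤3 (downFrom r) (λ k t → pair (suc h) k t ℤ.^ suc p)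
  (λ k t → 0≤^ℤ (suc p) (0≤pair (suc h) k t))
  (λ t → ℤP.≤-trans (∑-power (λ k → pair (suc h) k t) (+ 2 ℤ.* sizeℤ t) r p (λ k → 0≤pair (suc h) k t) (∑-pair (suc h) t r)) (size-powers t p p≤3)))

Er-dom : ∀ p {f : Tree → ℤ} h k → (∀ t → + ∣ f t ∣ ℤ.≤ pair (suc h) k t) → Er p (M (suc p) f) ≼ Ê p h k
Er-dom p {f} h k q = Er-mono {p} {p} {M (suc p) f} {M (suc p) (pair (suc h) k)} ℕP.≤-refl (M-dom {f} {pair (suc h) k} (suc p) q)

E⁰ : ℕ → ℕ → Ser
E⁰ p k = Er p (M (suc p) (lev k))

Pos-E⁰ : ∀ p k → Pos (E⁰ p k)
Pos-E⁰ p k = Pos-Er {p} {M (suc p) (lev k)} (Pos-lev (suc p) k)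

E⁰≼Ê : ∀ p h k → E⁰ p k ≼ Ê p h k
E⁰≼Ê p h k = Er-dom p {lev k} h k (λ t → ≤-by {d = lev (k ℕ.+ suc h) t} refl 0≤n)

NO-∑E⁰ : ∀ p → p ℕ.≤ 3 → NO 0 (∑# (λ _ k → E⁰ p k))
NO-∑E⁰ p p≤3 = NO-mono (λ h r → Pos-∑ˢ (downFrom r) (Pos-E⁰ p)) (λ h r → ∑ˢ-≼ r (E⁰≼Ê p h)) (NO-∑Ê p p≤3)

NO-E⁰ : ∀ p → p ℕ.≤ 3 → NO 0 (λ _ k → E⁰ p k)
NO-E⁰ p p≤3 = NO-term (λ _ → Pos-E⁰ p) (NO-∑E⁰ p p≤3)

NO-∑gap-suc : NO 0 (∑# (λ _ k → gap (suc k)))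
NO-∑gap-suc = NO-H (λ h r → Pos-∑ˢ (downFrom r) (λ k → Pos-gap (suc k)))
  (λ h r → ≼-respˡ (∑ˢ-cong (downFrom r) λ k → mk λ n → cong (λ z → gap (suc z) n) (ℕP.+-identityʳ k)) (∑-gap-suc 0 r))

M1-lev0 : M 1 (lev 0) ≈ y
M1-lev0 = mk λ n → ∑-cong (trees n) λ t → trans (ℤP.*-identityʳ (lev 0 t)) (lev-zero t)

Mq-lev0 : ∀ q → M q (lev 0) ≈ y
Mq-lev0 q = mk λ n → ∑-cong (trees n) λ t → trans (cong (ℤ._^ q) (lev-zero t)) (ℤP.^-zeroˡ q)

NO-U₀ : NO 0 (λ _ _ → U 0)
NO-U₀ = NO-⊞ {F = λ _ _ → M 1 (lev 0)} {G = λ _ _ → gap 0} (const-NO _ (λ _ _ → N-resp (≈-sym M1-lev0) N-y))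
  (NO-H (λ _ _ → Pos-gap 0) (λ _ _ → ≼-trans (≼-trans (term≼∑ gap 0 Pos-gap) (≼-respʳ (∑ˢ-cong (downFrom 1) λ k → mk λ n → cong (λ z → gap z n) (sym (ℕP.+-identityʳ k))) (Pos-∑ˢ (downFrom 1) Pos-gap))) (∑-gap 0 1)))

U-run : ∀ k → U k ≼ run (U 0) (λ k → gap (suc k)) k
U-run = run-dom (Pos-U 0) U-suc (λ k → Pos-gap (suc k))

NO-U : NO 0 (λ _ r → U r)
NO-U = NO-mono (λ _ → Pos-U) (λ _ → U-run) (NO-run {x₀ = λ _ → U 0} {p = λ _ k → gap (suc k)} (λ _ k → Pos-gap (suc k)) NO-U₀ NO-∑gap-suc)

SO-∑U : SO 0 (∑# (λ _ k → U k))
SO-∑U = SO-mono (λ h r → ∑ˢ-≼ r U-run) (SO-∑-run {x₀ = λ _ → U 0} {p = λ _ k → gap (suc k)} (λ _ k → Pos-gap (suc k)) NO-U₀ NO-∑gap-suc)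

y⊗U≼ : ∀ k → y ⊗ U k ≼ U (suc k)
y⊗U≼ k = ≼-respʳ (≈-sym (U-suc k)) (≼-⊕ʳ (≼-⊗ Pos-y (Pos-U k)) (Pos-gap (suc k)))

-- Second, third and fourth moments of a single level

Q₂ : ℕ → Ser
Q₂ k = E⁰ 1 k ⊕ U k ⊗ U k

Pos-Q₂ : ∀ k → Pos (Q₂ k)
Pos-Q₂ k = ≼-⊕ (Pos-E⁰ 1 k) (≼-⊗ (Pos-U k) (Pos-U k))

split-y : ∀ A B C → y ⊗ ((A ⊕ B) ⊕ C) ≈ y ⊗ A ⊕ y ⊗ (B ⊕ C)
split-y A B C = solve 4 (λ z p q r → z :* ((p :+ q) :+ r) := z :* p :+ z :* (q :+ r)) ≈-refl y A B C

Λ₂-run : ∀ k → M 2 (lev k) ≼ run y (λ k → y ⊗ Q₂ k) k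
Λ₂-run = run-dom (≼-respˡ (≈-sym (Mq-lev0 2)) Pos-y) (λ k → ≈-trans (Level.moment₂ k) (split-y (M 2 (lev k)) (E⁰ 1 k) (U k ⊗ U k)))
  (λ k → ≼-⊗ Pos-y (Pos-Q₂ k))

NO-Ud : NO 0 (λ h _ → U h)
NO-Ud = diag-N NO-U

NO-E⁰d : ∀ p → p ℕ.≤ 3 → NO 0 (λ h _ → E⁰ p h)
NO-E⁰d p q = diag-N (NO-E⁰ p q)

NO-Λ₂ : NO 1 (λ h _ → M 2 (lev h))
NO-Λ₂ = NO-mono (λ h _ → Pos-lev 2 h) (λ h _ → Λ₂-run h)
  (NO-accumulate {i = 0} {F = Q₂} N-y (NO-⊞ {F = λ h _ → E⁰ 1 h} {G = λ h _ → U h ⊗ U h} (NO-E⁰d 1 (s≤s z≤n)) (NO-⊠ NO-Ud NO-Ud)))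

-- As a factor the second moment costs O(h), but its coefficients stay O(1) a: U² is summed over the
-- levels with one U as common factor. With both bounds available, κ₂² is estimated as one factor of
-- each kind, which yields O(h) for the third and O(h²) for the fourth moment.
SO-Λ₂ : SO 0 (λ h _ → M 2 (lev h))
SO-Λ₂ = diag-S (SO-mono (λ _ k → ≼-trans (Λ₂-run k) (≼-respʳ (run-split k) (run-pos Pos-y (λ k → ≼-⊗ Pos-y (Pos-Q₂ k)) k)))
  (SO-run-⊞ {x₀ = λ _ → y} {p = λ _ k → y ⊗ E⁰ 1 k} {q = λ _ k → y ⊗ (U k ⊗ U k)}
    (NO⇒SO (NO-run {x₀ = λ _ → y} {p = λ _ k → y ⊗ E⁰ 1 k} (λ _ k → ≼-⊗ Pos-y (Pos-E⁰ 1 k)) NO-y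
      (NO-resp {F = y# ⊠ ∑# (λ _ k → E⁰ 1 k)} (λ h r → ≈-sym (⊗∑ˢ (downFrom r) (E⁰ 1) y)) (NO-⊠ NO-y (NO-∑E⁰ 1 (s≤s z≤n))))))
    (SO-common {X = λ _ k → U k} {Y = λ _ k → U k} (λ _ → Pos-U) (λ _ → y⊗U≼) NO-U SO-∑U)))
  where
  run-split : ∀ k → run y (λ k → y ⊗ Q₂ k) k ≈ run y (λ k → y ⊗ E⁰ 1 k ⊕ y ⊗ (U k ⊗ U k)) k
  run-split zero    = ≈-refl
  run-split (suc k) = ⊕-≈ (⊗-≈ ≈-refl (run-split k)) (solve 3 (λ z p q → z :* (p :+ q) := z :* p :+ z :* q) ≈-refl y (E⁰ 1 k) (U k ⊗ U k))

κ₂ κ₃ : ℕ → Ser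
κ₂ k = K 1 (lev k)
κ₃ k = K 2 (lev k)

NO-κ₂ : NO 1 (λ h _ → κ₂ h)
NO-κ₂ = NO-⊞ {F = λ h _ → M 2 (lev h)} {G = λ h _ → E⁰ 1 h} NO-Λ₂ (NO-weaken z≤n (NO-E⁰d 1 (s≤s z≤n)))

SO-κ₂ : SO 0 (λ h _ → κ₂ h)
SO-κ₂ = SO-⊞ {F = λ h _ → M 2 (lev h)} {G = λ h _ → E⁰ 1 h} SO-Λ₂ (NO⇒SO (NO-E⁰d 1 (s≤s z≤n)))

Pos-κ₂ : ∀ k → Pos (κ₂ k)
Pos-κ₂ k = ≼-⊕ (Pos-lev 2 k) (Pos-E⁰ 1 k)

Pos-κ₃ : ∀ k → Pos (κ₃ k)
Pos-κ₃ k = ≼-⊕ (Pos-lev 3 k) (Pos-E⁰ 2 k)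

R₃ R₄ : ℕ → Ser
R₃ k = cst (+ 3) ⊗ (U k ⊗ κ₂ k) ⊕ U k ⊗ (U k ⊗ U k)
R₄ k = cst (+ 4) ⊗ (U k ⊗ κ₃ k) ⊕ (cst (+ 3) ⊗ (κ₂ k ⊗ κ₂ k) ⊕ (cst (+ 6) ⊗ ((U k ⊗ U k) ⊗ κ₂ k) ⊕ (U k ⊗ U k) ⊗ (U k ⊗ U k)))

Pos-R₃ : ∀ k → Pos (R₃ k)
Pos-R₃ k = ≼-⊕ (≼-⊗ (Pos-cst 3) (≼-⊗ (Pos-U k) (Pos-κ₂ k))) (≼-⊗ (Pos-U k) (≼-⊗ (Pos-U k) (Pos-U k)))

Pos-R₄ : ∀ k → Pos (R₄ k)
Pos-R₄ k = ≼-⊕ (≼-⊗ (Pos-cst 4) (≼-⊗ (Pos-U k) (Pos-κ₃ k))) (≼-⊕ (≼-⊗ (Pos-cst 3) (≼-⊗ (Pos-κ₂ k) (Pos-κ₂ k)))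
  (≼-⊕ (≼-⊗ (Pos-cst 6) (≼-⊗ (≼-⊗ (Pos-U k) (Pos-U k)) (Pos-κ₂ k))) (≼-⊗ (≼-⊗ (Pos-U k) (Pos-U k)) (≼-⊗ (Pos-U k) (Pos-U k)))))

Ud κ₂d κ₃d : Fam
Ud h _ = U h
κ₂d h _ = κ₂ h
κ₃d h _ = κ₃ h

NO-U²d : NO 0 (Ud ⊠ Ud)
NO-U²d = NO-⊠ NO-Ud NO-Ud

SO-Λ₃ : SO 1 (λ h _ → M 3 (lev h))
SO-Λ₃ = SO-mono (λ h _ → run-dom (≼-respˡ (≈-sym (Mq-lev0 3)) Pos-y)
    (λ k → ≈-trans (Level.moment₃ k) (split-y (M 3 (lev k)) (E⁰ 2 k) (R₃ k))) (λ k → ≼-⊗ Pos-y (≼-⊕ (Pos-E⁰ 2 k) (Pos-R₃ k))) h)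
  (SO-accumulate {i = 0} {F = λ k → E⁰ 2 k ⊕ R₃ k} (N⇒S N-y)
    (SO-⊞ {F = λ h _ → E⁰ 2 h} {G = λ h _ → R₃ h} (NO⇒SO (NO-E⁰d 2 (s≤s (s≤s z≤n))))
      (SO-⊞ {F = cst# 3 ⊠ (Ud ⊠ κ₂d)} {G = Ud ⊠ (Ud ⊠ Ud)} (SO-⊠ {i = 0} {j = 0} (NO-cst 3) (SO-⊠ NO-Ud SO-κ₂)) (NO⇒SO (NO-⊠ NO-Ud NO-U²d)))))

SO-κ₃ : SO 1 κ₃d
SO-κ₃ = SO-⊞ {F = λ h _ → M 3 (lev h)} {G = λ h _ → E⁰ 2 h} SO-Λ₃ (SO-weaken z≤n (NO⇒SO (NO-E⁰d 2 (s≤s (s≤s z≤n)))))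

SO-Λ₄ : SO 2 (λ h _ → M 4 (lev h))
SO-Λ₄ = SO-mono (λ h _ → run-dom (≼-respˡ (≈-sym (Mq-lev0 4)) Pos-y)
    (λ k → ≈-trans (Level.moment₄ k) (split-y (M 4 (lev k)) (E⁰ 3 k) (R₄ k))) (λ k → ≼-⊗ Pos-y (≼-⊕ (Pos-E⁰ 3 k) (Pos-R₄ k))) h)
  (SO-accumulate {i = 1} {F = λ k → E⁰ 3 k ⊕ R₄ k} (N⇒S N-y)
    (SO-⊞ {F = λ h _ → E⁰ 3 h} {G = λ h _ → R₄ h} (SO-weaken z≤n (NO⇒SO (NO-E⁰d 3 ℕP.≤-refl)))
      (SO-⊞ {F = cst# 4 ⊠ (Ud ⊠ κ₃d)} (SO-⊠ {i = 0} (NO-cst 4) (SO-⊠ {i = 0} NO-Ud SO-κ₃))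
        (SO-⊞ {F = cst# 3 ⊠ (κ₂d ⊠ κ₂d)} (SO-⊠ {i = 0} (NO-cst 3) (SO-⊠ {i = 1} NO-κ₂ SO-κ₂))
          (SO-weaken {i = 0} z≤n (SO-⊞ {F = cst# 6 ⊠ ((Ud ⊠ Ud) ⊠ κ₂d)} (SO-⊠ {i = 0} (NO-cst 6) (SO-⊠ {i = 0} NO-U²d SO-κ₂)) (NO⇒SO (NO-⊠ NO-U²d NO-U²d))))))))

-- Differences of two levels

-- The lag is h + 1, so that powers of it are never 0; lag 0 is trivial and is split off in
-- `∑-dif⁴`.
dif : ℕ → ℕ → Tree → ℤ
dif h k t = lev k t ℤ.- lev (k ℕ.+ suc h) t

dif-class : ∀ h k → ClassFun (dif h k)
dif-class h k e = cong₂ ℤ._-_ (lev-class k e) (lev-class (k ℕ.+ suc h) e)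

dif-kids : ∀ h k T → dif h (suc k) T ≡ kids (dif h k) T
dif-kids h k T = trans (cong₂ ℤ._-_ (lev-suc k T) (lev-suc (k ℕ.+ suc h) T)) (go (ch T))
  where
  lem : ∀ p q r s → (p ℤ.+ q) ℤ.- (r ℤ.+ s) ≡ (p ℤ.- r) ℤ.+ (q ℤ.- s)
  lem = solveℤ
  go : ∀ ts → ∑ ts (lev k) ℤ.- ∑ ts (lev (k ℕ.+ suc h)) ≡ ∑ ts (dif h k)
  go []       = refl
  go (t ∷ ts) = trans (lem (lev k t) (∑ ts (lev k)) (lev (k ℕ.+ suc h) t) _) (cong (λ z → dif h k t ℤ.+ z) (go ts))

module Dif (h k : ℕ) = Moments (dif h k) (dif h (suc k)) (dif-class h k) (dif-kids h k)

A : ℕ → Fam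
A q h k = M q (dif h k)

E : ℕ → Fam
E p h k = Er p (M (suc p) (dif h k))

∣dif∣≤pair : ∀ h k t → + ∣ dif h k t ∣ ℤ.≤ pair (suc h) k t
∣dif∣≤pair h k t = abs-+ {lev k t} {ℤ.- lev (k ℕ.+ suc h) t} ℤP.≤-refl
  (ℤP.≤-reflexive (cong +_ (ℤP.∣-i∣≡∣i∣ (lev (k ℕ.+ suc h) t))))

E≼Ê : ∀ p h k → E p h k ≼ Ê p h k
E≼Ê p h k = Er-dom p {dif h k} h k (∣dif∣≤pair h k)

NO-Ê : ∀ p → p ℕ.≤ 3 → NO 0 (Ê p)
NO-Ê p q = NO-term (Pos-Ê p) (NO-∑Ê p q)

-- The gaps collected on the way from level k to level k + h + 1: U(k + h + 1) = y^(h+1) U(k) +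
-- `ε h k`.
ε : Fam
ε h k = run 𝟘 (λ m → gap (suc (m ℕ.+ k))) (suc h)

geo : ℕ → Ser
geo m = ∑ˢ (downFrom m) (y ^ˢ_)

1-y : Ser
1-y = 𝟙 ⊕ ⊝ y

geo-telescopes : ∀ m → geo m ⊗ 1-y ≈ 𝟙 ⊕ ⊝ (y ^ˢ m)
geo-telescopes zero = ≈-trans (⊗-≈ (∑ˢ-0 (y ^ˢ_)) ≈-refl)
  (solve 1 (λ z → con (+ 0) :* (con (+ 1) :- z) := con (+ 1) :- con (+ 1)) ≈-refl y)
geo-telescopes (suc m) = ≈-trans (⊗-≈ (∑ˢ-suc (y ^ˢ_) m) ≈-refl)
  (≈-trans (solve 3 (λ z p s → (p :+ s) :* (con (+ 1) :- z) := p :- z :* p :+ s :* (con (+ 1) :- z)) ≈-refl y (y ^ˢ m) (geo m))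
    (≈-trans (⊕-≈ ≈-refl (geo-telescopes m)) (solve 2 (λ z p → p :- z :* p :+ (con (+ 1) :- p) := con (+ 1) :- z :* p) ≈-refl y (y ^ˢ m))))

U-shift : ∀ m k → U (m ℕ.+ k) ≈ y ^ˢ m ⊗ U k ⊕ run 𝟘 (λ m → gap (suc (m ℕ.+ k))) m
U-shift zero    k = solve 1 (λ u → u := con (+ 1) :* u :+ con (+ 0)) ≈-refl (U k)
U-shift (suc m) k = ≈-trans (U-suc (m ℕ.+ k)) (≈-trans (⊕-≈ (⊗-≈ ≈-refl (U-shift m k)) ≈-refl)
  (solve 5 (λ z p u r g → z :* (p :* u :+ r) :+ g := (z :* p) :* u :+ (z :* r :+ g)) ≈-refl y (y ^ˢ m) (U k)
    (run 𝟘 (λ m → gap (suc (m ℕ.+ k))) m) (gap (suc (m ℕ.+ k)))))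

K₁ : Fam
K₁ h k = K 0 (dif h k)

K₁-U : ∀ h k → K₁ h k ≈ U k ⊕ ⊝ U (k ℕ.+ suc h)
K₁-U h k = ≈-trans (⊕-≈ M₁ (≈-trans (Er-cong {0} M₁) (Er-sub 0 (M 1 (lev k)) (M 1 (lev (k ℕ.+ suc h))))))
  (solve 4 (λ p q r s → (p :- q) :+ (r :- s) := (p :+ r) :- (q :+ s)) ≈-refl
    (M 1 (lev k)) (M 1 (lev (k ℕ.+ suc h))) (gap k) (gap (k ℕ.+ suc h)))
  where
  lem : ∀ p q → (p ℤ.- q) ℤ.* + 1 ≡ p ℤ.* + 1 ℤ.+ ℤ.- + 1 ℤ.* (q ℤ.* + 1)
  lem = solveℤ
  lem₂ : ∀ p q → p ℤ.+ ℤ.- + 1 ℤ.* q ≡ p ℤ.+ ℤ.- q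
  lem₂ = solveℤ
  M₁ : A 1 h k ≈ M 1 (lev k) ⊕ ⊝ M 1 (lev (k ℕ.+ suc h))
  M₁ = mk λ n → trans (∑-cong (trees n) λ t → lem (lev k t) (lev (k ℕ.+ suc h) t))
    (trans (∑-+ (λ t → lev k t ℤ.^ 1) (λ t → ℤ.- + 1 ℤ.* (lev (k ℕ.+ suc h) t ℤ.* + 1)) (trees n))
      (trans (cong (λ z → M 1 (lev k) n ℤ.+ z) (∑-* (ℤ.- + 1) (λ t → lev (k ℕ.+ suc h) t ℤ.* + 1) (trees n)))
        (trans (lem₂ (M 1 (lev k) n) (M 1 (lev (k ℕ.+ suc h)) n))
          (sym (trans (⊕-at _ _ n) (cong (λ z → M 1 (lev k) n ℤ.+ z) (⊝-at (M 1 (lev (k ℕ.+ suc h))) n)))))))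

G : ℕ → Ser
G h = geo (suc h)

Yh : ℕ → Ser
Yh h = y ^ˢ suc h

-- The first moment of a difference carries the factor 1 - y, up to a summable error.
K₁-eq : ∀ h k → K₁ h k ≈ (G h ⊗ 1-y) ⊗ U k ⊕ ⊝ ε h k
K₁-eq h k = ≈-trans (K₁-U h k) (≈-trans (⊕-≈ ≈-refl (⊝-≈ (≈-trans (mk λ n → cong (λ z → U z n) (ℕP.+-comm k (suc h))) (U-shift (suc h) k))))
  (≈-trans (solve 3 (λ p u e → u :- (p :* u :+ e) := (con (+ 1) :- p) :* u :- e) ≈-refl (Yh h) (U k) (ε h k))
    (⊕-≈ (⊗-≈ (≈-sym (geo-telescopes (suc h))) ≈-refl) ≈-refl)))

-- A nonnegative majorant of `K₁`. Taking absolute values destroys the factor 1 - y, so it serves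
-- only in products that remain summable without it.
Û : Fam
Û h k = U k ⊕ U (k ℕ.+ suc h)

ĝ : Fam
ĝ h k = gap (suc k) ⊕ gap (suc k ℕ.+ suc h)

Pos-Û : ∀ h k → Pos (Û h k)
Pos-Û h k = ≼-⊕ (Pos-U k) (Pos-U (k ℕ.+ suc h))

Pos-ĝ : ∀ h k → Pos (ĝ h k)
Pos-ĝ h k = ≼-⊕ (Pos-gap (suc k)) (Pos-gap (suc k ℕ.+ suc h))

Pos-ε : ∀ h k → Pos (ε h k)
Pos-ε h k = run-pos (Pos-cst 0) (λ m → Pos-gap (suc (m ℕ.+ k))) (suc h)

U≼Û : ∀ h k → U k ≼ Û h k
U≼Û h k = ≼-⊕ʳ (Pos-U k) (Pos-U (k ℕ.+ suc h))

gap≼ĝ : ∀ h k → gap (suc k) ≼ ĝ h k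
gap≼ĝ h k = ≼-⊕ʳ (Pos-gap (suc k)) (Pos-gap (suc k ℕ.+ suc h))

K₁≼Û : ∀ h k → K₁ h k ≼ Û h k
K₁≼Û h k = ≼-respˡ (≈-sym (K₁-U h k)) (≼-⊕ (Pos-U k) (≼-⊝ (Pos-U (k ℕ.+ suc h))))

Û-suc : ∀ h k → Û h (suc k) ≈ y ⊗ Û h k ⊕ ĝ h k
Û-suc h k = ≈-trans (⊕-≈ (U-suc k) (U-suc (k ℕ.+ suc h)))
  (solve 5 (λ z u v p q → (z :* u :+ p) :+ (z :* v :+ q) := z :* (u :+ v) :+ (p :+ q)) ≈-refl y (U k) (U (k ℕ.+ suc h)) (gap (suc k)) (gap (suc k ℕ.+ suc h)))

NO-∑ĝ : NO 0 (∑# ĝ)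
NO-∑ĝ = NO-∑-⊞ {F = λ _ k → gap (suc k)} {G = λ h k → gap (suc k ℕ.+ suc h)} NO-∑gap-suc
  (NO-H (λ h r → Pos-∑ˢ (downFrom r) (λ k → Pos-gap (suc k ℕ.+ suc h))) (λ h r → ∑-gap-suc (suc h) r))

NO-Û : NO 0 Û
NO-Û = NO-⊞ {F = λ _ r → U r} NO-U (shifted NO-U)
  where
  shifted : NO 0 (λ _ r → U r) → NO 0 (λ h r → U (r ℕ.+ suc h))
  shifted (C ▹ n) = C ▹ λ h r → n h (r ℕ.+ suc h)

y⊗Û≼ : ∀ h k → y ⊗ Û h k ≼ Û h (suc k)
y⊗Û≼ h k = ≼-respʳ (≈-sym (Û-suc h k)) (≼-⊕ʳ (≼-⊗ Pos-y (Pos-Û h k)) (Pos-ĝ h k))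

NO-suc : ∀ {j F} → NO j F → NO j (λ h k → F h (suc k))
NO-suc (C ▹ n) = C ▹ λ h k → n h (suc k)

SO-suc : ∀ {j F} → SO j F → SO j (λ h k → F h (suc k))
SO-suc (C ▹ n) = C ▹ λ h k → n h (suc k)

NO-at : ∀ {j F} → NO j F → NO j (λ h _ → F h 0)
NO-at (C ▹ n) = C ▹ λ h _ → n h 0

SO-∑Û : SO 0 (∑# Û)
SO-∑Û = SO-∑-sum {X = Û} {p = ĝ} {Q = 𝟙} (N-cst 1) Pos-Û Pos-ĝ
  (λ h k → ≼-respʳ (≈-trans (Û-suc h k) (⊕-≈ (⊗-≈ (solve 1 (λ z → z := z :* con (+ 1)) ≈-refl y) ≈-refl) ≈-refl)) (Pos-Û h (suc k)))
  (NO-at NO-Û) NO-∑ĝ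

Û² Û³ : Fam
Û² = Û ⊠ Û
Û³ = Û ⊠ (Û ⊠ Û)

Pos-Û² : ∀ h k → Pos (Û² h k)
Pos-Û² h k = ≼-⊗ (Pos-Û h k) (Pos-Û h k)

Pos-Û³ : ∀ h k → Pos (Û³ h k)
Pos-Û³ h k = ≼-⊗ (Pos-Û h k) (Pos-Û² h k)

SO-∑Û² : SO 0 (∑# Û²)
SO-∑Û² = SO-∑-sum {X = Û²} {p = ĝ ⊠ Y} {Q = y} N-y Pos-Û² (λ h k → ≼-⊗ (Pos-ĝ h k) (pY h k))
  (λ h k → ≼-resp (≈-sym (≈-trans (⊗-≈ (Û-suc h k) ≈-refl) (≈-trans
      (solve 4 (λ z u g v → (z :* u :+ g) :* v := z :* (u :* v) :+ g :* v) ≈-refl y (Û h k) (ĝ h k) (Û h (suc k)))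
      (≈-trans (⊕-≈ (⊗-≈ ≈-refl (⊗-≈ ≈-refl (Û-suc h k))) ≈-refl)
        (solve 4 (λ z u g v → z :* (u :* (z :* u :+ g)) :+ g :* v := (z :* z) :* (u :* u) :+ g :* (v :+ z :* u)) ≈-refl y (Û h k) (ĝ h k) (Û h (suc k)))))))
    ≈-refl (≼-⊕ (≼-⊗ (≼-⊗ Pos-y Pos-y) (Pos-Û² h k)) (≼-⊗ (Pos-ĝ h k) (≼-⊕ (Pos-Û h (suc k)) (y⊗Û≼ h k)))))
  (NO-at (NO-⊠ NO-Û NO-Û)) (NO-∑-⊠ {E = ĝ} {Y = Y} Pos-ĝ NO-∑ĝ (NO-⊞ (NO-suc NO-Û) (NO-suc NO-Û)))
  where
  Y : Fam
  Y h k = Û h (suc k) ⊕ Û h (suc k)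
  pY : ∀ h k → Pos (Y h k)
  pY h k = ≼-⊕ (Pos-Û h (suc k)) (Pos-Û h (suc k))

SO-∑Û³ : SO 0 (∑# Û³)
SO-∑Û³ = SO-∑-sum {X = Û³} {p = ĝ ⊠ Y} {Q = y ⊗ y} (N-⊗ N-y N-y) Pos-Û³ (λ h k → ≼-⊗ (Pos-ĝ h k) (NO-pos nY h k))
  (λ h k → ≼-resp (≈-sym (≈-trans (⊗-≈ (Û-suc h k) ≈-refl) (≈-trans
      (solve 4 (λ z u g v → (z :* u :+ g) :* (v :* v) := z :* (u :* (v :* v)) :+ g :* (v :* v)) ≈-refl y (Û h k) (ĝ h k) (Û h (suc k)))
      (≈-trans (⊕-≈ (⊗-≈ ≈-refl (⊗-≈ ≈-refl (⊗-≈ (Û-suc h k) ≈-refl))) ≈-refl) (≈-trans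
        (solve 4 (λ z u g v → z :* (u :* ((z :* u :+ g) :* v)) :+ g :* (v :* v) := (z :* z) :* (u :* (u :* v)) :+ g :* (v :* v :+ (z :* u) :* v)) ≈-refl y (Û h k) (ĝ h k) (Û h (suc k)))
        (≈-trans (⊕-≈ (⊗-≈ ≈-refl (⊗-≈ ≈-refl (⊗-≈ ≈-refl (Û-suc h k)))) ≈-refl)
          (solve 4 (λ z u g v → (z :* z) :* (u :* (u :* (z :* u :+ g))) :+ g :* (v :* v :+ (z :* u) :* v)
              := (z :* (z :* z)) :* (u :* (u :* u)) :+ g :* (v :* v :+ ((z :* u) :* v :+ (z :* u) :* (z :* u)))) ≈-refl y (Û h k) (ĝ h k) (Û h (suc k)))))))))
    ≈-refl (≼-⊕ (≼-⊗ (≼-⊗ Pos-y (≼-⊗ Pos-y Pos-y)) (Pos-Û³ h k)) (≼-⊗ (Pos-ĝ h k)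
      (≼-⊕ (Pos-Û² h (suc k)) (≼-⊕ (≼-⊗ (y⊗Û≼ h k) (Pos-Û h (suc k))) (≼-⊗ (y⊗Û≼ h k) (y⊗Û≼ h k)))))))
  (NO-at (NO-⊠ NO-Û (NO-⊠ NO-Û NO-Û))) (NO-∑-⊠ {E = ĝ} {Y = Y} Pos-ĝ NO-∑ĝ nY)
  where
  Y : Fam
  Y h k = Û² h (suc k) ⊕ (Û² h (suc k) ⊕ Û² h (suc k))
  nY : NO 0 Y
  nY = NO-⊞ {F = λ h k → Û² h (suc k)} (NO-suc (NO-⊠ NO-Û NO-Û)) (NO-⊞ (NO-suc (NO-⊠ NO-Û NO-Û)) (NO-suc (NO-⊠ NO-Û NO-Û)))

-- Although `ε h k` consists of h + 1 gaps, the double sum over levels and lags is below the single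
-- series `H`, so no power of h appears.
NO-∑ε : NO 0 (∑# ε)
NO-∑ε = go (proj₂ H-bounded)
  where
  pg : ∀ k m → Pos (gap (suc (m ℕ.+ k)))
  pg k m = Pos-gap (suc (m ℕ.+ k))
  go : ∀ {C} → N H C → NO 0 (∑# ε)
  go {C} nH = const-NO (∑# ε) (λ h r → mkN (Pos-∑ˢ (downFrom r) (Pos-ε h)) (≼-trans
    (≼-resp (∑ˢ-⊗ (downFrom r) (ε h) a) (∑ˢ-⊗ (downFrom r) (λ k → ∑ˢ (downFrom (suc h)) (λ m → gap (suc (m ℕ.+ k)))) a)
      (∑ˢ-≼ r λ k → ≼-respʳ (⊗-≈ (solve 1 (λ s → con (+ 0) :+ s := s) ≈-refl _) ≈-refl) (run-⊑ (Pos-cst 0) (pg k) (suc h))))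
    (≼-trans (≼-⊗ (∑∑-gap (suc h) r) Pos-a) (bound nH))))

NO-ε : NO 0 ε
NO-ε = NO-term Pos-ε NO-∑ε

-- Each of the h + 1 powers of y has norm 1; from here the linear growth in the lag enters the
-- second moment.
NO-geo : NO 1 (λ h _ → G h)
NO-geo = 1 ▹ λ h _ → subst (N (G h)) (sym (trans (ℕP.*-identityˡ _) (ℕP.*-identityʳ (suc h)))) (go (suc h))
  where
  pow : ∀ j → N (y ^ˢ j) 1
  pow zero    = N-cst 1
  pow (suc j) = N-y⊗ (pow j)
  go : ∀ m → N (geo m) m
  go zero    = N-resp (≈-sym (∑ˢ-0 (y ^ˢ_))) (N-cst 0)
  go (suc m) = N-resp (≈-sym (∑ˢ-suc (y ^ˢ_) m)) (N-⊕ (pow m) (go m))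

NO-Yh : NO 0 (λ h _ → Yh h)
NO-Yh = const-NO _ (λ h _ → pow (suc h))
  where
  pow : ∀ j → N (y ^ˢ j) 1
  pow zero    = N-cst 1
  pow (suc j) = N-y⊗ (pow j)

NO-∑-y : ∀ {j F} → NO j (∑# F) → NO j (∑# (λ h k → y ⊗ F h k))
NO-∑-y {j} {F} p = NO-resp {F = y# ⊠ ∑# F} (λ h r → ≈-sym (⊗∑ˢ (downFrom r) (F h) y)) (NO-⊠ {i = 0} NO-y p)

SO-∑-y : ∀ {j F} → SO j (∑# F) → SO j (∑# (λ h k → y ⊗ F h k))
SO-∑-y {j} {F} p = SO-∑-const {i = 0} {c = λ _ → y} {F = F} NO-y p

SO-∑-cst : ∀ {j F} c → SO j (∑# F) → SO j (∑# (λ h k → cst (+ c) ⊗ F h k))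
SO-∑-cst {j} {F} c p = SO-∑-const {i = 0} {c = λ _ → cst (+ c)} {F = F} (NO-cst c) p

NO-∑-const : ∀ {i j} {c : ℕ → Ser} {F} → NO i (λ h _ → c h) → NO j (∑# F) → NO (i ℕ.+ j) (∑# (λ h k → c h ⊗ F h k))
NO-∑-const {c = c} {F} p q = NO-resp {F = (λ h _ → c h) ⊠ ∑# F} (λ h r → ≈-sym (⊗∑ˢ (downFrom r) (F h) (c h))) (NO-⊠ p q)

SO-run-0 : ∀ {j x₀} → SO j (λ h _ → x₀ h) → SO j (run# x₀ (λ _ _ → 𝟘))
SO-run-0 {j} {x₀} (C ▹ s) = C ▹ go
  where
  go : ∀ h r → S (run (x₀ h) (λ _ → 𝟘) r) (C ℕ.* suc h ℕ.^ j)
  go h zero    = s h 0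
  go h (suc r) = ≼-respˡ (solve 2 (λ z x → z :* x := z :* x :+ con (+ 0)) ≈-refl y (run (x₀ h) (λ _ → 𝟘) r)) (S-y⊗ (go h r))

Ĵ : ℕ → Ser
Ĵ h = G h ⊗ (𝟙 ⊕ Yh h)

J : ℕ → Ser
J h = G h ⊗ (G h ⊗ 1-y)

Pos-G : ∀ h → Pos (G h)
Pos-G h = NO-pos NO-geo h 0

Pos-Yh : ∀ h → Pos (Yh h)
Pos-Yh h = NO-pos NO-Yh h 0

NO-Ĵ : NO 1 (λ h _ → Ĵ h)
NO-Ĵ = NO-⊠ {j = 0} {F = λ h _ → G h} NO-geo (NO-⊞ {F = cst# 1} (NO-cst 1) NO-Yh)

Pos-Ĵ : ∀ h → Pos (Ĵ h)
Pos-Ĵ h = NO-pos NO-Ĵ h 0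

G1-y≼ : ∀ h → G h ⊗ 1-y ≼ 𝟙 ⊕ Yh h
G1-y≼ h = ≼-respˡ (≈-sym (geo-telescopes (suc h))) (≼-⊕ (Pos-cst 1) (≼-⊝ (Pos-Yh h)))

-- One of the two factors `G h` telescopes against 1 - y before absolute values are taken. Thus `J`
-- is O(h), where G² alone would be O(h²).
J≼Ĵ : ∀ h → J h ≼ Ĵ h
J≼Ĵ h = ≼-⊗ (Pos-G h) (G1-y≼ h)

dif₀-dom : ∀ q h → A (suc q) h 0 ≼ y ⊕ M (suc q) (lev (suc h))
dif₀-dom q h = dom λ n → subst (+ ∣ A (suc q) h 0 n ∣ ℤ.≤_)
  (trans (∑-+ (λ _ → + 1) (λ t → lev (suc h) t ℤ.^ suc q) (trees n)) (sym (⊕-at y (M (suc q) (lev (suc h))) n)))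
  (∑-abs (All.universal (λ t → subst (λ z → + ∣ (z ℤ.- lev (suc h) t) ℤ.^ suc q ∣ ℤ.≤ + 1 ℤ.+ lev (suc h) t ℤ.^ suc q) (sym (lev-zero t)) (main (L t (suc h)))) (trees n)))
  where
  abs-^ : ∀ x k → ∣ x ℤ.^ k ∣ ≡ ∣ x ∣ ℕ.^ k
  abs-^ x zero    = refl
  abs-^ x (suc k) = trans (ℤP.abs-* x (x ℤ.^ k)) (cong (∣ x ∣ ℕ.*_) (abs-^ x k))
  ∣1-∣ : ∀ n → ∣ + 1 ℤ.- + suc n ∣ ≡ n
  ∣1-∣ n = trans (cong ∣_∣ (lem (+ n))) (ℤP.∣-i∣≡∣i∣ (+ n))
    where
    lem : ∀ x → + 1 ℤ.- (+ 1 ℤ.+ x) ≡ ℤ.- x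
    lem = solveℤ
  main : ∀ n → + ∣ (+ 1 ℤ.- + n) ℤ.^ suc q ∣ ℤ.≤ + 1 ℤ.+ (+ n) ℤ.^ suc q
  main zero = subst (λ z → + z ℤ.≤ + 1 ℤ.+ (+ 0) ℤ.^ suc q) (sym (trans (abs-^ (+ 1) (suc q)) (ℕP.^-zeroˡ (suc q)))) (≤-by {d = (+ 0) ℤ.^ suc q} refl (0≤^ 0 (suc q)))
  main (suc n) = subst₂ ℤ._≤_ (cong +_ (sym (trans (abs-^ (+ 1 ℤ.- + suc n) (suc q)) (cong (ℕ._^ suc q) (∣1-∣ n)))))
    (cong (λ z → + 1 ℤ.+ z) (sym (pos-^ (suc n) (suc q)))) (ℕ≤⇒ℤ≤ (ℕP.≤-trans (ℕP.^-monoˡ-≤ (suc q) (ℕP.n≤1+n n)) (ℕP.n≤1+n _)))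

scale-suc : ∀ C j h → C ℕ.* suc (suc h) ℕ.^ j ℕ.≤ C ℕ.* 2 ℕ.^ j ℕ.* suc h ℕ.^ j
scale-suc C j h = ℕP.≤-trans (ℕP.*-monoʳ-≤ C (ℕP.≤-trans (ℕP.^-monoˡ-≤ j (ℕP.≤-trans (ℕP.m≤m+n (2 ℕ.+ h) h) (ℕP.≤-reflexive (lem h)))) (ℕP.≤-reflexive (ℕ-^-*-^ 2 (suc h) j))))
  (ℕP.≤-reflexive (sym (ℕP.*-assoc C (2 ℕ.^ j) (suc h ℕ.^ j))))
  where
  lem : ∀ h → 2 ℕ.+ h ℕ.+ h ≡ 2 ℕ.* suc h
  lem = solveℕ

NO-lag : ∀ {j} {F : ℕ → Ser} → NO j (λ h _ → F h) → NO j (λ h _ → F (suc h))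
NO-lag {j} (C ▹ n) = C ℕ.* 2 ℕ.^ j ▹ λ h r → N-weaken (scale-suc C j h) (n (suc h) r)

SO-lag : ∀ {j} {F : ℕ → Ser} → SO j (λ h _ → F h) → SO j (λ h _ → F (suc h))
SO-lag {j} (C ▹ n) = C ℕ.* 2 ℕ.^ j ▹ λ h r → S-weaken (scale-suc C j h) (n (suc h) r)

-- The second moment

-- K₁² is G² (1 - y)² U² up to ε, which is not summable over k; J U² absorbs it, as (1 - y) + y = 1.
Z₂ : Fam
Z₂ h k = A 2 h k ⊕ J h ⊗ (U k ⊗ U k)

W₂ p₂ : Fam
W₂ h k = ε h k ⊕ cst (+ 2) ⊗ ((𝟙 ⊕ Yh h) ⊗ Û h k)
p₂ h k = y ⊗ (Ê 1 h k ⊕ ε h k ⊗ W₂ h k) ⊕ Ĵ h ⊗ (ĝ h k ⊗ (Û h (suc k) ⊕ Û h (suc k)))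

x₂ : ℕ → Ser
x₂ h = (y ⊕ M 2 (lev (suc h))) ⊕ Ĵ h ⊗ (Û h 0 ⊗ Û h 0)

Z₂-step : ∀ h k → Z₂ h (suc k) ≈ y ⊗ Z₂ h k ⊕
  (y ⊗ (E 1 h k ⊕ (ε h k ⊗ ε h k ⊕ ⊝ (cst (+ 2) ⊗ ((G h ⊗ 1-y) ⊗ (U k ⊗ ε h k))))) ⊕ J h ⊗ (gap (suc k) ⊗ (U (suc k) ⊕ y ⊗ U k)))
Z₂-step h k = ≈-trans (⊕-≈ (≈-trans (Dif.moment₂ h k) (⊗-≈ ≈-refl (⊕-≈ ≈-refl (⊗-≈ (K₁-eq h k) (K₁-eq h k))))) (⊗-≈ ≈-refl (⊗-≈ (U-suc k) (U-suc k))))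
  (≈-trans (solve 7 (λ z g u e q p b →
      z :* ((p :+ b) :+ ((g :* (con (+ 1) :- z)) :* u :- e) :* ((g :* (con (+ 1) :- z)) :* u :- e)) :+ (g :* (g :* (con (+ 1) :- z))) :* ((z :* u :+ q) :* (z :* u :+ q))
      := z :* (p :+ (g :* (g :* (con (+ 1) :- z))) :* (u :* u)) :+
         (z :* (b :+ (e :* e :- con (+ 2) :* ((g :* (con (+ 1) :- z)) :* (u :* e)))) :+ (g :* (g :* (con (+ 1) :- z))) :* (q :* ((z :* u :+ q) :+ z :* u))))
      ≈-refl y (G h) (U k) (ε h k) (gap (suc k)) (A 2 h k) (E 1 h k))
    (⊕-≈ ≈-refl (⊕-≈ ≈-refl (⊗-≈ ≈-refl (⊗-≈ ≈-refl (⊕-≈ (≈-sym (U-suc k)) ≈-refl))))))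

Pos-1+Yh : ∀ h → Pos (𝟙 ⊕ Yh h)
Pos-1+Yh h = ≼-⊕ (Pos-cst 1) (Pos-Yh h)

Pos-W₂ : ∀ h k → Pos (W₂ h k)
Pos-W₂ h k = ≼-⊕ (Pos-ε h k) (≼-⊗ (Pos-cst 2) (≼-⊗ (Pos-1+Yh h) (Pos-Û h k)))

Pos-p₂ : ∀ h k → Pos (p₂ h k)
Pos-p₂ h k = ≼-⊕ (≼-⊗ Pos-y (≼-⊕ (Pos-Ê 1 h k) (≼-⊗ (Pos-ε h k) (Pos-W₂ h k))))
  (≼-⊗ (Pos-Ĵ h) (≼-⊗ (Pos-ĝ h k) (≼-⊕ (Pos-Û h (suc k)) (Pos-Û h (suc k)))))

X : Fam
X = run# x₂ p₂

Z₂≼X : ∀ h k → Z₂ h k ≼ X h k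
Z₂≼X h = run-dom (≼-⊕ (dif₀-dom 1 h) (≼-⊗ (J≼Ĵ h) (≼-⊗ (U≼Û h 0) (U≼Û h 0)))) (Z₂-step h)
  (λ k → ≼-⊕ (≼-⊗ Pos-y (≼-⊕ (E≼Ê 1 h k) (≼-respʳ
      (solve 3 (λ e w u → e :* e :+ con (+ 2) :* (w :* (u :* e)) := e :* (e :+ con (+ 2) :* (w :* u))) ≈-refl (ε h k) (𝟙 ⊕ Yh h) (Û h k))
      (≼-⊕ (≼-⊗ (Pos-ε h k) (Pos-ε h k)) (≼-⊝ (≼-⊗ (Pos-cst 2) (≼-⊗ (G1-y≼ h) (≼-⊗ (U≼Û h k) (Pos-ε h k)))))))))
    (≼-⊗ (J≼Ĵ h) (≼-⊗ (gap≼ĝ h k) (≼-⊕ (U≼Û h (suc k)) (≼-trans (y⊗U≼ k) (U≼Û h (suc k)))))))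

NO-x₂ : NO 1 (λ h _ → x₂ h)
NO-x₂ = NO-⊞ {F = y# ⊞ (λ h _ → M 2 (lev (suc h)))} (NO-⊞ {F = y#} (NO-weaken z≤n NO-y) (NO-lag {F = λ h → M 2 (lev h)} NO-Λ₂))
  (NO-⊠ {i = 1} {j = 0} {F = λ h _ → Ĵ h} NO-Ĵ (NO-at {F = Û²} (NO-⊠ NO-Û NO-Û)))

NO-∑p₂ : NO 1 (∑# p₂)
NO-∑p₂ = NO-∑-⊞ {F = λ h k → y ⊗ (Ê 1 h k ⊕ ε h k ⊗ W₂ h k)} {G = λ h k → Ĵ h ⊗ (ĝ h k ⊗ (Û h (suc k) ⊕ Û h (suc k)))}
  (NO-weaken {i = 0} z≤n (NO-∑-y {F = Ê 1 ⊞ (ε ⊠ W₂)} (NO-∑-⊞ {F = Ê 1} {G = ε ⊠ W₂} (NO-∑Ê 1 (s≤s z≤n))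
    (NO-∑-⊠ {E = ε} {Y = W₂} Pos-ε NO-∑ε (NO-⊞ {F = ε} NO-ε (NO-⊠ {F = cst# 2} (NO-cst 2) (NO-⊠ {F = λ h _ → 𝟙 ⊕ Yh h} (NO-⊞ {F = cst# 1} (NO-cst 1) NO-Yh) NO-Û)))))))
  (NO-∑-const {i = 1} {j = 0} {c = Ĵ} {F = λ h k → ĝ h k ⊗ (Û h (suc k) ⊕ Û h (suc k))} NO-Ĵ
    (NO-∑-⊠ {E = ĝ} {Y = λ h k → Û h (suc k) ⊕ Û h (suc k)} Pos-ĝ NO-∑ĝ (NO-⊞ (NO-suc NO-Û) (NO-suc NO-Û))))

-- The majorant of K₂ in two parts of different use: `X′` grows along the levels and can be a common
-- factor, while the absorbed part is a product of first moments and is treated through Û.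
X′ B : Fam
X′ = X ⊞ Ê 1
B h k = X′ h k ⊕ Ĵ h ⊗ Û² h k

NO-X′ : NO 1 X′
NO-X′ = NO-⊞ {F = X} (NO-run {x₀ = x₂} {p = p₂} Pos-p₂ NO-x₂ NO-∑p₂) (NO-weaken z≤n (NO-Ê 1 (s≤s z≤n)))

Pos-X′ : ∀ h k → Pos (X′ h k)
Pos-X′ = NO-pos NO-X′

SO-∑X′ : SO 1 (∑# X′)
SO-∑X′ = SO-∑-⊞ {F = X} {G = Ê 1} (SO-∑-run {x₀ = x₂} {p = p₂} Pos-p₂ NO-x₂ NO-∑p₂) (SO-weaken z≤n (NO⇒SO (NO-∑Ê 1 (s≤s z≤n))))

-- The monotonicity demanded by `SO-common`. Adding the error `Ê 1` does not spoil it, because y ·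
-- `Ê 1 h k` is already a summand of the forcing `p₂`.
y⊗X′≼ : ∀ h k → y ⊗ X′ h k ≼ X′ h (suc k)
y⊗X′≼ h k = ≼-respˡ (solve 3 (λ z p q → z :* p :+ z :* q := z :* (p :+ q)) ≈-refl y (X h k) (Ê 1 h k))
  (≼-⊕ʳ (≼-⊕ (≼-⊗ Pos-y (run-pos (NO-pos NO-x₂ h 0) (Pos-p₂ h) k))
    (≼-⊕ʳ (≼-⊗ Pos-y (≼-⊕ʳ (Pos-Ê 1 h k) (≼-⊗ (Pos-ε h k) (Pos-W₂ h k))))
           (≼-⊗ (Pos-Ĵ h) (≼-⊗ (Pos-ĝ h k) (≼-⊕ (Pos-Û h (suc k)) (Pos-Û h (suc k)))))))
    (Pos-Ê 1 h (suc k)))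

K₂ K₃ : Fam
K₂ h k = K 1 (dif h k)
K₃ h k = K 2 (dif h k)

K₂≼B : ∀ h k → K₂ h k ≼ B h k
K₂≼B h k = ≼-resp
  (solve 3 (λ p j e → ((p :+ j) :+ e) :- j := p :+ e) ≈-refl (A 2 h k) (J h ⊗ (U k ⊗ U k)) (E 1 h k)) ≈-refl
  (≼-⊕ (≼-⊕ (Z₂≼X h k) (E≼Ê 1 h k)) (≼-⊝ (≼-⊗ (J≼Ĵ h) (≼-⊗ (U≼Û h k) (U≼Û h k)))))

-- The third moment

Q₃ Q̂₃ : Fam
Q₃ h k = cst (+ 3) ⊗ (K₁ h k ⊗ K₂ h k) ⊕ K₁ h k ⊗ (K₁ h k ⊗ K₁ h k)
Q̂₃ h k = cst (+ 3) ⊗ (Û h k ⊗ B h k) ⊕ Û³ h k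

Q₃≼ : ∀ h k → Q₃ h k ≼ Q̂₃ h k
Q₃≼ h k = ≼-⊕ (≼-⊗ (Pos-cst 3) (≼-⊗ (K₁≼Û h k) (K₂≼B h k))) (≼-⊗ (K₁≼Û h k) (≼-⊗ (K₁≼Û h k) (K₁≼Û h k)))

x₃ : ℕ → Ser
x₃ h = y ⊕ M 3 (lev (suc h))

SO-x₃ : SO 1 (λ h _ → x₃ h)
SO-x₃ = SO-⊞ {F = y#} (SO-weaken z≤n (NO⇒SO NO-y)) (SO-lag {F = λ h → M 3 (lev h)} SO-Λ₃)

-- The forcing is sorted by the factor to be carried forward: X′ with `Y₃ˣ`, Û with `Y₃ᵁ`. The first
-- contributes O(h) through X′, the second through Ĵ.
Y₃ˣ Y₃ᵁ p₃ : Fam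
Y₃ˣ h k = cst (+ 3) ⊗ Û h k
Y₃ᵁ h k = Ĵ h ⊗ (cst (+ 3) ⊗ Û² h k) ⊕ Û² h k
p₃ h k = ((𝟘 ⊕ y ⊗ Ê 2 h k) ⊕ y ⊗ (X′ h k ⊗ Y₃ˣ h k)) ⊕ y ⊗ (Û h k ⊗ Y₃ᵁ h k)

Â₃ : Fam
Â₃ = run# x₃ p₃

p₃-eq : ∀ h k → y ⊗ (Ê 2 h k ⊕ Q̂₃ h k) ≈ p₃ h k
p₃-eq h k = solve 5 (λ z e x u j →
    z :* (e :+ (con (+ 3) :* (u :* (x :+ j :* (u :* u))) :+ u :* (u :* u)))
    := ((con (+ 0) :+ z :* e) :+ z :* (x :* (con (+ 3) :* u))) :+ z :* (u :* (j :* (con (+ 3) :* (u :* u)) :+ u :* u)))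
  ≈-refl y (Ê 2 h k) (X′ h k) (Û h k) (Ĵ h)

A₃≼ : ∀ h k → A 3 h k ≼ Â₃ h k
A₃≼ h = run-dom (dif₀-dom 2 h) (λ k → ≈-trans (Dif.moment₃ h k) (split-y (A 3 h k) (E 2 h k) (Q₃ h k)))
  (λ k → ≼-respʳ (p₃-eq h k) (≼-⊗ Pos-y (≼-⊕ (E≼Ê 2 h k) (Q₃≼ h k))))

Pos-Y₃ˣ : ∀ h k → Pos (Y₃ˣ h k)
Pos-Y₃ˣ h k = ≼-⊗ (Pos-cst 3) (Pos-Û h k)

Pos-Y₃ᵁ : ∀ h k → Pos (Y₃ᵁ h k)
Pos-Y₃ᵁ h k = ≼-⊕ (≼-⊗ (Pos-Ĵ h) (≼-⊗ (Pos-cst 3) (Pos-Û² h k))) (Pos-Û² h k)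

NO-run-∑ : ∀ {j p} → (∀ h k → Pos (p h k)) → NO j (∑# p) → NO j (run# (λ _ → 𝟘) p)
NO-run-∑ pp n = NO-run {x₀ = λ _ → 𝟘} pp (NO-weaken z≤n (NO-cst 0)) n

SO-Â₃ : SO 1 Â₃
SO-Â₃ = SO-run-⊞ {p = ((λ _ _ → 𝟘) ⊞ (λ h k → y ⊗ Ê 2 h k)) ⊞ (λ h k → y ⊗ (X′ h k ⊗ Y₃ˣ h k))}
  (SO-run-⊞ {p = (λ _ _ → 𝟘) ⊞ (λ h k → y ⊗ Ê 2 h k)}
    (SO-run-⊞ {p = λ _ _ → 𝟘} (SO-run-0 SO-x₃)
      (SO-weaken {i = 0} z≤n (NO⇒SO (NO-run-∑ {p = λ h k → y ⊗ Ê 2 h k} (λ h k → ≼-⊗ Pos-y (Pos-Ê 2 h k)) (NO-∑-y {F = Ê 2} (NO-∑Ê 2 (s≤s (s≤s z≤n))))))))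
    (SO-common {i = 1} {j = 0} {X = X′} {Y = Y₃ˣ} Pos-Y₃ˣ y⊗X′≼ NO-X′ (SO-∑-cst {F = Û} 3 SO-∑Û)))
  (SO-common {i = 0} {j = 1} {X = Û} {Y = Y₃ᵁ} Pos-Y₃ᵁ y⊗Û≼ NO-Û
    (SO-∑-⊞ {F = λ h k → Ĵ h ⊗ (cst (+ 3) ⊗ Û² h k)} {G = Û²}
      (SO-∑-const {i = 1} {j = 0} {c = Ĵ} {F = λ h k → cst (+ 3) ⊗ Û² h k} NO-Ĵ (SO-∑-cst {F = Û²} 3 SO-∑Û²)) (SO-weaken z≤n SO-∑Û²)))

-- The fourth moment

R R̂ : Fam
R h k = cst (+ 3) ⊗ (K₂ h k ⊗ K₂ h k) ⊕ (cst (+ 6) ⊗ ((K₁ h k ⊗ K₁ h k) ⊗ K₂ h k) ⊕ (K₁ h k ⊗ K₁ h k) ⊗ (K₁ h k ⊗ K₁ h k))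
R̂ h k = cst (+ 3) ⊗ (B h k ⊗ B h k) ⊕ (cst (+ 6) ⊗ ((Û h k ⊗ Û h k) ⊗ B h k) ⊕ (Û h k ⊗ Û h k) ⊗ (Û h k ⊗ Û h k))

R≼ : ∀ h k → R h k ≼ R̂ h k
R≼ h k = ≼-⊕ (≼-⊗ (Pos-cst 3) (≼-⊗ (K₂≼B h k) (K₂≼B h k))) (≼-⊕ (≼-⊗ (Pos-cst 6) (≼-⊗ k² (K₂≼B h k))) (≼-⊗ k² k²))
  where
  k² = ≼-⊗ (K₁≼Û h k) (K₁≼Û h k)

4G : ℕ → Ser
4G h = cst (+ 4) ⊗ G h

NO-4G : NO 1 (λ h _ → 4G h)
NO-4G = NO-⊠ {i = 0} {F = cst# 4} (NO-cst 4) NO-geo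

Pos-4G : ∀ h → Pos (4G h)
Pos-4G h = NO-pos NO-4G h 0

-- 4 G U A₃ absorbs the term 4 K₁ A₃ of the recursion for A₄.
Z₄ P₄ : Fam
Z₄ h k = A 4 h k ⊕ 4G h ⊗ (U k ⊗ A 3 h k)
P₄ h k = y ⊗ (E 3 h k ⊕ R h k) ⊕ (y ⊗ (4G h ⊗ (U k ⊗ E 2 h k)) ⊕ (⊝ (y ⊗ (cst (+ 4) ⊗ (ε h k ⊗ K₃ h k)))
  ⊕ (y ⊗ (4G h ⊗ (y ⊗ (U k ⊗ Q₃ h k))) ⊕ 4G h ⊗ (gap (suc k) ⊗ A 3 h (suc k)))))

Z₄-step : ∀ h k → Z₄ h (suc k) ≈ y ⊗ Z₄ h k ⊕ P₄ h k
Z₄-step h k = ≈-trans (⊕-≈ (≈-trans (Dif.moment₄ h k) (⊗-≈ ≈-refl (⊕-≈ ≈-refl (⊕-≈ (⊗-≈ ≈-refl (⊗-≈ (K₁-eq h k) ≈-refl)) ≈-refl)))) (⊗-≈ ≈-refl (⊗-≈ (U-suc k) ≈-refl)))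
  (≈-trans (solve 12 (λ z g u e q a4 e4 a3 e3 r w a3′ →
      z :* ((a4 :+ e4) :+ (con (+ 4) :* (((g :* (con (+ 1) :- z)) :* u :- e) :* (a3 :+ e3)) :+ r)) :+ (con (+ 4) :* g) :* ((z :* u :+ q) :* a3′)
      := (con (+ 4) :* g) :* (z :* u :* a3′) :+ ((con (+ 4) :* g) :* (q :* a3′) :+
         z :* ((a4 :+ e4) :+ (con (+ 4) :* (((g :* (con (+ 1) :- z)) :* u :- e) :* (a3 :+ e3)) :+ r)))) ≈-refl
      y (G h) (U k) (ε h k) (gap (suc k)) (A 4 h k) (E 3 h k) (A 3 h k) (E 2 h k) (R h k) (Q₃ h k) (A 3 h (suc k)))
  -- The recursion for A₃ is inserted only next to y U, where y and 1 - y recombine to 1; next to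
  -- the gap A₃(k + 1) stays, as the gap is summable by itself.
  (≈-trans (⊕-≈ (⊗-≈ ≈-refl (⊗-≈ ≈-refl (Dif.moment₃ h k))) ≈-refl)
    (solve 12 (λ z g u e q a4 e4 a3 e3 r w a3′ →
      (con (+ 4) :* g) :* (z :* u :* (z :* ((a3 :+ e3) :+ w))) :+ ((con (+ 4) :* g) :* (q :* a3′) :+
         z :* ((a4 :+ e4) :+ (con (+ 4) :* (((g :* (con (+ 1) :- z)) :* u :- e) :* (a3 :+ e3)) :+ r)))
      := z :* (a4 :+ (con (+ 4) :* g) :* (u :* a3)) :+ (z :* (e4 :+ r) :+ (z :* ((con (+ 4) :* g) :* (u :* e3)) :+ (:- (z :* (con (+ 4) :* (e :* (a3 :+ e3))))
           :+ (z :* ((con (+ 4) :* g) :* (z :* (u :* w))) :+ (con (+ 4) :* g) :* (q :* a3′)))))) ≈-refl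
      y (G h) (U k) (ε h k) (gap (suc k)) (A 4 h k) (E 3 h k) (A 3 h k) (E 2 h k) (R h k) (Q₃ h k) (A 3 h (suc k)))))

-- Sorted as for the third moment, with h² as budget: X′ and the sum of `Y₄ˣ` take O(h) each, the
-- sum of `Y₄ᵁ` takes O(h²) next to the bounded Û, and the last three are summable errors times
-- bounded families.
Y₄ˣ Y₄ᵁ Y₄ᴱ Y₄ᵋ Y₄ᵍ p₄ : Fam
Y₄ˣ h k = (cst (+ 3) ⊗ X′ h k ⊕ cst (+ 6) ⊗ (Ĵ h ⊗ Û² h k)) ⊕ (cst (+ 6) ⊗ Û² h k ⊕ 4G h ⊗ (y ⊗ (cst (+ 3) ⊗ Û² h k)))
Y₄ᵁ h k = (cst (+ 3) ⊗ ((Ĵ h ⊗ Ĵ h) ⊗ Û³ h k) ⊕ cst (+ 6) ⊗ (Ĵ h ⊗ Û³ h k)) ⊕ (Û³ h k ⊕ (4G h ⊗ (y ⊗ (cst (+ 3) ⊗ (Ĵ h ⊗ Û³ h k))) ⊕ 4G h ⊗ (y ⊗ Û³ h k)))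
Y₄ᴱ h k = y ⊗ (4G h ⊗ Û h k)
Y₄ᵋ h k = y ⊗ (cst (+ 4) ⊗ (Â₃ h k ⊕ Ê 2 h k))
Y₄ᵍ h k = 4G h ⊗ Â₃ h (suc k)
p₄ h k = (((((𝟘 ⊕ y ⊗ Ê 3 h k) ⊕ y ⊗ (X′ h k ⊗ Y₄ˣ h k)) ⊕ y ⊗ (Û h k ⊗ Y₄ᵁ h k)) ⊕ Ê 2 h k ⊗ Y₄ᴱ h k) ⊕ ε h k ⊗ Y₄ᵋ h k) ⊕ ĝ h k ⊗ Y₄ᵍ h k

p₄-eq : ∀ h k → y ⊗ (Ê 3 h k ⊕ R̂ h k) ⊕ (y ⊗ (4G h ⊗ (Û h k ⊗ Ê 2 h k)) ⊕ (y ⊗ (cst (+ 4) ⊗ (ε h k ⊗ (Â₃ h k ⊕ Ê 2 h k)))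
  ⊕ (y ⊗ (4G h ⊗ (y ⊗ (Û h k ⊗ Q̂₃ h k))) ⊕ 4G h ⊗ (ĝ h k ⊗ Â₃ h (suc k))))) ≈ p₄ h k
p₄-eq h k = solve 11 (λ z e x u j f d a3 e2 g a3′ →
    let b = x :+ j :* (u :* u) ; u³ = u :* (u :* u) in
    z :* (e :+ (con (+ 3) :* (b :* b) :+ (con (+ 6) :* ((u :* u) :* b) :+ (u :* u) :* (u :* u))))
      :+ (z :* (f :* (u :* e2)) :+ (z :* (con (+ 4) :* (d :* (a3 :+ e2)))
      :+ (z :* (f :* (z :* (u :* (con (+ 3) :* (u :* b) :+ u³)))) :+ f :* (g :* a3′))))
    := (((((con (+ 0) :+ z :* e)
         :+ z :* (x :* ((con (+ 3) :* x :+ con (+ 6) :* (j :* (u :* u))) :+ (con (+ 6) :* (u :* u) :+ f :* (z :* (con (+ 3) :* (u :* u)))))))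
         :+ z :* (u :* ((con (+ 3) :* ((j :* j) :* u³) :+ con (+ 6) :* (j :* u³)) :+ (u³ :+ (f :* (z :* (con (+ 3) :* (j :* u³))) :+ f :* (z :* u³))))))
         :+ e2 :* (z :* (f :* u))) :+ d :* (z :* (con (+ 4) :* (a3 :+ e2)))) :+ g :* (f :* a3′))
  ≈-refl y (Ê 3 h k) (X′ h k) (Û h k) (Ĵ h) (4G h) (ε h k) (Â₃ h k) (Ê 2 h k) (ĝ h k) (Â₃ h (suc k))

P₄≼ : ∀ h k → P₄ h k ≼ p₄ h k
P₄≼ h k = ≼-respʳ (p₄-eq h k) (≼-⊕ (≼-⊗ Pos-y (≼-⊕ (E≼Ê 3 h k) (R≼ h k)))
  (≼-⊕ (≼-⊗ Pos-y (≼-⊗ (Pos-4G h) (≼-⊗ (U≼Û h k) (E≼Ê 2 h k))))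
  (≼-⊕ (≼-⊝ (≼-⊗ Pos-y (≼-⊗ (Pos-cst 4) (≼-⊗ (Pos-ε h k) (≼-⊕ (A₃≼ h k) (E≼Ê 2 h k))))))
  (≼-⊕ (≼-⊗ Pos-y (≼-⊗ (Pos-4G h) (≼-⊗ Pos-y (≼-⊗ (U≼Û h k) (Q₃≼ h k)))))
       (≼-⊗ (Pos-4G h) (≼-⊗ (gap≼ĝ h k) (A₃≼ h (suc k))))))))

x₄ : ℕ → Ser
x₄ h = (y ⊕ M 4 (lev (suc h))) ⊕ 4G h ⊗ (Û h 0 ⊗ Â₃ h 0)

Ẑ₄ : Fam
Ẑ₄ = run# x₄ p₄

Z₄≼ : ∀ h k → Z₄ h k ≼ Ẑ₄ h k
Z₄≼ h = run-dom (≼-⊕ (dif₀-dom 3 h) (≼-⊗ (Pos-4G h) (≼-⊗ (U≼Û h 0) (A₃≼ h 0)))) (Z₄-step h) (P₄≼ h)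

SO-at : ∀ {j F} → SO j F → SO j (λ h _ → F h 0)
SO-at (C ▹ n) = C ▹ λ h _ → n h 0

SO-x₄ : SO 2 (λ h _ → x₄ h)
SO-x₄ = SO-⊞ {F = y# ⊞ (λ h _ → M 4 (lev (suc h)))} (SO-⊞ {F = y#} (SO-weaken z≤n (NO⇒SO NO-y)) (SO-lag {F = λ h → M 4 (lev h)} SO-Λ₄))
  (SO-⊠ {i = 1} {j = 1} {F = λ h _ → 4G h} NO-4G (SO-at {F = Û ⊠ Â₃} (SO-⊠ {i = 0} NO-Û SO-Â₃)))

Pos-Y₄ˣ : ∀ h k → Pos (Y₄ˣ h k)
Pos-Y₄ˣ h k = ≼-⊕ (≼-⊕ (≼-⊗ (Pos-cst 3) (Pos-X′ h k)) (≼-⊗ (Pos-cst 6) (≼-⊗ (Pos-Ĵ h) (Pos-Û² h k))))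
  (≼-⊕ (≼-⊗ (Pos-cst 6) (Pos-Û² h k)) (≼-⊗ (Pos-4G h) (≼-⊗ Pos-y (≼-⊗ (Pos-cst 3) (Pos-Û² h k)))))

Pos-Y₄ᵁ : ∀ h k → Pos (Y₄ᵁ h k)
Pos-Y₄ᵁ h k = ≼-⊕ (≼-⊕ (≼-⊗ (Pos-cst 3) (≼-⊗ (≼-⊗ (Pos-Ĵ h) (Pos-Ĵ h)) (Pos-Û³ h k))) (≼-⊗ (Pos-cst 6) (≼-⊗ (Pos-Ĵ h) (Pos-Û³ h k))))
  (≼-⊕ (Pos-Û³ h k) (≼-⊕ (≼-⊗ (Pos-4G h) (≼-⊗ Pos-y (≼-⊗ (Pos-cst 3) (≼-⊗ (Pos-Ĵ h) (Pos-Û³ h k))))) (≼-⊗ (Pos-4G h) (≼-⊗ Pos-y (Pos-Û³ h k)))))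

SO-∑Y₄ˣ : SO 1 (∑# Y₄ˣ)
SO-∑Y₄ˣ = SO-∑-⊞ {F = (λ h k → cst (+ 3) ⊗ X′ h k) ⊞ (λ h k → cst (+ 6) ⊗ (Ĵ h ⊗ Û² h k))} {G = λ h k → cst (+ 6) ⊗ Û² h k ⊕ 4G h ⊗ (y ⊗ (cst (+ 3) ⊗ Û² h k))}
  (SO-∑-⊞ {F = λ h k → cst (+ 3) ⊗ X′ h k} {G = λ h k → cst (+ 6) ⊗ (Ĵ h ⊗ Û² h k)} (SO-∑-cst {F = X′} 3 SO-∑X′)
    (SO-∑-cst {F = λ h k → Ĵ h ⊗ Û² h k} 6 (SO-∑-const {i = 1} {j = 0} {c = Ĵ} {F = Û²} NO-Ĵ SO-∑Û²)))
  (SO-∑-⊞ {F = λ h k → cst (+ 6) ⊗ Û² h k} {G = λ h k → 4G h ⊗ (y ⊗ (cst (+ 3) ⊗ Û² h k))} (SO-weaken z≤n (SO-∑-cst {F = Û²} 6 SO-∑Û²))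
    (SO-∑-const {i = 1} {j = 0} {c = 4G} {F = λ h k → y ⊗ (cst (+ 3) ⊗ Û² h k)} NO-4G (SO-∑-y {F = λ h k → cst (+ 3) ⊗ Û² h k} (SO-∑-cst {F = Û²} 3 SO-∑Û²))))

SO-∑Y₄ᵁ : SO 2 (∑# Y₄ᵁ)
SO-∑Y₄ᵁ = SO-∑-⊞ {F = (λ h k → cst (+ 3) ⊗ ((Ĵ h ⊗ Ĵ h) ⊗ Û³ h k)) ⊞ (λ h k → cst (+ 6) ⊗ (Ĵ h ⊗ Û³ h k))}
    {G = Û³ ⊞ ((λ h k → 4G h ⊗ (y ⊗ (cst (+ 3) ⊗ (Ĵ h ⊗ Û³ h k)))) ⊞ (λ h k → 4G h ⊗ (y ⊗ Û³ h k)))}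
  (SO-∑-⊞ {F = λ h k → cst (+ 3) ⊗ ((Ĵ h ⊗ Ĵ h) ⊗ Û³ h k)} {G = λ h k → cst (+ 6) ⊗ (Ĵ h ⊗ Û³ h k)}
    (SO-∑-cst {F = λ h k → (Ĵ h ⊗ Ĵ h) ⊗ Û³ h k} 3 (SO-∑-const {i = 2} {j = 0} {c = λ h → Ĵ h ⊗ Ĵ h} {F = Û³} (NO-⊠ {i = 1} {j = 1} NO-Ĵ NO-Ĵ) SO-∑Û³))
    (SO-weaken {i = 1} (s≤s z≤n) (SO-∑-cst {F = λ h k → Ĵ h ⊗ Û³ h k} 6 ĴÛ³)))
  (SO-∑-⊞ {F = Û³} {G = (λ h k → 4G h ⊗ (y ⊗ (cst (+ 3) ⊗ (Ĵ h ⊗ Û³ h k)))) ⊞ (λ h k → 4G h ⊗ (y ⊗ Û³ h k))} (SO-weaken z≤n SO-∑Û³)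
    (SO-∑-⊞ {F = λ h k → 4G h ⊗ (y ⊗ (cst (+ 3) ⊗ (Ĵ h ⊗ Û³ h k)))} {G = λ h k → 4G h ⊗ (y ⊗ Û³ h k)}
      (SO-∑-const {i = 1} {j = 1} {c = 4G} {F = λ h k → y ⊗ (cst (+ 3) ⊗ (Ĵ h ⊗ Û³ h k))} NO-4G
        (SO-∑-y {F = λ h k → cst (+ 3) ⊗ (Ĵ h ⊗ Û³ h k)} (SO-∑-cst {F = λ h k → Ĵ h ⊗ Û³ h k} 3 ĴÛ³)))
      (SO-weaken {i = 1} (s≤s z≤n) (SO-∑-const {i = 1} {j = 0} {c = 4G} {F = λ h k → y ⊗ Û³ h k} NO-4G (SO-∑-y {F = Û³} SO-∑Û³)))))
  where
  ĴÛ³ : SO 1 (∑# (λ h k → Ĵ h ⊗ Û³ h k))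
  ĴÛ³ = SO-∑-const {i = 1} {j = 0} {c = Ĵ} {F = Û³} NO-Ĵ SO-∑Û³

SO-Ẑ₄ : SO 2 Ẑ₄
SO-Ẑ₄ = SO-run-⊞ {p = q₅} {q = ĝ ⊠ Y₄ᵍ} (SO-run-⊞ {p = q₄} {q = ε ⊠ Y₄ᵋ} (SO-run-⊞ {p = q₃} {q = Ê 2 ⊠ Y₄ᴱ}
    (SO-run-⊞ {p = q₂} {q = λ h k → y ⊗ (Û h k ⊗ Y₄ᵁ h k)} (SO-run-⊞ {p = q₁} {q = λ h k → y ⊗ (X′ h k ⊗ Y₄ˣ h k)}
      (SO-run-⊞ {p = λ _ _ → 𝟘} {q = λ h k → y ⊗ Ê 3 h k} (SO-run-0 SO-x₄)
        (SO-weaken {i = 0} z≤n (NO⇒SO (NO-run-∑ {p = λ h k → y ⊗ Ê 3 h k} (λ h k → ≼-⊗ Pos-y (Pos-Ê 3 h k)) (NO-∑-y {F = Ê 3} (NO-∑Ê 3 ℕP.≤-refl))))))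
      (SO-common {i = 1} {j = 1} {X = X′} {Y = Y₄ˣ} Pos-Y₄ˣ y⊗X′≼ NO-X′ SO-∑Y₄ˣ))
      (SO-common {i = 0} {j = 2} {X = Û} {Y = Y₄ᵁ} Pos-Y₄ᵁ y⊗Û≼ NO-Û SO-∑Y₄ᵁ))
    (SO-weaken {i = 1} (s≤s z≤n) (SO-run-err {i = 0} {j = 1} {E = Ê 2} {Y = Y₄ᴱ} (Pos-Ê 2) (NO-∑Ê 2 (s≤s (s≤s z≤n)))
      (SO-⊠ {i = 0} {F = y#} NO-y (NO⇒SO (NO-⊠ {i = 1} {j = 0} {F = λ h _ → 4G h} NO-4G NO-Û))))))
    (SO-weaken {i = 1} (s≤s z≤n) (SO-run-err {i = 0} {j = 1} {E = ε} {Y = Y₄ᵋ} Pos-ε NO-∑ε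
      (SO-⊠ {i = 0} {F = y#} NO-y (SO-⊠ {i = 0} {F = cst# 4} (NO-cst 4) (SO-⊞ {F = Â₃} SO-Â₃ (SO-weaken z≤n (NO⇒SO (NO-Ê 2 (s≤s (s≤s z≤n)))))))))))
    (SO-run-err {i = 0} {j = 2} {E = ĝ} {Y = Y₄ᵍ} Pos-ĝ NO-∑ĝ (SO-⊠ {i = 1} {j = 1} {F = λ h _ → 4G h} NO-4G (SO-suc SO-Â₃)))
  where
  q₁ q₂ q₃ q₄ q₅ : Fam
  q₁ = (λ _ _ → 𝟘) ⊞ (λ h k → y ⊗ Ê 3 h k)
  q₂ = q₁ ⊞ (λ h k → y ⊗ (X′ h k ⊗ Y₄ˣ h k))
  q₃ = q₂ ⊞ (λ h k → y ⊗ (Û h k ⊗ Y₄ᵁ h k))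
  q₄ = q₃ ⊞ (Ê 2 ⊠ Y₄ᴱ)
  q₅ = q₄ ⊞ (ε ⊠ Y₄ᵋ)

opaque
  -- The absorbing term is subtracted again; with a factor `4G` and a third moment of order h each,
  -- it is itself O(h²).
  SO-A₄ : SO 2 (A 4)
  SO-A₄ = SO-mono (λ h k → ≼-respˡ (solve 2 (λ p q → (p :+ q) :- q := p) ≈-refl (A 4 h k) (4G h ⊗ (U k ⊗ A 3 h k)))
      (≼-⊕ (Z₄≼ h k) (≼-⊝ (≼-⊗ (Pos-4G h) (≼-⊗ (U≼Û h k) (A₃≼ h k))))))
    (SO-⊞ {F = Ẑ₄} SO-Ẑ₄ (SO-⊠ {i = 1} {j = 1} {F = λ h _ → 4G h} NO-4G (SO-⊠ {i = 0} NO-Û SO-Â₃)))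

∑-dif⁴ : ∃ λ C → ∀ n r h → ∑ (trees n) (λ t → (+ L t r ℤ.- + L t (r ℕ.+ h)) ℤ.^ 4) ℤ.≤ + (C ℕ.* (h ℕ.^ 2 ℕ.* n)) ℤ.* + length (trees n)
∑-dif⁴ = SO.scale SO-A₄ , go
  where
  C = SO.scale SO-A₄
  go : ∀ n r h → ∑ (trees n) (λ t → (+ L t r ℤ.- + L t (r ℕ.+ h)) ℤ.^ 4) ℤ.≤ + (C ℕ.* (h ℕ.^ 2 ℕ.* n)) ℤ.* + length (trees n)
  go n r zero = ℤP.≤-trans (ℤP.≤-reflexive (∑-zero (All.universal (λ t → cong (ℤ._^ 4)
      (trans (cong (λ z → lev r t ℤ.- lev z t) (ℕP.+-identityʳ r)) (ℤP.+-inverseʳ (lev r t)))) (trees n))))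
    (0≤* {+ (C ℕ.* (0 ℕ.* n))} 0≤n 0≤n)
  -- There is no tree without vertices. The case is separate because a(0) = 1 is not at most 0 ·
  -- y(0).
  go zero r (suc h) = 0≤* {+ (C ℕ.* (suc h ℕ.^ 2 ℕ.* 0))} {+ 0} 0≤n 0≤n
  go n@(suc m) r (suc h) = begin
    A 4 h r n                                   ≤⟨ ℤP.≤-trans (≤-abs _) (le (SO.holds SO-A₄ h r) n) ⟩
    (cst (+ (C ℕ.* suc h ℕ.^ 2)) ⊗ a) n        ≡⟨ ⊗-cst (+ (C ℕ.* suc h ℕ.^ 2)) a n ⟩
    + (C ℕ.* suc h ℕ.^ 2) ℤ.* a n              ≤⟨ ℤP.*-monoˡ-≤-nonNeg (+ (C ℕ.* suc h ℕ.^ 2)) (a≤size m) ⟩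
    + (C ℕ.* suc h ℕ.^ 2) ℤ.* (+ n ℤ.* y n)    ≡⟨ sym (ℤP.*-assoc (+ (C ℕ.* suc h ℕ.^ 2)) (+ n) (y n)) ⟩
    + (C ℕ.* suc h ℕ.^ 2) ℤ.* + n ℤ.* y n      ≡⟨ cong₂ ℤ._*_ (trans (sym (ℤP.pos-* (C ℕ.* suc h ℕ.^ 2) n)) (cong +_ (ℕP.*-assoc C (suc h ℕ.^ 2) n))) (y-length n) ⟩
    + (C ℕ.* (suc h ℕ.^ 2 ℕ.* n)) ℤ.* + length (trees n) ∎
    where open ℤP.≤-Reasoning

-- Means

/≤/ : ∀ i j m n → i ℤ.* + suc n ℤ.≤ j ℤ.* + suc m → i ℚ./ suc m ℚ.≤ j ℚ./ suc n
/≤/ i j m n h = ℚP.toℚᵘ-cancel-≤ (begin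
  ℚ.toℚᵘ (i ℚ./ suc m) ≃⟨ ℚP.toℚᵘ-fromℚᵘ (mkℚᵘ i m) ⟩
  mkℚᵘ i m             ≤⟨ ℚᵘ.*≤* h ⟩
  mkℚᵘ j n             ≃⟨ ℚᵘP.≃-sym (ℚP.toℚᵘ-fromℚᵘ (mkℚᵘ j n)) ⟩
  ℚ.toℚᵘ (j ℚ./ suc n) ∎)
  where open ℚᵘP.≤-Reasoning

/1-* : ∀ i j → (i ℚ./ 1) ℚ.* (j ℚ./ 1) ≡ (i ℤ.* j) ℚ./ 1
/1-* i j = ℚP.toℚᵘ-injective (begin
  ℚ.toℚᵘ ((i ℚ./ 1) ℚ.* (j ℚ./ 1))          ≈⟨ ℚP.toℚᵘ-homo-* (i ℚ./ 1) (j ℚ./ 1) ⟩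
  ℚ.toℚᵘ (i ℚ./ 1) ℚᵘ.* ℚ.toℚᵘ (j ℚ./ 1)    ≈⟨ ℚᵘP.*-cong (ℚP.toℚᵘ-fromℚᵘ (mkℚᵘ i 0)) (ℚP.toℚᵘ-fromℚᵘ (mkℚᵘ j 0)) ⟩
  mkℚᵘ (i ℤ.* j) 0                           ≈⟨ ℚᵘP.≃-sym (ℚP.toℚᵘ-fromℚᵘ (mkℚᵘ (i ℤ.* j) 0)) ⟩
  ℚ.toℚᵘ ((i ℤ.* j) ℚ./ 1)                   ∎)
  where open import Relation.Binary.Reasoning.Setoid ℚᵘP.≃-setoid

foldr-∑ : ∀ {Y : Tree → ℤ} ts → foldr ℤ._+_ (+ 0) (map Y ts) ≡ ∑ ts Y
foldr-∑ []       = refl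
foldr-∑ {Y} (t ∷ ts) = cong (λ z → Y t ℤ.+ z) (foldr-∑ ts)

𝔼-≤ : ∀ n (Y : Tree → ℤ) c → ∑ (trees n) Y ℤ.≤ + c ℤ.* + length (trees n) → 𝔼 n Y ℚ.≤ + c ℚ./ 1
𝔼-≤ n Y c = go (trees n)
  where
  go : ∀ ts → ∑ ts Y ℤ.≤ + c ℤ.* + length ts → mean (map Y ts) ℚ.≤ + c ℚ./ 1
  go []       h = /≤/ (+ 0) (+ c) 0 0 (subst (+ 0 ℤ.≤_) (sym (ℤP.*-identityʳ (+ c))) 0≤n)
  go (t ∷ ts) h = /≤/ (foldr ℤ._+_ (+ 0) (map Y (t ∷ ts))) (+ c) (length (map Y ts)) 0 (subst₂ ℤ._≤_
    (trans (sym (foldr-∑ {Y} (t ∷ ts))) (sym (ℤP.*-identityʳ _))) (cong (λ z → + c ℤ.* + suc z) (sym (ListP.length-map Y ts))) h)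

fourth-moment : ∃ λ (C : ℚ) → 0ℚ ℚ.< C × (∀ (n r h : ℕ) →
  𝔼 n (λ t → (+ L t r ℤ.- + L t (r ℕ.+ h)) ℤ.^ 4) ℚ.≤ C ℚ.* (+ (h ℕ.^ 2 ℕ.* n) ℚ./ 1))
fourth-moment with ∑-dif⁴
-- The constant has to be positive, hence `suc C`.
... | C , h = + suc C ℚ./ 1 , ℚP.positive⁻¹ (+ suc C ℚ./ 1) {{ℚP.normalize-pos (suc C) 1}} , λ n r k →
  subst (𝔼 n (λ t → (+ L t r ℤ.- + L t (r ℕ.+ k)) ℤ.^ 4) ℚ.≤_)
    (trans (cong (λ z → z ℚ./ 1) (ℤP.pos-* (suc C) (k ℕ.^ 2 ℕ.* n))) (sym (/1-* (+ suc C) (+ (k ℕ.^ 2 ℕ.* n)))))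
    (𝔼-≤ n _ (suc C ℕ.* (k ℕ.^ 2 ℕ.* n)) (ℤP.≤-trans (h n r k)
      (ℤP.*-monoʳ-≤-nonNeg (+ length (trees n)) (ℕ≤⇒ℤ≤ (ℕP.*-monoˡ-≤ (k ℕ.^ 2 ℕ.* n) (ℕP.n≤1+n C))))))

-- Rational inequalities

opaque
  ι : ℕ → ℚ
  ι n = + n ℚ./ 1

  ι-def : ∀ n → ι n ≡ + n ℚ./ 1
  ι-def n = refl

  ι-0 : ι 0 ≡ 0ℚ
  ι-0 = refl

  ι-1 : ι 1 ≡ 1ℚ
  ι-1 = refl

q≤-by : ∀ {x z d} → z ≡ x ℚ.+ d → 0ℚ ℚ.≤ d → x ℚ.≤ z
q≤-by {x} e p = subst₂ ℚ._≤_ (ℚP.+-identityʳ x) (sym e) (ℚP.+-monoʳ-≤ x p)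

q0≤- : ∀ {x z} → x ℚ.≤ z → 0ℚ ℚ.≤ z ℚ.- x
q0≤- {x} {z} p = subst (ℚ._≤ z ℚ.- x) (ℚP.+-inverseʳ x) (ℚP.+-monoˡ-≤ (ℚ.- x) p)

q0≤+ : ∀ {x z} → 0ℚ ℚ.≤ x → 0ℚ ℚ.≤ z → 0ℚ ℚ.≤ x ℚ.+ z
q0≤+ = ℚP.+-mono-≤

*≤* : ∀ {p q r s} → 0ℚ ℚ.≤ p → 0ℚ ℚ.≤ s → p ℚ.≤ q → r ℚ.≤ s → p ℚ.* r ℚ.≤ q ℚ.* s
*≤* {p} {q} {r} {s} 0≤p 0≤s p≤q r≤s = ℚP.≤-trans (ℚP.*-monoˡ-≤-nonNeg p {{ℚ.nonNegative 0≤p}} r≤s)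
  (ℚP.*-monoʳ-≤-nonNeg s {{ℚ.nonNegative 0≤s}} p≤q)

q0≤* : ∀ {x z} → 0ℚ ℚ.≤ x → 0ℚ ℚ.≤ z → 0ℚ ℚ.≤ x ℚ.* z
q0≤* {x} {z} p q = subst (ℚ._≤ x ℚ.* z) (ℚP.*-zeroˡ 0ℚ) (*≤* {0ℚ} {x} {0ℚ} {z} ℚP.≤-refl q p q)

∣∣≤ : ∀ {x r} → x ℚ.≤ r → ℚ.- x ℚ.≤ r → ℚ.∣ x ∣ ℚ.≤ r
∣∣≤ {x} p q with ℚP.∣p∣≡p∨∣p∣≡-p x
... | inj₁ e = subst (ℚ._≤ _) (sym e) p
... | inj₂ e = subst (ℚ._≤ _) (sym e) q

≤∣∣ : ∀ x → x ℚ.≤ ℚ.∣ x ∣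
≤∣∣ x with ℚP.≤-total 0ℚ x
... | inj₁ p = ℚP.≤-reflexive (sym (ℚP.0≤p⇒∣p∣≡p p))
... | inj₂ p = ℚP.≤-trans p (ℚP.0≤∣p∣ x)

-≤∣∣ : ∀ x → ℚ.- x ℚ.≤ ℚ.∣ x ∣
-≤∣∣ x = subst (ℚ.- x ℚ.≤_) (ℚP.∣-p∣≡∣p∣ x) (≤∣∣ (ℚ.- x))

∣-∣-sym : ∀ x z → ℚ.∣ x ℚ.- z ∣ ≡ ℚ.∣ z ℚ.- x ∣
∣-∣-sym x z = trans (cong ℚ.∣_∣ (ℚS.solve 2 (λ x z → x ℚS.:- z ℚS.:= ℚS.:- (z ℚS.:- x)) refl x z)) (ℚP.∣-p∣≡∣p∣ (z ℚ.- x))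

∣-∣-tri : ∀ x z w {r s} → ℚ.∣ x ℚ.- z ∣ ℚ.≤ r → ℚ.∣ z ℚ.- w ∣ ℚ.≤ s → ℚ.∣ x ℚ.- w ∣ ℚ.≤ r ℚ.+ s
∣-∣-tri x z w p q = ℚP.≤-trans (subst (λ u → ℚ.∣ u ∣ ℚ.≤ ℚ.∣ x ℚ.- z ∣ ℚ.+ ℚ.∣ z ℚ.- w ∣) (ℚS.solve 3 (λ x z w → (x ℚS.:- z) ℚS.:+ (z ℚS.:- w) ℚS.:= x ℚS.:- w) refl x z w)
  (ℚP.∣p+q∣≤∣p∣+∣q∣ (x ℚ.- z) (z ℚ.- w))) (ℚP.+-mono-≤ p q)

∣-∣-upper : ∀ {x z r} → ℚ.∣ x ℚ.- z ∣ ℚ.≤ r → x ℚ.≤ z ℚ.+ r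
∣-∣-upper {x} {z} {r} p = q≤-by (ℚS.solve 3 (λ x z r → z ℚS.:+ r ℚS.:= x ℚS.:+ (r ℚS.:- (x ℚS.:- z))) refl x z r) (q0≤- (ℚP.≤-trans (≤∣∣ (x ℚ.- z)) p))

∣-∣-lower : ∀ {x z r} → ℚ.∣ x ℚ.- z ∣ ℚ.≤ r → z ℚ.≤ x ℚ.+ r
∣-∣-lower {x} {z} p = ∣-∣-upper (subst (ℚ._≤ _) (∣-∣-sym x z) p)

∣-∣-intro : ∀ {x z r} → x ℚ.≤ z ℚ.+ r → z ℚ.≤ x ℚ.+ r → ℚ.∣ x ℚ.- z ∣ ℚ.≤ r
∣-∣-intro {x} {z} {r} p q = ∣∣≤ (q≤-by (ℚS.solve 3 (λ x z r → r ℚS.:= (x ℚS.:- z) ℚS.:+ (z ℚS.:+ r ℚS.:- x)) refl x z r) (q0≤- p))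
  (q≤-by (ℚS.solve 3 (λ x z r → r ℚS.:= ℚS.:- (x ℚS.:- z) ℚS.:+ (x ℚS.:+ r ℚS.:- z)) refl x z r) (q0≤- q))

∣*∣ : ∀ x z {r s} → ℚ.∣ x ∣ ℚ.≤ r → ℚ.∣ z ∣ ℚ.≤ s → ℚ.∣ x ℚ.* z ∣ ℚ.≤ r ℚ.* s
∣*∣ x z {r} {s} p q = subst (ℚ._≤ r ℚ.* s) (sym (ℚP.∣p*q∣≡∣p∣*∣q∣ x z)) (*≤* (ℚP.0≤∣p∣ x) (ℚP.≤-trans (ℚP.0≤∣p∣ z) q) p q)

≤+∣-∣ : ∀ x z → x ℚ.≤ z ℚ.+ ℚ.∣ x ℚ.- z ∣
≤+∣-∣ x z = ∣-∣-upper {x} {z} ℚP.≤-refl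

≤+∣-∣′ : ∀ x z → z ℚ.≤ x ℚ.+ ℚ.∣ x ℚ.- z ∣
≤+∣-∣′ x z = ∣-∣-lower {x} {z} ℚP.≤-refl

⊔-lip : ∀ c x z → ℚ.∣ (c ℚ.⊔ x) ℚ.- (c ℚ.⊔ z) ∣ ℚ.≤ ℚ.∣ x ℚ.- z ∣
⊔-lip c x z = ∣-∣-intro (half x z (ℚP.0≤∣p∣ (x ℚ.- z)) (≤+∣-∣ x z)) (half z x (ℚP.0≤∣p∣ (x ℚ.- z)) (≤+∣-∣′ x z))
  where
  half : ∀ x z {r} → 0ℚ ℚ.≤ r → x ℚ.≤ z ℚ.+ r → c ℚ.⊔ x ℚ.≤ (c ℚ.⊔ z) ℚ.+ r
  half x z {r} 0≤r h = ℚP.⊔-lub (ℚP.≤-trans (ℚP.p≤p⊔q c z) (q≤-by refl 0≤r)) (ℚP.≤-trans h (ℚP.+-monoˡ-≤ r (ℚP.p≤q⊔p c z)))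

⊓-lip : ∀ c x z → ℚ.∣ (c ℚ.⊓ x) ℚ.- (c ℚ.⊓ z) ∣ ℚ.≤ ℚ.∣ x ℚ.- z ∣
⊓-lip c x z = ∣-∣-intro (half x z (ℚP.0≤∣p∣ (x ℚ.- z)) (≤+∣-∣ x z)) (half z x (ℚP.0≤∣p∣ (x ℚ.- z)) (≤+∣-∣′ x z))
  where
  half : ∀ x z {r} → 0ℚ ℚ.≤ r → x ℚ.≤ z ℚ.+ r → c ℚ.⊓ x ℚ.≤ (c ℚ.⊓ z) ℚ.+ r
  half x z {r} 0≤r h with ℚP.⊓-sel c z
  ... | inj₁ e = subst (λ w → c ℚ.⊓ x ℚ.≤ w ℚ.+ r) (sym e) (ℚP.≤-trans (ℚP.p⊓q≤p c x) (q≤-by refl 0≤r))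
  ... | inj₂ e = subst (λ w → c ℚ.⊓ x ℚ.≤ w ℚ.+ r) (sym e) (ℚP.≤-trans (ℚP.p⊓q≤q c x) h)

opaque
  unfolding ι

  ι-+ : ∀ m n → ι (m ℕ.+ n) ≡ ι m ℚ.+ ι n
  ι-+ m n = ℚP.toℚᵘ-injective (begin
    ℚ.toℚᵘ (ι (m ℕ.+ n))                ≈⟨ ℚP.toℚᵘ-fromℚᵘ (mkℚᵘ (+ (m ℕ.+ n)) 0) ⟩
    mkℚᵘ (+ (m ℕ.+ n)) 0                ≈⟨ ℚᵘ.*≡* (cong (ℤ._* + 1) (trans (ℤP.pos-+ m n) (cong₂ ℤ._+_ (sym (ℤP.*-identityʳ (+ m))) (sym (ℤP.*-identityʳ (+ n)))))) ⟩
    mkℚᵘ (+ m) 0 ℚᵘ.+ mkℚᵘ (+ n) 0      ≈⟨ ℚᵘP.≃-sym (ℚᵘP.+-cong (ℚP.toℚᵘ-fromℚᵘ (mkℚᵘ (+ m) 0)) (ℚP.toℚᵘ-fromℚᵘ (mkℚᵘ (+ n) 0))) ⟩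
    ℚ.toℚᵘ (ι m) ℚᵘ.+ ℚ.toℚᵘ (ι n)      ≈⟨ ℚᵘP.≃-sym (ℚP.toℚᵘ-homo-+ (ι m) (ι n)) ⟩
    ℚ.toℚᵘ (ι m ℚ.+ ι n)                ∎)
    where open import Relation.Binary.Reasoning.Setoid ℚᵘP.≃-setoid

  ι-* : ∀ m n → ι (m ℕ.* n) ≡ ι m ℚ.* ι n
  ι-* m n = trans (cong (λ z → z ℚ./ 1) (ℤP.pos-* m n)) (sym (/1-* (+ m) (+ n)))

ι-suc : ∀ n → ι (suc n) ≡ 1ℚ ℚ.+ ι n
ι-suc n = trans (ι-+ 1 n) (cong (ℚ._+ ι n) ι-1)

opaque
  unfolding ι

  ι-mono : ∀ {m n} → m ℕ.≤ n → ι m ℚ.≤ ι n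
  ι-mono {m} {n} p = /≤/ (+ m) (+ n) 0 0 (ℤP.*-monoʳ-≤-nonNeg (+ 1) (ℕ≤⇒ℤ≤ p))

0≤ι : ∀ n → 0ℚ ℚ.≤ ι n
0≤ι n = subst (ℚ._≤ ι n) ι-0 (ι-mono {0} {n} z≤n)

ι-cancel : ∀ {m n} → ι m ℚ.≤ ι n → m ℕ.≤ n
ι-cancel {m} {n} p with m ℕP.≤? n
... | yes q = q
... | no q = contradiction (ℚP.≤-trans (ℚP.≤-reflexive (sym (ι-suc n))) (ℚP.≤-trans (ι-mono (ℕP.≰⇒> q)) p))
    (λ h → ℚP.<-irrefl refl (ℚP.<-≤-trans (ℚP.positive⁻¹ 1ℚ) (q≤-by′ h)))
  where
  q≤-by′ : 1ℚ ℚ.+ ι n ℚ.≤ ι n → 1ℚ ℚ.≤ 0ℚ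
  q≤-by′ h = q≤-by (ℚS.solve 2 (λ a b → ℚS.con 0ℚ ℚS.:= a ℚS.:+ (b ℚS.:- (a ℚS.:+ b))) refl 1ℚ (ι n)) (q0≤- h)

opaque
  unfolding ι

  inv : ℕ → ℚ
  inv n = + 1 ℚ./ suc n

  inv-ι : ∀ n → inv n ℚ.* ι (suc n) ≡ 1ℚ
  inv-ι n = ℚP.toℚᵘ-injective (begin
    ℚ.toℚᵘ (inv n ℚ.* ι (suc n))              ≈⟨ ℚP.toℚᵘ-homo-* (inv n) (ι (suc n)) ⟩
    ℚ.toℚᵘ (inv n) ℚᵘ.* ℚ.toℚᵘ (ι (suc n))    ≈⟨ ℚᵘP.*-cong (ℚP.toℚᵘ-fromℚᵘ (mkℚᵘ (+ 1) n)) (ℚP.toℚᵘ-fromℚᵘ (mkℚᵘ (+ suc n) 0)) ⟩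
    mkℚᵘ (+ 1) n ℚᵘ.* mkℚᵘ (+ suc n) 0        ≈⟨ ℚᵘ.*≡* (cong +_ (lem n)) ⟩
    mkℚᵘ (+ 1) 0                               ∎)
    where
    open import Relation.Binary.Reasoning.Setoid ℚᵘP.≃-setoid
    lem : ∀ n → 1 ℕ.* suc n ℕ.* 1 ≡ 1 ℕ.* (suc n ℕ.* 1)
    lem = solveℕ

  0<inv : ∀ n → 0ℚ ℚ.< inv n
  0<inv n = ℚP.positive⁻¹ (inv n) {{ℚP.normalize-pos 1 (suc n)}}

0≤inv : ∀ n → 0ℚ ℚ.≤ inv n
0≤inv n = ℚP.<⇒≤ (0<inv n)

ι-inv : ∀ n → ι (suc n) ℚ.* inv n ≡ 1ℚ
ι-inv n = trans (ℚP.*-comm (ι (suc n)) (inv n)) (inv-ι n)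

opaque
  unfolding inv

  inv-antimono : ∀ {m n} → m ℕ.≤ n → inv n ℚ.≤ inv m
  inv-antimono {m} {n} p = /≤/ (+ 1) (+ 1) n m (ℤP.*-monoˡ-≤-nonNeg (+ 1) (ℕ≤⇒ℤ≤ (s≤s p)))

  archimedes : ∀ ε → 0ℚ ℚ.< ε → ∃ λ n → inv n ℚ.≤ ε
  archimedes (ℚ.mkℚ ℤ.+[1+ p ] d c) _ = d , ℚP.toℚᵘ-cancel-≤ (ℚᵘP.≤-trans (ℚᵘP.≤-reflexive (ℚP.toℚᵘ-fromℚᵘ (mkℚᵘ (+ 1) d)))
    (ℚᵘ.*≤* (ℤP.*-monoʳ-≤-nonNeg (+ suc d) (ℕ≤⇒ℤ≤ {1} {suc p} (s≤s z≤n)))))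
  archimedes (ℚ.mkℚ (+ 0) d c)      h with () ← ℚ.positive h
  archimedes (ℚ.mkℚ ℤ.-[1+ _ ] d c) h with () ← ℚ.positive h

-- Hat functions and piecewise linear interpolation

hat : ℚ → ℚ
hat u = 0ℚ ℚ.⊔ (1ℚ ℚ.- ℚ.∣ u ∣)

0≤hat : ∀ u → 0ℚ ℚ.≤ hat u
0≤hat u = ℚP.p≤p⊔q 0ℚ (1ℚ ℚ.- ℚ.∣ u ∣)

hat-zero : ∀ u → 1ℚ ℚ.≤ ℚ.∣ u ∣ → hat u ≡ 0ℚ
hat-zero u h = ℚP.p≥q⇒p⊔q≡p {0ℚ} {1ℚ ℚ.- ℚ.∣ u ∣} (q≤-by (ℚS.solve 2 (λ a b → ℚS.con 0ℚ ℚS.:= (a ℚS.:- b) ℚS.:+ (b ℚS.:- a)) refl 1ℚ ℚ.∣ u ∣) (q0≤- h))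

hat-one : ∀ u → ℚ.∣ u ∣ ℚ.≤ 1ℚ → hat u ≡ 1ℚ ℚ.- ℚ.∣ u ∣
hat-one u h = ℚP.p≤q⇒p⊔q≡q {0ℚ} {1ℚ ℚ.- ℚ.∣ u ∣} (q0≤- h)

hat-lip : ∀ u v → ℚ.∣ hat u ℚ.- hat v ∣ ℚ.≤ ℚ.∣ u ℚ.- v ∣
hat-lip u v = ℚP.≤-trans (⊔-lip 0ℚ (1ℚ ℚ.- ℚ.∣ u ∣) (1ℚ ℚ.- ℚ.∣ v ∣)) (subst (ℚ._≤ ℚ.∣ u ℚ.- v ∣) (cong ℚ.∣_∣ (ℚS.solve 3 (λ a b c → c ℚS.:- b ℚS.:= (a ℚS.:- b) ℚS.:- (a ℚS.:- c)) refl 1ℚ ℚ.∣ u ∣ ℚ.∣ v ∣))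
  (∣-∣-intro (half v u (≤+∣-∣′ u v) (≤+∣-∣ u v)) (half u v (≤+∣-∣ u v) (≤+∣-∣′ u v))))
  where
  half : ∀ u v {r} → u ℚ.≤ v ℚ.+ r → v ℚ.≤ u ℚ.+ r → ℚ.∣ u ∣ ℚ.≤ ℚ.∣ v ∣ ℚ.+ r
  half u v {r} p q = ∣∣≤ (ℚP.≤-trans p (ℚP.+-monoˡ-≤ r (≤∣∣ v)))
    (ℚP.≤-trans (q≤-by (ℚS.solve 3 (λ u v r → ℚS.:- v ℚS.:+ r ℚS.:= ℚS.:- u ℚS.:+ (u ℚS.:+ r ℚS.:- v)) refl u v r) (q0≤- q)) (ℚP.+-monoˡ-≤ r (-≤∣∣ v)))

∑ᵠ : ℕ → (ℕ → ℚ) → ℚ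
∑ᵠ zero    f = 0ℚ
∑ᵠ (suc n) f = f n ℚ.+ ∑ᵠ n f

∑ᵠ-cong : ∀ {f g : ℕ → ℚ} n → (∀ k → k ℕ.< n → f k ≡ g k) → ∑ᵠ n f ≡ ∑ᵠ n g
∑ᵠ-cong zero    e = refl
∑ᵠ-cong (suc n) e = cong₂ ℚ._+_ (e n ℕP.≤-refl) (∑ᵠ-cong n λ k p → e k (ℕP.m≤n⇒m≤1+n p))

∑ᵠ-zero : ∀ {f : ℕ → ℚ} n → (∀ k → k ℕ.< n → f k ≡ 0ℚ) → ∑ᵠ n f ≡ 0ℚ
∑ᵠ-zero zero    e = refl
∑ᵠ-zero (suc n) e = cong₂ ℚ._+_ (e n ℕP.≤-refl) (∑ᵠ-zero n λ k p → e k (ℕP.m≤n⇒m≤1+n p))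

∑ᵠ-abs : ∀ {f g : ℕ → ℚ} n → (∀ k → k ℕ.< n → ℚ.∣ f k ∣ ℚ.≤ g k) → ℚ.∣ ∑ᵠ n f ∣ ℚ.≤ ∑ᵠ n g
∑ᵠ-abs zero    h = ℚP.≤-refl
∑ᵠ-abs {f} (suc n) h = ℚP.≤-trans (ℚP.∣p+q∣≤∣p∣+∣q∣ (f n) (∑ᵠ n f)) (ℚP.+-mono-≤ (h n ℕP.≤-refl) (∑ᵠ-abs n λ k p → h k (ℕP.m≤n⇒m≤1+n p)))

∑ᵠ-* : ∀ c (f : ℕ → ℚ) n → ∑ᵠ n (λ k → c ℚ.* f k) ≡ c ℚ.* ∑ᵠ n f
∑ᵠ-* c f zero    = sym (ℚP.*-zeroʳ c)
∑ᵠ-* c f (suc n) = trans (cong (c ℚ.* f n ℚ.+_) (∑ᵠ-* c f n)) (sym (ℚP.*-distribˡ-+ c (f n) (∑ᵠ n f)))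

∑ᵠ-sub : ∀ (f g : ℕ → ℚ) n → ∑ᵠ n (λ k → f k ℚ.- g k) ≡ ∑ᵠ n f ℚ.- ∑ᵠ n g
∑ᵠ-sub f g zero    = refl
∑ᵠ-sub f g (suc n) = trans (cong (f n ℚ.- g n ℚ.+_) (∑ᵠ-sub f g n))
  (ℚS.solve 4 (λ a b c d → (a ℚS.:- b) ℚS.:+ (c ℚS.:- d) ℚS.:= (a ℚS.:+ c) ℚS.:- (b ℚS.:+ d)) refl (f n) (g n) (∑ᵠ n f) (∑ᵠ n g))

far : ∀ {q k r} → ι k ℚ.+ r ℚ.≤ q → r ℚ.≤ ℚ.∣ q ℚ.- ι k ∣
far {q} {k} {r} h = ℚP.≤-trans (q≤-by (ℚS.solve 3 (λ q k r → q ℚS.:- k ℚS.:= r ℚS.:+ (q ℚS.:- (k ℚS.:+ r))) refl q (ι k) r) (q0≤- h)) (≤∣∣ (q ℚ.- ι k))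

far′ : ∀ {q k r} → q ℚ.+ r ℚ.≤ ι k → r ℚ.≤ ℚ.∣ q ℚ.- ι k ∣
far′ {q} {k} {r} h = ℚP.≤-trans (q≤-by (ℚS.solve 3 (λ q k r → ℚS.:- (q ℚS.:- k) ℚS.:= r ℚS.:+ (k ℚS.:- (q ℚS.:+ r))) refl q (ι k) r) (q0≤- h)) (-≤∣∣ (q ℚ.- ι k))

hats : ℕ → ℚ → ℚ
hats n q = ∑ᵠ n (λ k → hat (q ℚ.- ι k))

hats-beyond : ∀ n q → ι n ℚ.≤ q → hats n q ≡ 0ℚ
hats-beyond n q h = ∑ᵠ-zero n λ k p → hat-zero (q ℚ.- ι k) (far {q} {k} (ℚP.≤-trans (subst (ℚ._≤ ι n) (trans (ι-suc k) (ℚP.+-comm 1ℚ (ι k))) (ι-mono p)) h))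

hats-last : ∀ n q → 0ℚ ℚ.≤ q → ι n ℚ.≤ q → q ℚ.≤ 1ℚ ℚ.+ ι n → hats (suc n) q ≡ (1ℚ ℚ.+ ι n) ℚ.- q
hats-last n q 0≤q h₁ h₂ = trans (cong₂ ℚ._+_ (trans (hat-one _ (subst (ℚ._≤ 1ℚ) (sym e) (q≤-by (ℚS.solve 2 (λ q k → ℚS.con 1ℚ ℚS.:= (q ℚS.:- k) ℚS.:+ ((ℚS.con 1ℚ ℚS.:+ k) ℚS.:- q)) refl q (ι n)) (q0≤- h₂))))
    (cong (λ z → 1ℚ ℚ.- z) e)) (hats-beyond n q h₁)) (ℚS.solve 2 (λ q k → (ℚS.con 1ℚ ℚS.:- (q ℚS.:- k)) ℚS.:+ ℚS.con 0ℚ ℚS.:= (ℚS.con 1ℚ ℚS.:+ k) ℚS.:- q) refl q (ι n))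
  where
  e : ℚ.∣ q ℚ.- ι n ∣ ≡ q ℚ.- ι n
  e = ℚP.0≤p⇒∣p∣≡p (q0≤- h₁)

hats-one : ∀ n q → 0ℚ ℚ.≤ q → q ℚ.≤ ι n → hats (suc n) q ≡ 1ℚ
hats-one zero q h₁ h₂ = trans (cong (λ z → hat z ℚ.+ 0ℚ) (trans (cong₂ ℚ._-_ (ℚP.≤-antisym (subst (q ℚ.≤_) ι-0 h₂) h₁) ι-0) refl)) refl
hats-one (suc n) q h₁ h₂ with ℚP.≤-total q (ι n)
... | inj₁ h = trans (cong₂ ℚ._+_ (hat-zero (q ℚ.- ι (suc n)) (far′ {q} {suc n} (subst (q ℚ.+ 1ℚ ℚ.≤_) (trans (ℚP.+-comm (ι n) 1ℚ) (sym (ι-suc n))) (ℚP.+-monoˡ-≤ 1ℚ h))))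
      (hats-one n q h₁ h)) refl
... | inj₂ h = trans (cong₂ ℚ._+_ (trans (hat-one _ (subst (ℚ._≤ 1ℚ) (sym e) (q≤-by (ℚS.solve 2 (λ q k → ℚS.con 1ℚ ℚS.:= ((ℚS.con 1ℚ ℚS.:+ k) ℚS.:- q) ℚS.:+ (q ℚS.:- k)) refl q (ι n)) (q0≤- h)))) (cong (λ z → 1ℚ ℚ.- z) e))
      (hats-last n q h₁ h h₂′)) (ℚS.solve 2 (λ q k → (ℚS.con 1ℚ ℚS.:- ((ℚS.con 1ℚ ℚS.:+ k) ℚS.:- q)) ℚS.:+ ((ℚS.con 1ℚ ℚS.:+ k) ℚS.:- q) ℚS.:= ℚS.con 1ℚ) refl q (ι n))
  where
  h₂′ : q ℚ.≤ 1ℚ ℚ.+ ι n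
  h₂′ = subst (q ℚ.≤_) (ι-suc n) h₂
  e : ℚ.∣ q ℚ.- ι (suc n) ∣ ≡ (1ℚ ℚ.+ ι n) ℚ.- q
  e = trans (∣-∣-sym q (ι (suc n))) (trans (cong (λ z → ℚ.∣ z ℚ.- q ∣) (ι-suc n)) (ℚP.0≤p⇒∣p∣≡p (q0≤- h₂′)))

wave : ℕ → (ℕ → ℚ) → ℚ → ℚ
wave n c q = ∑ᵠ n (λ k → c k ℚ.* hat (q ℚ.- ι k))

-- The hats form a partition of unity, so a wave is a local average of its values.
wave-near : ∀ n c z ε q → 0ℚ ℚ.≤ q → q ℚ.≤ ι n → (∀ k → k ℕ.≤ n → ℚ.∣ q ℚ.- ι k ∣ ℚ.≤ 1ℚ → ℚ.∣ c k ℚ.- z ∣ ℚ.≤ ε) →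
  ℚ.∣ wave (suc n) c q ℚ.- z ∣ ℚ.≤ ε
wave-near n c z ε q h₁ h₂ near = subst₂ (λ u v → ℚ.∣ u ∣ ℚ.≤ v) eqˡ eqʳ (∑ᵠ-abs (suc n) λ { k (s≤s p) → term k p })
  where
  w : ℕ → ℚ
  w k = hat (q ℚ.- ι k)
  term : ∀ k → k ℕ.≤ n → ℚ.∣ c k ℚ.* w k ℚ.- z ℚ.* w k ∣ ℚ.≤ ε ℚ.* w k
  term k p with ℚP.≤-total ℚ.∣ q ℚ.- ι k ∣ 1ℚ
  ... | inj₁ h = subst (λ u → ℚ.∣ u ∣ ℚ.≤ ε ℚ.* w k) (ℚS.solve 3 (λ c z w → (c ℚS.:- z) ℚS.:* w ℚS.:= c ℚS.:* w ℚS.:- z ℚS.:* w) refl (c k) z (w k))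
    (∣*∣ (c k ℚ.- z) (w k) (near k p h) (ℚP.≤-reflexive (ℚP.0≤p⇒∣p∣≡p (0≤hat (q ℚ.- ι k)))))
  ... | inj₂ h = ℚP.≤-reflexive (trans (cong₂ (λ u v → ℚ.∣ c k ℚ.* u ℚ.- z ℚ.* v ∣) e e) (trans (cong ℚ.∣_∣ (ℚS.solve 2 (λ c z → c ℚS.:* ℚS.con 0ℚ ℚS.:- z ℚS.:* ℚS.con 0ℚ ℚS.:= ℚS.con 0ℚ) refl (c k) z))
      (sym (trans (cong (ε ℚ.*_) e) (ℚP.*-zeroʳ ε)))))
    where e = hat-zero (q ℚ.- ι k) h
  one : ∑ᵠ (suc n) w ≡ 1ℚ
  one = hats-one n q h₁ h₂
  eqˡ : ∑ᵠ (suc n) (λ k → c k ℚ.* w k ℚ.- z ℚ.* w k) ≡ wave (suc n) c q ℚ.- z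
  eqˡ = trans (∑ᵠ-sub (λ k → c k ℚ.* w k) (λ k → z ℚ.* w k) (suc n)) (cong (λ u → wave (suc n) c q ℚ.- u) (trans (∑ᵠ-* z w (suc n)) (trans (cong (z ℚ.*_) one) (ℚP.*-identityʳ z))))
  eqʳ : ∑ᵠ (suc n) (λ k → ε ℚ.* w k) ≡ ε
  eqʳ = trans (∑ᵠ-* ε w (suc n)) (trans (cong (ε ℚ.*_) one) (ℚP.*-identityʳ ε))

wave-lip : ∀ n c p q → (∀ k → 0ℚ ℚ.≤ c k) → ℚ.∣ wave n c p ℚ.- wave n c q ∣ ℚ.≤ ℚ.∣ p ℚ.- q ∣ ℚ.* ∑ᵠ n c
wave-lip n c p q nn = subst₂ (λ u v → ℚ.∣ u ∣ ℚ.≤ v) (∑ᵠ-sub (λ k → c k ℚ.* hat (p ℚ.- ι k)) (λ k → c k ℚ.* hat (q ℚ.- ι k)) n) (∑ᵠ-* ℚ.∣ p ℚ.- q ∣ c n)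
  (∑ᵠ-abs n λ k _ → subst₂ (λ u v → ℚ.∣ u ∣ ℚ.≤ v) (ℚS.solve 3 (λ c x z → c ℚS.:* (x ℚS.:- z) ℚS.:= c ℚS.:* x ℚS.:- c ℚS.:* z) refl (c k) (hat (p ℚ.- ι k)) (hat (q ℚ.- ι k)))
    (ℚP.*-comm (c k) ℚ.∣ p ℚ.- q ∣)
    (∣*∣ (c k) _ (ℚP.≤-reflexive (ℚP.0≤p⇒∣p∣≡p (nn k))) (subst (ℚ.∣ hat (p ℚ.- ι k) ℚ.- hat (q ℚ.- ι k) ∣ ℚ.≤_)
      (cong ℚ.∣_∣ (ℚS.solve 3 (λ p q k → (p ℚS.:- k) ℚS.:- (q ℚS.:- k) ℚS.:= p ℚS.:- q) refl p q (ι k))) (hat-lip (p ℚ.- ι k) (q ℚ.- ι k)))))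

0≤wave : ∀ n c q → (∀ k → 0ℚ ℚ.≤ c k) → 0ℚ ℚ.≤ wave n c q
0≤wave zero    c q nn = ℚP.≤-refl
0≤wave (suc n) c q nn = q0≤+ (q0≤* (nn n) (0≤hat (q ℚ.- ι n))) (0≤wave n c q nn)

-- Distances between real numbers

Close : ℝ → ℝ → ℚ → Set
Close x z η = ∣ x -ᵣ z ∣ᵣ ≤ᵣ fromℚ η

0<* : ∀ {x z} → 0ℚ ℚ.< x → 0ℚ ℚ.< z → 0ℚ ℚ.< x ℚ.* z
0<* {x} {z} p q = ℚP.positive⁻¹ (x ℚ.* z) {{ℚP.pos*pos⇒pos x {{ℚ.positive p}} z {{ℚ.positive q}}}}

0<½ : ∀ {ε} → 0ℚ ℚ.< ε → 0ℚ ℚ.< ½ ℚ.* ε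
0<½ = 0<* (ℚP.positive⁻¹ ½)

halves : ∀ ε → ½ ℚ.* ε ℚ.+ ½ ℚ.* ε ≡ ε
halves ε = trans (sym (ℚP.*-distribʳ-+ ε ½ ½)) (ℚP.*-identityˡ ε)

close-tri : ∀ x y z {η θ} → Close x y η → Close y z θ → Close x z (η ℚ.+ θ)
close-tri x y z {η} {θ} p q ε ε>0 with p (½ ℚ.* ε) (0<½ ε>0) | q (½ ℚ.* ε) (0<½ ε>0)
... | N₁ , h₁ | N₂ , h₂ = N₁ ℕ.⊔ N₂ , λ n n≥ → ℚP.≤-trans
  (∣-∣-tri (seq x n) (seq y n) (seq z n) (h₁ n (ℕP.m⊔n≤o⇒m≤o N₁ N₂ n≥)) (h₂ n (ℕP.m⊔n≤o⇒n≤o N₁ N₂ n≥)))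
  (ℚP.≤-reflexive (trans (ℚS.solve 3 (λ a b c → (a ℚS.:+ c) ℚS.:+ (b ℚS.:+ c) ℚS.:= (a ℚS.:+ b) ℚS.:+ (c ℚS.:+ c)) refl η θ (½ ℚ.* ε)) (cong (η ℚ.+ θ ℚ.+_) (halves ε))))

close-sym : ∀ x y {η} → Close x y η → Close y x η
close-sym x y p ε ε>0 with p ε ε>0
... | N₁ , h = N₁ , λ n n≥ → subst (ℚ._≤ _) (∣-∣-sym (seq x n) (seq y n)) (h n n≥)

close-weaken : ∀ x y {η θ} → η ℚ.≤ θ → Close x y η → Close x y θ
close-weaken x y h p ε ε>0 with p ε ε>0
... | N₁ , g = N₁ , λ n n≥ → ℚP.≤-trans (g n n≥) (ℚP.+-monoˡ-≤ ε h)

close-≈ : ∀ x y → x ≈ᵣ y → Close x y 0ℚ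
close-≈ x y p ε ε>0 with p ε ε>0
... | N₁ , g = N₁ , λ n n≥ → ℚP.≤-trans (g n n≥) (ℚP.≤-reflexive (sym (ℚP.+-identityˡ ε)))

close-seq : ∀ x y {η} N → (∀ n → N ℕ.≤ n → ℚ.∣ seq x n ℚ.- seq y n ∣ ℚ.≤ η) → Close x y η
close-seq x y {η} N h ε ε>0 = N , λ n n≥ → ℚP.≤-trans (h n n≥) (q≤-by refl (ℚP.<⇒≤ ε>0))

-- Completeness

module Limit (z : ℕ → ℝ) (cz : ∀ ε → 0ℚ ℚ.< ε → ∃ λ N → ∀ i j → N ℕ.≤ i → N ℕ.≤ j → Close (z i) (z j) ε) where

  private
    i# n# : ℕ → ℕ
    i# k = proj₁ (cz (inv k) (0<inv k))
    n# k = proj₁ (cauchy (z (i# k)) (inv k) (0<inv k))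

    -- A diagonal sequence: from the index `i# k` on, z is constant up to `inv k`, and `w k` is a
    -- rational within `inv k` of the later terms of that real number.
    w : ℕ → ℚ
    w k = seq (z (i# k)) (n# k)

    near-w : ∀ k n → n# k ℕ.≤ n → ℚ.∣ seq (z (i# k)) n ℚ.- w k ∣ ℚ.≤ inv k
    near-w k n p = proj₂ (cauchy (z (i# k)) (inv k) (0<inv k)) n (n# k) p ℕP.≤-refl

    -- An index i after which z stays within η of z i.
    to-w : ∀ i η → (∀ j → i ℕ.≤ j → Close (z i) (z j) η) → ∀ k ε → 0ℚ ℚ.< ε →
      ∃ λ N → ∀ n → N ℕ.≤ n → ℚ.∣ seq (z i) n ℚ.- w k ∣ ℚ.≤ (η ℚ.+ ε) ℚ.+ ((inv k ℚ.+ ε) ℚ.+ inv k)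
    to-w i η h k ε ε>0 = proj₁ c₁ ℕ.⊔ (proj₁ c₂ ℕ.⊔ n# k) , λ n n≥ →
      ∣-∣-tri (seq (z i) n) (seq (z j) n) (w k) (proj₂ c₁ n (ℕP.m⊔n≤o⇒m≤o (proj₁ c₁) _ n≥))
        (∣-∣-tri (seq (z j) n) (seq (z (i# k)) n) (w k) (proj₂ c₂ n (ℕP.m⊔n≤o⇒m≤o (proj₁ c₂) (n# k) (ℕP.m⊔n≤o⇒n≤o (proj₁ c₁) _ n≥)))
          (near-w k n (ℕP.m⊔n≤o⇒n≤o (proj₁ c₂) (n# k) (ℕP.m⊔n≤o⇒n≤o (proj₁ c₁) _ n≥))))
      where
      j = i ℕ.⊔ i# k
      c₁ = h j (ℕP.m≤m⊔n i (i# k)) ε ε>0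
      c₂ = proj₂ (cz (inv k) (0<inv k)) j (i# k) (ℕP.m≤n⊔m i (i# k)) ℕP.≤-refl ε ε>0

    inv-scale : ∀ n ε → ι (suc n) ℚ.* (inv n ℚ.* ε) ≡ ε
    inv-scale n ε = trans (sym (ℚP.*-assoc (ι (suc n)) (inv n) ε)) (trans (cong (ℚ._* ε) (ι-inv n)) (ℚP.*-identityˡ ε))

    w-near : ∀ k₀ k → k₀ ℕ.≤ k → ∃ λ N → ∀ n → N ℕ.≤ n → ℚ.∣ seq (z (i# k₀)) n ℚ.- w k ∣ ℚ.≤ (inv k₀ ℚ.+ inv k₀) ℚ.+ ((inv k₀ ℚ.+ inv k₀) ℚ.+ inv k₀)
    w-near k₀ k p = proj₁ q , λ n n≥ → ℚP.≤-trans (proj₂ q n n≥) (ℚP.+-monoʳ-≤ (inv k₀ ℚ.+ inv k₀) (ℚP.+-mono-≤ (ℚP.+-monoˡ-≤ (inv k₀) (inv-antimono p)) (inv-antimono p)))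
      where
      q = to-w (i# k₀) (inv k₀) (λ j r → proj₂ (cz (inv k₀) (0<inv k₀)) (i# k₀) j ℕP.≤-refl r) k (inv k₀) (0<inv k₀)

    -- Both rationals are within 5 · `inv k₀` of one and the same late term of z (i# k₀).
    w-diff : ∀ k₀ k l → k₀ ℕ.≤ k → k₀ ℕ.≤ l → ℚ.∣ w k ℚ.- w l ∣ ℚ.≤ ι 10 ℚ.* inv k₀
    w-diff k₀ k l p q = subst (ℚ.∣ w k ℚ.- w l ∣ ℚ.≤_) (lem (inv k₀)) (∣-∣-tri (w k) (seq (z (i# k₀)) n) (w l)
        (subst (ℚ._≤ (inv k₀ ℚ.+ inv k₀) ℚ.+ ((inv k₀ ℚ.+ inv k₀) ℚ.+ inv k₀)) (∣-∣-sym (seq (z (i# k₀)) n) (w k)) (proj₂ r₁ n (ℕP.m≤m⊔n (proj₁ r₁) (proj₁ r₂)))) (proj₂ r₂ n (ℕP.m≤n⊔m (proj₁ r₁) (proj₁ r₂))))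
      where
      r₁ = w-near k₀ k p
      r₂ = w-near k₀ l q
      n = proj₁ r₁ ℕ.⊔ proj₁ r₂
      lem : ∀ x → ((x ℚ.+ x) ℚ.+ ((x ℚ.+ x) ℚ.+ x)) ℚ.+ ((x ℚ.+ x) ℚ.+ ((x ℚ.+ x) ℚ.+ x)) ≡ ι 10 ℚ.* x
      lem x = trans (ℚS.solve 1 (λ x → ((x ℚS.:+ x) ℚS.:+ ((x ℚS.:+ x) ℚS.:+ x)) ℚS.:+ ((x ℚS.:+ x) ℚS.:+ ((x ℚS.:+ x) ℚS.:+ x)) ℚS.:= ℚS.con (+ 10 ℚ./ 1) ℚS.:* x) refl x) (cong (ℚ._* x) (sym (ι-def 10)))

    w-cauchy : Cauchy w
    w-cauchy ε ε>0 = proj₁ k₀ , λ k l p q → ℚP.≤-trans (w-diff (proj₁ k₀) k l p q)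
      (ℚP.≤-trans (ℚP.*-monoˡ-≤-nonNeg (ι 10) {{ℚ.nonNegative (0≤ι 10)}} (proj₂ k₀)) (ℚP.≤-reflexive (inv-scale 9 ε)))
      where
      k₀ = archimedes (inv 9 ℚ.* ε) (0<* (0<inv 9) ε>0)

    w-close : ∀ i η → (∀ j → i ℕ.≤ j → Close (z i) (z j) η) → ∀ ε → 0ℚ ℚ.< ε →
      ∃ λ N → ∀ n → N ℕ.≤ n → ℚ.∣ seq (z i) n ℚ.- w n ∣ ℚ.≤ η ℚ.+ ε
    w-close i η h ε ε>0 = proj₁ q ℕ.⊔ n₀ , λ n n≥ → ℚP.≤-trans (∣-∣-tri (seq (z i) n) (w (k ℕ.⊔ n₀)) (w n) (proj₂ q n (ℕP.m⊔n≤o⇒m≤o (proj₁ q) n₀ n≥))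
          (proj₂ wc (k ℕ.⊔ n₀) n (ℕP.m≤n⊔m k n₀) (ℕP.m⊔n≤o⇒n≤o (proj₁ q) n₀ n≥)))
        (ℚP.≤-trans (ℚP.+-monoˡ-≤ θ (ℚP.+-monoʳ-≤ (η ℚ.+ θ) (ℚP.+-mono-≤ (ℚP.+-monoˡ-≤ θ k≤) k≤)))
          (ℚP.≤-reflexive (trans (lem η θ) (cong (η ℚ.+_) (inv-scale 4 ε)))))
      where
      -- Besides η, five errors of size at most θ are added below.
      θ = inv 4 ℚ.* ε
      θ>0 = 0<* (0<inv 4) ε>0
      k = proj₁ (archimedes θ θ>0)
      wc = w-cauchy θ θ>0
      n₀ = proj₁ wc
      q = to-w i η h (k ℕ.⊔ n₀) θ θ>0
      k≤ : inv (k ℕ.⊔ n₀) ℚ.≤ θ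
      k≤ = ℚP.≤-trans (inv-antimono (ℕP.m≤m⊔n k n₀)) (proj₂ (archimedes θ θ>0))
      lem : ∀ η θ → (η ℚ.+ θ) ℚ.+ ((θ ℚ.+ θ) ℚ.+ θ) ℚ.+ θ ≡ η ℚ.+ ι 5 ℚ.* θ
      lem η θ = trans (ℚS.solve 2 (λ η θ → (η ℚS.:+ θ) ℚS.:+ ((θ ℚS.:+ θ) ℚS.:+ θ) ℚS.:+ θ ℚS.:= η ℚS.:+ ℚS.con (+ 5 ℚ./ 1) ℚS.:* θ) refl η θ) (cong (λ z → η ℚ.+ z ℚ.* θ) (sym (ι-def 5)))

  opaque
    limit : ℝ
    limit = real w w-cauchy

    limit-close : ∀ i η → (∀ j → i ℕ.≤ j → Close (z i) (z j) η) → Close (z i) limit η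
    limit-close = w-close

opaque
  unfolding ι

  ℕ-above : ∀ q → ∃ λ m → q ℚ.≤ ι m
  ℕ-above q@(ℚ.mkℚ n d c) = ∣ n ∣ , ℚP.toℚᵘ-cancel-≤ (ℚᵘP.≤-trans (ℚᵘ.*≤* bound₀) (ℚᵘP.≤-reflexive (ℚᵘP.≃-sym (ℚP.toℚᵘ-fromℚᵘ (mkℚᵘ (+ ∣ n ∣) 0)))))
    where
    bound₀ : n ℤ.* + 1 ℤ.≤ + ∣ n ∣ ℤ.* + suc d
    bound₀ = ℤP.≤-trans (ℤP.≤-reflexive (ℤP.*-identityʳ n)) (ℤP.≤-trans (≤-abs n)
      (subst (ℤ._≤ + ∣ n ∣ ℤ.* + suc d) (ℤP.*-identityʳ (+ ∣ n ∣)) (ℤP.*-monoˡ-≤-nonNeg (+ ∣ n ∣) (ℕ≤⇒ℤ≤ {1} {suc d} (s≤s z≤n)))))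

real-above : ∀ x → ∃ λ m → x ≤ᵣ fromℕ m
real-above x with cauchy x 1ℚ (ℚP.positive⁻¹ 1ℚ)
... | N , h with ℕ-above (seq x N ℚ.+ 1ℚ)
... | m , hm = m , λ ε ε>0 → N , λ n n≥ → ℚP.≤-trans (∣-∣-upper {seq x n} {seq x N} (h n N n≥ ℕP.≤-refl)) (ℚP.≤-trans (subst (seq x N ℚ.+ 1ℚ ℚ.≤_) (ι-def m) hm) (q≤-by refl (ℚP.<⇒≤ ε>0)))

≤ᵣ-fromℕ-mono : ∀ x {m n} → m ℕ.≤ n → x ≤ᵣ fromℕ m → x ≤ᵣ fromℕ n
≤ᵣ-fromℕ-mono x {m} {n} p h ε ε>0 with h ε ε>0
... | N , g = N , λ i i≥ → ℚP.≤-trans (g i i≥) (ℚP.+-monoˡ-≤ ε (subst₂ ℚ._≤_ (ι-def m) (ι-def n) (ι-mono p)))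

close-≤ : ∀ x y m → Close y x 1ℚ → x ≤ᵣ fromℕ m → y ≤ᵣ fromℕ (suc m)
close-≤ x y m c h ε ε>0 with c (½ ℚ.* ε) (0<½ ε>0) | h (½ ℚ.* ε) (0<½ ε>0)
... | N₁ , h₁ | N₂ , h₂ = N₁ ℕ.⊔ N₂ , λ n n≥ → ℚP.≤-trans (∣-∣-upper {seq y n} {seq x n} (h₁ n (ℕP.m⊔n≤o⇒m≤o N₁ N₂ n≥)))
  (ℚP.≤-trans (ℚP.+-monoˡ-≤ (1ℚ ℚ.+ ½ ℚ.* ε) (h₂ n (ℕP.m⊔n≤o⇒n≤o N₁ N₂ n≥)))
    (ℚP.≤-reflexive (trans (ℚS.solve 3 (λ m o e → (m ℚS.:+ e) ℚS.:+ (o ℚS.:+ e) ℚS.:= (o ℚS.:+ m) ℚS.:+ (e ℚS.:+ e)) refl (+ m ℚ./ 1) 1ℚ (½ ℚ.* ε))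
      (cong₂ ℚ._+_ (trans (cong (1ℚ ℚ.+_) (sym (ι-def m))) (trans (sym (ι-suc m)) (ι-def (suc m)))) (halves ε)))))

module LimitFun (F : ℕ → C[0,∞[) (cF : CauchySequence F) where

  private
    cauchy-at : ∀ x 0≤x ε → 0ℚ ℚ.< ε → ∃ λ N → ∀ i j → N ℕ.≤ i → N ℕ.≤ j → Close (fun (F i) x 0≤x) (fun (F j) x 0≤x) ε
    cauchy-at x 0≤x ε ε>0 = proj₁ c , λ i j p q → proj₂ c i j p q x 0≤x (proj₂ (real-above x))
      where c = cF (proj₁ (real-above x)) ε ε>0

    module At (x : ℝ) (0≤x : 0ᵣ ≤ᵣ x) = Limit (λ i → fun (F i) x 0≤x) (cauchy-at x 0≤x)

    value : ∀ x → 0ᵣ ≤ᵣ x → ℝ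
    value x 0≤x = At.limit x 0≤x

    near : ∀ m ε (ε>0 : 0ℚ ℚ.< ε) i → proj₁ (cF m ε ε>0) ℕ.≤ i → ∀ x 0≤x → x ≤ᵣ fromℕ m → Close (fun (F i) x 0≤x) (value x 0≤x) ε
    near m ε ε>0 i p x 0≤x hx = At.limit-close x 0≤x i ε (λ j q → proj₂ (cF m ε ε>0) i j p (ℕP.≤-trans p q) x 0≤x hx)

    ⅓ : ℚ
    ⅓ = + 1 ℚ./ 3

    thirds : ∀ ε → (⅓ ℚ.* ε ℚ.+ ⅓ ℚ.* ε) ℚ.+ ⅓ ℚ.* ε ≡ ε
    thirds ε = ℚS.solve 1 (λ e → (ℚS.con ⅓ ℚS.:* e ℚS.:+ ℚS.con ⅓ ℚS.:* e) ℚS.:+ ℚS.con ⅓ ℚS.:* e ℚS.:= e) refl ε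

  limitFun : C[0,∞[
  fun limitFun = value
  continuous limitFun x 0≤x ε ε>0 = go (continuous (F i) x 0≤x (⅓ ℚ.* ε) ε′>0)
    where
    m = proj₁ (real-above x)
    hm = proj₂ (real-above x)
    ε′>0 = 0<* (ℚP.positive⁻¹ ⅓) ε>0
    i = proj₁ (cF (suc m) (⅓ ℚ.* ε) ε′>0)
    go : (∃ λ δ → 0ℚ ℚ.< δ × (∀ y 0≤y → ∣ y -ᵣ x ∣ᵣ ≤ᵣ fromℚ δ → ∣ fun (F i) y 0≤y -ᵣ fun (F i) x 0≤x ∣ᵣ ≤ᵣ fromℚ (⅓ ℚ.* ε))) →
      ∃ λ δ → 0ℚ ℚ.< δ × (∀ y 0≤y → ∣ y -ᵣ x ∣ᵣ ≤ᵣ fromℚ δ → ∣ value y 0≤y -ᵣ value x 0≤x ∣ᵣ ≤ᵣ fromℚ ε)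
    -- The cap 1 keeps y below m + 1, the range on which `F i` is uniformly close to the limit.
    go (δ , δ>0 , h) = 1ℚ ℚ.⊓ δ , pos-⊓ , λ y 0≤y c →
      subst (λ e → Close (value y 0≤y) (value x 0≤x) e) (thirds ε)
        (close-tri (value y 0≤y) (fun (F i) x 0≤x) (value x 0≤x) {⅓ ℚ.* ε ℚ.+ ⅓ ℚ.* ε} {⅓ ℚ.* ε}
          (close-tri (value y 0≤y) (fun (F i) y 0≤y) (fun (F i) x 0≤x) {⅓ ℚ.* ε} {⅓ ℚ.* ε}
            (close-sym (fun (F i) y 0≤y) (value y 0≤y) {⅓ ℚ.* ε} (near (suc m) (⅓ ℚ.* ε) ε′>0 i ℕP.≤-refl y 0≤y
              (close-≤ x y m (close-weaken y x {1ℚ ℚ.⊓ δ} {1ℚ} (ℚP.p⊓q≤p 1ℚ δ) c) hm)))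
            (h y 0≤y (close-weaken y x {1ℚ ℚ.⊓ δ} {δ} (ℚP.p⊓q≤q 1ℚ δ) c)))
          (near (suc m) (⅓ ℚ.* ε) ε′>0 i ℕP.≤-refl x 0≤x (≤ᵣ-fromℕ-mono x (ℕP.n≤1+n m) hm)))
      where
      pos-⊓ : 0ℚ ℚ.< 1ℚ ℚ.⊓ δ
      pos-⊓ with ℚP.⊓-sel 1ℚ δ
      ... | inj₁ e = subst (0ℚ ℚ.<_) (sym e) (ℚP.positive⁻¹ 1ℚ)
      ... | inj₂ e = subst (0ℚ ℚ.<_) (sym e) δ>0

  limitFun-within : ∀ m ε (ε>0 : 0ℚ ℚ.< ε) i → proj₁ (cF m ε ε>0) ℕ.≤ i → Within m ε (F i) limitFun
  limitFun-within m ε ε>0 i p x 0≤x hx = near m ε ε>0 i p x 0≤x hx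

  limitFun-⟶ : F ⟶ limitFun
  limitFun-⟶ m ε ε>0 = proj₁ (cF m ε ε>0) , limitFun-within m ε ε>0

-- Lipschitz functions on ℚ with values in [0, V]

record Path (V : ℕ) : Set where
  field
    fn    : ℚ → ℚ
    const : ℕ
    lip   : ∀ p q → ℚ.∣ fn p ℚ.- fn q ∣ ℚ.≤ ℚ.∣ p ℚ.- q ∣ ℚ.* ι const
    lo    : ∀ q → 0ℚ ℚ.≤ fn q
    hi    : ∀ q → fn q ℚ.≤ ι V
open Path public

inv-cancel : ∀ c {d ε} → 0ℚ ℚ.≤ ε → d ℚ.≤ inv c ℚ.* ε → d ℚ.* ι c ℚ.≤ ε
inv-cancel c {d} {ε} 0≤ε h = ℚP.≤-trans (ℚP.*-monoʳ-≤-nonNeg (ι c) {{ℚ.nonNegative (0≤ι c)}} h)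
  (ℚP.≤-trans (*≤* (q0≤* (0≤inv c) 0≤ε) (0≤ι (suc c)) ℚP.≤-refl (ι-mono (ℕP.n≤1+n c)))
    (ℚP.≤-reflexive (trans (ℚS.solve 3 (λ i e c → (i ℚS.:* e) ℚS.:* c ℚS.:= (i ℚS.:* c) ℚS.:* e) refl (inv c) ε (ι (suc c)))
      (trans (cong (ℚ._* ε) (inv-ι c)) (ℚP.*-identityˡ ε)))))

-- A Lipschitz function on the rationals preserves Cauchy sequences, so it acts on a real number
-- term by term.
lift : ∀ {V} → Path V → C[0,∞[
fun (lift P) x _ = real (λ n → fn P (seq x n)) λ ε ε>0 →
  let c = cauchy x (inv (const P) ℚ.* ε) (0<* (0<inv (const P)) ε>0) in
  proj₁ c , λ m n p q → ℚP.≤-trans (lip P (seq x m) (seq x n)) (inv-cancel (const P) (ℚP.<⇒≤ ε>0) (proj₂ c m n p q))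
continuous (lift P) x 0≤x ε ε>0 = inv (const P) ℚ.* ε , 0<* (0<inv (const P)) ε>0 , λ y 0≤y h ε′ ε′>0 →
  let c = h (inv (const P) ℚ.* ε′) (0<* (0<inv (const P)) ε′>0) in
  proj₁ c , λ n n≥ → ℚP.≤-trans (lip P (seq y n) (seq x n)) (inv-cancel (const P) (q0≤+ (ℚP.<⇒≤ ε>0) (ℚP.<⇒≤ ε′>0))
    (ℚP.≤-trans (proj₂ c n n≥) (ℚP.≤-reflexive (sym (ℚP.*-distribˡ-+ (inv (const P)) ε ε′)))))

-- The rational terms of a real x ≤ m may exceed m, but eventually not m + 1; hence the wider range
-- in the hypothesis.
within-lift : ∀ m ε {V W} (P : Path V) (Q : Path W) → (∀ q → q ℚ.≤ ι (suc m) → ℚ.∣ fn P q ℚ.- fn Q q ∣ ℚ.≤ ε) → Within m ε (lift P) (lift Q)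
within-lift m ε P Q h x 0≤x hx = close-seq (fun (lift P) x 0≤x) (fun (lift Q) x 0≤x) {ε} (proj₁ b) λ n n≥ → h (seq x n)
  (ℚP.≤-trans (proj₂ b n n≥) (ℚP.≤-reflexive (trans (cong (ℚ._+ 1ℚ) (sym (ι-def m))) (trans (ℚP.+-comm (ι m) 1ℚ) (sym (ι-suc m))))))
  where b = hx 1ℚ (ℚP.positive⁻¹ 1ℚ)

-- Powers of 1/2, clamping, and finite lists of codes

pw : ℕ → ℚ
pw zero    = 1ℚ
pw (suc j) = ½ ℚ.* pw j

0<pw : ∀ j → 0ℚ ℚ.< pw j
0<pw zero    = ℚP.positive⁻¹ 1ℚ
0<pw (suc j) = 0<½ (0<pw j)

0≤pw : ∀ j → 0ℚ ℚ.≤ pw j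
0≤pw j = ℚP.<⇒≤ (0<pw j)

pw-twice : ∀ j → pw (suc j) ℚ.+ pw (suc j) ≡ pw j
pw-twice j = halves (pw j)

pw≤inv : ∀ j → pw j ℚ.≤ inv j
pw≤inv j = subst₂ ℚ._≤_ (trans (ℚP.*-assoc (pw j) (ι (suc j)) (inv j)) (trans (cong (pw j ℚ.*_) (ι-inv j)) (ℚP.*-identityʳ (pw j)))) (ℚP.*-identityˡ (inv j))
  (ℚP.*-monoʳ-≤-nonNeg (inv j) {{ℚ.nonNegative (0≤inv j)}} (go j))
  where
  go : ∀ j → pw j ℚ.* ι (suc j) ℚ.≤ 1ℚ
  go zero    = ℚP.≤-reflexive (trans (ℚP.*-identityˡ (ι 1)) ι-1)
  go (suc j) = ℚP.≤-trans (*≤* (0≤pw (suc j)) (0≤ι (suc j ℕ.+ suc j)) ℚP.≤-refl (ι-mono (s≤s (ℕP.≤-trans (s≤s (ℕP.m≤n+m j j)) (ℕP.≤-reflexive (sym (ℕP.+-suc j j)))))))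
    (ℚP.≤-trans (ℚP.≤-reflexive (trans (cong (pw (suc j) ℚ.*_) (ι-+ (suc j) (suc j)))
        (trans (ℚS.solve 2 (λ p s → p ℚS.:* (s ℚS.:+ s) ℚS.:= (p ℚS.:+ p) ℚS.:* s) refl (pw (suc j)) (ι (suc j))) (cong (ℚ._* ι (suc j)) (pw-twice j))))) (go j))

pw-small : ∀ ε → 0ℚ ℚ.< ε → ∃ λ j → pw j ℚ.≤ ε
pw-small ε ε>0 = proj₁ (archimedes ε ε>0) , ℚP.≤-trans (pw≤inv _) (proj₂ (archimedes ε ε>0))

pw-mono : ∀ {i j} → i ℕ.≤ j → pw j ℚ.≤ pw i
pw-mono {i} {j} p with ℕP.m≤n⇒∃[o]m+o≡n p
... | o , refl = go o
  where
  go : ∀ o → pw (i ℕ.+ o) ℚ.≤ pw i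
  go zero    = ℚP.≤-reflexive (cong pw (ℕP.+-identityʳ i))
  go (suc o) = subst (λ z → pw z ℚ.≤ pw i) (sym (ℕP.+-suc i o)) (ℚP.≤-trans (q≤-by (sym (pw-twice (i ℕ.+ o))) (0≤pw (suc (i ℕ.+ o)))) (go o))

clampᵠ : ℚ → ℚ → ℚ → ℚ
clampᵠ e r v = (e ℚ.- r) ℚ.⊔ ((e ℚ.+ r) ℚ.⊓ v)

clamp-id : ∀ e r v → ℚ.∣ v ℚ.- e ∣ ℚ.≤ r → clampᵠ e r v ≡ v
clamp-id e r v h = trans (cong ((e ℚ.- r) ℚ.⊔_) (ℚP.p≥q⇒p⊓q≡q {e ℚ.+ r} {v} (∣-∣-upper {v} {e} h)))
  (ℚP.p≤q⇒p⊔q≡q {e ℚ.- r} {v} (q≤-by (ℚS.solve 3 (λ e r v → v ℚS.:= (e ℚS.:- r) ℚS.:+ ((v ℚS.:+ r) ℚS.:- e)) refl e r v) (q0≤- (∣-∣-lower {v} {e} h))))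

clamp-lip : ∀ e r v w → ℚ.∣ clampᵠ e r v ℚ.- clampᵠ e r w ∣ ℚ.≤ ℚ.∣ v ℚ.- w ∣
clamp-lip e r v w = ℚP.≤-trans (⊔-lip (e ℚ.- r) ((e ℚ.+ r) ℚ.⊓ v) ((e ℚ.+ r) ℚ.⊓ w)) (⊓-lip (e ℚ.+ r) v w)

clamp-near : ∀ e r v → 0ℚ ℚ.≤ r → ℚ.∣ clampᵠ e r v ℚ.- e ∣ ℚ.≤ r
clamp-near e r v 0≤r = ∣-∣-intro {clampᵠ e r v} {e} {r} (ℚP.⊔-lub (q≤-by {e ℚ.- r} {e ℚ.+ r} (ℚS.solve 2 (λ e r → e ℚS.:+ r ℚS.:= (e ℚS.:- r) ℚS.:+ (r ℚS.:+ r)) refl e r) (q0≤+ 0≤r 0≤r)) (ℚP.p⊓q≤p (e ℚ.+ r) v))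
  (ℚP.≤-trans (ℚP.≤-reflexive (ℚS.solve 2 (λ e r → e ℚS.:= (e ℚS.:- r) ℚS.:+ r) refl e r)) (ℚP.+-monoˡ-≤ r (ℚP.p≤p⊔q (e ℚ.- r) ((e ℚ.+ r) ℚ.⊓ v))))

clamp-lo : ∀ e r v → 0ℚ ℚ.≤ e → 0ℚ ℚ.≤ r → 0ℚ ℚ.≤ v → 0ℚ ℚ.≤ clampᵠ e r v
clamp-lo e r v pe pr pv = ℚP.≤-trans (ℚP.⊓-glb (q0≤+ pe pr) pv) (ℚP.p≤q⊔p (e ℚ.- r) ((e ℚ.+ r) ℚ.⊓ v))

clamp-hi : ∀ e r v {V} → 0ℚ ℚ.≤ r → e ℚ.≤ V → v ℚ.≤ V → clampᵠ e r v ℚ.≤ V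
clamp-hi e r v pr pe pv = ℚP.⊔-lub (ℚP.≤-trans (q≤-by {e ℚ.- r} {e} (ℚS.solve 2 (λ e r → e ℚS.:= (e ℚS.:- r) ℚS.:+ r) refl e r) pr) pe) (ℚP.≤-trans (ℚP.p⊓q≤q (e ℚ.+ r) v) pv)

⊔-lip₂ : ∀ a b a′ b′ → ℚ.∣ (a ℚ.⊔ b) ℚ.- (a′ ℚ.⊔ b′) ∣ ℚ.≤ ℚ.∣ a ℚ.- a′ ∣ ℚ.+ ℚ.∣ b ℚ.- b′ ∣
⊔-lip₂ a b a′ b′ = ∣-∣-tri (a ℚ.⊔ b) (a′ ℚ.⊔ b) (a′ ℚ.⊔ b′) (subst₂ (λ u v → ℚ.∣ u ℚ.- v ∣ ℚ.≤ ℚ.∣ a ℚ.- a′ ∣) (ℚP.⊔-comm b a) (ℚP.⊔-comm b a′) (⊔-lip b a a′)) (⊔-lip a′ b b′)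

⊓-lip₂ : ∀ a b a′ b′ → ℚ.∣ (a ℚ.⊓ b) ℚ.- (a′ ℚ.⊓ b′) ∣ ℚ.≤ ℚ.∣ a ℚ.- a′ ∣ ℚ.+ ℚ.∣ b ℚ.- b′ ∣
⊓-lip₂ a b a′ b′ = ∣-∣-tri (a ℚ.⊓ b) (a′ ℚ.⊓ b) (a′ ℚ.⊓ b′) (subst₂ (λ u v → ℚ.∣ u ℚ.- v ∣ ℚ.≤ ℚ.∣ a ℚ.- a′ ∣) (ℚP.⊓-comm b a) (ℚP.⊓-comm b a′) (⊓-lip b a a′)) (⊓-lip a′ b b′)

fnList : ℕ → ℕ → List (ℕ → ℕ)
fnList zero    W = (λ _ → 0) ∷ []
fnList (suc n) W = concatMap (λ g → map (λ v → extend g n v) (downFrom (suc W))) (fnList n W)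
  module FnList where
  extend : (ℕ → ℕ) → ℕ → ℕ → ℕ → ℕ
  extend g n v k with k ℕP.≟ n
  ... | yes _ = v
  ... | no _  = g k

any-downFrom : ∀ {P : ℕ → Set} n v → v ℕ.< n → P v → Any P (downFrom n)
any-downFrom (suc n) v p h with ℕP.m<1+n⇒m<n∨m≡n p
... | inj₂ refl = here h
... | inj₁ q    = there (any-downFrom n v q h)

fnList-complete : ∀ n W (γ : ℕ → ℕ) → (∀ k → γ k ℕ.≤ W) → Any (λ g → ∀ k → k ℕ.< n → g k ≡ γ k) (fnList n W)
fnList-complete zero    W γ h = here λ k ()
fnList-complete (suc n) W γ h = AnyP.concatMap⁺ _ (Any.map (λ {g} e → AnyP.map⁺ (any-downFrom (suc W) (γ n) (s≤s (h n)) (agree g e))) (fnList-complete n W γ h))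
  where
  agree : ∀ g → (∀ k → k ℕ.< n → g k ≡ γ k) → ∀ k → k ℕ.< suc n → FnList.extend n W g n (γ n) k ≡ γ k
  agree g e k p with k ℕP.≟ n
  ... | yes refl = refl
  ... | no k≢n   = e k (ℕP.≤∧≢⇒< (ℕP.≤-pred p) k≢n)

-- Codes at level j give waves of mesh 1/(suc (mesh j)), with values in multiples of
-- 1/(suc (unit j)) between 0 and top j; successive levels are clamped together.
module Chains (mesh unit top : ℕ → ℕ) (top-mono : ∀ j → top j ℕ.≤ top (suc j)) where

  opaque
    -- The nodes cover [0, j + 3], while level j has to fit only on [0, j + 2]: nodes adjacent to a
    -- point of that interval may lie up to 1 beyond it.
    nodes steps : ℕ → ℕ
    nodes j = (3 ℕ.+ j) ℕ.* suc (mesh j)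
    steps j = top j ℕ.* suc (unit j)

    nodes-def : ∀ j → nodes j ≡ (3 ℕ.+ j) ℕ.* suc (mesh j)
    nodes-def j = refl

    steps-def : ∀ j → steps j ≡ top j ℕ.* suc (unit j)
    steps-def j = refl

  -- The cap at `steps j` makes every function a legitimate code with values in [0, top j].
  value : ℕ → (ℕ → ℕ) → ℕ → ℚ
  value j g k = ι (g k ℕ.⊓ steps j) ℚ.* inv (unit j)

  0≤value : ∀ j g k → 0ℚ ℚ.≤ value j g k
  0≤value j g k = q0≤* (0≤ι (g k ℕ.⊓ steps j)) (0≤inv (unit j))

  value≤top : ∀ j g k → value j g k ℚ.≤ ι (top j)
  value≤top j g k = ℚP.≤-trans (ℚP.*-monoʳ-≤-nonNeg (inv (unit j)) {{ℚ.nonNegative (0≤inv (unit j))}} (ι-mono (ℕP.m⊓n≤n (g k) (steps j))))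
    (ℚP.≤-reflexive (trans (cong (ℚ._* inv (unit j)) (trans (cong ι (steps-def j)) (ι-* (top j) (suc (unit j))))) (trans (ℚP.*-assoc (ι (top j)) (ι (suc (unit j))) (inv (unit j)))
      (trans (cong (ι (top j) ℚ.*_) (ι-inv (unit j))) (ℚP.*-identityʳ (ι (top j)))))))

  pos⁺ : ℚ → ℚ
  pos⁺ q = 0ℚ ℚ.⊔ q

  wave-hi : ∀ n c {V} q → (∀ k → 0ℚ ℚ.≤ c k) → (∀ k → c k ℚ.≤ V) → hats n q ℚ.≤ 1ℚ → 0ℚ ℚ.≤ V → wave n c q ℚ.≤ V
  wave-hi n c {V} q nn h one 0≤V = ℚP.≤-trans (go n) (ℚP.≤-trans (ℚP.≤-reflexive (∑ᵠ-* V (λ k → hat (q ℚ.- ι k)) n))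
      (ℚP.≤-trans (ℚP.*-monoˡ-≤-nonNeg V {{ℚ.nonNegative 0≤V}} one) (ℚP.≤-reflexive (ℚP.*-identityʳ V))))
    where
    go : ∀ n → wave n c q ℚ.≤ ∑ᵠ n (λ k → V ℚ.* hat (q ℚ.- ι k))
    go zero    = ℚP.≤-refl
    go (suc n) = ℚP.+-mono-≤ (ℚP.*-monoʳ-≤-nonNeg (hat (q ℚ.- ι n)) {{ℚ.nonNegative (0≤hat (q ℚ.- ι n))}} (h n)) (go n)

  hats≤1 : ∀ n q → 0ℚ ℚ.≤ q → hats (suc n) q ℚ.≤ 1ℚ
  hats≤1 n q h with ℚP.≤-total q (ι n)
  ... | inj₁ p = ℚP.≤-reflexive (hats-one n q h p)
  ... | inj₂ p with ℚP.≤-total q (1ℚ ℚ.+ ι n)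
  ... | inj₁ r = ℚP.≤-trans (ℚP.≤-reflexive (hats-last n q h p r))
    (q≤-by (ℚS.solve 2 (λ k q → ℚS.con 1ℚ ℚS.:= ((ℚS.con 1ℚ ℚS.:+ k) ℚS.:- q) ℚS.:+ (q ℚS.:- k)) refl (ι n) q) (q0≤- p))
  ... | inj₂ r = ℚP.≤-trans (ℚP.≤-reflexive (hats-beyond (suc n) q (subst (ℚ._≤ q) (sym (ι-suc n)) r))) (ℚP.<⇒≤ (ℚP.positive⁻¹ 1ℚ))

  arg : ℕ → ℚ → ℚ
  arg j q = ι (suc (mesh j)) ℚ.* pos⁺ q

  0≤arg : ∀ j q → 0ℚ ℚ.≤ arg j q
  0≤arg j q = q0≤* (0≤ι (suc (mesh j))) (ℚP.p≤p⊔q 0ℚ q)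

  ∑ℕ : ℕ → (ℕ → ℕ) → ℕ
  ∑ℕ zero    f = 0
  ∑ℕ (suc n) f = f n ℕ.+ ∑ℕ n f

  φ : ∀ j → (ℕ → ℕ) → Path (top j)
  fn    (φ j g) q = wave (suc (nodes j)) (value j g) (arg j q)
  const (φ j g)   = suc (mesh j) ℕ.* ∑ℕ (suc (nodes j)) (λ _ → top j)
  lip   (φ j g) p q = ℚP.≤-trans (wave-lip (suc (nodes j)) (value j g) (arg j p) (arg j q) (0≤value j g))
    (ℚP.≤-trans (*≤* (ℚP.0≤∣p∣ (arg j p ℚ.- arg j q)) (0≤ι (∑ℕ (suc (nodes j)) (λ _ → top j))) diff (sums (suc (nodes j))))
      (ℚP.≤-reflexive (trans (ℚS.solve 3 (λ m d s → (m ℚS.:* d) ℚS.:* s ℚS.:= d ℚS.:* (m ℚS.:* s)) refl (ι (suc (mesh j))) ℚ.∣ p ℚ.- q ∣ (ι (∑ℕ (suc (nodes j)) (λ _ → top j))))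
        (cong (ℚ.∣ p ℚ.- q ∣ ℚ.*_) (sym (ι-* (suc (mesh j)) (∑ℕ (suc (nodes j)) (λ _ → top j))))))))
    where
    sums : ∀ n → ∑ᵠ n (value j g) ℚ.≤ ι (∑ℕ n (λ _ → top j))
    sums zero    = 0≤ι 0
    sums (suc n) = ℚP.≤-trans (ℚP.+-mono-≤ (value≤top j g n) (sums n)) (ℚP.≤-reflexive (sym (ι-+ (top j) _)))
    diff : ℚ.∣ arg j p ℚ.- arg j q ∣ ℚ.≤ ι (suc (mesh j)) ℚ.* ℚ.∣ p ℚ.- q ∣
    diff = subst (λ z → ℚ.∣ z ∣ ℚ.≤ ι (suc (mesh j)) ℚ.* ℚ.∣ p ℚ.- q ∣) (ℚS.solve 3 (λ m p q → m ℚS.:* (p ℚS.:- q) ℚS.:= m ℚS.:* p ℚS.:- m ℚS.:* q) refl (ι (suc (mesh j))) (pos⁺ p) (pos⁺ q))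
      (∣*∣ (ι (suc (mesh j))) (pos⁺ p ℚ.- pos⁺ q) (ℚP.≤-reflexive (ℚP.0≤p⇒∣p∣≡p (0≤ι (suc (mesh j))))) (⊔-lip 0ℚ p q))
  lo    (φ j g) q = 0≤wave (suc (nodes j)) (value j g) (arg j q) (0≤value j g)
  hi    (φ j g) q = wave-hi (suc (nodes j)) (value j g) (arg j q) (0≤value j g) (value≤top j g) (hats≤1 (nodes j) (arg j q) (0≤arg j q)) (0≤ι (top j))

  -- The radius is pw j up to j + 1 and leaves the next level free after j + 2.
  radius : ℕ → ℚ → ℚ
  radius j q = pw j ℚ.+ ι (top (suc j)) ℚ.* pos⁺ (q ℚ.- ι (suc j))

  0≤ramp : ∀ j q → 0ℚ ℚ.≤ ι (top (suc j)) ℚ.* pos⁺ (q ℚ.- ι (suc j))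
  0≤ramp j q = q0≤* (0≤ι (top (suc j))) (ℚP.p≤p⊔q 0ℚ (q ℚ.- ι (suc j)))

  0≤radius : ∀ j q → 0ℚ ℚ.≤ radius j q
  0≤radius j q = q0≤+ (0≤pw j) (0≤ramp j q)

  radius-lip : ∀ j p q → ℚ.∣ radius j p ℚ.- radius j q ∣ ℚ.≤ ℚ.∣ p ℚ.- q ∣ ℚ.* ι (top (suc j))
  radius-lip j p q = subst₂ (λ u v → ℚ.∣ u ∣ ℚ.≤ v)
    (ℚS.solve 4 (λ w t p q → t ℚS.:* (p ℚS.:- q) ℚS.:= (w ℚS.:+ t ℚS.:* p) ℚS.:- (w ℚS.:+ t ℚS.:* q)) refl (pw j) (ι (top (suc j))) (pos⁺ (p ℚ.- ι (suc j))) (pos⁺ (q ℚ.- ι (suc j))))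
    (ℚP.*-comm (ι (top (suc j))) ℚ.∣ p ℚ.- q ∣)
    (∣*∣ (ι (top (suc j))) _ (ℚP.≤-reflexive (ℚP.0≤p⇒∣p∣≡p (0≤ι (top (suc j)))))
      (ℚP.≤-trans (⊔-lip 0ℚ (p ℚ.- ι (suc j)) (q ℚ.- ι (suc j))) (ℚP.≤-reflexive (cong ℚ.∣_∣ (ℚS.solve 3 (λ p q k → (p ℚS.:- k) ℚS.:- (q ℚS.:- k) ℚS.:= p ℚS.:- q) refl p q (ι (suc j)))))))

  next : ∀ j → Path (top j) → Path (top (suc j)) → Path (top (suc j))
  fn    (next j e f) q = clampᵠ (fn e q) (radius j q) (fn f q)
  const (next j e f) = (const e ℕ.+ top (suc j)) ℕ.+ ((const e ℕ.+ top (suc j)) ℕ.+ const f)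
  lip   (next j e f) p q = ℚP.≤-trans (⊔-lip₂ (fn e p ℚ.- radius j p) ((fn e p ℚ.+ radius j p) ℚ.⊓ fn f p) (fn e q ℚ.- radius j q) ((fn e q ℚ.+ radius j q) ℚ.⊓ fn f q))
    (ℚP.≤-trans (ℚP.+-mono-≤ minus (ℚP.≤-trans (⊓-lip₂ (fn e p ℚ.+ radius j p) (fn f p) (fn e q ℚ.+ radius j q) (fn f q)) (ℚP.+-mono-≤ plus (lip f p q))))
      (ℚP.≤-reflexive (trans (ℚS.solve 4 (λ d a t b → (d ℚS.:* a ℚS.:+ d ℚS.:* t) ℚS.:+ ((d ℚS.:* a ℚS.:+ d ℚS.:* t) ℚS.:+ d ℚS.:* b) ℚS.:= d ℚS.:* ((a ℚS.:+ t) ℚS.:+ ((a ℚS.:+ t) ℚS.:+ b)))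
          refl ℚ.∣ p ℚ.- q ∣ (ι (const e)) (ι (top (suc j))) (ι (const f)))
        (cong (ℚ.∣ p ℚ.- q ∣ ℚ.*_) (sym (trans (ι-+ (const e ℕ.+ top (suc j)) _) (cong₂ ℚ._+_ (ι-+ (const e) (top (suc j)))
          (trans (ι-+ (const e ℕ.+ top (suc j)) (const f)) (cong (ℚ._+ ι (const f)) (ι-+ (const e) (top (suc j)))))))))))
    )
    where
    rl : ℚ.∣ fn e p ℚ.- fn e q ∣ ℚ.+ ℚ.∣ radius j p ℚ.- radius j q ∣ ℚ.≤ ℚ.∣ p ℚ.- q ∣ ℚ.* ι (const e) ℚ.+ ℚ.∣ p ℚ.- q ∣ ℚ.* ι (top (suc j))
    rl = ℚP.+-mono-≤ (lip e p q) (radius-lip j p q)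
    plus : ℚ.∣ (fn e p ℚ.+ radius j p) ℚ.- (fn e q ℚ.+ radius j q) ∣ ℚ.≤ ℚ.∣ p ℚ.- q ∣ ℚ.* ι (const e) ℚ.+ ℚ.∣ p ℚ.- q ∣ ℚ.* ι (top (suc j))
    plus = ℚP.≤-trans (ℚP.≤-trans (ℚP.≤-reflexive (cong ℚ.∣_∣ (ℚS.solve 4 (λ a b c d → (a ℚS.:+ b) ℚS.:- (c ℚS.:+ d) ℚS.:= (a ℚS.:- c) ℚS.:+ (b ℚS.:- d)) refl (fn e p) (radius j p) (fn e q) (radius j q))))
      (ℚP.∣p+q∣≤∣p∣+∣q∣ (fn e p ℚ.- fn e q) (radius j p ℚ.- radius j q))) rl
    minus : ℚ.∣ (fn e p ℚ.- radius j p) ℚ.- (fn e q ℚ.- radius j q) ∣ ℚ.≤ ℚ.∣ p ℚ.- q ∣ ℚ.* ι (const e) ℚ.+ ℚ.∣ p ℚ.- q ∣ ℚ.* ι (top (suc j))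
    minus = ℚP.≤-trans (ℚP.≤-trans (ℚP.≤-reflexive (cong ℚ.∣_∣ (ℚS.solve 4 (λ a b c d → (a ℚS.:- b) ℚS.:- (c ℚS.:- d) ℚS.:= (a ℚS.:- c) ℚS.:+ (ℚS.:- (b ℚS.:- d))) refl (fn e p) (radius j p) (fn e q) (radius j q))))
      (ℚP.≤-trans (ℚP.∣p+q∣≤∣p∣+∣q∣ (fn e p ℚ.- fn e q) (ℚ.- (radius j p ℚ.- radius j q))) (ℚP.≤-reflexive (cong (ℚ.∣ fn e p ℚ.- fn e q ∣ ℚ.+_) (ℚP.∣-p∣≡∣p∣ (radius j p ℚ.- radius j q)))))) rl
  lo    (next j e f) q = clamp-lo (fn e q) (radius j q) (fn f q) (lo e q) (0≤radius j q) (lo f q)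
  hi    (next j e f) q = clamp-hi (fn e q) (radius j q) (fn f q) (0≤radius j q) (ℚP.≤-trans (hi e q) (ι-mono (top-mono j))) (hi f q)

  codes : ℕ → List (ℕ → ℕ)
  codes j = fnList (suc (nodes j)) (steps j)

  ends : ∀ j → List (Path (top j))
  ends zero    = map (φ 0) (codes 0)
  ends (suc j) = concatMap (λ e → map (λ g → next j e (φ (suc j) g)) (codes (suc j))) (ends j)

  -- `F i` stands for the i-th rational approximation of one path, whose √n is known only
  -- approximately; `e` has to fit all of them.
  Fits : ∀ (F : ℕ → ℚ → ℚ) j → Path (top j) → Set
  Fits F j e = ∀ i q → q ℚ.≤ ι (2 ℕ.+ j) → ℚ.∣ fn e q ℚ.- F i q ∣ ℚ.≤ pw j

  -- On [0, j + 2] the target lies within the radius of `e`, so clamping fixes it and, being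
  -- 1-Lipschitz, does not increase the distance of `f` to it. Beyond j + 2 the radius exceeds the
  -- whole range of values and clamping does nothing.
  next-fits : ∀ F j e f → Fits F j e → Fits F (suc j) f → Fits F (suc j) (next j e f)
  next-fits F j e f he hf i q q≤ with ℚP.≤-total q (ι (2 ℕ.+ j))
  ... | inj₁ h = subst (λ z → ℚ.∣ clampᵠ (fn e q) (radius j q) (fn f q) ℚ.- z ∣ ℚ.≤ pw (suc j))
    (clamp-id (fn e q) (radius j q) (F i q) (ℚP.≤-trans (ℚP.≤-reflexive (∣-∣-sym (F i q) (fn e q))) (ℚP.≤-trans (he i q h) (q≤-by refl (0≤ramp j q)))))
    (ℚP.≤-trans (clamp-lip (fn e q) (radius j q) (fn f q) (F i q)) (hf i q q≤))
  ... | inj₂ h = subst (λ z → ℚ.∣ z ℚ.- F i q ∣ ℚ.≤ pw (suc j)) (sym (clamp-id (fn e q) (radius j q) (fn f q) far₀)) (hf i q q≤)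
    where
    T = ι (top (suc j))
    T≤ : T ℚ.≤ radius j q
    T≤ = ℚP.≤-trans (ℚP.≤-trans (ℚP.≤-reflexive (sym (ℚP.*-identityʳ T))) (ℚP.*-monoˡ-≤-nonNeg T {{ℚ.nonNegative (0≤ι (top (suc j)))}}
        (ℚP.≤-trans (q≤-by (ℚS.solve 2 (λ q k → q ℚS.:- k ℚS.:= ℚS.con 1ℚ ℚS.:+ (q ℚS.:- (ℚS.con 1ℚ ℚS.:+ k))) refl q (ι (suc j))) (q0≤- (subst (ℚ._≤ q) (ι-suc (suc j)) h))) (ℚP.p≤q⊔p 0ℚ (q ℚ.- ι (suc j))))))
      (ℚP.≤-trans (ℚP.≤-reflexive (sym (ℚP.+-identityˡ (T ℚ.* pos⁺ (q ℚ.- ι (suc j)))))) (ℚP.+-monoˡ-≤ (T ℚ.* pos⁺ (q ℚ.- ι (suc j))) (0≤pw j)))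
    far₀ : ℚ.∣ fn f q ℚ.- fn e q ∣ ℚ.≤ radius j q
    far₀ = ∣-∣-intro {fn f q} {fn e q} (ℚP.≤-trans (hi f q) (ℚP.≤-trans T≤ (q≤-by (ℚP.+-comm (fn e q) (radius j q)) (lo e q))))
      (ℚP.≤-trans (hi e q) (ℚP.≤-trans (ι-mono (top-mono j)) (ℚP.≤-trans T≤ (q≤-by (ℚP.+-comm (fn f q) (radius j q)) (lo f q)))))

  ends-fit : ∀ F J → (∀ j → j ℕ.≤ J → Any (λ g → Fits F j (φ j g)) (codes j)) → Any (Fits F J) (ends J)
  ends-fit F zero    h = AnyP.map⁺ (h 0 z≤n)
  ends-fit F (suc J) h = AnyP.concatMap⁺ _ (Any.map (λ {e} he → AnyP.map⁺ (Any.map (λ {g} hg → next-fits F J e (φ (suc J) g) he hg) (h (suc J) ℕP.≤-refl)))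
    (ends-fit F J (λ j p → h j (ℕP.m≤n⇒m≤1+n p))))

  -- Used with δ = 2 `pw j`: the moves at levels i, ..., j - 1 sum to 2 `pw i` - 2 `pw j`, and the
  -- subtracted term lets the estimate telescope exactly.
  Truncates : ∀ i → (ℚ → ℚ) → ℚ → Path (top i) → Set
  Truncates i f δ e = ∀ q → q ℚ.≤ ι (suc i) → ℚ.∣ f q ℚ.- fn e q ∣ ℚ.≤ (pw i ℚ.+ pw i) ℚ.- δ

  radius-inner : ∀ i j q → i ℕ.≤ j → q ℚ.≤ ι (suc i) → radius j q ≡ pw j
  radius-inner i j q i≤j q≤ = trans (cong (λ z → pw j ℚ.+ ι (top (suc j)) ℚ.* z) (ℚP.p≥q⇒p⊔q≡p {0ℚ} {q ℚ.- ι (suc j)}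
      (q≤-by (ℚS.solve 2 (λ q k → ℚS.con 0ℚ ℚS.:= (q ℚS.:- k) ℚS.:+ (k ℚS.:- q)) refl q (ι (suc j))) (q0≤- (ℚP.≤-trans q≤ (ι-mono (s≤s i≤j)))))))
    (trans (cong (pw j ℚ.+_) (ℚP.*-zeroʳ (ι (top (suc j))))) (ℚP.+-identityʳ (pw j)))

  truncate-step : ∀ i j e f e₀ → i ℕ.≤ j → Truncates i (fn e) (pw j ℚ.+ pw j) e₀ → Truncates i (fn (next j e f)) (pw (suc j) ℚ.+ pw (suc j)) e₀
  truncate-step i j e f e₀ i≤j h q q≤ = ℚP.≤-trans (∣-∣-tri (fn (next j e f) q) (fn e q) (fn e₀ q)
      (ℚP.≤-trans (clamp-near (fn e q) (radius j q) (fn f q) (0≤radius j q)) (ℚP.≤-reflexive (radius-inner i j q i≤j q≤))) (h q q≤))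
    (ℚP.≤-reflexive (trans (ℚS.solve 2 (λ p w → p ℚS.:+ (w ℚS.:- (p ℚS.:+ p)) ℚS.:= w ℚS.:- p) refl (pw j) (pw i ℚ.+ pw i)) (cong (λ z → (pw i ℚ.+ pw i) ℚ.- z) (sym (pw-twice j)))))

  truncate-self : ∀ i (es : List (Path (top i))) → All (λ e → Any (Truncates i (fn e) (pw i ℚ.+ pw i)) es) es
  truncate-self i []       = []
  truncate-self i (e ∷ es) = here (λ q _ → ℚP.≤-reflexive (trans (cong ℚ.∣_∣ (ℚP.+-inverseʳ (fn e q))) (sym (ℚP.+-inverseʳ (pw i ℚ.+ pw i))))) ∷ All.map there (truncate-self i es)

  truncate-all : ∀ i j → i ℕ.≤ j → (es : List (Path (top j))) (gs : List (ℕ → ℕ)) →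
    All (λ e → Any (Truncates i (fn e) (pw j ℚ.+ pw j)) (ends i)) es →
    All (λ e → Any (Truncates i (fn e) (pw (suc j) ℚ.+ pw (suc j))) (ends i)) (concatMap (λ e → map (λ g → next j e (φ (suc j) g)) gs) es)
  truncate-all i j i≤j []       gs []       = []
  truncate-all i j i≤j (e ∷ es) gs (h ∷ hs) = AllP.++⁺ (AllP.map⁺ (All.universal (λ g → Any.map (λ {e₀} t → truncate-step i j e (φ (suc j) g) e₀ i≤j t) h) gs))
    (truncate-all i j i≤j es gs hs)

  truncate : ∀ i d → All (λ e → Any (Truncates i (fn e) (pw (d ℕ.+ i) ℚ.+ pw (d ℕ.+ i))) (ends i)) (ends (d ℕ.+ i))
  truncate i zero    = truncate-self i (ends i)
  truncate i (suc d) = truncate-all i (d ℕ.+ i) (ℕP.m≤n+m i d) (ends (d ℕ.+ i)) (codes (suc (d ℕ.+ i))) (truncate i d)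

-- Each level has finitely many codes, and the levels after j change a chain by at most 2 pw j on a long
-- interval: hence total boundedness.
module Closure (mesh unit top : ℕ → ℕ) (top-mono : ∀ j → top j ℕ.≤ top (suc j)) where

  open Chains mesh unit top top-mono

  -- Closedness is built in, so a limit of members is again a member; the chains that approximate f
  -- at different accuracies need not be compatible.
  𝒦 : C[0,∞[ → Set
  𝒦 f = ∀ m ε → 0ℚ ℚ.< ε → ∃ λ j → Any (λ e → Within m ε f (lift e)) (ends j)

  within-tri : ∀ m f g h {ε δ} → Within m ε f g → Within m δ g h → Within m (ε ℚ.+ δ) f h
  within-tri m f g h {ε} {δ} p q x 0≤x hx = close-tri (fun f x 0≤x) (fun g x 0≤x) (fun h x 0≤x) {ε} {δ} (p x 0≤x hx) (q x 0≤x hx)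

  within-sym : ∀ m f g {ε} → Within m ε f g → Within m ε g f
  within-sym m f g {ε} p x 0≤x hx = close-sym (fun f x 0≤x) (fun g x 0≤x) {ε} (p x 0≤x hx)

  within-weaken : ∀ m f g {ε δ} → ε ℚ.≤ δ → Within m ε f g → Within m δ f g
  within-weaken m f g {ε} {δ} h p x 0≤x hx = close-weaken (fun f x 0≤x) (fun g x 0≤x) {ε} {δ} h (p x 0≤x hx)

  within-half : ∀ m f g h {ε} → Within m (½ ℚ.* ε) f g → Within m (½ ℚ.* ε) g h → Within m ε f h
  within-half m f g h {ε} p q = within-weaken m f h {½ ℚ.* ε ℚ.+ ½ ℚ.* ε} {ε} (ℚP.≤-reflexive (halves ε)) (within-tri m f g h {½ ℚ.* ε} {½ ℚ.* ε} p q)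

  private
    respects′ : ∀ {f g} → f ≐ g → 𝒦 f → 𝒦 g
    respects′ {f} {g} f≐g Kf m ε ε>0 = proj₁ c , Any.map (λ {e} w x 0≤x hx →
        close-weaken (fun g x 0≤x) (fun (lift e) x 0≤x) {0ℚ ℚ.+ ε} {ε} (ℚP.≤-reflexive (ℚP.+-identityˡ ε))
          (close-tri (fun g x 0≤x) (fun f x 0≤x) (fun (lift e) x 0≤x) {0ℚ} {ε}
            (close-sym (fun f x 0≤x) (fun g x 0≤x) {0ℚ} (close-≈ (fun f x 0≤x) (fun g x 0≤x) (f≐g x 0≤x))) (w x 0≤x hx))) (proj₂ c)
      where c = Kf m ε ε>0

    all-self : ∀ j m ε → 0ℚ ℚ.< ε → (es : List (Path (top j))) → All (λ e → Any (λ e′ → Within m ε (lift e) (lift e′)) es) es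
    all-self j m ε ε>0 []       = []
    all-self j m ε ε>0 (e ∷ es) = here (within-lift m ε e e (λ q _ → ℚP.≤-trans (ℚP.≤-reflexive (cong ℚ.∣_∣ (ℚP.+-inverseʳ (fn e q)))) (ℚP.<⇒≤ ε>0)))
      ∷ All.map there (all-self j m ε ε>0 es)

    𝒦-ends : ∀ j → All (λ e → 𝒦 (lift e)) (ends j)
    𝒦-ends j = go (ends j) (λ m ε ε>0 → all-self j m ε ε>0 (ends j))
      where
      go : ∀ es → (∀ m ε → 0ℚ ℚ.< ε → All (λ e → Any (λ e′ → Within m ε (lift e) (lift e′)) (ends j)) es) → All (λ e → 𝒦 (lift e)) es
      go []       h = []
      go (e ∷ es) h = (λ m ε ε>0 → j , All.head (h m ε ε>0)) ∷ go es (λ m ε ε>0 → All.tail (h m ε ε>0))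

    upto : ℕ → List C[0,∞[
    upto zero    = map lift (ends 0)
    upto (suc i) = map lift (ends (suc i)) ++ upto i

    upto-𝒦 : ∀ i → All 𝒦 (upto i)
    upto-𝒦 zero    = AllP.map⁺ (𝒦-ends 0)
    upto-𝒦 (suc i) = AllP.++⁺ (AllP.map⁺ (𝒦-ends (suc i))) (upto-𝒦 i)

    upto-any : ∀ {P : C[0,∞[ → Set} i j → j ℕ.≤ i → Any (λ e → P (lift e)) (ends j) → Any P (upto i)
    upto-any zero    zero    z≤n h = AnyP.map⁺ h
    upto-any (suc i) j       p   h with ℕP.m≤n⇒m<n∨m≡n p
    ... | inj₁ (s≤s q) = AnyP.++⁺ʳ (map lift (ends (suc i))) (upto-any i j q h)
    ... | inj₂ refl    = AnyP.++⁺ˡ (AnyP.map⁺ h)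

    -- A chain of level j ≥ i stays within 2 `pw i` of its own beginning of level i on [0, i + 1],
    -- so the beginning approximates f almost as well.
    truncated : ∀ i m ε f → m ℕ.≤ i → pw i ℚ.+ pw i ℚ.≤ ½ ℚ.* ε → ∀ j → Any (λ e → Within m (½ ℚ.* ε) f (lift e)) (ends j) → i ℕ.≤ j →
      Any (λ e → Within m ε f (lift e)) (ends i)
    truncated i m ε f m≤i small j h i≤j with ℕP.m≤n⇒∃[o]m+o≡n i≤j
    ... | d , refl = go (ends j) h (subst (λ j → All (λ e → Any (Truncates i (fn e) (pw j ℚ.+ pw j)) (ends i)) (ends j)) (ℕP.+-comm d i) (truncate i d))
      where
      go : ∀ es → Any (λ e → Within m (½ ℚ.* ε) f (lift e)) es → All (λ e → Any (Truncates i (fn e) (pw j ℚ.+ pw j)) (ends i)) es →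
        Any (λ e → Within m ε f (lift e)) (ends i)
      go (e ∷ es) (here w)  (t ∷ ts) = Any.map (λ {e₀} tr → within-half m f (lift e) (lift e₀) {ε} w
        (within-lift m (½ ℚ.* ε) e e₀ (λ q q≤ → ℚP.≤-trans (tr q (ℚP.≤-trans q≤ (ι-mono (s≤s m≤i))))
          (ℚP.≤-trans (q≤-by (ℚS.solve 2 (λ w p → w ℚS.:= (w ℚS.:- p) ℚS.:+ p) refl (pw i ℚ.+ pw i) (pw j ℚ.+ pw j)) (q0≤+ (0≤pw j) (0≤pw j))) small)))) t
      go (e ∷ es) (there h) (t ∷ ts) = go es h ts

    totallyBounded′ : ∀ m ε → 0ℚ ℚ.< ε → ∃ λ fs → All 𝒦 fs × (∀ f → 𝒦 f → Any (Within m ε f) fs)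
    totallyBounded′ m ε ε>0 = upto i , upto-𝒦 i , find
      where
      s = pw-small (½ ℚ.* (½ ℚ.* ε)) (0<½ (0<½ ε>0))
      i = m ℕ.⊔ proj₁ s
      small : pw i ℚ.+ pw i ℚ.≤ ½ ℚ.* ε
      small = ℚP.≤-trans (ℚP.+-mono-≤ p p) (ℚP.≤-reflexive (halves (½ ℚ.* ε)))
        where p = ℚP.≤-trans (pw-mono (ℕP.m≤n⊔m m (proj₁ s))) (proj₂ s)
      find : ∀ f → 𝒦 f → Any (Within m ε f) (upto i)
      find f Kf with Kf m (½ ℚ.* ε) (0<½ ε>0)
      ... | j , h with ℕP.≤-total j i
      ... | inj₁ j≤i = upto-any i j j≤i (Any.map (λ {e} w → within-weaken m f (lift e) {½ ℚ.* ε} {ε}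
              (q≤-by (sym (halves ε)) (ℚP.<⇒≤ (0<½ ε>0))) w) h)
      ... | inj₂ i≤j = upto-any i i ℕP.≤-refl (truncated i m ε f (ℕP.m≤m⊔n m (proj₁ s)) small j h i≤j)

    complete′ : ∀ F → (∀ i → 𝒦 (F i)) → CauchySequence F → ∃ λ g → 𝒦 g × F ⟶ g
    complete′ F KF cF = limitFun , (λ m ε ε>0 →
        let i = proj₁ (cF m (½ ℚ.* ε) (0<½ ε>0)) ; c = KF i m (½ ℚ.* ε) (0<½ ε>0) in
        proj₁ c , Any.map (λ {e} w → within-half m limitFun (F i) (lift e) {ε}
          (within-sym m (F i) limitFun {½ ℚ.* ε} (limitFun-within m (½ ℚ.* ε) (0<½ ε>0) i ℕP.≤-refl)) w) (proj₂ c)) , limitFun-⟶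
      where open LimitFun F cF

  𝒦-compact : Compact 𝒦
  𝒦-compact = record { respects = λ {f} {g} → respects′ {f} {g} ; totallyBounded = totallyBounded′ ; complete = complete′ }

-- The rescaled path of a tree

isqrt-lower : ∀ n → isqrt n ℕ.* isqrt n ℕ.≤ n
isqrt-lower zero = z≤n
isqrt-lower (suc n) with suc (isqrt n) ℕ.* suc (isqrt n) ℕP.≤? suc n
... | yes h = h
... | no  _ = ℕP.m≤n⇒m≤1+n (isqrt-lower n)

isqrt-upper : ∀ n → n ℕ.< suc (isqrt n) ℕ.* suc (isqrt n)
isqrt-upper zero = s≤s z≤n
isqrt-upper (suc n) with suc (isqrt n) ℕ.* suc (isqrt n) ℕP.≤? suc n
... | yes _ = ℕP.≤-<-trans (isqrt-upper n) (ℕP.*-mono-< (ℕP.n<1+n (suc (isqrt n))) (ℕP.n<1+n (suc (isqrt n))))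
... | no  h = ℕP.≰⇒> h

opaque
  root : ℕ → ℕ → ℚ
  root n m = seq (√ n) m

  root-def : ∀ n m → root n m ≡ seq (√ n) m
  root-def n m = refl

opaque
  unfolding ι inv

  /≡ι*inv : ∀ k m → + k ℚ./ suc m ≡ ι k ℚ.* inv m
  /≡ι*inv k m = ℚP.toℚᵘ-injective (begin
    ℚ.toℚᵘ (+ k ℚ./ suc m)                        ≈⟨ ℚP.toℚᵘ-fromℚᵘ (mkℚᵘ (+ k) m) ⟩
    mkℚᵘ (+ k) m                                   ≈⟨ ℚᵘ.*≡* (trans (cong (λ z → + k ℤ.* + suc z) (ℕP.+-identityʳ m)) (cong (ℤ._* + suc m) (sym (ℤP.*-identityʳ (+ k))))) ⟩
    mkℚᵘ (+ k) 0 ℚᵘ.* mkℚᵘ (+ 1) m                 ≈⟨ ℚᵘP.≃-sym (ℚᵘP.*-cong (ℚP.toℚᵘ-fromℚᵘ (mkℚᵘ (+ k) 0)) (ℚP.toℚᵘ-fromℚᵘ (mkℚᵘ (+ 1) m))) ⟩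
    ℚ.toℚᵘ (ι k) ℚᵘ.* ℚ.toℚᵘ (inv m)               ≈⟨ ℚᵘP.≃-sym (ℚP.toℚᵘ-homo-* (ι k) (inv m)) ⟩
    ℚ.toℚᵘ (ι k ℚ.* inv m)                         ∎)
    where open import Relation.Binary.Reasoning.Setoid ℚᵘP.≃-setoid

root-≡ : ∀ n m → root n m ≡ ι (isqrt (n ℕ.* (suc m ℕ.* suc m))) ℚ.* inv m
root-≡ n m = trans (root-def n m) (/≡ι*inv (isqrt (n ℕ.* (suc m ℕ.* suc m))) m)

0≤root : ∀ n m → 0ℚ ℚ.≤ root n m
0≤root n m = subst (0ℚ ℚ.≤_) (sym (root-≡ n m)) (q0≤* (0≤ι _) (0≤inv m))

cancel-square : ∀ x m → (x ℚ.* (ι (suc m) ℚ.* ι (suc m))) ℚ.* (inv m ℚ.* inv m) ≡ x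
cancel-square x m = trans (ℚS.solve 3 (λ x a b → (x ℚS.:* (a ℚS.:* a)) ℚS.:* (b ℚS.:* b) ℚS.:= x ℚS.:* ((a ℚS.:* b) ℚS.:* (a ℚS.:* b))) refl x (ι (suc m)) (inv m))
  (trans (cong (λ z → x ℚ.* (z ℚ.* z)) (ι-inv m)) (trans (cong (x ℚ.*_) (ℚP.*-identityˡ 1ℚ)) (ℚP.*-identityʳ x)))

ι-square : ∀ n m → ι (n ℕ.* (suc m ℕ.* suc m)) ≡ ι n ℚ.* (ι (suc m) ℚ.* ι (suc m))
ι-square n m = trans (ι-* n (suc m ℕ.* suc m)) (cong (ι n ℚ.*_) (ι-* (suc m) (suc m)))

0≤inv² : ∀ m → 0ℚ ℚ.≤ inv m ℚ.* inv m
0≤inv² m = q0≤* (0≤inv m) (0≤inv m)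

root²≤ : ∀ n m → root n m ℚ.* root n m ℚ.≤ ι n
root²≤ n m = ℚP.≤-trans (ℚP.≤-reflexive (trans (cong (λ z → z ℚ.* z) (root-≡ n m))
    (trans (ℚS.solve 2 (λ a b → (a ℚS.:* b) ℚS.:* (a ℚS.:* b) ℚS.:= (a ℚS.:* a) ℚS.:* (b ℚS.:* b)) refl (ι k) (inv m)) (cong (ℚ._* (inv m ℚ.* inv m)) (sym (ι-* k k))))))
  (ℚP.≤-trans (ℚP.*-monoʳ-≤-nonNeg (inv m ℚ.* inv m) {{ℚ.nonNegative (0≤inv² m)}} (ι-mono (isqrt-lower (n ℕ.* (suc m ℕ.* suc m)))))
    (ℚP.≤-reflexive (trans (cong (ℚ._* (inv m ℚ.* inv m)) (ι-square n m)) (cancel-square (ι n) m))))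
  where k = isqrt (n ℕ.* (suc m ℕ.* suc m))

-- With s = m + 1 and k = ⌊s √n⌋, maximality gives n s² ≤ k² + 2 k, and k ≤ n s bounds the excess by
-- (2 n + 1) s.
root²≥ : ∀ n m → ι n ℚ.≤ root n m ℚ.* root n m ℚ.+ ι (suc (n ℕ.+ n)) ℚ.* inv m
root²≥ n m = ℚP.≤-trans (ℚP.≤-reflexive (sym (trans (cong (ℚ._* (inv m ℚ.* inv m)) (ι-square n m)) (cancel-square (ι n) m))))
  (ℚP.≤-trans (ℚP.*-monoʳ-≤-nonNeg (inv m ℚ.* inv m) {{ℚ.nonNegative (0≤inv² m)}} (ι-mono main))
    (ℚP.≤-reflexive (trans (cong (ℚ._* (inv m ℚ.* inv m)) (trans (ι-+ (k ℕ.* k) _) (cong₂ ℚ._+_ (ι-* k k) (ι-* (suc (n ℕ.+ n)) (suc m)))))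
      (trans (ℚS.solve 4 (λ a b c d → (a ℚS.:* a ℚS.:+ c ℚS.:* d) ℚS.:* (b ℚS.:* b) ℚS.:= (a ℚS.:* b) ℚS.:* (a ℚS.:* b) ℚS.:+ c ℚS.:* (b ℚS.:* (d ℚS.:* b))) refl (ι k) (inv m) (ι (suc (n ℕ.+ n))) (ι (suc m)))
        (cong₂ ℚ._+_ (cong (λ z → z ℚ.* z) (sym (root-≡ n m))) (cong (ι (suc (n ℕ.+ n)) ℚ.*_) (trans (cong (inv m ℚ.*_) (ι-inv m)) (ℚP.*-identityʳ (inv m)))))))))
  where
  k = isqrt (n ℕ.* (suc m ℕ.* suc m))
  k≤ : k ℕ.≤ n ℕ.* suc m
  k≤ = ℕP.≮⇒≥ λ lt → ℕP.<⇒≱ (ℕP.<-≤-trans (ℕP.*-mono-< lt lt) (isqrt-lower (n ℕ.* (suc m ℕ.* suc m)))) (big n)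
    where
    big : ∀ n → n ℕ.* (suc m ℕ.* suc m) ℕ.≤ n ℕ.* suc m ℕ.* (n ℕ.* suc m)
    big zero = z≤n
    big n@(suc _) = ℕP.≤-trans (ℕP.m≤n*m (n ℕ.* (suc m ℕ.* suc m)) n) (ℕP.≤-reflexive (lem n (suc m)))
      where
      lem : ∀ n s → n ℕ.* (n ℕ.* (s ℕ.* s)) ≡ n ℕ.* s ℕ.* (n ℕ.* s)
      lem = solveℕ
  main : n ℕ.* (suc m ℕ.* suc m) ℕ.≤ k ℕ.* k ℕ.+ suc (n ℕ.+ n) ℕ.* suc m
  main = ℕP.≤-trans (ℕP.≤-pred (isqrt-upper (n ℕ.* (suc m ℕ.* suc m)))) (ℕP.≤-trans (ℕP.≤-reflexive (lem k))
    (ℕP.+-monoʳ-≤ (k ℕ.* k) (ℕP.≤-trans (ℕP.+-mono-≤ k≤ k≤) (ℕP.≤-trans (ℕP.m≤n+m _ (suc m)) (ℕP.≤-reflexive (lem₂ n (suc m)))))))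
    where
    lem : ∀ k → k ℕ.+ k ℕ.* suc k ≡ k ℕ.* k ℕ.+ (k ℕ.+ k)
    lem = solveℕ
    lem₂ : ∀ n s → s ℕ.+ (n ℕ.* s ℕ.+ n ℕ.* s) ≡ (1 ℕ.+ (n ℕ.+ n)) ℕ.* s
    lem₂ = solveℕ

root≤ : ∀ n m → root (suc n) m ℚ.≤ ι (suc n)
root≤ n m with ℚP.≤-total (root (suc n) m) 1ℚ
... | inj₁ h = ℚP.≤-trans h (subst (ℚ._≤ ι (suc n)) ι-1 (ι-mono (s≤s z≤n)))
... | inj₂ h = ℚP.≤-trans (ℚP.≤-trans (ℚP.≤-reflexive (sym (ℚP.*-identityʳ (root (suc n) m)))) (ℚP.*-monoˡ-≤-nonNeg (root (suc n) m) {{ℚ.nonNegative (0≤root (suc n) m)}} h)) (root²≤ (suc n) m)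

L-beyond : ∀ t k → size t ℕ.≤ k → L t k ≡ 0
L-beyond t k p = ℤP.+-injective (trans (lev-∑ k t) (∑-zero (All.map (λ {x} x<s → ind-no (x ℕP.≟ k) (ℕP.<⇒≢ (ℕP.<-≤-trans x<s p))) (depths< t))))

∑-L : ∀ t r → ∑ᵠ r (λ k → ι (L t k)) ℚ.≤ ι (size t)
∑-L t r = ℚP.≤-trans (ℚP.≤-reflexive (eq r)) (ι-mono (ℤP.drop‿+≤+ (subst (ℤ._≤ sizeℤ t) (trans (∑-cong (downFrom r) λ k → cong (λ z → lev z t) (ℕP.+-identityʳ k)) (nat r)) (∑-lev t 0 r))))
  where
  total : ℕ → ℕ
  total zero    = 0
  total (suc r) = L t r ℕ.+ total r
  nat : ∀ r → ∑ (downFrom r) (λ k → lev k t) ≡ + total r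
  nat zero    = refl
  nat (suc r) = cong (λ z → lev r t ℤ.+ z) (nat r)
  eq : ∀ r → ∑ᵠ r (λ k → ι (L t k)) ≡ ι (total r)
  eq zero    = sym ι-0
  eq (suc r) = trans (cong (ι (L t r) ℚ.+_) (eq r)) (sym (ι-+ (L t r) (total r)))

-- Linear interpolation of the profile

interp : Tree → ℚ → ℚ
interp t = wave (size t) (λ k → ι (L t k))

interp-lip : ∀ t p q → ℚ.∣ interp t p ℚ.- interp t q ∣ ℚ.≤ ℚ.∣ p ℚ.- q ∣ ℚ.* ι (size t)
interp-lip t p q = ℚP.≤-trans (wave-lip (size t) _ p q (λ k → 0≤ι (L t k))) (ℚP.*-monoˡ-≤-nonNeg ℚ.∣ p ℚ.- q ∣ {{ℚ.nonNegative (ℚP.0≤∣p∣ (p ℚ.- q))}} (∑-L t (size t)))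

0≤interp : ∀ t q → 0ℚ ℚ.≤ interp t q
0≤interp t q = 0≤wave (size t) _ q (λ k → 0≤ι (L t k))

hat≤1 : ∀ u → hat u ℚ.≤ 1ℚ
hat≤1 u = ℚP.⊔-lub (ℚP.<⇒≤ (ℚP.positive⁻¹ 1ℚ)) (q≤-by {1ℚ ℚ.- ℚ.∣ u ∣} (ℚS.solve 1 (λ x → ℚS.con 1ℚ ℚS.:= (ℚS.con 1ℚ ℚS.:- x) ℚS.:+ x) refl ℚ.∣ u ∣) (ℚP.0≤∣p∣ u))

interp≤ : ∀ t q → interp t q ℚ.≤ ι (size t)
interp≤ t q = ℚP.≤-trans (go (size t)) (∑-L t (size t))
  where
  go : ∀ n → wave n (λ k → ι (L t k)) q ℚ.≤ ∑ᵠ n (λ k → ι (L t k))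
  go zero    = ℚP.≤-refl
  go (suc n) = ℚP.+-mono-≤ (ℚP.≤-trans (ℚP.*-monoˡ-≤-nonNeg (ι (L t n)) {{ℚ.nonNegative (0≤ι (L t n))}} (hat≤1 (q ℚ.- ι n))) (ℚP.≤-reflexive (ℚP.*-identityʳ (ι (L t n))))) (go n)

wave-tail : ∀ c M N q → M ℕ.≤ N → (∀ k → M ℕ.≤ k → c k ≡ 0ℚ) → wave N c q ≡ wave M c q
wave-tail c M N q M≤N z with ℕP.m≤n⇒∃[o]m+o≡n M≤N
... | o , refl = go o
  where
  go : ∀ o → wave (M ℕ.+ o) c q ≡ wave M c q
  go zero    = cong (λ z → wave z c q) (ℕP.+-identityʳ M)
  go (suc o) = trans (cong (λ z → wave z c q) (ℕP.+-suc M o)) (trans (cong₂ ℚ._+_ (trans (cong (ℚ._* hat (q ℚ.- ι (M ℕ.+ o))) (z (M ℕ.+ o) (ℕP.m≤m+n M o))) (ℚP.*-zeroˡ (hat (q ℚ.- ι (M ℕ.+ o))))) (go o)) (ℚP.+-identityˡ (wave M c q)))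

interp-wave : ∀ t N q → size t ℕ.≤ N → wave N (λ k → ι (L t k)) q ≡ interp t q
interp-wave t N q p = wave-tail (λ k → ι (L t k)) (size t) N q p (λ k h → trans (cong ι (L-beyond t k h)) ι-0)

-- On [k, k+1] only the hats at k and k + 1 contribute.
wave-cell : ∀ c k q → ι k ℚ.≤ q → q ℚ.≤ ι (suc k) → wave (suc (suc k)) c q ≡ (ι (suc k) ℚ.- q) ℚ.* c k ℚ.+ (q ℚ.- ι k) ℚ.* c (suc k)
wave-cell c k q h₁ h₂ = trans (cong₂ ℚ._+_ (cong (c (suc k) ℚ.*_) top) (cong₂ ℚ._+_ (cong (c k ℚ.*_) mid) (∑ᵠ-zero k λ i i<k → trans (cong (c i ℚ.*_) (low i i<k)) (ℚP.*-zeroʳ (c i)))))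
  (trans (ℚS.solve 4 (λ q k a b → b ℚS.:* (ℚS.con 1ℚ ℚS.:- ((ℚS.con 1ℚ ℚS.:+ k) ℚS.:- q)) ℚS.:+ (a ℚS.:* (ℚS.con 1ℚ ℚS.:- (q ℚS.:- k)) ℚS.:+ ℚS.con 0ℚ)
      ℚS.:= ((ℚS.con 1ℚ ℚS.:+ k) ℚS.:- q) ℚS.:* a ℚS.:+ (q ℚS.:- k) ℚS.:* b) refl q (ι k) (c k) (c (suc k)))
    (cong (λ z → (z ℚ.- q) ℚ.* c k ℚ.+ (q ℚ.- ι k) ℚ.* c (suc k)) (sym (ι-suc k))))
  where
  h₂′ : q ℚ.≤ 1ℚ ℚ.+ ι k
  h₂′ = subst (q ℚ.≤_) (ι-suc k) h₂
  dk : ℚ.∣ q ℚ.- ι k ∣ ≡ q ℚ.- ι k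
  dk = ℚP.0≤p⇒∣p∣≡p (q0≤- h₁)
  dk′ : ℚ.∣ q ℚ.- ι (suc k) ∣ ≡ (1ℚ ℚ.+ ι k) ℚ.- q
  dk′ = trans (∣-∣-sym q (ι (suc k))) (trans (cong (λ z → ℚ.∣ z ℚ.- q ∣) (ι-suc k)) (ℚP.0≤p⇒∣p∣≡p (q0≤- h₂′)))
  mid : hat (q ℚ.- ι k) ≡ 1ℚ ℚ.- (q ℚ.- ι k)
  mid = trans (hat-one (q ℚ.- ι k) (subst (ℚ._≤ 1ℚ) (sym dk) (q≤-by (ℚS.solve 2 (λ q k → ℚS.con 1ℚ ℚS.:= (q ℚS.:- k) ℚS.:+ ((ℚS.con 1ℚ ℚS.:+ k) ℚS.:- q)) refl q (ι k)) (q0≤- h₂′)))) (cong (λ z → 1ℚ ℚ.- z) dk)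
  top : hat (q ℚ.- ι (suc k)) ≡ 1ℚ ℚ.- ((1ℚ ℚ.+ ι k) ℚ.- q)
  top = trans (hat-one (q ℚ.- ι (suc k)) (subst (ℚ._≤ 1ℚ) (sym dk′) (q≤-by (ℚS.solve 2 (λ q k → ℚS.con 1ℚ ℚS.:= ((ℚS.con 1ℚ ℚS.:+ k) ℚS.:- q) ℚS.:+ (q ℚS.:- k)) refl q (ι k)) (q0≤- h₁)))) (cong (λ z → 1ℚ ℚ.- z) dk′)
  low : ∀ i → i ℕ.< k → hat (q ℚ.- ι i) ≡ 0ℚ
  low i i<k = hat-zero (q ℚ.- ι i) (far {q} {i} (ℚP.≤-trans (subst (ℚ._≤ ι k) (trans (ι-suc i) (ℚP.+-comm 1ℚ (ι i))) (ι-mono i<k)) h₁))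

interp-cell : ∀ t k q → ι k ℚ.≤ q → q ℚ.≤ ι (suc k) → interp t q ≡ (ι (suc k) ℚ.- q) ℚ.* ι (L t k) ℚ.+ (q ℚ.- ι k) ℚ.* ι (L t (suc k))
interp-cell t k q h₁ h₂ = trans (sym (interp-wave t n₀ q (ℕP.m≤m⊔n (size t) (suc (suc k))))) (trans (extend (ℕP.m≤n⇒∃[o]m+o≡n (ℕP.m≤n⊔m (size t) (suc (suc k))))) (wave-cell c k q h₁ h₂))
  where
  c : ℕ → ℚ
  c i = ι (L t i)
  n₀ = size t ℕ.⊔ suc (suc k)
  extend : (∃ λ o → suc (suc k) ℕ.+ o ≡ n₀) → wave n₀ c q ≡ wave (suc (suc k)) c q
  extend (o , e) = trans (cong (λ z → wave z c q) (sym e)) (go o)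
    where
    go : ∀ o → wave (suc (suc k) ℕ.+ o) c q ≡ wave (suc (suc k)) c q
    go zero    = cong (λ z → wave z c q) (ℕP.+-identityʳ (suc (suc k)))
    go (suc o) = trans (cong (λ z → wave z c q) (ℕP.+-suc (suc (suc k)) o)) (trans (cong₂ ℚ._+_ (trans (cong (c j ℚ.*_) (hat-zero (q ℚ.- ι j) (far′ {q} {j}
        (ℚP.≤-trans (ℚP.+-monoˡ-≤ 1ℚ h₂) (subst (ℚ._≤ ι j) (trans (ι-suc (suc k)) (ℚP.+-comm 1ℚ (ι (suc k)))) (ι-mono (ℕP.m≤m+n (suc (suc k)) o))))))) (ℚP.*-zeroʳ (c j))) (go o)) (ℚP.+-identityˡ _))
      where j = suc (suc k) ℕ.+ o

module Rescaled (n′ : ℕ) (t : Tree) (size≡ : size t ≡ suc n′) where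

  private
    n : ℕ
    n = suc n′

    s : ℕ → ℚ
    s m = root n m

    0≤s : ∀ m → 0ℚ ℚ.≤ s m
    0≤s m = 0≤root n m

    g : ℚ → ℚ
    g = interp t

    g-lip : ∀ p q → ℚ.∣ g p ℚ.- g q ∣ ℚ.≤ ℚ.∣ p ℚ.- q ∣ ℚ.* ι n
    g-lip p q = subst (λ z → ℚ.∣ g p ℚ.- g q ∣ ℚ.≤ ℚ.∣ p ℚ.- q ∣ ℚ.* ι z) size≡ (interp-lip t p q)

    g≤ : ∀ q → g q ℚ.≤ ι n
    g≤ q = subst (λ z → g q ℚ.≤ ι z) size≡ (interp≤ t q)

    ∣g∣≤ : ∀ q → ℚ.∣ g q ∣ ℚ.≤ ι n
    ∣g∣≤ q = subst (ℚ._≤ ι n) (sym (ℚP.0≤p⇒∣p∣≡p (0≤interp t q))) (g≤ q)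

    w : ℚ
    w = inv n′

    w*n : w ℚ.* ι n ≡ 1ℚ
    w*n = inv-ι n′

    ∣∣-id : ∀ {x} → 0ℚ ℚ.≤ x → ℚ.∣ x ∣ ℚ.≤ x
    ∣∣-id p = ℚP.≤-reflexive (ℚP.0≤p⇒∣p∣≡p p)

  -- The outer factor is √n / n instead of 1 / √n, so no approximation of √n is ever inverted;
  -- negative arguments are sent to 0.
  F : ℕ → ℚ → ℚ
  F m q = (w ℚ.* s m) ℚ.* g ((0ℚ ℚ.⊔ q) ℚ.* s m)

  0≤F : ∀ m q → 0ℚ ℚ.≤ F m q
  0≤F m q = q0≤* (q0≤* (0≤inv n′) (0≤s m)) (0≤interp t ((0ℚ ℚ.⊔ q) ℚ.* s m))

  -- The profile is n-Lipschitz because the levels sum to n; with both scalings this gives (s / n) ·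
  -- n · s = s² ≤ n, uniformly in the approximation index.
  F-lip : ∀ m p q → ℚ.∣ F m p ℚ.- F m q ∣ ℚ.≤ ℚ.∣ p ℚ.- q ∣ ℚ.* ι n
  F-lip m p q = ℚP.≤-trans (ℚP.≤-reflexive (cong ℚ.∣_∣ (sym (ℚS.solve 3 (λ c a b → c ℚS.:* (a ℚS.:- b) ℚS.:= c ℚS.:* a ℚS.:- c ℚS.:* b) refl (w ℚ.* s m) (g (p⁺ ℚ.* s m)) (g (q⁺ ℚ.* s m))))))
    (ℚP.≤-trans (∣*∣ (w ℚ.* s m) (g (p⁺ ℚ.* s m) ℚ.- g (q⁺ ℚ.* s m)) (∣∣-id (q0≤* (0≤inv n′) (0≤s m)))
        (ℚP.≤-trans (g-lip (p⁺ ℚ.* s m) (q⁺ ℚ.* s m)) (ℚP.*-monoʳ-≤-nonNeg (ι n) {{ℚ.nonNegative (0≤ι n)}} arg)))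
      (ℚP.≤-trans (ℚP.≤-reflexive (trans (ℚS.solve 4 (λ w s d n → (w ℚS.:* s) ℚS.:* ((d ℚS.:* s) ℚS.:* n) ℚS.:= (d ℚS.:* (s ℚS.:* s)) ℚS.:* (w ℚS.:* n)) refl w (s m) ℚ.∣ p ℚ.- q ∣ (ι n))
          (trans (cong ((ℚ.∣ p ℚ.- q ∣ ℚ.* (s m ℚ.* s m)) ℚ.*_) w*n) (ℚP.*-identityʳ _))))
        (ℚP.*-monoˡ-≤-nonNeg ℚ.∣ p ℚ.- q ∣ {{ℚ.nonNegative (ℚP.0≤∣p∣ (p ℚ.- q))}} (root²≤ n m))))
    where
    p⁺ = 0ℚ ℚ.⊔ p
    q⁺ = 0ℚ ℚ.⊔ q
    arg : ℚ.∣ p⁺ ℚ.* s m ℚ.- q⁺ ℚ.* s m ∣ ℚ.≤ ℚ.∣ p ℚ.- q ∣ ℚ.* s m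
    arg = ℚP.≤-trans (ℚP.≤-reflexive (cong ℚ.∣_∣ (ℚS.solve 3 (λ p q s → p ℚS.:* s ℚS.:- q ℚS.:* s ℚS.:= (p ℚS.:- q) ℚS.:* s) refl p⁺ q⁺ (s m))))
      (∣*∣ (p⁺ ℚ.- q⁺) (s m) (⊔-lip 0ℚ p q) (∣∣-id (0≤s m)))

  -- The approximation of √n enters twice: the outer factor contributes the 1 and the argument
  -- contributes n R.
  F-root : ∀ m k q {R} → 0ℚ ℚ.⊔ q ℚ.≤ ι R → ℚ.∣ F m q ℚ.- F k q ∣ ℚ.≤ ℚ.∣ s m ℚ.- s k ∣ ℚ.* ι (suc (n ℕ.* R))
  F-root m k q {R} q≤ = ℚP.≤-trans (ℚP.≤-reflexive (cong ℚ.∣_∣ (ℚS.solve 5 (λ w a b x y → (w ℚS.:* a) ℚS.:* x ℚS.:- (w ℚS.:* b) ℚS.:* y ℚS.:= (w ℚS.:* (a ℚS.:- b)) ℚS.:* x ℚS.:+ (w ℚS.:* b) ℚS.:* (x ℚS.:- y)) refl w (s m) (s k) (g (q⁺ ℚ.* s m)) (g (q⁺ ℚ.* s k)))))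
    (ℚP.≤-trans (ℚP.∣p+q∣≤∣p∣+∣q∣ ((w ℚ.* (s m ℚ.- s k)) ℚ.* g (q⁺ ℚ.* s m)) ((w ℚ.* s k) ℚ.* (g (q⁺ ℚ.* s m) ℚ.- g (q⁺ ℚ.* s k))))
      (ℚP.≤-trans (ℚP.+-mono-≤ one two) (ℚP.≤-reflexive (trans (ℚS.solve 2 (λ d z → d ℚS.:+ d ℚS.:* z ℚS.:= d ℚS.:* (ℚS.con 1ℚ ℚS.:+ z)) refl Δ (ι (n ℕ.* R))) (cong (Δ ℚ.*_) (sym (ι-suc (n ℕ.* R))))))))
    where
    q⁺ = 0ℚ ℚ.⊔ q
    0≤q⁺ : 0ℚ ℚ.≤ q⁺
    0≤q⁺ = ℚP.p≤p⊔q 0ℚ q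
    Δ = ℚ.∣ s m ℚ.- s k ∣
    0≤Δ : 0ℚ ℚ.≤ Δ
    0≤Δ = ℚP.0≤∣p∣ (s m ℚ.- s k)
    one : ℚ.∣ (w ℚ.* (s m ℚ.- s k)) ℚ.* g (q⁺ ℚ.* s m) ∣ ℚ.≤ Δ
    one = ℚP.≤-trans (∣*∣ (w ℚ.* (s m ℚ.- s k)) (g (q⁺ ℚ.* s m)) (∣*∣ w (s m ℚ.- s k) (∣∣-id (0≤inv n′)) ℚP.≤-refl) (∣g∣≤ (q⁺ ℚ.* s m)))
      (ℚP.≤-reflexive (trans (ℚS.solve 3 (λ w d n → (w ℚS.:* d) ℚS.:* n ℚS.:= d ℚS.:* (w ℚS.:* n)) refl w Δ (ι n)) (trans (cong (Δ ℚ.*_) w*n) (ℚP.*-identityʳ Δ))))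
    two : ℚ.∣ (w ℚ.* s k) ℚ.* (g (q⁺ ℚ.* s m) ℚ.- g (q⁺ ℚ.* s k)) ∣ ℚ.≤ Δ ℚ.* ι (n ℕ.* R)
    two = ℚP.≤-trans (∣*∣ (w ℚ.* s k) (g (q⁺ ℚ.* s m) ℚ.- g (q⁺ ℚ.* s k)) (∣∣-id (q0≤* (0≤inv n′) (0≤s k)))
        (ℚP.≤-trans (g-lip (q⁺ ℚ.* s m) (q⁺ ℚ.* s k)) (ℚP.*-monoʳ-≤-nonNeg (ι n) {{ℚ.nonNegative (0≤ι n)}}
          (ℚP.≤-trans (ℚP.≤-reflexive (cong ℚ.∣_∣ (ℚS.solve 3 (λ q a b → q ℚS.:* a ℚS.:- q ℚS.:* b ℚS.:= q ℚS.:* (a ℚS.:- b)) refl q⁺ (s m) (s k)))) (∣*∣ q⁺ (s m ℚ.- s k) (∣∣-id 0≤q⁺) ℚP.≤-refl)))))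
      (ℚP.≤-trans (ℚP.≤-reflexive (trans (ℚS.solve 5 (λ w b q d n → (w ℚS.:* b) ℚS.:* ((q ℚS.:* d) ℚS.:* n) ℚS.:= (d ℚS.:* (b ℚS.:* q)) ℚS.:* (w ℚS.:* n)) refl w (s k) q⁺ Δ (ι n))
          (trans (cong ((Δ ℚ.* (s k ℚ.* q⁺)) ℚ.*_) w*n) (ℚP.*-identityʳ _))))
        (ℚP.*-monoˡ-≤-nonNeg Δ {{ℚ.nonNegative 0≤Δ}} (ℚP.≤-trans (*≤* (0≤s k) (0≤ι R) (root≤ n′ k) q≤) (ℚP.≤-reflexive (sym (ι-* n R))))))

  root-cauchy : Cauchy s
  root-cauchy ε ε>0 = proj₁ c , λ m k p q → subst₂ (λ a b → ℚ.∣ a ℚ.- b ∣ ℚ.≤ ε) (sym (root-def n m)) (sym (root-def n k)) (proj₂ c m k p q)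
    where c = cauchy (√ n) ε ε>0

  private
    path-cauchy : ∀ x → Cauchy (λ m → F m (seq x m))
    path-cauchy x ε ε>0 = proj₁ cx ℕ.⊔ (proj₁ cs ℕ.⊔ proj₁ cb) , λ m k p q →
        ℚP.≤-trans (∣-∣-tri (F m (seq x m)) (F m (seq x k)) (F k (seq x k))
          (ℚP.≤-trans (F-lip m (seq x m) (seq x k)) (inv-cancel n (ℚP.<⇒≤ h>0) (proj₂ cx m k (ℕP.m⊔n≤o⇒m≤o (proj₁ cx) _ p) (ℕP.m⊔n≤o⇒m≤o (proj₁ cx) _ q))))
          (ℚP.≤-trans (F-root m k (seq x k) {suc (proj₁ b)} (ℚP.⊔-lub (0≤ι (suc (proj₁ b))) (upper k (right q))))
            (inv-cancel (suc (n ℕ.* suc (proj₁ b))) (ℚP.<⇒≤ h>0) (proj₂ cs m k (left p) (left q)))))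
        (ℚP.≤-reflexive (halves ε))
      where
      h>0 = 0<½ ε>0
      b = real-above x
      cb = proj₂ b 1ℚ (ℚP.positive⁻¹ 1ℚ)
      cx = cauchy x (inv n ℚ.* (½ ℚ.* ε)) (0<* (0<inv n) h>0)
      cs = root-cauchy (inv (suc (n ℕ.* suc (proj₁ b))) ℚ.* (½ ℚ.* ε)) (0<* (0<inv (suc (n ℕ.* suc (proj₁ b)))) h>0)
      left : ∀ {m} → proj₁ cx ℕ.⊔ (proj₁ cs ℕ.⊔ proj₁ cb) ℕ.≤ m → proj₁ cs ℕ.≤ m
      left p = ℕP.m⊔n≤o⇒m≤o (proj₁ cs) (proj₁ cb) (ℕP.m⊔n≤o⇒n≤o (proj₁ cx) _ p)
      right : ∀ {m} → proj₁ cx ℕ.⊔ (proj₁ cs ℕ.⊔ proj₁ cb) ℕ.≤ m → proj₁ cb ℕ.≤ m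
      right p = ℕP.m⊔n≤o⇒n≤o (proj₁ cs) (proj₁ cb) (ℕP.m⊔n≤o⇒n≤o (proj₁ cx) _ p)
      upper : ∀ k → proj₁ cb ℕ.≤ k → seq x k ℚ.≤ ι (suc (proj₁ b))
      upper k p = ℚP.≤-trans (proj₂ cb k p) (ℚP.≤-reflexive (trans (cong (ℚ._+ 1ℚ) (sym (ι-def (proj₁ b)))) (trans (ℚP.+-comm (ι (proj₁ b)) 1ℚ) (sym (ι-suc (proj₁ b))))))

  opaque
    path : ℝ → ℝ
    path x = real (λ m → F m (seq x m)) (path-cauchy x)

    path-seq : ∀ x m → seq (path x) m ≡ F m (seq x m)
    path-seq x m = refl

  rescaled : C[0,∞[
  fun rescaled x _ = path x
  continuous rescaled x 0≤x ε ε>0 = inv n ℚ.* ε , 0<* (0<inv n) ε>0 , λ y 0≤y h ε′ ε′>0 →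
    let c = h (inv n ℚ.* ε′) (0<* (0<inv n) ε′>0) in
    proj₁ c , λ k k≥ → subst₂ (λ a b → ℚ.∣ a ℚ.- b ∣ ℚ.≤ ε ℚ.+ ε′) (sym (path-seq y k)) (sym (path-seq x k))
      (ℚP.≤-trans (F-lip k (seq y k) (seq x k)) (inv-cancel n (q0≤+ (ℚP.<⇒≤ ε>0) (ℚP.<⇒≤ ε′>0))
        (ℚP.≤-trans (proj₂ c k k≥) (ℚP.≤-reflexive (sym (ℚP.*-distribˡ-+ (inv n) ε ε′))))))

  private
    -- `σ` bounds two defects, that u may be slightly below k and that s² is slightly below n. At
    -- max(k, u) the cell formula is exact, and both sides are compared with it there.
    cell : ∀ k u σ m q → u ≡ q ℚ.* s m → ι k ℚ.≤ u ℚ.+ σ → u ℚ.≤ ι (suc k) → 0ℚ ℚ.≤ σ → ι n ℚ.≤ s m ℚ.* s m ℚ.+ σ →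
      ℚ.∣ s m ℚ.* F m q ℚ.- ((ι (suc k) ℚ.- u) ℚ.* ι (L t k) ℚ.+ (u ℚ.- ι k) ℚ.* ι (L t (suc k))) ∣ ℚ.≤ σ ℚ.* ι (suc (n ℕ.+ (L t k ℕ.+ L t (suc k))))
    cell k u σ m q refl h₁ h₂ 0≤σ hs = ℚP.≤-trans (∣-∣-tri (s m ℚ.* F m q) (g v) (rhs u) (∣-∣-tri (s m ℚ.* F m q) (g u⁺) (g v) one two) three)
        (ℚP.≤-reflexive (trans (ℚS.solve 4 (λ e n a b → (e ℚS.:+ e ℚS.:* n) ℚS.:+ e ℚS.:* (a ℚS.:+ b) ℚS.:= e ℚS.:* (ℚS.con 1ℚ ℚS.:+ (n ℚS.:+ (a ℚS.:+ b)))) refl σ (ι n) l₀ l₁)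
          (cong (σ ℚ.*_) (sym (trans (ι-suc (n ℕ.+ (L t k ℕ.+ L t (suc k)))) (cong (1ℚ ℚ.+_) (trans (ι-+ n _) (cong (ι n ℚ.+_) (ι-+ (L t k) (L t (suc k)))))))))))
      where
      l₀ = ι (L t k)
      l₁ = ι (L t (suc k))
      rhs : ℚ → ℚ
      rhs z = (ι (suc k) ℚ.- z) ℚ.* l₀ ℚ.+ (z ℚ.- ι k) ℚ.* l₁
      v = ι k ℚ.⊔ u
      u⁺ = (0ℚ ℚ.⊔ q) ℚ.* s m
      u⁺≡ : u⁺ ≡ 0ℚ ℚ.⊔ u
      u⁺≡ = trans (ℚP.*-distribʳ-⊔-nonNeg (s m) {{ℚ.nonNegative (0≤s m)}} 0ℚ q) (cong (ℚ._⊔ u) (ℚP.*-zeroˡ (s m)))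
      ds : ℚ.∣ s m ℚ.* s m ℚ.- ι n ∣ ℚ.≤ σ
      ds = ∣-∣-intro {s m ℚ.* s m} {ι n} (ℚP.≤-trans (root²≤ n m) (q≤-by refl 0≤σ)) hs
      one : ℚ.∣ s m ℚ.* F m q ℚ.- g u⁺ ∣ ℚ.≤ σ
      one = ℚP.≤-trans (ℚP.≤-reflexive (cong ℚ.∣_∣ (trans (cong (λ z → s m ℚ.* F m q ℚ.- z) (sym (trans (cong (ℚ._* g u⁺) w*n) (ℚP.*-identityˡ (g u⁺)))))
            (ℚS.solve 4 (λ s w x n → s ℚS.:* ((w ℚS.:* s) ℚS.:* x) ℚS.:- (w ℚS.:* n) ℚS.:* x ℚS.:= (w ℚS.:* (s ℚS.:* s ℚS.:- n)) ℚS.:* x) refl (s m) w (g u⁺) (ι n)))))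
        (ℚP.≤-trans (∣*∣ (w ℚ.* (s m ℚ.* s m ℚ.- ι n)) (g u⁺) (∣*∣ w (s m ℚ.* s m ℚ.- ι n) (∣∣-id (0≤inv n′)) ds) (∣g∣≤ u⁺))
          (ℚP.≤-reflexive (trans (ℚS.solve 3 (λ w e n → (w ℚS.:* e) ℚS.:* n ℚS.:= e ℚS.:* (w ℚS.:* n)) refl w σ (ι n)) (trans (cong (σ ℚ.*_) w*n) (ℚP.*-identityʳ σ)))))
      dv : ℚ.∣ v ℚ.- u ∣ ℚ.≤ σ
      dv = ∣-∣-intro {v} {u} (ℚP.⊔-lub h₁ (q≤-by refl 0≤σ)) (ℚP.≤-trans (ℚP.p≤q⊔p (ι k) u) (q≤-by refl 0≤σ))
      two : ℚ.∣ g u⁺ ℚ.- g v ∣ ℚ.≤ σ ℚ.* ι n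
      two = ℚP.≤-trans (g-lip u⁺ v) (ℚP.*-monoʳ-≤-nonNeg (ι n) {{ℚ.nonNegative (0≤ι n)}} (subst (λ z → ℚ.∣ z ℚ.- v ∣ ℚ.≤ σ) (sym u⁺≡)
        (∣-∣-intro {0ℚ ℚ.⊔ u} {v} (ℚP.⊔-lub (ℚP.≤-trans (0≤ι k) (ℚP.≤-trans (ℚP.p≤p⊔q (ι k) u) (q≤-by refl 0≤σ))) (ℚP.≤-trans (ℚP.p≤q⊔p (ι k) u) (q≤-by refl 0≤σ)))
          (ℚP.⊔-lub (ℚP.≤-trans h₁ (ℚP.+-monoˡ-≤ σ (ℚP.p≤q⊔p 0ℚ u))) (ℚP.≤-trans (ℚP.p≤q⊔p 0ℚ u) (q≤-by refl 0≤σ))))))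
      gv : g v ≡ rhs v
      gv = interp-cell t k v (ℚP.p≤p⊔q (ι k) u) (ℚP.⊔-lub (ι-mono (ℕP.n≤1+n k)) h₂)
      three : ℚ.∣ g v ℚ.- rhs u ∣ ℚ.≤ σ ℚ.* (l₀ ℚ.+ l₁)
      three = ℚP.≤-trans (ℚP.≤-reflexive (cong ℚ.∣_∣ (trans (cong (ℚ._- rhs u) gv)
            (ℚS.solve 6 (λ k₁ k v u a b → ((k₁ ℚS.:- v) ℚS.:* a ℚS.:+ (v ℚS.:- k) ℚS.:* b) ℚS.:- ((k₁ ℚS.:- u) ℚS.:* a ℚS.:+ (u ℚS.:- k) ℚS.:* b) ℚS.:= (v ℚS.:- u) ℚS.:* (b ℚS.:- a)) refl (ι (suc k)) (ι k) v u l₀ l₁))))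
        (∣*∣ (v ℚ.- u) (l₁ ℚ.- l₀) dv (∣-∣-intro {l₁} {l₀} (q≤-by (ℚS.solve 2 (λ a b → a ℚS.:+ (a ℚS.:+ b) ℚS.:= b ℚS.:+ (a ℚS.:+ a)) refl l₀ l₁) (q0≤+ (0≤ι (L t k)) (0≤ι (L t k))))
          (q≤-by (ℚS.solve 2 (λ a b → b ℚS.:+ (a ℚS.:+ b) ℚS.:= a ℚS.:+ (b ℚS.:+ b)) refl l₀ l₁) (q0≤+ (0≤ι (L t (suc k))) (0≤ι (L t (suc k)))))))

  rescaled-l : l n t rescaled
  rescaled-l x 0≤x k k≤ <k ε ε>0 = proj₁ c₁ ℕ.⊔ (proj₁ (proj₂ (proj₂ <k)) ℕ.⊔ proj₁ c₂) , λ m p →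
      ℚP.≤-trans (ℚP.≤-reflexive (cong ℚ.∣_∣ (cong₂ ℚ._-_ (cong₂ ℚ._*_ (sym (root-def n m)) (path-seq x m))
          (cong₂ ℚ._+_ (cong₂ ℚ._*_ (cong (ℚ._- seq x m ℚ.* seq (√ n) m) (sym (ι-def (suc k)))) (sym (ι-def (L t k))))
                       (cong₂ ℚ._*_ (cong (λ z → seq x m ℚ.* seq (√ n) m ℚ.- z) (sym (ι-def k))) (sym (ι-def (L t (suc k)))))))))
      (ℚP.≤-trans (cell k (seq x m ℚ.* seq (√ n) m) σ m (seq x m) (cong (seq x m ℚ.*_) (sym (root-def n m)))
          (subst (ℚ._≤ seq x m ℚ.* seq (√ n) m ℚ.+ σ) (sym (ι-def k)) (proj₂ c₁ m (ℕP.m⊔n≤o⇒m≤o (proj₁ c₁) _ p)))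
          (subst (seq x m ℚ.* seq (√ n) m ℚ.≤_) (sym (ι-def (suc k))) (ℚP.≤-trans (q≤-by refl (ℚP.<⇒≤ (proj₁ (proj₂ <k))))
            (proj₂ (proj₂ (proj₂ <k)) m (ℕP.m⊔n≤o⇒m≤o (proj₁ (proj₂ (proj₂ <k))) (proj₁ c₂) (ℕP.m⊔n≤o⇒n≤o (proj₁ c₁) _ p)))))
          (ℚP.<⇒≤ σ>0)
          (ℚP.≤-trans (root²≥ n m) (ℚP.+-monoʳ-≤ (s m ℚ.* s m) (ℚP.≤-trans (ℚP.≤-reflexive (ℚP.*-comm (ι (suc (n ℕ.+ n))) (inv m)))
            (inv-cancel (suc (n ℕ.+ n)) (ℚP.<⇒≤ σ>0) (ℚP.≤-trans (inv-antimono (ℕP.m⊔n≤o⇒n≤o (proj₁ (proj₂ (proj₂ <k))) (proj₁ c₂) (ℕP.m⊔n≤o⇒n≤o (proj₁ c₁) _ p))) (proj₂ c₂)))))))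
        (inv-cancel w₀ (ℚP.<⇒≤ ε>0) ℚP.≤-refl))
    where
    w₀ = suc (n ℕ.+ (L t k ℕ.+ L t (suc k)))
    σ = inv w₀ ℚ.* ε
    σ>0 = 0<* (0<inv w₀) ε>0
    c₁ = k≤ σ σ>0
    c₂ = archimedes (inv (suc (n ℕ.+ n)) ℚ.* σ) (0<* (0<inv (suc (n ℕ.+ n))) σ>0)

-- Approximation of paths by chains

grid : ∀ u W z → 0ℚ ℚ.≤ z → z ℚ.≤ ι W ℚ.* inv u → ∃ λ γ → γ ℕ.≤ W × ℚ.∣ ι γ ℚ.* inv u ℚ.- z ∣ ℚ.≤ inv u
grid u zero z h₁ h₂ = 0 , z≤n , subst (λ x → ℚ.∣ x ℚ.- z ∣ ℚ.≤ inv u) (sym e)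
    (subst (λ x → ℚ.∣ 0ℚ ℚ.- x ∣ ℚ.≤ inv u) (ℚP.≤-antisym h₁ (subst (z ℚ.≤_) e h₂)) (0≤inv u))
  where
  e : ι 0 ℚ.* inv u ≡ 0ℚ
  e = trans (cong (ℚ._* inv u) ι-0) (ℚP.*-zeroˡ (inv u))
grid u (suc W) z h₁ h₂ with ℚP.≤-total z (ι W ℚ.* inv u)
... | inj₁ h = let γ , p , q = grid u W z h₁ h in γ , ℕP.m≤n⇒m≤1+n p , q
... | inj₂ h = W , ℕP.n≤1+n W , ∣-∣-intro {ι W ℚ.* inv u} {z} (ℚP.≤-trans h (q≤-by refl (0≤inv u)))
    (ℚP.≤-trans h₂ (ℚP.≤-reflexive (trans (cong (ℚ._* inv u) (ι-suc W)) (ℚS.solve 2 (λ w i → (ℚS.con 1ℚ ℚS.:+ w) ℚS.:* i ℚS.:= w ℚS.:* i ℚS.:+ i) refl (ι W) (inv u)))))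

-- Error budget of level j: a quarter of `pw j` for quantisation, a quarter for the modulus of
-- continuity, and half for the approximation of √n.
¼pw : ℕ → ℚ
¼pw j = ½ ℚ.* (½ ℚ.* pw j)

0<¼pw : ∀ j → 0ℚ ℚ.< ¼pw j
0<¼pw j = 0<½ (0<½ (0<pw j))

opaque
  unitOf : ℕ → ℕ
  unitOf j = proj₁ (archimedes (¼pw j) (0<¼pw j))

  unitOf-small : ∀ j → inv (unitOf j) ℚ.≤ ¼pw j
  unitOf-small j = proj₂ (archimedes (¼pw j) (0<¼pw j))

-- `top j` exceeds the number of the last node. A path that starts at height at most 1 and moves by
-- at most 1 between neighbouring nodes stays below it, so the modulus of continuity also bounds the
-- path. Adding up makes it monotone.
topOf : (ℕ → ℕ) → ℕ → ℕ
topOf mesh zero    = suc (3 ℕ.* suc (mesh 0))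
topOf mesh (suc j) = topOf mesh j ℕ.+ suc ((4 ℕ.+ j) ℕ.* suc (mesh (suc j)))

topOf-mono : ∀ mesh j → topOf mesh j ℕ.≤ topOf mesh (suc j)
topOf-mono mesh j = ℕP.m≤m+n (topOf mesh j) _

nodes<topOf : ∀ mesh j → suc ((3 ℕ.+ j) ℕ.* suc (mesh j)) ℕ.≤ topOf mesh j
nodes<topOf mesh zero    = ℕP.≤-refl
nodes<topOf mesh (suc j) = ℕP.m≤n+m _ (topOf mesh j)

pw≤1 : ∀ j → pw j ℚ.≤ 1ℚ
pw≤1 j = pw-mono {0} {j} z≤n

½*≤ : ∀ {x} → 0ℚ ℚ.≤ x → ½ ℚ.* x ℚ.≤ x
½*≤ {x} p = q≤-by (sym (halves x)) (q0≤* (ℚP.<⇒≤ (ℚP.positive⁻¹ ½)) p)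

¼pw≤1 : ∀ j → ¼pw j ℚ.≤ 1ℚ
¼pw≤1 j = ℚP.≤-trans (½*≤ (q0≤* (ℚP.<⇒≤ (ℚP.positive⁻¹ ½)) (0≤pw j))) (ℚP.≤-trans (½*≤ (0≤pw j)) (pw≤1 j))

module Approximate (mesh : ℕ → ℕ) (n′ : ℕ) (t : Tree) (size≡ : size t ≡ suc n′) where

  open Rescaled n′ t size≡
  open Closure mesh unitOf (topOf mesh) (topOf-mono mesh)
  open Chains mesh unitOf (topOf mesh) (topOf-mono mesh)

  Modulus : Set
  Modulus = ∀ j i p q → 0ℚ ℚ.≤ p → p ℚ.≤ ι (3 ℕ.+ j) → 0ℚ ℚ.≤ q → q ℚ.≤ ι (3 ℕ.+ j) → ℚ.∣ p ℚ.- q ∣ ℚ.≤ inv (mesh j) → ℚ.∣ F i p ℚ.- F i q ∣ ℚ.≤ ¼pw j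

  module _ (modulus : Modulus) where

    private
      p# : ℕ → ℕ → ℚ
      p# j k = ι k ℚ.* inv (mesh j)

      0≤p# : ∀ j k → 0ℚ ℚ.≤ p# j k
      0≤p# j k = q0≤* (0≤ι k) (0≤inv (mesh j))

      ι-mesh : ∀ j x → (x ℚ.* ι (suc (mesh j))) ℚ.* inv (mesh j) ≡ x
      ι-mesh j x = trans (ℚP.*-assoc x (ι (suc (mesh j))) (inv (mesh j))) (trans (cong (x ℚ.*_) (ι-inv (mesh j))) (ℚP.*-identityʳ x))

      ι-nodes : ∀ j → ι (nodes j) ≡ ι (3 ℕ.+ j) ℚ.* ι (suc (mesh j))
      ι-nodes j = trans (cong ι (nodes-def j)) (ι-* (3 ℕ.+ j) (suc (mesh j)))

      p#≤ : ∀ j k → k ℕ.≤ nodes j → p# j k ℚ.≤ ι (3 ℕ.+ j)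
      p#≤ j k h = ℚP.≤-trans (ℚP.*-monoʳ-≤-nonNeg (inv (mesh j)) {{ℚ.nonNegative (0≤inv (mesh j))}} (ι-mono h))
        (ℚP.≤-reflexive (trans (cong (ℚ._* inv (mesh j)) (ι-nodes j)) (ι-mesh j (ι (3 ℕ.+ j)))))

      F-zero : ∀ i → F i 0ℚ ℚ.≤ 1ℚ
      F-zero i = ℚP.≤-trans (ℚP.*-monoˡ-≤-nonNeg (inv n′ ℚ.* root (suc n′) i) {{ℚ.nonNegative (q0≤* (0≤inv n′) (0≤root (suc n′) i))}} (ℚP.≤-reflexive at0))
          (ℚP.≤-trans (ℚP.≤-reflexive (ℚP.*-identityʳ _)) (ℚP.≤-trans (ℚP.*-monoˡ-≤-nonNeg (inv n′) {{ℚ.nonNegative (0≤inv n′)}} (root≤ n′ i)) (ℚP.≤-reflexive (inv-ι n′))))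
        where
        at0 : interp t ((0ℚ ℚ.⊔ 0ℚ) ℚ.* root (suc n′) i) ≡ 1ℚ
        at0 = trans (cong (interp t) (ℚP.*-zeroˡ (root (suc n′) i))) (trans (interp-cell t 0 0ℚ (ℚP.≤-reflexive ι-0) (0≤ι 1))
          (trans (cong₂ ℚ._+_ (cong₂ ℚ._*_ (trans (cong (λ z → z ℚ.- 0ℚ) ι-1) refl) (trans (cong ι (ℤP.+-injective (lev-zero t))) ι-1))
            (trans (cong (λ z → (0ℚ ℚ.- z) ℚ.* ι (L t 1)) ι-0) (ℚP.*-zeroˡ (ι (L t 1))))) refl))

      F-bound : ∀ i j k → k ℕ.≤ nodes j → F i (p# j k) ℚ.≤ ι (suc k)
      F-bound i j zero    h = ℚP.≤-trans (ℚP.≤-reflexive (cong (F i) (trans (cong (ℚ._* inv (mesh j)) ι-0) (ℚP.*-zeroˡ (inv (mesh j)))))) (ℚP.≤-trans (F-zero i) (ℚP.≤-reflexive (sym ι-1)))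
      F-bound i j (suc k) h = ℚP.≤-trans (∣-∣-upper {F i (p# j (suc k))} {F i (p# j k)} (modulus j i (p# j (suc k)) (p# j k) (0≤p# j (suc k)) (p#≤ j (suc k) h) (0≤p# j k) (p#≤ j k k≤) step))
        (ℚP.≤-trans (ℚP.+-mono-≤ (F-bound i j k k≤) (¼pw≤1 j)) (ℚP.≤-reflexive (trans (ℚP.+-comm (ι (suc k)) 1ℚ) (sym (ι-suc (suc k))))))
        where
        k≤ = ℕP.≤-trans (ℕP.n≤1+n k) h
        step : ℚ.∣ p# j (suc k) ℚ.- p# j k ∣ ℚ.≤ inv (mesh j)
        step = ℚP.≤-reflexive (trans (cong ℚ.∣_∣ (trans (cong (λ z → z ℚ.* inv (mesh j) ℚ.- p# j k) (ι-suc k))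
          (ℚS.solve 2 (λ k i → (ℚS.con 1ℚ ℚS.:+ k) ℚS.:* i ℚS.:- k ℚS.:* i ℚS.:= i) refl (ι k) (inv (mesh j))))) (ℚP.0≤p⇒∣p∣≡p (0≤inv (mesh j))))

      ι-steps : ∀ j → ι (steps j) ℚ.* inv (unitOf j) ≡ ι (topOf mesh j)
      ι-steps j = trans (cong (ℚ._* inv (unitOf j)) (trans (cong ι (steps-def j)) (ι-* (topOf mesh j) (suc (unitOf j)))))
        (trans (ℚP.*-assoc (ι (topOf mesh j)) (ι (suc (unitOf j))) (inv (unitOf j))) (trans (cong (ι (topOf mesh j) ℚ.*_) (ι-inv (unitOf j))) (ℚP.*-identityʳ _)))

      capped : ℕ → ℕ → ℕ → ℚ
      capped i j k = ι (topOf mesh j) ℚ.⊓ F i (p# j k)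

      code : ∀ i j k → ∃ λ γ → γ ℕ.≤ steps j × ℚ.∣ ι γ ℚ.* inv (unitOf j) ℚ.- capped i j k ∣ ℚ.≤ inv (unitOf j)
      code i j k = grid (unitOf j) (steps j) (capped i j k) (ℚP.⊓-glb (0≤ι (topOf mesh j)) (0≤F i (p# j k)))
        (ℚP.≤-trans (ℚP.p⊓q≤p (ι (topOf mesh j)) (F i (p# j k))) (ℚP.≤-reflexive (sym (ι-steps j))))

      value-near : ∀ i j g k → g k ≡ proj₁ (code i j k) → k ℕ.≤ nodes j → ℚ.∣ value j g k ℚ.- F i (p# j k) ∣ ℚ.≤ inv (unitOf j)
      value-near i j g k e h = subst₂ (λ u v → ℚ.∣ ι u ℚ.* inv (unitOf j) ℚ.- v ∣ ℚ.≤ inv (unitOf j))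
        (sym (trans (cong (ℕ._⊓ steps j) e) (ℕP.m≤n⇒m⊓n≡m (proj₁ (proj₂ (code i j k))))))
        (ℚP.p≥q⇒p⊓q≡q {ι (topOf mesh j)} {F i (p# j k)} (ℚP.≤-trans (F-bound i j k h) (ι-mono (ℕP.≤-trans (s≤s h) (subst (λ z → suc z ℕ.≤ topOf mesh j) (sym (nodes-def j)) (nodes<topOf mesh j))))))
        (proj₂ (proj₂ (code i j k)))

      F-pos : ∀ i q → F i (0ℚ ℚ.⊔ q) ≡ F i q
      F-pos i q = cong (λ z → (inv n′ ℚ.* root (suc n′) i) ℚ.* interp t (z ℚ.* root (suc n′) i)) (ℚP.p≤q⇒p⊔q≡q {0ℚ} {0ℚ ℚ.⊔ q} (ℚP.p≤p⊔q 0ℚ q))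

      φ-near : ∀ i j g → (∀ k → k ℕ.< suc (nodes j) → g k ≡ proj₁ (code i j k)) → ∀ q → q ℚ.≤ ι (2 ℕ.+ j) → ℚ.∣ fn (φ j g) q ℚ.- F i q ∣ ℚ.≤ ½ ℚ.* pw j
      φ-near i j g e q q≤ = wave-near (nodes j) (value j g) (F i q) (½ ℚ.* pw j) (arg j q) (0≤arg j q)
          (ℚP.≤-trans (ℚP.*-monoˡ-≤-nonNeg (ι (suc (mesh j))) {{ℚ.nonNegative (0≤ι (suc (mesh j)))}} q⁺≤) (ℚP.≤-reflexive (trans (ℚP.*-comm (ι (suc (mesh j))) (ι (3 ℕ.+ j))) (sym (ι-nodes j)))))
          (λ k k≤ h → ℚP.≤-trans (∣-∣-tri (value j g k) (F i (p# j k)) (F i q) (ℚP.≤-trans (value-near i j g k (e k (s≤s k≤)) k≤) (unitOf-small j))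
              (subst (λ z → ℚ.∣ F i (p# j k) ℚ.- z ∣ ℚ.≤ ¼pw j) (F-pos i q) (modulus j i (p# j k) q⁺ (0≤p# j k) (p#≤ j k k≤) 0≤q⁺ q⁺≤ (close₀ k h))))
            (ℚP.≤-reflexive (halves (½ ℚ.* pw j))))
        where
        q⁺ = 0ℚ ℚ.⊔ q
        0≤q⁺ : 0ℚ ℚ.≤ q⁺
        0≤q⁺ = ℚP.p≤p⊔q 0ℚ q
        q⁺≤ : q⁺ ℚ.≤ ι (3 ℕ.+ j)
        q⁺≤ = ℚP.⊔-lub (0≤ι (3 ℕ.+ j)) (ℚP.≤-trans q≤ (ι-mono (ℕP.n≤1+n (2 ℕ.+ j))))
        close₀ : ∀ k → ℚ.∣ arg j q ℚ.- ι k ∣ ℚ.≤ 1ℚ → ℚ.∣ p# j k ℚ.- q⁺ ∣ ℚ.≤ inv (mesh j)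
        close₀ k h = ℚP.≤-trans (ℚP.≤-reflexive (trans (∣-∣-sym (p# j k) q⁺) (cong ℚ.∣_∣ (trans (cong (ℚ._- p# j k) (trans (sym (ι-mesh j q⁺)) (cong (ℚ._* inv (mesh j)) (ℚP.*-comm q⁺ (ι (suc (mesh j)))))))
            (ℚS.solve 3 (λ a k i → a ℚS.:* i ℚS.:- k ℚS.:* i ℚS.:= (a ℚS.:- k) ℚS.:* i) refl (arg j q) (ι k) (inv (mesh j)))))))
          (ℚP.≤-trans (∣*∣ (arg j q ℚ.- ι k) (inv (mesh j)) h (ℚP.≤-reflexive (ℚP.0≤p⇒∣p∣≡p (0≤inv (mesh j))))) (ℚP.≤-reflexive (ℚP.*-identityˡ (inv (mesh j)))))

      -- All codes are read off from the single approximation `F i₀`; the hypothesis says that later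
      -- approximations differ from it by at most half the budget of level J, and hence of every
      -- earlier level.
      fits : ∀ i₀ J → (∀ i q → q ℚ.≤ ι (2 ℕ.+ J) → ℚ.∣ F i₀ q ℚ.- F (i₀ ℕ.+ i) q ∣ ℚ.≤ ½ ℚ.* pw J) → Any (Fits (λ i → F (i₀ ℕ.+ i)) J) (ends J)
      fits i₀ J h = ends-fit (λ i → F (i₀ ℕ.+ i)) J λ j j≤J →
        Any.map (λ {g} e i q q≤ → ℚP.≤-trans (∣-∣-tri (fn (φ j g) q) (F i₀ q) (F (i₀ ℕ.+ i) q) (φ-near i₀ j g e q q≤)
            (ℚP.≤-trans (h i q (ℚP.≤-trans q≤ (ι-mono (s≤s (s≤s j≤J))))) (ℚP.*-monoˡ-≤-nonNeg ½ {{ℚ.nonNegative (ℚP.<⇒≤ (ℚP.positive⁻¹ ½))}} (pw-mono j≤J))))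
          (ℚP.≤-reflexive (halves (pw j))))
        (fnList-complete (suc (nodes j)) (steps j) (λ k → proj₁ (code i₀ j k)) (λ k → proj₁ (proj₂ (code i₀ j k))))

    rescaled-𝒦 : 𝒦 rescaled
    rescaled-𝒦 m ε ε>0 = j₀ , Any.map (λ {e} h → within e h) (fits i₀ j₀ λ i q q≤ →
        ℚP.≤-trans (F-root i₀ (i₀ ℕ.+ i) q {2 ℕ.+ j₀} (ℚP.⊔-lub (0≤ι (2 ℕ.+ j₀)) q≤))
          (inv-cancel c₀ (ℚP.<⇒≤ (0<½ (0<pw j₀))) (proj₂ cs i₀ (i₀ ℕ.+ i) ℕP.≤-refl (ℕP.m≤m+n i₀ i))))
      where
      small = pw-small ε ε>0
      j₀ = m ℕ.⊔ proj₁ small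
      pw≤ : pw j₀ ℚ.≤ ε
      pw≤ = ℚP.≤-trans (pw-mono (ℕP.m≤n⊔m m (proj₁ small))) (proj₂ small)
      c₀ = suc (suc n′ ℕ.* (2 ℕ.+ j₀))
      cs = root-cauchy (inv c₀ ℚ.* (½ ℚ.* pw j₀)) (0<* (0<inv c₀) (0<½ (0<pw j₀)))
      i₀ = proj₁ cs
      within : ∀ e → Fits (λ i → F (i₀ ℕ.+ i)) j₀ e → Within m ε rescaled (lift e)
      within e h x 0≤x hx = close-seq (path x) (fun (lift e) x 0≤x) {ε} (proj₁ b ℕ.⊔ i₀) λ k k≥ →
          subst (λ z → ℚ.∣ z ℚ.- fn e (seq x k) ∣ ℚ.≤ ε) (sym (path-seq x k)) (ℚP.≤-trans (ℚP.≤-reflexive (∣-∣-sym (F k (seq x k)) (fn e (seq x k))))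
            (ℚP.≤-trans (from k (ℕP.m≤n⇒∃[o]m+o≡n (ℕP.m⊔n≤o⇒n≤o (proj₁ b) i₀ k≥)) (upper k (ℕP.m⊔n≤o⇒m≤o (proj₁ b) i₀ k≥))) pw≤))
        where
        b = hx 1ℚ (ℚP.positive⁻¹ 1ℚ)
        upper : ∀ k → proj₁ b ℕ.≤ k → seq x k ℚ.≤ ι (2 ℕ.+ j₀)
        upper k p = ℚP.≤-trans (proj₂ b k p) (ℚP.≤-trans (ℚP.≤-reflexive (trans (cong (ℚ._+ 1ℚ) (sym (ι-def m))) (trans (ℚP.+-comm (ι m) 1ℚ) (sym (ι-suc m)))))
          (ι-mono (s≤s (ℕP.≤-trans (ℕP.m≤m⊔n m (proj₁ small)) (ℕP.n≤1+n j₀)))))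
        from : ∀ k → (∃ λ o → i₀ ℕ.+ o ≡ k) → seq x k ℚ.≤ ι (2 ℕ.+ j₀) → ℚ.∣ fn e (seq x k) ℚ.- F k (seq x k) ∣ ℚ.≤ pw j₀
        from k (o , refl) q≤ = h o (seq x k) q≤

-- Dyadic chaining

module Dyadic (c gain : ℕ → ℚ) (range : ℕ) (0≤gain : ∀ b → 0ℚ ℚ.≤ gain b)
  (β : ℕ) (step : ∀ b k x → b ℕ.≤ β → x ≡ k ℕ.* 2 ℕ.^ b → x ℕ.+ 2 ℕ.^ b ℕ.≤ range → ℚ.∣ c x ℚ.- c (x ℕ.+ 2 ℕ.^ b) ∣ ℚ.≤ gain b) where

  -- Bound for at most i steps of length 2^b followed by a remainder shorter than 2^b, which is
  -- walked along its binary digits.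
  reach : ℕ → ℕ → ℚ
  reach b zero    = ∑ᵠ b gain
  reach b (suc i) = gain b ℚ.+ reach b i

  mutual
    inside : ∀ b k x r → b ℕ.≤ β → x ≡ k ℕ.* 2 ℕ.^ b → r ℕ.< 2 ℕ.^ b → x ℕ.+ r ℕ.≤ range → ℚ.∣ c x ℚ.- c (x ℕ.+ r) ∣ ℚ.≤ ∑ᵠ b gain
    inside zero    k x zero    b≤ e r< ≤range = ℚP.≤-reflexive (trans (cong (λ z → ℚ.∣ c x ℚ.- c z ∣) (ℕP.+-identityʳ x)) (cong ℚ.∣_∣ (ℚP.+-inverseʳ (c x))))
    inside zero    k x (suc r) b≤ e (s≤s ()) ≤range
    inside (suc b) k x r       b≤ e r< ≤range = walk b 1 (k ℕ.* 2) x r (ℕP.≤-trans (ℕP.n≤1+n b) b≤) (trans e (sym (ℕP.*-assoc k 2 (2 ℕ.^ b)))) r< ≤range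

    walk : ∀ b i k x r → b ℕ.≤ β → x ≡ k ℕ.* 2 ℕ.^ b → r ℕ.< suc i ℕ.* 2 ℕ.^ b → x ℕ.+ r ℕ.≤ range → ℚ.∣ c x ℚ.- c (x ℕ.+ r) ∣ ℚ.≤ reach b i
    walk b zero    k x r b≤ e r< ≤range = inside b k x r b≤ e (subst (r ℕ.<_) (ℕP.+-identityʳ (2 ℕ.^ b)) r<) ≤range
    walk b (suc i) k x r b≤ e r< ≤range with r ℕP.<? 2 ℕ.^ b
    ... | yes h = ℚP.≤-trans (walk b i k x r b≤ e (ℕP.<-≤-trans h (ℕP.m≤m+n (2 ℕ.^ b) (i ℕ.* 2 ℕ.^ b))) ≤range)
      (q≤-by (ℚP.+-comm (gain b) (reach b i)) (0≤gain b))
    ... | no h = far-end (ℕP.m≤n⇒∃[o]m+o≡n (ℕP.≮⇒≥ h))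
      where
      far-end : (∃ λ o → 2 ℕ.^ b ℕ.+ o ≡ r) → ℚ.∣ c x ℚ.- c (x ℕ.+ r) ∣ ℚ.≤ gain b ℚ.+ reach b i
      far-end (o , refl) = ∣-∣-tri (c x) (c (x ℕ.+ 2 ℕ.^ b)) (c (x ℕ.+ (2 ℕ.^ b ℕ.+ o)))
        (step b k x b≤ e (ℕP.≤-trans (ℕP.+-monoʳ-≤ x (ℕP.m≤m+n (2 ℕ.^ b) o)) ≤range))
        (subst (λ z → ℚ.∣ c (x ℕ.+ 2 ℕ.^ b) ℚ.- c z ∣ ℚ.≤ reach b i) assoc
          (walk b i (suc k) (x ℕ.+ 2 ℕ.^ b) o b≤ (trans (cong (ℕ._+ 2 ℕ.^ b) e) (ℕP.+-comm (k ℕ.* 2 ℕ.^ b) (2 ℕ.^ b)))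
            (ℕP.+-cancelˡ-< (2 ℕ.^ b) o (suc i ℕ.* 2 ℕ.^ b) r<) (subst (ℕ._≤ range) (sym assoc) ≤range)))
        where
        assoc : x ℕ.+ 2 ℕ.^ b ℕ.+ o ≡ x ℕ.+ (2 ℕ.^ b ℕ.+ o)
        assoc = ℕP.+-assoc x (2 ℕ.^ b) o

  -- Rounding x down to a multiple of 2^β loses less than 2^β, so z is less than 4 · 2^β above it:
  -- at most three full steps and a remainder.
  near : ∀ x z → x ℕ.≤ z → z ℕ.≤ x ℕ.+ 3 ℕ.* 2 ℕ.^ β → z ℕ.≤ range → ℚ.∣ c x ℚ.- c z ∣ ℚ.≤ ∑ᵠ β gain ℚ.+ reach β 3
  near x z x≤z z≤ ≤range = go (ℕP.m≤n⇒∃[o]m+o≡n x≤z)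
    where
    instance _ = ℕP.m^n≢0 2 β
    r = x ℕ.% 2 ℕ.^ β
    k = x ℕ./ 2 ℕ.^ β
    x₀ = k ℕ.* 2 ℕ.^ β
    x≡ : x ≡ x₀ ℕ.+ r
    x≡ = trans (ℕD.m≡m%n+[m/n]*n x (2 ℕ.^ β)) (ℕP.+-comm r x₀)
    go : (∃ λ o → x ℕ.+ o ≡ z) → ℚ.∣ c x ℚ.- c z ∣ ℚ.≤ ∑ᵠ β gain ℚ.+ reach β 3
    go (o , refl) = ∣-∣-tri (c x) (c x₀) (c (x ℕ.+ o))
        (ℚP.≤-trans (ℚP.≤-reflexive (trans (∣-∣-sym (c x) (c x₀)) (cong (λ w → ℚ.∣ c x₀ ℚ.- c w ∣) x≡)))
          (inside β k x₀ r ℕP.≤-refl refl (ℕD.m%n<n x (2 ℕ.^ β)) (subst (ℕ._≤ range) x≡ (ℕP.≤-trans x≤z ≤range))))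
        (subst (λ w → ℚ.∣ c x₀ ℚ.- c w ∣ ℚ.≤ reach β 3) (sym xo≡)
          (walk β 3 k x₀ (r ℕ.+ o) ℕP.≤-refl refl (ℕP.+-mono-<-≤ (ℕD.m%n<n x (2 ℕ.^ β)) (ℕP.+-cancelˡ-≤ x o (3 ℕ.* 2 ℕ.^ β) z≤)) (subst (ℕ._≤ range) xo≡ ≤range)))
      where
      xo≡ : x ℕ.+ o ≡ x₀ ℕ.+ (r ℕ.+ o)
      xo≡ = trans (cong (ℕ._+ o) x≡) (ℕP.+-assoc x₀ r o)

-- A ratio q < 1 makes the gains summable, here to 7 after the first term. Depth d has of order 2^d
-- intervals with fourth moments of order 4^-d, so thresholds of order q^d are exceeded with
-- probability of order (2 q⁴)^-d, which requires 2 q⁴ > 1.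
⅞ : ℚ
⅞ = + 7 ℚ./ 8

decay : ℕ → ℚ
decay zero    = 1ℚ
decay (suc d) = ⅞ ℚ.* decay d

0≤decay : ∀ d → 0ℚ ℚ.≤ decay d
0≤decay zero    = ℚP.<⇒≤ (ℚP.positive⁻¹ 1ℚ)
0≤decay (suc d) = q0≤* (ℚP.<⇒≤ (ℚP.positive⁻¹ ⅞)) (0≤decay d)

opaque
  unfolding ι

  ι-8 : ι 8 ℚ.* ⅞ ≡ ι 7
  ι-8 = refl

  ι-7 : ⅞ ℚ.+ ⅞ ℚ.* ι 7 ≡ ι 7
  ι-7 = refl

ι-decay : ∀ d → ι (8 ℕ.^ d) ℚ.* decay d ≡ ι (7 ℕ.^ d)
ι-decay zero    = ℚP.*-identityʳ (ι 1)
ι-decay (suc d) = trans (cong (ℚ._* decay (suc d)) (ι-* 8 (8 ℕ.^ d))) (trans (ℚS.solve 4 (λ a b c d → (a ℚS.:* b) ℚS.:* (c ℚS.:* d) ℚS.:= (a ℚS.:* c) ℚS.:* (b ℚS.:* d)) refl (ι 8) (ι (8 ℕ.^ d)) ⅞ (decay d))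
  (trans (cong₂ ℚ._*_ ι-8 (ι-decay d)) (sym (ι-* 7 (7 ℕ.^ d)))))

∑-decay : ∀ u β → 0ℚ ℚ.≤ u → ∑ᵠ β (λ b → u ℚ.* decay (β ℕ.∸ b)) ℚ.≤ u ℚ.* ι 7
∑-decay u zero    0≤u = q0≤* 0≤u (0≤ι 7)
∑-decay u (suc β) 0≤u = ℚP.≤-trans (ℚP.≤-reflexive (cong₂ ℚ._+_ (trans (cong (λ z → u ℚ.* decay z) (ℕP.m+n∸n≡m 1 β)) (cong (u ℚ.*_) (ℚP.*-identityʳ ⅞)))
    (trans (∑ᵠ-cong β (λ b p → trans (cong (λ z → u ℚ.* decay z) (ℕP.+-∸-assoc 1 (ℕP.<⇒≤ p)))
      (ℚS.solve 3 (λ a b c → a ℚS.:* (b ℚS.:* c) ℚS.:= b ℚS.:* (a ℚS.:* c)) refl u ⅞ (decay (β ℕ.∸ b))))) (∑ᵠ-* ⅞ (λ b → u ℚ.* decay (β ℕ.∸ b)) β))))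
  (ℚP.≤-trans (ℚP.+-monoʳ-≤ (u ℚ.* ⅞) (ℚP.*-monoˡ-≤-nonNeg ⅞ (∑-decay u β 0≤u)))
    (ℚP.≤-reflexive (trans (ℚS.solve 3 (λ u s t → u ℚS.:* s ℚS.:+ s ℚS.:* (u ℚS.:* t) ℚS.:= u ℚS.:* (s ℚS.:+ s ℚS.:* t)) refl u ⅞ (ι 7)) (cong (u ℚ.*_) ι-7))))

-- Each interpolated value averages nodes at distance at most 1 from its argument, so the nodes
-- involved are at most w + 2 apart; `wave-near` is applied once for each argument.
interp-near : ∀ t N R w ρ → (∀ x z → x ℕ.≤ z → z ℕ.≤ x ℕ.+ (2 ℕ.+ w) → z ℕ.≤ R → ℚ.∣ ι (L t x) ℚ.- ι (L t z) ∣ ℚ.≤ ρ) → suc N ℕ.≤ R →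
  ∀ u v → 0ℚ ℚ.≤ u → u ℚ.≤ ι N → 0ℚ ℚ.≤ v → v ℚ.≤ ι N → ℚ.∣ u ℚ.- v ∣ ℚ.≤ ι w → ℚ.∣ interp t u ℚ.- interp t v ∣ ℚ.≤ ρ
interp-near t N R w ρ h N<R u v 0≤u u≤ 0≤v v≤ uv = subst (λ z → ℚ.∣ z ℚ.- interp t v ∣ ℚ.≤ ρ) (wave≡ u)
  (wave-near n₀ c (interp t v) ρ u 0≤u (big u≤) λ k _ p → ℚP.≤-trans (ℚP.≤-reflexive (∣-∣-sym (c k) (interp t v)))
    (subst (λ z → ℚ.∣ z ℚ.- c k ∣ ℚ.≤ ρ) (wave≡ v) (wave-near n₀ c (c k) ρ v 0≤v (big v≤) λ i _ q → nodes-near i k (below v i v≤ q) (below u k u≤ p)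
      (apart v u i k q p (subst (ℚ._≤ ι w) (∣-∣-sym u v) uv)) (apart u v k i p q uv))))
  where
  n₀ = size t ℕ.+ N
  c : ℕ → ℚ
  c k = ι (L t k)
  big : ∀ {z} → z ℚ.≤ ι N → z ℚ.≤ ι n₀
  big p = ℚP.≤-trans p (ι-mono (ℕP.m≤n+m N (size t)))
  wave≡ : ∀ z → wave (suc n₀) c z ≡ interp t z
  wave≡ z = interp-wave t (suc n₀) z (ℕP.m≤n⇒m≤1+n (ℕP.m≤m+n (size t) N))
  below : ∀ z i → z ℚ.≤ ι N → ℚ.∣ z ℚ.- ι i ∣ ℚ.≤ 1ℚ → i ℕ.≤ R
  below z i z≤ p = ℕP.≤-trans (ι-cancel (ℚP.≤-trans (∣-∣-lower {z} {ι i} p) (ℚP.≤-trans (ℚP.+-monoˡ-≤ 1ℚ z≤) (ℚP.≤-reflexive (trans (ℚP.+-comm (ι N) 1ℚ) (sym (ι-suc N))))))) N<R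
  apart : ∀ u v k i → ℚ.∣ u ℚ.- ι k ∣ ℚ.≤ 1ℚ → ℚ.∣ v ℚ.- ι i ∣ ℚ.≤ 1ℚ → ℚ.∣ u ℚ.- v ∣ ℚ.≤ ι w → k ℕ.≤ i ℕ.+ (2 ℕ.+ w)
  apart u v k i p q r = ι-cancel (ℚP.≤-trans (∣-∣-lower {u} {ι k} p) (ℚP.≤-trans (ℚP.+-monoˡ-≤ 1ℚ (ℚP.≤-trans (∣-∣-upper {u} {v} r) (ℚP.+-monoˡ-≤ (ι w) (∣-∣-upper {v} {ι i} q))))
    (ℚP.≤-reflexive (sym (trans (ι-+ i (2 ℕ.+ w)) (trans (cong (ι i ℚ.+_) (trans (ι-suc (suc w)) (cong (1ℚ ℚ.+_) (ι-suc w))))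
      (ℚS.solve 3 (λ i o w → i ℚS.:+ (o ℚS.:+ (o ℚS.:+ w)) ℚS.:= ((i ℚS.:+ o) ℚS.:+ w) ℚS.:+ o) refl (ι i) 1ℚ (ι w))))))))
  nodes-near : ∀ i k → i ℕ.≤ R → k ℕ.≤ R → i ℕ.≤ k ℕ.+ (2 ℕ.+ w) → k ℕ.≤ i ℕ.+ (2 ℕ.+ w) → ℚ.∣ c i ℚ.- c k ∣ ℚ.≤ ρ
  nodes-near i k i≤ k≤ p q with ℕP.≤-total i k
  ... | inj₁ i≤k = h i k i≤k q k≤
  ... | inj₂ k≤i = ℚP.≤-trans (ℚP.≤-reflexive (∣-∣-sym (c i) (c k))) (h k i k≤i p i≤)

ι-dist : ∀ m n → ℚ.∣ ι m ℚ.- ι n ∣ ℚ.≤ ι ∣ + m ℤ.- + n ∣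
ι-dist m n = ∣-∣-intro {ι m} {ι n} (half m n refl) (half n m (ℤP.∣i-j∣≡∣j-i∣ (+ n) (+ m)))
  where
  half : ∀ m n {i} → ∣ + m ℤ.- + n ∣ ≡ i → ι m ℚ.≤ ι n ℚ.+ ι i
  half m n {i} e = ℚP.≤-trans (ι-mono (ℤP.drop‿+≤+ (subst (λ z → + m ℤ.≤ + n ℤ.+ + z) e (≤-by (lem (+ m) (+ n) (+ ∣ + m ℤ.- + n ∣)) (0≤- (≤-abs (+ m ℤ.- + n))))))) (ℚP.≤-reflexive (ι-+ n i))
    where
    lem : ∀ m n d → n ℤ.+ d ≡ m ℤ.+ (d ℤ.- (m ℤ.- n))
    lem = solveℤ

square-cancel : ∀ {p q} → 0ℚ ℚ.≤ q → p ℚ.* p ℚ.≤ q ℚ.* q → p ℚ.≤ q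
square-cancel {p} {q} 0≤q h with p ℚP.≤? q
... | yes p≤q = p≤q
... | no p≰q = contradiction (ℚP.<-≤-trans (ℚP.*-monoʳ-<-pos p {{ℚ.positive (ℚP.≤-<-trans 0≤q q<p)}} q<p)
    (ℚP.≤-trans h (ℚP.*-monoʳ-≤-nonNeg q {{ℚ.nonNegative 0≤q}} (ℚP.<⇒≤ q<p)))) (ℚP.<-irrefl refl)
  where
  q<p : q ℚ.< p
  q<p = ℚP.≰⇒> p≰q

-- Replaces √n by the power 2^e, correct up to a factor 2, so that dyadic intervals match the scale
-- of the path.
log₄ : ∀ n′ → ∃ λ e → 4 ℕ.^ e ℕ.≤ suc n′ × suc n′ ℕ.< 4 ℕ.^ suc e
log₄ zero = 0 , s≤s z≤n , s≤s (s≤s z≤n)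
log₄ (suc n′) with log₄ n′
... | e , lower , upper with suc (suc n′) ℕP.<? 4 ℕ.^ suc e
...   | yes h = e , ℕP.m≤n⇒m≤1+n lower , h
...   | no h = suc e , ℕP.≮⇒≥ h , ℕP.≤-<-trans upper (subst (4 ℕ.^ suc e ℕ.<_) (ℕP.*-comm (4 ℕ.^ suc e) 4) (ℕP.m<m*n (4 ℕ.^ suc e) 4 {{ℕP.m^n≢0 4 (suc e)}} (s≤s (s≤s z≤n))))

-- The probability of an irregular path

bad : ∀ {P : Set} → Dec P → ℤ
bad (yes _) = + 0
bad (no _)  = + 1

bad-≤ : ∀ {P : Set} (d : Dec P) {c} → + 0 ℤ.≤ c → (¬ P → + 1 ℤ.≤ c) → bad d ℤ.≤ c
bad-≤ (yes _) p q = p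
bad-≤ (no ¬p) p q = q ¬p

0≤bad : ∀ {P : Set} (d : Dec P) → + 0 ℤ.≤ bad d
0≤bad (yes _) = ℤP.≤-refl
0≤bad (no _)  = 0≤n

bad-no : ∀ {P : Set} (d : Dec P) → ¬ P → bad d ≡ + 1
bad-no (yes p) ¬p = contradiction p ¬p
bad-no (no _)  ¬p = refl

bad-all : ∀ {A : Set} {P : A → Set} (P? : ∀ x → Dec (P x)) xs → bad (All.all? P? xs) ℤ.≤ ∑ xs (λ x → bad (P? x))
bad-all {P = P} P? xs = bad-≤ (All.all? P? xs) (∑-nonneg (All.universal (λ x → 0≤bad (P? x)) xs)) (λ ¬all → hit (AllP.¬All⇒Any¬ P? xs ¬all))
  where
  hit : ∀ {xs} → Any (λ x → ¬ P x) xs → + 1 ℤ.≤ ∑ xs (λ x → bad (P? x))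
  hit {x ∷ xs} (here ¬p) = ℤP.≤-trans (ℤP.≤-reflexive (sym (trans (cong (ℤ._+ + 0) (bad-no (P? x) ¬p)) refl)))
    (ℤP.+-monoʳ-≤ (bad (P? x)) (∑-nonneg (All.universal (λ z → 0≤bad (P? z)) xs)))
  hit {x ∷ xs} (there h) = ℤP.+-mono-≤ (0≤bad (P? x)) (hit h)

all-below : ∀ {P : ℕ → Set} n → All P (downFrom n) → ∀ j → j ℕ.< n → P j
all-below (suc n) (p ∷ ps) j h with ℕP.m<1+n⇒m<n∨m≡n h
... | inj₁ j<n  = all-below n ps j j<n
... | inj₂ refl = p

halving-sum : ∀ (x : ℕ → ℤ) D n → + 0 ℤ.≤ D → (∀ j → j ℕ.< n → (+ 2) ℤ.^ suc j ℤ.* x j ℤ.≤ D) → ∑ (downFrom n) x ℤ.≤ D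
halving-sum x D n 0≤D h = ℤP.*-cancelˡ-≤-pos (∑ (downFrom n) x) D ((+ 2) ℤ.^ n) {{pos2 n}} (≤-by (lem₀ ((+ 2) ℤ.^ n) D (∑ (downFrom n) x)) (0≤+ (0≤- (go n h)) 0≤D))
  where
  pos2 : ∀ n → ℤ.Positive ((+ 2) ℤ.^ n)
  pos2 n = subst ℤ.Positive (sym (pos-^ 2 n)) (ℤ.positive (ℤ.+<+ (ℕP.m^n>0 2 n)))
  lem₀ : ∀ p D s → p ℤ.* D ≡ p ℤ.* s ℤ.+ ((p ℤ.- + 1) ℤ.* D ℤ.- p ℤ.* s ℤ.+ D)
  lem₀ = solveℤ
  lem : ∀ p D s x → (+ 2 ℤ.* p ℤ.- + 1) ℤ.* D ≡ + 2 ℤ.* p ℤ.* (x ℤ.+ s) ℤ.+ (D ℤ.- + 2 ℤ.* p ℤ.* x ℤ.+ (((p ℤ.- + 1) ℤ.* D ℤ.- p ℤ.* s) ℤ.+ ((p ℤ.- + 1) ℤ.* D ℤ.- p ℤ.* s)))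
  lem = solveℤ
  go : ∀ n → (∀ j → j ℕ.< n → (+ 2) ℤ.^ suc j ℤ.* x j ℤ.≤ D) → (+ 2) ℤ.^ n ℤ.* ∑ (downFrom n) x ℤ.≤ ((+ 2) ℤ.^ n ℤ.- + 1) ℤ.* D
  go zero    h = ℤP.≤-refl
  go (suc n) h = ≤-by (lem ((+ 2) ℤ.^ n) D (∑ (downFrom n) x) (x n))
    (0≤+ (0≤- (h n ℕP.≤-refl)) (0≤+ (0≤- (go n λ j p → h j (ℕP.m≤n⇒m≤1+n p))) (0≤- (go n λ j p → h j (ℕP.m≤n⇒m≤1+n p)))))

∣i∣⁴ : ∀ i → (+ ∣ i ∣) ℤ.^ 4 ≡ i ℤ.^ 4
∣i∣⁴ (+ n)    = refl
∣i∣⁴ -[1+ n ] = sym (lem (+ suc n))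
  where
  lem : ∀ x → (ℤ.- x) ℤ.* ((ℤ.- x) ℤ.* ((ℤ.- x) ℤ.* ((ℤ.- x) ℤ.* + 1))) ≡ x ℤ.* (x ℤ.* (x ℤ.* (x ℤ.* + 1)))
  lem = solveℤ

jump : ℕ → ℕ → Tree → ℤ
jump b k t = + L t (k ℕ.* 2 ℕ.^ b) ℤ.- + L t (k ℕ.* 2 ℕ.^ b ℕ.+ 2 ℕ.^ b)

-- The increments over dyadic intervals of length 2^(β-d) are at most (7/8)^d 2^e / M.
Small : ℕ → ℕ → ℕ → ℕ → Tree → ℕ → Set
Small M e β d t k = M ℕ.* 8 ℕ.^ d ℕ.* ∣ jump (β ℕ.∸ d) k t ∣ ℕ.≤ 2 ℕ.^ e ℕ.* 7 ℕ.^ d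

small? : ∀ M e β d t k → Dec (Small M e β d t k)
small? M e β d t k = M ℕ.* 8 ℕ.^ d ℕ.* ∣ jump (β ℕ.∸ d) k t ∣ ℕP.≤? 2 ℕ.^ e ℕ.* 7 ℕ.^ d

markov : ∀ M e β d t k → ((+ 2) ℤ.^ e ℤ.* (+ 7) ℤ.^ d) ℤ.^ 4 ℤ.* bad (small? M e β d t k) ℤ.≤ (+ M ℤ.* (+ 8) ℤ.^ d) ℤ.^ 4 ℤ.* jump (β ℕ.∸ d) k t ℤ.^ 4
markov M e β d t k = go (small? M e β d t k)
  where
  i = jump (β ℕ.∸ d) k t
  0≤lhs : + 0 ℤ.≤ (+ 2) ℤ.^ e ℤ.* (+ 7) ℤ.^ d
  0≤lhs = 0≤* {(+ 2) ℤ.^ e} (0≤^ 2 e) (0≤^ 7 d)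
  0≤M8 : + 0 ℤ.≤ + M ℤ.* (+ 8) ℤ.^ d
  0≤M8 = 0≤* {+ M} 0≤n (0≤^ 8 d)
  go : (s : Dec (Small M e β d t k)) → ((+ 2) ℤ.^ e ℤ.* (+ 7) ℤ.^ d) ℤ.^ 4 ℤ.* bad s ℤ.≤ (+ M ℤ.* (+ 8) ℤ.^ d) ℤ.^ 4 ℤ.* i ℤ.^ 4
  go (yes _) = subst (ℤ._≤ (+ M ℤ.* (+ 8) ℤ.^ d) ℤ.^ 4 ℤ.* i ℤ.^ 4) (sym (ℤP.*-zeroʳ (((+ 2) ℤ.^ e ℤ.* (+ 7) ℤ.^ d) ℤ.^ 4)))
    (subst (λ z → + 0 ℤ.≤ (+ M ℤ.* (+ 8) ℤ.^ d) ℤ.^ 4 ℤ.* z) (∣i∣⁴ i) (0≤* {(+ M ℤ.* (+ 8) ℤ.^ d) ℤ.^ 4} (0≤^ℤ 4 0≤M8) (0≤^ ∣ i ∣ 4)))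
  go (no ¬s) = ℤP.≤-trans (ℤP.≤-reflexive (ℤP.*-identityʳ (((+ 2) ℤ.^ e ℤ.* (+ 7) ℤ.^ d) ℤ.^ 4))) (ℤP.≤-trans (^-mono 4 0≤lhs
      (subst₂ ℤ._≤_ (trans (ℤP.pos-* (2 ℕ.^ e) (7 ℕ.^ d)) (cong₂ ℤ._*_ (sym (pos-^ 2 e)) (sym (pos-^ 7 d))))
        (trans (ℤP.pos-* (M ℕ.* 8 ℕ.^ d) ∣ i ∣) (cong (ℤ._* + ∣ i ∣) (trans (ℤP.pos-* M (8 ℕ.^ d)) (cong (+ M ℤ.*_) (sym (pos-^ 8 d))))))
        (ℕ≤⇒ℤ≤ (ℕP.<⇒≤ (ℕP.≰⇒> ¬s)))))
    (ℤP.≤-reflexive (trans (lem (+ M ℤ.* (+ 8) ℤ.^ d) (+ ∣ i ∣)) (cong ((+ M ℤ.* (+ 8) ℤ.^ d) ℤ.^ 4 ℤ.*_) (∣i∣⁴ i)))))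
    where
    lem : ∀ x z → x ℤ.* z ℤ.* (x ℤ.* z ℤ.* (x ℤ.* z ℤ.* (x ℤ.* z ℤ.* + 1))) ≡ x ℤ.* (x ℤ.* (x ℤ.* (x ℤ.* + 1))) ℤ.* (z ℤ.* (z ℤ.* (z ℤ.* (z ℤ.* + 1))))
    lem = solveℤ

module Events (M m a₀ β : ℕ) where

  e : ℕ
  e = β ℕ.+ a₀

  -- 2^e is comparable to √n. The coarsest intervals have length 2^β = 2^e / 2^a₀, depth d refines
  -- them to 2^(β-d) and depth β to single levels; at each depth they cover [0, m 2^e].
  intervals : ℕ → ℕ
  intervals d = m ℕ.* 2 ℕ.^ (a₀ ℕ.+ d)

  Fine : Tree → ℕ → Set
  Fine t d = All (Small M e β d t) (downFrom (intervals d))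

  fine? : ∀ t d → Dec (Fine t d)
  fine? t d = All.all? (small? M e β d t) (downFrom (intervals d))

  Regular : Tree → Set
  Regular t = All (Fine t) (downFrom (suc β))

  regular? : ∀ t → Dec (Regular t)
  regular? t = All.all? (fine? t) (downFrom (suc β))

module Irregular (C : ℕ) (moment : ∀ n r h → ∑ (trees n) (λ t → (+ L t r ℤ.- + L t (r ℕ.+ h)) ℤ.^ 4) ℤ.≤ + (C ℕ.* (h ℕ.^ 2 ℕ.* n)) ℤ.* + length (trees n))
  (M m a₀ β n : ℕ) (n≤ : n ℕ.≤ 4 ℕ.* (2 ℕ.^ (β ℕ.+ a₀)) ℕ.^ 2) where

  open Events M m a₀ β

  T : ℤ
  T = + length (trees n)

  weight : ℤ
  weight = + 4 ℤ.* (+ C ℤ.* (+ m ℤ.* (+ M) ℤ.^ 4 ℤ.* T))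

  private
    σ : ℕ → ℤ
    σ d = ∑ (trees n) (λ t → bad (fine? t d))

    pos^ : ∀ c .{{_ : ℕ.NonZero c}} k → ℤ.Positive ((+ c) ℤ.^ k)
    pos^ c k = subst ℤ.Positive (sym (pos-^ c k)) (ℤ.positive (ℤ.+<+ (ℕP.m^n>0 c k)))

    one-interval : ∀ d k → ((+ 2) ℤ.^ e ℤ.* (+ 7) ℤ.^ d) ℤ.^ 4 ℤ.* ∑ (trees n) (λ t → bad (small? M e β d t k)) ℤ.≤
      (+ M ℤ.* (+ 8) ℤ.^ d) ℤ.^ 4 ℤ.* (+ C ℤ.* (((+ 2) ℤ.^ (β ℕ.∸ d)) ℤ.^ 2 ℤ.* (+ 4 ℤ.* ((+ 2) ℤ.^ e) ℤ.^ 2)) ℤ.* T)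
    one-interval d k = ℤP.≤-trans (ℤP.≤-reflexive (sym (∑-* (((+ 2) ℤ.^ e ℤ.* (+ 7) ℤ.^ d) ℤ.^ 4) (λ t → bad (small? M e β d t k)) (trees n)))) (ℤP.≤-trans (∑-mono (All.universal (λ t → markov M e β d t k) (trees n)))
      (ℤP.≤-trans (ℤP.≤-reflexive (∑-* ((+ M ℤ.* (+ 8) ℤ.^ d) ℤ.^ 4) (λ t → jump (β ℕ.∸ d) k t ℤ.^ 4) (trees n))) (ℤP.*-monoˡ-≤-nonNeg ((+ M ℤ.* (+ 8) ℤ.^ d) ℤ.^ 4) {{ℤ.nonNegative (0≤^ℤ 4 (0≤* {+ M} 0≤n (0≤^ 8 d)))}}
        (ℤP.≤-trans (moment n (k ℕ.* h) h) (ℤP.*-monoʳ-≤-nonNeg T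
          (subst (+ (C ℕ.* (h ℕ.^ 2 ℕ.* n)) ℤ.≤_) cast (ℕ≤⇒ℤ≤ (ℕP.*-monoʳ-≤ C (ℕP.*-monoʳ-≤ (h ℕ.^ 2) n≤)))))))))
      where
      h = 2 ℕ.^ (β ℕ.∸ d)
      sq : ∀ b → + ((2 ℕ.^ b) ℕ.^ 2) ≡ ((+ 2) ℤ.^ b) ℤ.^ 2
      sq b = trans (sym (pos-^ (2 ℕ.^ b) 2)) (cong (ℤ._^ 2) (sym (pos-^ 2 b)))
      cast : + (C ℕ.* (h ℕ.^ 2 ℕ.* (4 ℕ.* (2 ℕ.^ e) ℕ.^ 2))) ≡ + C ℤ.* (((+ 2) ℤ.^ (β ℕ.∸ d)) ℤ.^ 2 ℤ.* (+ 4 ℤ.* ((+ 2) ℤ.^ e) ℤ.^ 2))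
      cast = trans (ℤP.pos-* C (h ℕ.^ 2 ℕ.* (4 ℕ.* (2 ℕ.^ e) ℕ.^ 2))) (cong (+ C ℤ.*_) (trans (ℤP.pos-* (h ℕ.^ 2) (4 ℕ.* (2 ℕ.^ e) ℕ.^ 2)) (cong₂ ℤ._*_ (sq (β ℕ.∸ d)) (trans (ℤP.pos-* 4 ((2 ℕ.^ e) ℕ.^ 2)) (cong (+ 4 ℤ.*_) (sq e))))))

    one-level : ∀ d → ((+ 2) ℤ.^ e ℤ.* (+ 7) ℤ.^ d) ℤ.^ 4 ℤ.* σ d ℤ.≤
      (+ m ℤ.* (+ 2) ℤ.^ (a₀ ℕ.+ d)) ℤ.* ((+ M ℤ.* (+ 8) ℤ.^ d) ℤ.^ 4 ℤ.* (+ C ℤ.* (((+ 2) ℤ.^ (β ℕ.∸ d)) ℤ.^ 2 ℤ.* (+ 4 ℤ.* ((+ 2) ℤ.^ e) ℤ.^ 2)) ℤ.* T))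
    one-level d = ℤP.≤-trans (ℤP.*-monoˡ-≤-nonNeg V {{ℤ.nonNegative (0≤^ℤ 4 (0≤* {(+ 2) ℤ.^ e} (0≤^ 2 e) (0≤^ 7 d)))}}
        (ℤP.≤-trans (∑-mono (All.universal (λ t → bad-all (small? M e β d t) (downFrom (intervals d))) (trees n)))
          (ℤP.≤-reflexive (∑-swap (λ t k → bad (small? M e β d t k)) (trees n) (downFrom (intervals d))))))
      (ℤP.≤-trans (ℤP.≤-reflexive (sym (∑-* V (λ k → ∑ (trees n) (λ t → bad (small? M e β d t k))) (downFrom (intervals d))))) (ℤP.≤-trans (∑-rng-bound (intervals d) λ k _ → one-interval d k)
        (ℤP.≤-reflexive (cong (ℤ._* W) (trans (ℤP.pos-* m (2 ℕ.^ (a₀ ℕ.+ d))) (cong (+ m ℤ.*_) (sym (pos-^ 2 (a₀ ℕ.+ d)))))))))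
      where
      V = ((+ 2) ℤ.^ e ℤ.* (+ 7) ℤ.^ d) ℤ.^ 4
      W = (+ M ℤ.* (+ 8) ℤ.^ d) ℤ.^ 4 ℤ.* (+ C ℤ.* (((+ 2) ℤ.^ (β ℕ.∸ d)) ℤ.^ 2 ℤ.* (+ 4 ℤ.* ((+ 2) ℤ.^ e) ℤ.^ 2)) ℤ.* T)

    -- Division by 2^(4b + 3a + 3d), with e = b + a + d.
    reduced : ∀ d b → b ℕ.+ d ≡ β → (+ 2) ℤ.^ d ℤ.* ((+ 7) ℤ.^ d) ℤ.^ 4 ℤ.* ((+ 2) ℤ.^ a₀ ℤ.* σ d) ℤ.≤ ((+ 8) ℤ.^ d) ℤ.^ 4 ℤ.* weight
    reduced d b e≡ = ℤP.*-cancelˡ-≤-pos ((+ 2) ℤ.^ d ℤ.* ((+ 7) ℤ.^ d) ℤ.^ 4 ℤ.* ((+ 2) ℤ.^ a₀ ℤ.* σ d)) (((+ 8) ℤ.^ d) ℤ.^ 4 ℤ.* weight) Π {{posΠ}} (subst₂ ℤ._≤_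
        (trans (cong (λ z → (z ℤ.* (+ 7) ℤ.^ d) ℤ.^ 4 ℤ.* σ d) 2^e) (lemˡ ((+ 2) ℤ.^ b) ((+ 2) ℤ.^ a₀) ((+ 2) ℤ.^ d) ((+ 7) ℤ.^ d) (σ d)))
        (trans (cong₃ (λ x p z → (+ m ℤ.* x) ℤ.* ((+ M ℤ.* (+ 8) ℤ.^ d) ℤ.^ 4 ℤ.* (+ C ℤ.* (p ℤ.^ 2 ℤ.* (+ 4 ℤ.* z ℤ.^ 2)) ℤ.* T)))
            (ℤP.^-distribˡ-+-* (+ 2) a₀ d) (cong ((+ 2) ℤ.^_) b≡) 2^e)
          (lemʳ ((+ 2) ℤ.^ b) ((+ 2) ℤ.^ a₀) ((+ 2) ℤ.^ d) (+ m) (+ M) ((+ 8) ℤ.^ d) (+ C) T))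
        (one-level d))
      where
      cong₃ : ∀ (f : ℤ → ℤ → ℤ → ℤ) {x x′ p p′ z z′} → x ≡ x′ → p ≡ p′ → z ≡ z′ → f x p z ≡ f x′ p′ z′
      cong₃ f refl refl refl = refl
      P = (+ 2) ℤ.^ b
      R₀ = (+ 2) ℤ.^ a₀
      R₁ = (+ 2) ℤ.^ d
      Π = P ℤ.^ 4 ℤ.* ((R₀ ℤ.^ 3) ℤ.* (R₁ ℤ.^ 3))
      pos* : ∀ {i j} → ℤ.Positive i → ℤ.Positive j → ℤ.Positive (i ℤ.* j)
      pos* {+ suc _} {+ suc _} _ _ = _
      posΠ : ℤ.Positive Π
      posΠ = pos* (pos^ℤ 4 (pos^ 2 b)) (pos* (pos^ℤ 3 (pos^ 2 a₀)) (pos^ℤ 3 (pos^ 2 d)))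
        where
        pos^ℤ : ∀ {i} k → ℤ.Positive i → ℤ.Positive (i ℤ.^ k)
        pos^ℤ zero    p = _
        pos^ℤ (suc k) p = pos* p (pos^ℤ k p)
      b≡ : β ℕ.∸ d ≡ b
      b≡ = trans (cong (ℕ._∸ d) (sym e≡)) (ℕP.m+n∸n≡m b d)
      2^e : (+ 2) ℤ.^ e ≡ (+ 2) ℤ.^ b ℤ.* (+ 2) ℤ.^ d ℤ.* (+ 2) ℤ.^ a₀
      2^e = trans (ℤP.^-distribˡ-+-* (+ 2) β a₀) (cong (ℤ._* (+ 2) ℤ.^ a₀) (trans (cong ((+ 2) ℤ.^_) (sym e≡)) (ℤP.^-distribˡ-+-* (+ 2) b d)))
      lemˡ : ∀ p q r s z → ((p ℤ.* r ℤ.* q ℤ.* s) ℤ.* ((p ℤ.* r ℤ.* q ℤ.* s) ℤ.* ((p ℤ.* r ℤ.* q ℤ.* s) ℤ.* ((p ℤ.* r ℤ.* q ℤ.* s) ℤ.* + 1)))) ℤ.* z ≡ ((p ℤ.* (p ℤ.* (p ℤ.* (p ℤ.* + 1)))) ℤ.* ((q ℤ.* (q ℤ.* (q ℤ.* + 1))) ℤ.* (r ℤ.* (r ℤ.* (r ℤ.* + 1))))) ℤ.* (r ℤ.* (s ℤ.* (s ℤ.* (s ℤ.* (s ℤ.* + 1)))) ℤ.* (q ℤ.* z))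
      lemˡ = solveℤ
      lemʳ : ∀ p q r m M v C T → (m ℤ.* (q ℤ.* r)) ℤ.* (((M ℤ.* v) ℤ.* ((M ℤ.* v) ℤ.* ((M ℤ.* v) ℤ.* ((M ℤ.* v) ℤ.* + 1)))) ℤ.* (C ℤ.* ((p ℤ.* (p ℤ.* + 1)) ℤ.* (+ 4 ℤ.* ((p ℤ.* r ℤ.* q) ℤ.* ((p ℤ.* r ℤ.* q) ℤ.* + 1)))) ℤ.* T)) ≡
        ((p ℤ.* (p ℤ.* (p ℤ.* (p ℤ.* + 1)))) ℤ.* ((q ℤ.* (q ℤ.* (q ℤ.* + 1))) ℤ.* (r ℤ.* (r ℤ.* (r ℤ.* + 1))))) ℤ.* ((v ℤ.* (v ℤ.* (v ℤ.* (v ℤ.* + 1)))) ℤ.* (+ 4 ℤ.* (C ℤ.* (m ℤ.* (M ℤ.* (M ℤ.* (M ℤ.* (M ℤ.* + 1)))) ℤ.* T))))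
      lemʳ = solveℤ

    0≤weight : + 0 ℤ.≤ weight
    0≤weight = 0≤* {+ 4} 0≤n (0≤* {+ C} 0≤n (0≤* {+ m ℤ.* (+ M) ℤ.^ 4} (0≤* {+ m} 0≤n (0≤^ M 4)) 0≤n))

    -- 9/8 ≤ 2 (7/8)^4
    decaying : ∀ d → d ℕ.≤ β → (+ 9) ℤ.^ d ℤ.* ((+ 2) ℤ.^ a₀ ℤ.* σ d) ℤ.≤ (+ 8) ℤ.^ d ℤ.* weight
    decaying d d≤β = ℤP.*-cancelˡ-≤-pos ((+ 9) ℤ.^ d ℤ.* ((+ 2) ℤ.^ a₀ ℤ.* σ d)) ((+ 8) ℤ.^ d ℤ.* weight) (((+ 8) ℤ.^ d) ℤ.^ 4) {{subst ℤ.Positive (sym (^4 8)) (pos^ (8 ℕ.^ 4) d)}} (begin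
        ((+ 8) ℤ.^ d) ℤ.^ 4 ℤ.* ((+ 9) ℤ.^ d ℤ.* x)                       ≡⟨ sym (ℤP.*-assoc (((+ 8) ℤ.^ d) ℤ.^ 4) ((+ 9) ℤ.^ d) x) ⟩
        ((+ 8) ℤ.^ d) ℤ.^ 4 ℤ.* (+ 9) ℤ.^ d ℤ.* x                         ≤⟨ ℤP.*-monoʳ-≤-nonNeg x {{ℤ.nonNegative 0≤x}} powers ⟩
        (+ 8) ℤ.^ d ℤ.* ((+ 2) ℤ.^ d ℤ.* ((+ 7) ℤ.^ d) ℤ.^ 4) ℤ.* x       ≡⟨ ℤP.*-assoc ((+ 8) ℤ.^ d) ((+ 2) ℤ.^ d ℤ.* ((+ 7) ℤ.^ d) ℤ.^ 4) x ⟩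
        (+ 8) ℤ.^ d ℤ.* ((+ 2) ℤ.^ d ℤ.* ((+ 7) ℤ.^ d) ℤ.^ 4 ℤ.* x)       ≤⟨ ℤP.*-monoˡ-≤-nonNeg ((+ 8) ℤ.^ d) {{ℤ.nonNegative (0≤^ 8 d)}} (reduced d (β ℕ.∸ d) (ℕP.m∸n+n≡m d≤β)) ⟩
        (+ 8) ℤ.^ d ℤ.* (((+ 8) ℤ.^ d) ℤ.^ 4 ℤ.* weight)                  ≡⟨ swap ((+ 8) ℤ.^ d) (((+ 8) ℤ.^ d) ℤ.^ 4) weight ⟩
        ((+ 8) ℤ.^ d) ℤ.^ 4 ℤ.* ((+ 8) ℤ.^ d ℤ.* weight)                  ∎)
      where
      open ℤP.≤-Reasoning
      x = (+ 2) ℤ.^ a₀ ℤ.* σ d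
      0≤x : + 0 ℤ.≤ x
      0≤x = 0≤* {(+ 2) ℤ.^ a₀} (0≤^ 2 a₀) (∑-nonneg (All.universal (λ t → 0≤bad (fine? t d)) (trees n)))
      swap : ∀ p q r → p ℤ.* (q ℤ.* r) ≡ q ℤ.* (p ℤ.* r)
      swap = solveℤ
      ^4 : ∀ c → ((+ c) ℤ.^ d) ℤ.^ 4 ≡ (+ (c ℕ.^ 4)) ℤ.^ d
      ^4 c = trans (cong (ℤ._^ 4) (pos-^ c d)) (trans (pos-^ (c ℕ.^ d) 4) (trans (cong +_ (ℕ-^-swap c d 4)) (sym (pos-^ (c ℕ.^ 4) d))))
      powers : ((+ 8) ℤ.^ d) ℤ.^ 4 ℤ.* (+ 9) ℤ.^ d ℤ.≤ (+ 8) ℤ.^ d ℤ.* ((+ 2) ℤ.^ d ℤ.* ((+ 7) ℤ.^ d) ℤ.^ 4)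
      powers = subst₂ ℤ._≤_ (trans (cong +_ (ℕ-^-*-^ (8 ℕ.^ 4) 9 d)) (trans (ℤP.pos-* ((8 ℕ.^ 4) ℕ.^ d) (9 ℕ.^ d)) (cong₂ ℤ._*_ (trans (sym (pos-^ (8 ℕ.^ 4) d)) (sym (^4 8))) (sym (pos-^ 9 d)))))
        (trans (cong +_ (trans (ℕ-^-*-^ 8 (2 ℕ.* 7 ℕ.^ 4) d) (cong (8 ℕ.^ d ℕ.*_) (ℕ-^-*-^ 2 (7 ℕ.^ 4) d))))
          (trans (ℤP.pos-* (8 ℕ.^ d) (2 ℕ.^ d ℕ.* (7 ℕ.^ 4) ℕ.^ d)) (cong₂ ℤ._*_ (sym (pos-^ 8 d)) (trans (ℤP.pos-* (2 ℕ.^ d) ((7 ℕ.^ 4) ℕ.^ d)) (cong₂ ℤ._*_ (sym (pos-^ 2 d)) (trans (sym (pos-^ (7 ℕ.^ 4) d)) (sym (^4 7))))))))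
        -- 8 · 2 · 7⁴ = 38416 = 8⁴ · 9 + 1552.
        (ℕ≤⇒ℤ≤ (ℕP.^-monoˡ-≤ d (ℕP.m≤m+n (8 ℕ.^ 4 ℕ.* 9) 1552)))

  -- Apart from the number of trees, the right side depends on neither n nor β, so the probability
  -- of irregularity is O(2^-a₀) uniformly in n. Of the constants, 9 sums the ratio 8/9 and the 4 in
  -- `weight` comes from n ≤ 4 (2^e)².
  irregular : (+ 2) ℤ.^ a₀ ℤ.* ∑ (trees n) (λ t → bad (regular? t)) ℤ.≤ + 9 ℤ.* weight
  irregular = ℤP.≤-trans (ℤP.*-monoˡ-≤-nonNeg ((+ 2) ℤ.^ a₀) {{ℤ.nonNegative (0≤^ 2 a₀)}}
      (ℤP.≤-trans (∑-mono (All.universal (λ t → bad-all (fine? t) (downFrom (suc β))) (trees n)))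
        (ℤP.≤-reflexive (∑-swap (λ t d → bad (fine? t d)) (trees n) (downFrom (suc β))))))
    (ℤP.≤-trans (ℤP.≤-reflexive (sym (∑-* ((+ 2) ℤ.^ a₀) σ (downFrom (suc β))))) (geometric-sum (λ d → (+ 2) ℤ.^ a₀ ℤ.* σ d) weight β 0≤weight decaying))

-- From regular increments to a modulus of continuity

0<ι : ∀ {n} → 1 ℕ.≤ n → 0ℚ ℚ.< ι n
0<ι {n} p = ℚP.<-≤-trans (ℚP.positive⁻¹ 1ℚ) (subst (ℚ._≤ ι n) ι-1 (ι-mono p))

module Smooth (n′ : ℕ) (t : Tree) (size≡ : size t ≡ suc n′) (j a₀ β M′ μ : ℕ)
  (lower : (2 ℕ.^ (β ℕ.+ a₀)) ℕ.^ 2 ℕ.≤ suc n′) (upper : suc n′ ℕ.≤ 4 ℕ.* (2 ℕ.^ (β ℕ.+ a₀)) ℕ.^ 2)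
  (M′-large : inv M′ ℚ.≤ inv 17 ℚ.* ¼pw j) (μ-fine : 2 ℕ.* 2 ℕ.^ a₀ ℕ.≤ suc μ)
  (regular : Events.Regular (suc M′) (7 ℕ.+ (j ℕ.+ j)) a₀ β t) where

  open Rescaled n′ t size≡
  open Events (suc M′) (7 ℕ.+ (j ℕ.+ j)) a₀ β

  private
    span m range : ℕ
    span = 2 ℕ.^ e
    m = 7 ℕ.+ (j ℕ.+ j)
    range = m ℕ.* span

    1≤span : 1 ℕ.≤ span
    1≤span = ℕP.m^n>0 2 e

    u : ℚ
    u = ι span ℚ.* inv M′

    0≤u : 0ℚ ℚ.≤ u
    0≤u = q0≤* (0≤ι span) (0≤inv M′)

    c gain : ℕ → ℚ
    c x = ι (L t x)
    gain b = u ℚ.* decay (β ℕ.∸ b)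

    small-step : ∀ d x b k → β ℕ.∸ d ≡ b → x ≡ k ℕ.* 2 ℕ.^ b → Small (suc M′) e β d t k → ℚ.∣ c x ℚ.- c (x ℕ.+ 2 ℕ.^ b) ∣ ℚ.≤ u ℚ.* decay d
    small-step d _ _ k refl refl h = ℚP.≤-trans (ι-dist (L t x₀) (L t (x₀ ℕ.+ 2 ℕ.^ (β ℕ.∸ d))))
        (ℚP.*-cancelˡ-≤-pos (ι (suc M′ ℕ.* 8 ℕ.^ d)) {{ℚ.positive (0<ι {suc M′ ℕ.* 8 ℕ.^ d} (ℕP.*-mono-≤ {1} {suc M′} {1} {8 ℕ.^ d} (s≤s z≤n) (ℕP.m^n>0 8 d)))}}
          (ℚP.≤-trans (ℚP.≤-reflexive (sym (ι-* (suc M′ ℕ.* 8 ℕ.^ d) ∣ jump (β ℕ.∸ d) k t ∣))) (ℚP.≤-trans (ι-mono h) (ℚP.≤-reflexive scaled))))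
      where
      x₀ = k ℕ.* 2 ℕ.^ (β ℕ.∸ d)
      scaled : ι (span ℕ.* 7 ℕ.^ d) ≡ ι (suc M′ ℕ.* 8 ℕ.^ d) ℚ.* (u ℚ.* decay d)
      scaled = trans (ι-* span (7 ℕ.^ d)) (trans (cong (ι span ℚ.*_) (sym (ι-decay d))) (sym (trans (cong (ℚ._* (u ℚ.* decay d)) (ι-* (suc M′) (8 ℕ.^ d)))
        (trans (ℚS.solve 5 (λ M v s i f → (M ℚS.:* v) ℚS.:* ((s ℚS.:* i) ℚS.:* f) ℚS.:= (M ℚS.:* i) ℚS.:* (s ℚS.:* (v ℚS.:* f))) refl (ι (suc M′)) (ι (8 ℕ.^ d)) (ι span) (inv M′) (decay d))
          (trans (cong (ℚ._* (ι span ℚ.* (ι (8 ℕ.^ d) ℚ.* decay d))) (ι-inv M′)) (ℚP.*-identityˡ _))))))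

    step : ∀ b k x → b ℕ.≤ β → x ≡ k ℕ.* 2 ℕ.^ b → x ℕ.+ 2 ℕ.^ b ℕ.≤ range → ℚ.∣ c x ℚ.- c (x ℕ.+ 2 ℕ.^ b) ∣ ℚ.≤ gain b
    step b k x b≤ x≡ x≤ = small-step d x b k (ℕP.m∸[m∸n]≡n b≤) x≡
        (all-below (intervals d) (all-below (suc β) regular d (s≤s (ℕP.m∸n≤m β b))) k
          (ℕP.*-cancelʳ-≤ (suc k) (intervals d) (2 ℕ.^ b) {{ℕP.m^n≢0 2 b}} (subst₂ ℕ._≤_ (trans (cong (ℕ._+ 2 ℕ.^ b) x≡) (ℕP.+-comm (k ℕ.* 2 ℕ.^ b) (2 ℕ.^ b))) range≡ x≤)))
      where
      d = β ℕ.∸ b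
      range≡ : range ≡ intervals d ℕ.* 2 ℕ.^ b
      range≡ = trans (cong (λ z → m ℕ.* 2 ℕ.^ z) (trans (cong (ℕ._+ a₀) (sym (ℕP.m∸n+n≡m b≤))) (lem d b a₀)))
        (trans (cong (m ℕ.*_) (ℕP.^-distribˡ-+-* 2 (a₀ ℕ.+ d) b)) (sym (ℕP.*-assoc m (2 ℕ.^ (a₀ ℕ.+ d)) (2 ℕ.^ b))))
        where
        lem : ∀ d b a → d ℕ.+ b ℕ.+ a ≡ a ℕ.+ d ℕ.+ b
        lem = solveℕ

    open Dyadic c gain range (λ b → q0≤* 0≤u (0≤decay (β ℕ.∸ b))) β step

    ∑-gain : ∑ᵠ β gain ℚ.≤ u ℚ.* ι 7
    ∑-gain = ∑-decay u β 0≤u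

    gain-top : gain β ℚ.≤ u
    gain-top = ℚP.≤-reflexive (trans (cong (λ z → u ℚ.* decay z) (ℕP.n∸n≡0 β)) (ℚP.*-identityʳ u))

    -- 17 = 7 + 3 + 7: from x down to a multiple of 2^β, three coarse steps, and the remainder. The
    -- 2 in the distance is what interpolation adds.
    levels-near : ∀ x z → x ℕ.≤ z → z ℕ.≤ x ℕ.+ (2 ℕ.+ 2 ℕ.^ β) → z ℕ.≤ range → ℚ.∣ c x ℚ.- c z ∣ ℚ.≤ u ℚ.* ι 17
    levels-near x z x≤z z≤ ≤range = ℚP.≤-trans (near x z x≤z (ℕP.≤-trans z≤ (ℕP.+-monoʳ-≤ x three)) ≤range)
      (ℚP.≤-trans (ℚP.+-mono-≤ ∑-gain (ℚP.+-mono-≤ gain-top (ℚP.+-mono-≤ gain-top (ℚP.+-mono-≤ gain-top ∑-gain)))) (ℚP.≤-reflexive seventeen))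
      where
      three : 2 ℕ.+ 2 ℕ.^ β ℕ.≤ 3 ℕ.* 2 ℕ.^ β
      three = ℕP.≤-trans (ℕP.+-monoˡ-≤ (2 ℕ.^ β) (ℕP.*-monoʳ-≤ 2 (ℕP.m^n>0 2 β))) (ℕP.≤-reflexive (lem (2 ℕ.^ β)))
        where
        lem : ∀ p → 2 ℕ.* p ℕ.+ p ≡ 3 ℕ.* p
        lem = solveℕ
      seventeen : u ℚ.* ι 7 ℚ.+ (u ℚ.+ (u ℚ.+ (u ℚ.+ u ℚ.* ι 7))) ≡ u ℚ.* ι 17
      seventeen = trans (cong (λ z → u ℚ.* ι 7 ℚ.+ z) (cong (λ v → v ℚ.+ (v ℚ.+ (v ℚ.+ u ℚ.* ι 7))) (sym (trans (cong (u ℚ.*_) ι-1) (ℚP.*-identityʳ u)))))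
        (trans (ℚS.solve 3 (λ u a o → u ℚS.:* a ℚS.:+ (u ℚS.:* o ℚS.:+ (u ℚS.:* o ℚS.:+ (u ℚS.:* o ℚS.:+ u ℚS.:* a))) ℚS.:= u ℚS.:* (a ℚS.:+ (o ℚS.:+ (o ℚS.:+ (o ℚS.:+ a))))) refl u (ι 7) (ι 1))
          (cong (u ℚ.*_) (sym (trans (ι-+ 7 10) (cong (ι 7 ℚ.+_) (trans (ι-+ 1 9) (cong (ι 1 ℚ.+_) (trans (ι-+ 1 8) (cong (ι 1 ℚ.+_) (ι-+ 1 7))))))))))

    -- Up to time j + 3 the profile is evaluated below (j + 3) √n ≤ (2 j + 6) 2^e; one more 2^e for
    -- the neighbouring node gives the factor 7 + 2 j of the range.
    horizon : ℕ
    horizon = (3 ℕ.+ j) ℕ.* (2 ℕ.* span)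

    horizon<range : suc horizon ℕ.≤ range
    horizon<range = ℕP.≤-trans (ℕP.+-monoˡ-≤ horizon 1≤span) (ℕP.≤-reflexive (lem j span))
      where
      lem : ∀ j s → s ℕ.+ (3 ℕ.+ j) ℕ.* (2 ℕ.* s) ≡ (7 ℕ.+ (j ℕ.+ j)) ℕ.* s
      lem = solveℕ

    root≤span : ∀ i → root (suc n′) i ℚ.≤ ι (2 ℕ.* span)
    root≤span i = square-cancel (0≤ι (2 ℕ.* span)) (ℚP.≤-trans (root²≤ (suc n′) i) (ℚP.≤-trans (ι-mono upper) (ℚP.≤-reflexive (trans (cong ι (lem span)) (ι-* (2 ℕ.* span) (2 ℕ.* span))))))
      where
      lem : ∀ s → 4 ℕ.* (s ℕ.* (s ℕ.* 1)) ≡ 2 ℕ.* s ℕ.* (2 ℕ.* s)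
      lem = solveℕ

    -- Turns increments of size 2^e / M of the profile into increments of size 1 / M of the rescaled
    -- path, whose factor is √n / n.
    root*span≤ : ∀ i → root (suc n′) i ℚ.* ι span ℚ.≤ ι (suc n′)
    root*span≤ i = square-cancel (0≤ι (suc n′)) (ℚP.≤-trans (ℚP.≤-reflexive (ℚS.solve 2 (λ r s → (r ℚS.:* s) ℚS.:* (r ℚS.:* s) ℚS.:= (r ℚS.:* r) ℚS.:* (s ℚS.:* s)) refl (root (suc n′) i) (ι span)))
      (*≤* (q0≤* (0≤root (suc n′) i) (0≤root (suc n′) i)) (0≤ι (suc n′)) (root²≤ (suc n′) i)
        (ℚP.≤-trans (ℚP.≤-reflexive (trans (sym (ι-* span span)) (cong ι (cong (span ℕ.*_) (sym (ℕP.*-identityʳ span)))))) (ι-mono lower))))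

  smooth : ∀ i p q → p ℚ.≤ ι (3 ℕ.+ j) → q ℚ.≤ ι (3 ℕ.+ j) → ℚ.∣ p ℚ.- q ∣ ℚ.≤ inv μ → ℚ.∣ F i p ℚ.- F i q ∣ ℚ.≤ ¼pw j
  smooth i p q p≤ q≤ pq = ℚP.≤-trans (ℚP.≤-reflexive (cong ℚ.∣_∣ (ℚS.solve 3 (λ k x z → k ℚS.:* x ℚS.:- k ℚS.:* z ℚS.:= k ℚS.:* (x ℚS.:- z)) refl (w ℚ.* s) (interp t (p⁺ ℚ.* s)) (interp t (q⁺ ℚ.* s)))))
      (ℚP.≤-trans (∣*∣ (w ℚ.* s) (interp t (p⁺ ℚ.* s) ℚ.- interp t (q⁺ ℚ.* s)) (ℚP.≤-reflexive (ℚP.0≤p⇒∣p∣≡p 0≤ws))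
          (interp-near t horizon range (2 ℕ.^ β) (u ℚ.* ι 17) levels-near horizon<range (p⁺ ℚ.* s) (q⁺ ℚ.* s) (q0≤* (0≤⁺ p) 0≤s) (within p p≤) (q0≤* (0≤⁺ q) 0≤s) (within q q≤) close))
        (ℚP.≤-trans (ℚP.≤-reflexive (ℚS.solve 5 (λ w s v i c → (w ℚS.:* s) ℚS.:* ((v ℚS.:* i) ℚS.:* c) ℚS.:= (w ℚS.:* (s ℚS.:* v)) ℚS.:* (i ℚS.:* c)) refl w s (ι span) (inv M′) (ι 17)))
          (ℚP.≤-trans (*≤* (q0≤* (0≤inv n′) (q0≤* 0≤s (0≤ι span))) (ℚP.<⇒≤ (0<¼pw j))
              (ℚP.≤-trans (ℚP.*-monoˡ-≤-nonNeg w {{ℚ.nonNegative (0≤inv n′)}} (root*span≤ i)) (ℚP.≤-reflexive (inv-ι n′)))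
              (inv-cancel 17 (ℚP.<⇒≤ (0<¼pw j)) M′-large))
            (ℚP.≤-reflexive (ℚP.*-identityˡ (¼pw j))))))
    where
    w = inv n′
    s = root (suc n′) i
    p⁺ = 0ℚ ℚ.⊔ p
    q⁺ = 0ℚ ℚ.⊔ q
    0≤s : 0ℚ ℚ.≤ s
    0≤s = 0≤root (suc n′) i
    0≤ws : 0ℚ ℚ.≤ w ℚ.* s
    0≤ws = q0≤* (0≤inv n′) 0≤s
    0≤⁺ : ∀ x → 0ℚ ℚ.≤ 0ℚ ℚ.⊔ x
    0≤⁺ x = ℚP.p≤p⊔q 0ℚ x
    within : ∀ x → x ℚ.≤ ι (3 ℕ.+ j) → (0ℚ ℚ.⊔ x) ℚ.* s ℚ.≤ ι horizon
    within x x≤ = ℚP.≤-trans (*≤* (0≤⁺ x) (0≤ι (2 ℕ.* span)) (ℚP.⊔-lub (0≤ι (3 ℕ.+ j)) x≤) (root≤span i)) (ℚP.≤-reflexive (sym (ι-* (3 ℕ.+ j) (2 ℕ.* span))))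
    close : ℚ.∣ p⁺ ℚ.* s ℚ.- q⁺ ℚ.* s ∣ ℚ.≤ ι (2 ℕ.^ β)
    close = ℚP.≤-trans (ℚP.≤-reflexive (cong ℚ.∣_∣ (ℚS.solve 3 (λ p q s → p ℚS.:* s ℚS.:- q ℚS.:* s ℚS.:= (p ℚS.:- q) ℚS.:* s) refl p⁺ q⁺ s)))
      (ℚP.≤-trans (∣*∣ (p⁺ ℚ.- q⁺) s (ℚP.≤-trans (⊔-lip 0ℚ p q) pq) (ℚP.≤-trans (ℚP.≤-reflexive (ℚP.0≤p⇒∣p∣≡p 0≤s)) (root≤span i)))
        (ℚP.≤-trans (ℚP.*-monoˡ-≤-nonNeg (inv μ) {{ℚ.nonNegative (0≤inv μ)}} (ℚP.≤-trans (ι-mono spans) (ℚP.≤-reflexive (ι-* (suc μ) (2 ℕ.^ β)))))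
          (ℚP.≤-reflexive (trans (sym (ℚP.*-assoc (inv μ) (ι (suc μ)) (ι (2 ℕ.^ β)))) (trans (cong (ℚ._* ι (2 ℕ.^ β)) (inv-ι μ)) (ℚP.*-identityˡ _))))))
      where
      -- √n / (μ + 1) ≤ 2 · 2^e / (2 · 2^a₀) = 2^β: times closer than one mesh width are at most one
      -- coarse interval apart.
      spans : 2 ℕ.* span ℕ.≤ suc μ ℕ.* 2 ℕ.^ β
      spans = ℕP.≤-trans (ℕP.≤-reflexive (trans (cong (2 ℕ.*_) (trans (ℕP.^-distribˡ-+-* 2 β a₀) (ℕP.*-comm (2 ℕ.^ β) (2 ℕ.^ a₀)))) (sym (ℕP.*-assoc 2 (2 ℕ.^ a₀) (2 ℕ.^ β)))))
        (ℕP.*-monoˡ-≤ (2 ℕ.^ β) μ-fine)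

-- Choice of the scales and the event of regular paths

n<2^n : ∀ n → n ℕ.< 2 ℕ.^ n
n<2^n zero    = s≤s z≤n
n<2^n (suc n) = ℕP.≤-trans (ℕP.+-mono-≤ (ℕP.m^n>0 2 n) (n<2^n n)) (ℕP.≤-reflexive (cong (2 ℕ.^ n ℕ.+_) (sym (ℕP.+-identityʳ (2 ℕ.^ n)))))

4^≡2^² : ∀ e → 4 ℕ.^ e ≡ (2 ℕ.^ e) ℕ.^ 2
4^≡2^² e = ℕ-^-swap 2 2 e

trees-nonempty : ∀ n′ → 1 ℕ.≤ length (trees (suc n′))
trees-nonempty n′ = ℤP.drop‿+≤+ (subst (+ 1 ℤ.≤_) (y-length (suc n′)) (go n′))
  where
  go : ∀ n′ → + 1 ℤ.≤ y (suc n′)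
  go zero     = ℤP.≤-reflexive (sym y1)
  go (suc n′) = ℤP.≤-trans (go n′) (y-mono (suc n′) (s≤s z≤n))

mean-≥ : ∀ N (Y : Tree → ℤ) ts → 1 ℕ.≤ length ts → + N ℤ.* + length ts ℤ.≤ ∑ ts Y ℤ.* + suc N → ι N ℚ.* inv N ℚ.≤ mean (map Y ts)
mean-≥ N Y (t ∷ ts) _ h = ℚP.≤-trans (ℚP.≤-reflexive (sym (/≡ι*inv N N)))
  (/≤/ (+ N) (foldr ℤ._+_ (+ 0) (map Y (t ∷ ts))) N (length (map Y ts)) (subst₂ ℤ._≤_ (cong (λ z → + N ℤ.* + suc z) (sym (ListP.length-map Y ts)))
    (cong (ℤ._* + suc N) (sym (foldr-∑ {Y} (t ∷ ts)))) h))

1-inv : ∀ N → 1ℚ ℚ.- inv N ≡ ι N ℚ.* inv N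
1-inv N = trans (cong (ℚ._- inv N) (sym (trans (cong (ℚ._* inv N) (sym (ι-suc N))) (ι-inv N))))
  (ℚS.solve 2 (λ k i → (ℚS.con 1ℚ ℚS.:+ k) ℚS.:* i ℚS.:- i ℚS.:= k ℚS.:* i) refl (ι N) (inv N))

rangeOf : ℕ → ℕ
rangeOf j = 7 ℕ.+ (j ℕ.+ j)

module Scales (C : ℕ) (moment : ∀ n r h → ∑ (trees n) (λ t → (+ L t r ℤ.- + L t (r ℕ.+ h)) ℤ.^ 4) ℤ.≤ + (C ℕ.* (h ℕ.^ 2 ℕ.* n)) ℤ.* + length (trees n))
  (N : ℕ) (M′ cut mesh : ℕ → ℕ)
  (cut-large : ∀ j → suc (36 ℕ.* (C ℕ.* (rangeOf j ℕ.* suc (M′ j) ℕ.^ 4))) ℕ.* (suc N ℕ.* 2 ℕ.^ suc j) ℕ.≤ cut j) (j≤cut : ∀ j → j ℕ.≤ cut j)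
  (M′-large : ∀ j → inv (M′ j) ℚ.≤ inv 17 ℚ.* ¼pw j)
  (mesh-fine : ∀ j → 2 ℕ.* 2 ℕ.^ cut j ℕ.≤ suc (mesh j)) (mesh-small : ∀ j → inv (mesh j) ℚ.≤ inv (4 ℕ.^ cut j) ℚ.* ¼pw j) where

  open Closure mesh unitOf (topOf mesh) (topOf-mono mesh)

  module _ (n′ e : ℕ) (lower : 4 ℕ.^ e ℕ.≤ suc n′) (upper : suc n′ ℕ.< 4 ℕ.^ suc e) where

    private
      n : ℕ
      n = suc n′

      T : ℤ
      T = + length (trees n)

    RegularAt : ℕ → Tree → Set
    RegularAt j t = Events.Regular (suc (M′ j)) (rangeOf j) (cut j) (e ℕ.∸ cut j) t

    regularAt? : ∀ j t → Dec (RegularAt j t)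
    regularAt? j t = Events.regular? (suc (M′ j)) (rangeOf j) (cut j) (e ℕ.∸ cut j) t

    regularIf? : ∀ j t → Dec (cut j ℕ.≤ e → RegularAt j t)
    regularIf? j t = (cut j ℕP.≤? e) →-dec regularAt? j t

    -- Finitely many levels suffice, which keeps the event decidable: `cut j ≤ e` forces j ≤ e < n,
    -- so the condition is vacuous for j ≥ n.
    Regular : Tree → Set
    Regular t = All (λ j → cut j ℕ.≤ e → RegularAt j t) (downFrom n)

    regular? : ∀ t → Dec (Regular t)
    regular? t = All.all? (λ j → regularIf? j t) (downFrom n)

    private
      upper² : n ℕ.≤ 4 ℕ.* (2 ℕ.^ e) ℕ.^ 2
      upper² = ℕP.≤-trans (ℕP.<⇒≤ upper) (ℕP.≤-reflexive (cong (4 ℕ.*_) (4^≡2^² e)))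

      badAt badIf : ℕ → ℤ
      badAt j = ∑ (trees n) (λ t → bad (regularAt? j t))
      badIf j = ∑ (trees n) (λ t → bad (regularIf? j t))

      -- Level j is allotted the share 2^-(j+1) of the total failure probability 1 / (N + 1). Since
      -- cut j < 2^(cut j), the linear lower bound on `cut j` already beats the constant of
      -- `irregular`.
      badAt≤ : ∀ j → cut j ℕ.≤ e → (+ 2) ℤ.^ suc j ℤ.* (+ suc N ℤ.* badAt j) ℤ.≤ T
      badAt≤ j h = ℤP.*-cancelˡ-≤-pos ((+ 2) ℤ.^ suc j ℤ.* (+ suc N ℤ.* badAt j)) T (+ D) (begin
          + D ℤ.* ((+ 2) ℤ.^ suc j ℤ.* (+ suc N ℤ.* badAt j))     ≡⟨ assoc (+ D) ((+ 2) ℤ.^ suc j) (+ suc N) (badAt j) ⟩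
          + D ℤ.* (+ suc N ℤ.* (+ 2) ℤ.^ suc j) ℤ.* badAt j       ≡⟨ cong (ℤ._* badAt j) (sym (trans (ℤP.pos-* D (suc N ℕ.* 2 ℕ.^ suc j)) (cong (+ D ℤ.*_) (trans (ℤP.pos-* (suc N) (2 ℕ.^ suc j)) (cong (+ suc N ℤ.*_) (sym (pos-^ 2 (suc j)))))))) ⟩
          + (D ℕ.* (suc N ℕ.* 2 ℕ.^ suc j)) ℤ.* badAt j           ≤⟨ ℤP.*-monoʳ-≤-nonNeg (badAt j) {{ℤ.nonNegative 0≤badAt}} (ℕ≤⇒ℤ≤ (ℕP.≤-trans (cut-large j) (ℕP.<⇒≤ (n<2^n (cut j))))) ⟩
          + (2 ℕ.^ cut j) ℤ.* badAt j                              ≡⟨ cong (ℤ._* badAt j) (sym (pos-^ 2 (cut j))) ⟩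
          (+ 2) ℤ.^ cut j ℤ.* badAt j                              ≤⟨ irregular ⟩
          + 9 ℤ.* weight                                           ≡⟨ regroup (+ C) (+ m) ((+ suc (M′ j)) ℤ.^ 4) T ⟩
          + 36 ℤ.* (+ C ℤ.* (+ m ℤ.* (+ suc (M′ j)) ℤ.^ 4)) ℤ.* T ≡⟨ cong (ℤ._* T) (sym (trans (ℤP.pos-* 36 (C ℕ.* (m ℕ.* suc (M′ j) ℕ.^ 4))) (cong (+ 36 ℤ.*_) (trans (ℤP.pos-* C (m ℕ.* suc (M′ j) ℕ.^ 4)) (cong (+ C ℤ.*_) (trans (ℤP.pos-* m (suc (M′ j) ℕ.^ 4)) (cong (+ m ℤ.*_) (sym (pos-^ (suc (M′ j)) 4))))))))) ⟩
          + (36 ℕ.* (C ℕ.* (m ℕ.* suc (M′ j) ℕ.^ 4))) ℤ.* T       ≤⟨ ℤP.*-monoʳ-≤-nonNeg T (ℕ≤⇒ℤ≤ (ℕP.n≤1+n (36 ℕ.* (C ℕ.* (m ℕ.* suc (M′ j) ℕ.^ 4))))) ⟩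
          + D ℤ.* T                                                ∎)
        where
        open ℤP.≤-Reasoning
        m = rangeOf j
        D = suc (36 ℕ.* (C ℕ.* (m ℕ.* suc (M′ j) ℕ.^ 4)))
        open Irregular C moment (suc (M′ j)) m (cut j) (e ℕ.∸ cut j) n (subst (λ z → n ℕ.≤ 4 ℕ.* (2 ℕ.^ z) ℕ.^ 2) (sym (ℕP.m∸n+n≡m h)) upper²) using (irregular; weight)
        0≤badAt : + 0 ℤ.≤ badAt j
        0≤badAt = ∑-nonneg (All.universal (λ t → 0≤bad (regularAt? j t)) (trees n))
        assoc : ∀ d p q b → d ℤ.* (p ℤ.* (q ℤ.* b)) ≡ d ℤ.* (q ℤ.* p) ℤ.* b
        assoc = solveℤ
        regroup : ∀ C m M T → + 9 ℤ.* (+ 4 ℤ.* (C ℤ.* (m ℤ.* M ℤ.* T))) ≡ + 36 ℤ.* (C ℤ.* (m ℤ.* M)) ℤ.* T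
        regroup = solveℤ

      scaled-mono : ∀ j {b b′} → b ℤ.≤ b′ → (+ 2) ℤ.^ suc j ℤ.* (+ suc N ℤ.* b) ℤ.≤ (+ 2) ℤ.^ suc j ℤ.* (+ suc N ℤ.* b′)
      scaled-mono j p = ℤP.*-monoˡ-≤-nonNeg ((+ 2) ℤ.^ suc j) {{ℤ.nonNegative (0≤^ 2 (suc j))}} (ℤP.*-monoˡ-≤-nonNeg (+ suc N) p)

      badIf≤ : ∀ j → Dec (cut j ℕ.≤ e) → (+ 2) ℤ.^ suc j ℤ.* (+ suc N ℤ.* badIf j) ℤ.≤ T
      badIf≤ j (yes h) = ℤP.≤-trans (scaled-mono j (∑-mono (All.universal (λ t → bad-≤ (regularIf? j t) (0≤bad (regularAt? j t))
        (λ ¬r → ℤP.≤-reflexive (sym (bad-no (regularAt? j t) (λ r → ¬r λ _ → r))))) (trees n)))) (badAt≤ j h)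
      badIf≤ j (no ¬h) = ℤP.≤-trans (scaled-mono j (ℤP.≤-trans (∑-mono {g = λ _ → + 0} (All.universal (λ t → bad-≤ (regularIf? j t) ℤP.≤-refl
          (λ ¬r → ⊥-elim (¬r λ h → contradiction h ¬h))) (trees n))) (ℤP.≤-reflexive (∑-zero (All.universal (λ _ → refl) (trees n))))))
        (ℤP.≤-trans (ℤP.≤-reflexive (trans (cong ((+ 2) ℤ.^ suc j ℤ.*_) (ℤP.*-zeroʳ (+ suc N))) (ℤP.*-zeroʳ ((+ 2) ℤ.^ suc j)))) 0≤n)

      ∑-bad : + suc N ℤ.* ∑ (trees n) (λ t → bad (regular? t)) ℤ.≤ T
      ∑-bad = ℤP.≤-trans (ℤP.*-monoˡ-≤-nonNeg (+ suc N) (ℤP.≤-trans (∑-mono (All.universal (λ t → bad-all (λ j → regularIf? j t) (downFrom n)) (trees n)))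
          (ℤP.≤-reflexive (∑-swap (λ t j → bad (regularIf? j t)) (trees n) (downFrom n)))))
        (ℤP.≤-trans (ℤP.≤-reflexive (sym (∑-* (+ suc N) badIf (downFrom n)))) (halving-sum (λ j → + suc N ℤ.* badIf j) T n 0≤n λ j _ → badIf≤ j (cut j ℕP.≤? e)))

    probability : 1ℚ ℚ.- inv N ℚ.≤ ℙ n (λ t → does (regular? t))
    probability = ℚP.≤-trans (ℚP.≤-reflexive (1-inv N)) (mean-≥ N (λ t → if does (regular? t) then + 1 else + 0) (trees n) (trees-nonempty n′)
        (≤-by (trans (cong (ℤ._* + suc N) ∑-good) (lem T (∑ (trees n) (λ t → bad (regular? t))) (+ N))) (0≤- ∑-bad)))
      where
      lem : ∀ T b N → (T ℤ.- b) ℤ.* (+ 1 ℤ.+ N) ≡ N ℤ.* T ℤ.+ (T ℤ.- (+ 1 ℤ.+ N) ℤ.* b)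
      lem = solveℤ
      good≡ : ∀ {P : Set} (d : Dec P) → (if does d then + 1 else + 0) ≡ + 1 ℤ.- bad d
      good≡ (yes _) = refl
      good≡ (no _)  = refl
      count : ∀ ts → ∑ ts (λ t → if does (regular? t) then + 1 else + 0) ≡ + length ts ℤ.- ∑ ts (λ t → bad (regular? t))
      count []       = refl
      count (t ∷ ts) = trans (cong₂ ℤ._+_ (good≡ (regular? t)) (count ts)) (lem′ (bad (regular? t)) (+ length ts) (∑ ts (λ t → bad (regular? t))))
        where
        lem′ : ∀ b k s → + 1 ℤ.- b ℤ.+ (k ℤ.- s) ≡ + 1 ℤ.+ k ℤ.- (b ℤ.+ s)
        lem′ = solveℤ
      ∑-good : ∑ (trees n) (λ t → if does (regular? t) then + 1 else + 0) ≡ T ℤ.- ∑ (trees n) (λ t → bad (regular? t))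
      ∑-good = count (trees n)

    member : ∀ t → t ∈ trees n → Regular t → ∃ λ f → l n t f × 𝒦 f
    member t t∈ reg = rescaled , rescaled-l , Approximate.rescaled-𝒦 mesh n′ t size≡ λ j i p q 0≤p p≤ 0≤q q≤ pq → modulus j i p q p≤ q≤ pq (cut j ℕP.≤? e)
      where
      size≡ : size t ≡ n
      size≡ = All.lookup (trees-sizes n) t∈
      open Rescaled n′ t size≡
      modulus : ∀ j i p q → p ℚ.≤ ι (3 ℕ.+ j) → q ℚ.≤ ι (3 ℕ.+ j) → ℚ.∣ p ℚ.- q ∣ ℚ.≤ inv (mesh j) → Dec (cut j ℕ.≤ e) → ℚ.∣ F i p ℚ.- F i q ∣ ℚ.≤ ¼pw j
      -- Small trees: here n < 4^(e+1) ≤ 4^(cut j), and the mesh was chosen so fine that the crude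
      -- Lipschitz constant n is enough, whatever the tree.
      modulus j i p q p≤ q≤ pq (no ¬h) = ℚP.≤-trans (F-lip i p q) (ℚP.≤-trans
        (ℚP.*-monoˡ-≤-nonNeg ℚ.∣ p ℚ.- q ∣ {{ℚ.nonNegative (ℚP.0≤∣p∣ (p ℚ.- q))}} (ι-mono (ℕP.≤-trans (ℕP.<⇒≤ upper) (ℕP.^-monoʳ-≤ 4 (ℕP.≰⇒> ¬h)))))
        (inv-cancel (4 ℕ.^ cut j) (ℚP.<⇒≤ (0<¼pw j)) (ℚP.≤-trans pq (mesh-small j))))
      modulus j i p q p≤ q≤ pq (yes h) = Smooth.smooth n′ t size≡ j (cut j) (e ℕ.∸ cut j) (M′ j) (mesh j)
          (subst (λ z → (2 ℕ.^ z) ℕ.^ 2 ℕ.≤ n) (sym e≡) (ℕP.≤-trans (ℕP.≤-reflexive (sym (4^≡2^² e))) lower))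
          (subst (λ z → n ℕ.≤ 4 ℕ.* (2 ℕ.^ z) ℕ.^ 2) (sym e≡) upper²)
          (M′-large j) (mesh-fine j) (all-below n reg j j<n h) i p q p≤ q≤ pq
        where
        e≡ = ℕP.m∸n+n≡m h
        j<n : j ℕ.< n
        j<n = ℕP.≤-<-trans (ℕP.≤-trans (j≤cut j) h) (ℕP.<-≤-trans (n<2^n e) (ℕP.≤-trans (ℕP.^-monoˡ-≤ e (s≤s (s≤s (z≤n {2})))) lower))

  tight-at : ∀ n → 1 ℕ.≤ n → Σ (Tree → Bool) λ A → (∀ t → t ∈ trees n → A t ≡ true → ∃ λ f → l n t f × 𝒦 f) × 1ℚ ℚ.- inv N ℚ.≤ ℙ n A
  tight-at (suc n′) _ = go (log₄ n′)
    where
    go : (∃ λ e → 4 ℕ.^ e ℕ.≤ suc n′ × suc n′ ℕ.< 4 ℕ.^ suc e) → _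
    go (e , lower , upper) = (λ t → does (regular? n′ e lower upper t)) ,
      (λ t t∈ yes! → member n′ e lower upper t t∈ (holds! (regular? n′ e lower upper t) yes!)) , probability n′ e lower upper
      where
      holds! : ∀ {P : Set} (d : Dec P) → does d ≡ true → P
      holds! (yes p) _ = p
      holds! (no _)  ()

tight-l : Tight l
tight-l ε ε>0 = 𝒦 , 𝒦-compact , λ n 1≤n → weaken n (tight-at n 1≤n)
  where
  C₀ = proj₁ ∑-dif⁴
  N₀ = proj₁ (archimedes ε ε>0)
  M′ cut mesh : ℕ → ℕ
  M′ j = proj₁ (archimedes (inv 17 ℚ.* ¼pw j) (0<* (0<inv 17) (0<¼pw j)))
  -- 36 = 9 · 4 collects the constants of `irregular`, `suc` keeps the factor positive so that it
  -- can be cancelled, and the summand j secures j ≤ cut j.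
  cut j = suc (36 ℕ.* (C₀ ℕ.* (rangeOf j ℕ.* suc (M′ j) ℕ.^ 4))) ℕ.* (suc N₀ ℕ.* 2 ℕ.^ suc j) ℕ.+ j
  slack : ∀ j → ∃ λ μ → inv μ ℚ.≤ inv (4 ℕ.^ cut j) ℚ.* ¼pw j
  slack j = archimedes (inv (4 ℕ.^ cut j) ℚ.* ¼pw j) (0<* (0<inv (4 ℕ.^ cut j)) (0<¼pw j))
  -- The first entry serves the trees with `cut j ≤ e`, through dyadic chaining; the second serves
  -- the smaller ones, through the Lipschitz bound. One compact set thus covers all n ≥ 1.
  mesh j = 2 ℕ.* 2 ℕ.^ cut j ℕ.⊔ proj₁ (slack j)
  open Closure mesh unitOf (topOf mesh) (topOf-mono mesh)
  open Scales C₀ (proj₂ ∑-dif⁴) N₀ M′ cut mesh (λ j → ℕP.m≤m+n _ j) (λ j → ℕP.m≤n+m j _)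
    (λ j → proj₂ (archimedes (inv 17 ℚ.* ¼pw j) (0<* (0<inv 17) (0<¼pw j))))
    (λ j → ℕP.m≤n⇒m≤1+n (ℕP.m≤m⊔n (2 ℕ.* 2 ℕ.^ cut j) (proj₁ (slack j))))
    (λ j → ℚP.≤-trans (inv-antimono (ℕP.m≤n⊔m (2 ℕ.* 2 ℕ.^ cut j) (proj₁ (slack j)))) (proj₂ (slack j)))
  weaken : ∀ n → (Σ (Tree → Bool) λ A → (∀ t → t ∈ trees n → A t ≡ true → ∃ λ f → l n t f × 𝒦 f) × 1ℚ ℚ.- inv N₀ ℚ.≤ ℙ n A) →
    Σ (Tree → Bool) λ A → (∀ t → t ∈ trees n → A t ≡ true → ∃ λ f → l n t f × 𝒦 f) × 1ℚ ℚ.- ε ℚ.≤ ℙ n A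
  weaken n (A , p , q) = A , p , ℚP.≤-trans (ℚP.+-monoʳ-≤ 1ℚ (ℚP.neg-antimono-≤ (proj₂ (archimedes ε ε>0)))) q

mainTheorem5 :
    (∃ λ (C : ℚ) → 0ℚ ℚ.< C ×
      (∀ (n r h : ℕ) →
        𝔼 n (λ t → (+ L t r ℤ.- + L t (r ℕ.+ h)) ℤ.^ 4) ℚ.≤ C ℚ.* (+ (h ℕ.^ 2 ℕ.* n) ℚ./ 1)))
    × Tight l
mainTheorem5 = fourth-moment , tight-l
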